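{- As identities of $q$-series (for $|q|<1$): \begin{align*} \varphi^3 (q)\varphi (q^{10})= & \tfrac{1}{7} \big(-E_{\chi_0,\chi_3}(q) - 5E_{\chi_1,\chi_2}(q) +4 E_{\chi_2,\chi_1}(q) +20E_{\chi_3,\chi_0}(q)\big) +\tfrac{4}{7}\big(-3D_1(q)+15D_2(q) -15 D_3(q)+ 9 D_4(q)\big),\\ \varphi^2(q)\varphi (q^2)\varphi (q^5)=&\tfrac{1}{7}\big(- E_{\chi_0,\chi_3}(q) +5E_{\chi_1,\chi_2}(q) - 4 E_{\chi_2,\chi_1}(q) +20 E_{\chi_3,\chi_0}(q)\big) + \tfrac{8}{7}\big(-D_1(q) + 2D_4(q)\big),\\ \varphi(q)\varphi^2 (q^2)\varphi (q^{10})=& \tfrac{1}{7}\big(- E_{\chi_0,\chi_3}(q) -5E_{\chi_1,\chi_2}(q) +2 E_{\chi_2,\chi_1}(q) +10E_{\chi_3,\chi_0}(q)\big) +\tfrac{4}{7}\big(D_1(q)+ 5 D_2(q) + 5 D_3(q)+D_4(q)\big),\\ \varphi(q)\varphi^2 (q^5)\varphi (q^{10})=& \tfrac{1}{7} \big(-E_{\chi_0,\chi_3}(q) -E_{\chi_1,\chi_2}(q) +4 E_{\chi_2,\chi_1}(q) + 4 E_{\chi_3,\chi_0}(q)\big) +\tfrac{8}{7}\big(D_2(q) -D_3(q)+D_4(q)\big),\\ \varphi (q)\varphi^3 (q^{10})=& - \tfrac{1}{7} \big(E_{\chi_0,\chi_3}(q) + E_{\chi_1,\chi_2}(q) -2 E_{\chi_2,\chi_1}(q)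 - 2E_{\chi_3,\chi_0}(q) \big) +\tfrac{12}{7}\big(D_2(q) +D_3(q)+D_4(q)\big),\\ \varphi^3 (q^2) \varphi (q^5)=& \tfrac{1}{7}\big(- E_{\chi_0,\chi_3}(q) + 5E_{\chi_1,\chi_2}(q) - 2E_{\chi_2,\chi_1}(q) + 10E_{\chi_3,\chi_0}(q) -12D_1(q)\big) ,\\ \varphi (q^2) \varphi^3 (q^5)=& \tfrac{1}{7}\big(- E_{\chi_0,\chi_3}(q) +E_{\chi_1,\chi_2}(q) -4 E_{\chi_2,\chi_1}(q) +4E_{\chi_3,\chi_0}(q) \big) -\tfrac{12}{7}\big(D_1(q)+D_2(q) + 3D_3(q) -D_4(q)\big),\\ \varphi(q^2)\varphi (q^5)\varphi^2 (q^{10})=& \tfrac{1}{7}\big(- E_{\chi_0,\chi_3}(q) + E_{\chi_1,\chi_2}(q) - 2E_{\chi_2,\chi_1}(q) + 2 E_{\chi_3,\chi_0}(q)\big) +\tfrac{4}{7}\big(-D_1(q)+D_2(q) - 3D_3(q)+D_4(q)\big). \end{align*}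
   Context: $\varphi(q)=\sum_{m=-\infty}^{\infty}q^{m^2}$. $\chi_0$ is the trivial character, $\chi_1(m)=\left(\frac{5}{m}\right)$, $\chi_2(m)=\left(\frac{8}{m}\right)$, $\chi_3(m)=\left(\frac{40}{m}\right)$ (Kronecker symbols). For $n\in\mathbb{N}$, $\sigma_{\chi,\psi}(n)=\sum_{m\mid n}\psi(m)\chi(n/m)m$. $E_{\chi_0,\chi_3}(q)=-7+\sum_{n\ge1}\sigma_{\chi_0,\chi_3}(n)q^n$, and for $(\chi,\psi)\in\{(\chi_1,\chi_2),(\chi_2,\chi_1),(\chi_3,\chi_0)\}$, $E_{\chi,\psi}(q)=\sum_{n\ge1}\sigma_{\chi,\psi}(n)q^n$. With $q=e^{2\pi i z}$ and $\eta(z)=q^{1/24}\prod_{m\ge1}(1-q^m)$: $D_1(q)=\frac{\eta^2(z)\eta^6(4z)\eta(20z)}{\eta^3(2z)\eta^2(8z)}$, $D_2(q)=\frac{\eta^2(5z)\eta(8z)\eta(10z)\eta(40z)}{\eta(20z)}$, $D_3(q)=\frac{\eta(z)\eta(5z)\eta(20z)\eta^2(40z)}{\eta(10z)}$, $D_4(q)=\frac{\eta(z)\eta(4z)\eta(5z)\eta^2(8z)}{\eta(2z)}$. -}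

module Defs where

open import Data.Nat as ℕ using (ℕ; zero; suc; _%_)
open import Data.Integer as ℤ using (ℤ; +_; -[1+_]; _+_; _*_; -_)
open import Data.Bool using (Bool; true; false; if_then_else_)
open import Data.List using (List; []; _∷_)
open import Data.Product using (_×_; _,_)
open import Relation.Nullary.Decidable using (⌊_⌋)
open import Data.Nat.Divisibility using (_∣?_)
open import Relation.Binary.PropositionalEquality using (_≡_)

-- Formal power series in q with integer coefficients: n ↦ coeff of q^n

Series : Set
Series = ℕ → ℤ

sumTo : ℕ → (ℕ → ℤ) → ℤ
sumTo zero    f = f zero
sumTo (suc n) f = sumTo n f + f (suc n)

sum1To : ℕ → (ℕ → ℤ) → ℤ
sum1To zero    f = + 0
sum1To (suc n) f = sum1To n f + f (suc n)

[_]ᶻ : Bool → ℤ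
[ true  ]ᶻ = + 1
[ false ]ᶻ = + 0

oneS : Series
oneS zero    = + 1
oneS (suc _) = + 0

infixl 6 _⊕_
infixl 7 _⊛_
infixr 8 _⊙_

_⊕_ : Series → Series → Series
(f ⊕ g) n = f n + g n

_⊙_ : ℤ → Series → Series
(c ⊙ f) n = c * f n

_⊛_ : Series → Series → Series
(f ⊛ g) n = sumTo n (λ i → f i * g (n ℕ.∸ i))

powS : Series → ℕ → Series
powS f zero    = oneS
powS f (suc k) = f ⊛ powS f k

shift : ℕ → Series → Series
shift k f n = if ⌊ k ℕ.≤? n ⌋ then f (n ℕ.∸ k) else + 0

-- φ(q^k) = Σ_{m∈ℤ} q^{k m²}.  Coefficient of q^n counts m ∈ ℤ with
-- k m² = n; m and -m are counted together (weight 2 for m ≠ 0).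
-- For k ≥ 1 such m satisfy |m| ≤ n.

weight : ℕ → ℤ
weight zero    = + 1
weight (suc _) = + 2

φ[q^_] : ℕ → Series
φ[q^ k ] n = sumTo n (λ m → if ⌊ k ℕ.* m ℕ.* m ℕ.≟ n ⌋ then weight m else + 0)

-- Eta quotients.
-- (1 - q^c) and its inverse 1/(1 - q^c) = Σ_{j≥0} q^{c j}  (c ≥ 1)

oneMinusQ : ℕ → Series
oneMinusQ c n = oneS n + - [ ⌊ n ℕ.≟ c ⌋ ]ᶻ

geomQ : ℕ → Series
geomQ c n = [ ⌊ c ∣? n ⌋ ]ᶻ

oneMinusQ^ : ℕ → ℤ → Series
oneMinusQ^ c (+ k)      = powS (oneMinusQ c) k
oneMinusQ^ c -[1+ k ]   = powS (geomQ c) (suc k)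

etaFactor : List (ℕ × ℤ) → ℕ → Series
etaFactor []            m = oneS
etaFactor ((δ , r) ∷ L) m = oneMinusQ^ (δ ℕ.* m) r ⊛ etaFactor L m

prodTo : ℕ → (ℕ → Series) → Series
prodTo zero    F = oneS
prodTo (suc N) F = prodTo N F ⊛ F (suc N)

-- Infinite product Π_{m≥1} F m, where F m ≡ 1 mod q^{m+1} (true for
-- etaFactor with all δ ≥ 1): the coefficient of q^n is that of the
-- finite product up to m = n (the later factors do not affect it).
infProd : (ℕ → Series) → Series
infProd F n = prodTo n F n

-- q-exponent of Π η(δz)^{r}:  (Σ δ r) / 24  (here always a positive integer)
weightSum : List (ℕ × ℤ) → ℤ
weightSum []            = + 0
weightSum ((δ , r) ∷ L) = + δ * r + weightSum L

qOffset : List (ℕ × ℤ) → ℕ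
qOffset L = ℤ.∣ weightSum L ∣ ℕ./ 24

etaQuotient : List (ℕ × ℤ) → Series
etaQuotient L = shift (qOffset L) (infProd (etaFactor L))

D₁ D₂ D₃ D₄ : Series
D₁ = etaQuotient ((1 , + 2) ∷ (4 , + 6) ∷ (20 , + 1) ∷ (2 , - + 3) ∷ (8 , - + 2) ∷ [])
D₂ = etaQuotient ((5 , + 2) ∷ (8 , + 1) ∷ (10 , + 1) ∷ (40 , + 1) ∷ (20 , - + 1) ∷ [])
D₃ = etaQuotient ((1 , + 1) ∷ (5 , + 1) ∷ (20 , + 1) ∷ (40 , + 2) ∷ (10 , - + 1) ∷ [])
D₄ = etaQuotient ((1 , + 1) ∷ (4 , + 1) ∷ (5 , + 1) ∷ (8 , + 2) ∷ (2 , - + 1) ∷ [])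

χ₀ : ℕ → ℤ
χ₀ _ = + 1

-- Kronecker symbol (5/m): depends on m mod 5
χ₁ : ℕ → ℤ
χ₁ m with m % 5
... | 1 = + 1
... | 4 = + 1
... | 2 = - + 1
... | 3 = - + 1
... | _ = + 0

-- Kronecker symbol (8/m) = (2/m): depends on m mod 8
χ₂ : ℕ → ℤ
χ₂ m with m % 8
... | 1 = + 1
... | 7 = + 1
... | 3 = - + 1
... | 5 = - + 1
... | _ = + 0

-- Kronecker symbol (40/m) = (8/m)(5/m)
χ₃ : ℕ → ℤ
χ₃ m = χ₂ m * χ₁ m

-- σ_{χ,ψ}(n) = Σ_{m ∣ n} ψ(m) χ(n/m) m, written as a sum over pairs
-- (m, k) with m k = n, 1 ≤ m, k ≤ n.
σ : (ℕ → ℤ) → (ℕ → ℤ) → ℕ → ℤ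
σ χ ψ n = sum1To n (λ m → sum1To n (λ k →
            if ⌊ m ℕ.* k ℕ.≟ n ⌋ then ψ m * χ k * + m else + 0))

Eis : ℤ → (ℕ → ℤ) → (ℕ → ℤ) → Series
Eis c₀ χ ψ zero    = c₀
Eis c₀ χ ψ (suc n) = σ χ ψ (suc n)

E₀₃ E₁₂ E₂₁ E₃₀ : Series
E₀₃ = Eis (- + 7) χ₀ χ₃
E₁₂ = Eis (+ 0) χ₁ χ₂
E₂₁ = Eis (+ 0) χ₂ χ₁
E₃₀ = Eis (+ 0) χ₃ χ₀

infix 4 _≋_
_≋_ : Series → Series → Set
f ≋ g = ∀ n → f n ≡ g n

module Submission where

-- Put A = φ(q), B = φ(q⁵), C = φ(q²), D = φ(q¹⁰), with a, b, c, d their values at - q, - q⁵, - q², - q¹⁰.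
-- Rearranging ℤ² along Gaussian sublattices gives A² + a² = 2 C², A a = c² and, after splitting φ by
-- residues modulo 5, (A b - a B)² = (B b - A a)(5 B b - A a).  The Lambert series Σ 2qᵐ/(1+q²ᵐ) and
-- Σ (qᵐ+q³ᵐ)/(1+q⁴ᵐ) over m ∈ ℤ are A² and A C: partial fractions of products of two terms, summed along
-- the lines m + n = M, show that the first satisfies the recursion of the arithmetic-geometric mean, whose
-- solution is unique.  The same partial fractions, weighted by characters modulo 5, express the four
-- Eisenstein series as quartic forms in A, B, C, D.  On the other side Gauss' product for φ(- q) and Jacobi's
-- for φ(q)⁴ - φ(- q)⁴ turn B b - A a and 5 B b - A a into eta quotients, because their sextic products
-- are explicit, and so D₁, …, D₄ become quartic forms as well.  The theorem inverts this linear system.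

-- Everything takes place in formal power series over ℤ. An equation that would need division is
-- multiplied by a regular series and checked as a polynomial identity; a square root is taken by
-- multiplying with the conjugate, whose lowest coefficient selects the sign. The delicate point is
-- convergence. In terms of q^m = e^(-t) the basic partial fraction is sech s sech t = (tanh s +
-- tanh t) / sinh (s + t). Most Lambert terms at index m have order at least |m|, so that the
-- coefficient of q^i only sees |m| ≤ i. But tanh tends to ±1, and the sum of tanh over a line m + n
-- = M has a value only for symmetric windows, where its signs leave 2 M. This 2 M becomes the
-- divisor weight of `E₂₁` and `E₃₀`. The pole of 1 / sinh at M = 0 is the second source of weights:
-- there the partial fractions degenerate to derivatives, which give `E₁₂` and `E₀₃`.

-- Polynomial normal forms over ℤ, and identities proved by certificates.

module Polynomials where

  open import Algebra.Bundles using (CommutativeRing)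
  open import Data.Bool using (Bool; true; false; if_then_else_; T)
  open import Data.Fin using (Fin; zero; suc)
  open import Data.Integer as ℤ using (ℤ; +_; -[1+_])
  open import Data.List using (List; []; _∷_)
  open import Data.List.Relation.Unary.All using (All; []; _∷_)
  open import Data.Nat as ℕ using (ℕ; zero; suc)
  open import Data.Product using (_×_; _,_; proj₁; proj₂)
  open import Data.Vec using (Vec; []; _∷_; lookup; replicate)
  open import Level using (0ℓ)
  open import Relation.Binary.PropositionalEquality as ≡ using (_≡_)
  open import Relation.Nullary using (yes; no)

  -- Integers act in two ways, through `ι` and through `_·_`, so that for series both `constS c ⊛ f`
  -- and the scaling `c ⊙ f` of the statement are values of expressions.
  record ℤ-Ring : Set₁ where
    field
      cring : CommutativeRing 0ℓ 0ℓ
    open CommutativeRing cring public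
    infixr 8 _·_
    field
      ι     : ℤ → Carrier
      _·_   : ℤ → Carrier → Carrier
      ι-+   : ∀ i j → ι (i ℤ.+ j) ≈ ι i + ι j
      ι-*   : ∀ i j → ι (i ℤ.* j) ≈ ι i * ι j
      ι-neg : ∀ i → ι (ℤ.- i) ≈ - ι i
      ι-0   : ι (+ 0) ≈ 0#
      ι-1   : ι (+ 1) ≈ 1#
      ι-·   : ∀ c x → ι c * x ≈ c · x

  infixl 6 _:+_ _:-_
  infixl 7 _:*_
  infixr 8 _:^_ _:·_
  infix  9 #_

  data Expr (n : ℕ) : Set where
    con  : ℤ → Expr n
    #_   : Fin n → Expr n
    _:+_ _:-_ _:*_ : Expr n → Expr n → Expr n
    _:^_ : Expr n → ℕ → Expr n
    _:·_ : ℤ → Expr n → Expr n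

  Mon : ℕ → Set
  Mon = Vec ℕ

  Poly : ℕ → Set
  Poly n = List (Mon n × ℤ)

  data Order {n} (s t : Mon n) : Set where
    lt gt : Order s t
    eq    : s ≡ t → Order s t

  order : ∀ {n} (s t : Mon n) → Order s t
  order []      []      = eq ≡.refl
  order (k ∷ s) (l ∷ t) with k ℕ.≟ l
  ... | no _ = if k ℕ.<ᵇ l then lt else gt
  ... | yes ≡.refl with order s t
  ...   | lt = lt
  ...   | gt = gt
  ...   | eq e = eq (≡.cong (k ∷_) e)

  consTerm : ∀ {n} → Mon n → ℤ → Poly n → Poly n
  consTerm s (+ 0)     p = p
  consTerm s (+ suc k) p = (s , + suc k) ∷ p
  consTerm s -[1+ k ]  p = (s , -[1+ k ]) ∷ p

  merge : ∀ {n} → Mon n × ℤ → (Poly n → Poly n) → Poly n → Poly n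
  merge x f []      = x ∷ f []
  merge x f (y ∷ q) with order (proj₁ x) (proj₁ y)
  ... | lt   = x ∷ f (y ∷ q)
  ... | gt   = y ∷ merge x f q
  ... | eq _ = consTerm (proj₁ x) (proj₂ x ℤ.+ proj₂ y) (f q)

  add : ∀ {n} → Poly n → Poly n → Poly n
  add []      q = q
  add (x ∷ p) q = merge x (add p) q

  mulMon : ∀ {n} → Mon n → Mon n → Mon n
  mulMon []      []      = []
  mulMon (k ∷ s) (l ∷ t) = (k ℕ.+ l) ∷ mulMon s t

  mulTerm : ∀ {n} → Mon n × ℤ → Poly n → Poly n
  mulTerm (s , k) []            = []
  mulTerm (s , k) ((t , l) ∷ p) = (mulMon s t , k ℤ.* l) ∷ mulTerm (s , k) p

  mul : ∀ {n} → Poly n → Poly n → Poly n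
  mul []      q = []
  mul (x ∷ p) q = add (mulTerm x q) (mul p q)

  unit : ∀ {n} → Mon n
  unit = replicate _ 0

  single : ∀ {n} → Fin n → Mon n
  single zero    = 1 ∷ unit
  single (suc i) = 0 ∷ single i

  pow : ∀ {n} → Poly n → ℕ → Poly n
  pow p zero    = (unit , + 1) ∷ []
  pow p (suc k) = mul p (pow p k)

  normalise : ∀ {n} → Expr n → Poly n
  normalise (con c)  = consTerm unit c []
  normalise (# i)    = (single i , + 1) ∷ []
  normalise (e :+ f) = add (normalise e) (normalise f)
  normalise (e :- f) = add (normalise e) (mulTerm (unit , -[1+ 0 ]) (normalise f))
  normalise (e :* f) = mul (normalise e) (normalise f)
  normalise (e :^ k) = pow (normalise e) k
  normalise (c :· e) = mulTerm (unit , c) (normalise e)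

  null : ∀ {n} → Poly n → Bool
  null []      = true
  null (_ ∷ _) = false

  toWit : ∀ {n} (p : Poly n) → T (null p) → p ≡ []
  toWit [] _ = ≡.refl

  module Solve (R : ℤ-Ring) where
    open ℤ-Ring R
    open import Algebra.Properties.Ring ring using (-1*x≈-x)
    open import Relation.Binary.Reasoning.Setoid setoid
    open import Algebra.Properties.CommutativeSemigroup *-commutativeSemigroup using () renaming (interchange to *-interchange; x∙yz≈y∙xz to *-left-comm)
    open import Algebra.Properties.CommutativeSemigroup +-commutativeSemigroup using () renaming (interchange to +-interchange; x∙yz≈y∙xz to +-left-comm)

    infixr 8 _^_
    _^_ : Carrier → ℕ → Carrier
    x ^ zero    = 1#
    x ^ suc k   = x * x ^ k

    infix 8 ⟦_⟧
    ⟦_⟧ : ∀ {n} → Expr n → Vec Carrier n → Carrier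
    ⟦ con c ⟧  ρ = ι c
    ⟦ # i ⟧    ρ = lookup ρ i
    ⟦ e :+ f ⟧ ρ = ⟦ e ⟧ ρ + ⟦ f ⟧ ρ
    ⟦ e :- f ⟧ ρ = ⟦ e ⟧ ρ - ⟦ f ⟧ ρ
    ⟦ e :* f ⟧ ρ = ⟦ e ⟧ ρ * ⟦ f ⟧ ρ
    ⟦ e :^ k ⟧ ρ = ⟦ e ⟧ ρ ^ k
    ⟦ c :· e ⟧ ρ = c · ⟦ e ⟧ ρ

    ^-+ : ∀ x k l → x ^ (k ℕ.+ l) ≈ x ^ k * x ^ l
    ^-+ x zero    l = sym (*-identityˡ _)
    ^-+ x (suc k) l = trans (*-congˡ (^-+ x k l)) (sym (*-assoc _ _ _))

    private
      ⟦_⟧ᵐ : ∀ {n} → Mon n → Vec Carrier n → Carrier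
      ⟦ []    ⟧ᵐ []      = 1#
      ⟦ k ∷ s ⟧ᵐ (x ∷ ρ) = x ^ k * ⟦ s ⟧ᵐ ρ

      ⟦_⟧ᵖ : ∀ {n} → Poly n → Vec Carrier n → Carrier
      ⟦ []          ⟧ᵖ ρ = 0#
      ⟦ (s , k) ∷ p ⟧ᵖ ρ = ι k * ⟦ s ⟧ᵐ ρ + ⟦ p ⟧ᵖ ρ

      consTerm-sound : ∀ {n} (s : Mon n) k p ρ → ⟦ consTerm s k p ⟧ᵖ ρ ≈ ι k * ⟦ s ⟧ᵐ ρ + ⟦ p ⟧ᵖ ρ
      consTerm-sound s (+ 0)     p ρ = sym (trans (+-congʳ (trans (*-congʳ ι-0) (zeroˡ _))) (+-identityˡ _))
      consTerm-sound s (+ suc k) p ρ = refl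
      consTerm-sound s -[1+ k ]  p ρ = refl

      merge-sound : ∀ {n} s k (f : Poly n → Poly n) z ρ → (∀ q → ⟦ f q ⟧ᵖ ρ ≈ z + ⟦ q ⟧ᵖ ρ) →
                    ∀ q → ⟦ merge (s , k) f q ⟧ᵖ ρ ≈ (ι k * ⟦ s ⟧ᵐ ρ + z) + ⟦ q ⟧ᵖ ρ
      merge-sound s k f z ρ h []            = trans (+-congˡ (h [])) (sym (+-assoc _ _ _))
      merge-sound s k f z ρ h ((t , l) ∷ q) with order s t
      ... | lt = trans (+-congˡ (h ((t , l) ∷ q))) (sym (+-assoc _ _ _))
      ... | gt = trans (+-congˡ (merge-sound s k f z ρ h q)) (+-left-comm _ _ _)
      ... | eq ≡.refl = begin
        ⟦ consTerm s (k ℤ.+ l) (f q) ⟧ᵖ ρ            ≈⟨ consTerm-sound s (k ℤ.+ l) (f q) ρ ⟩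
        ι (k ℤ.+ l) * m + ⟦ f q ⟧ᵖ ρ                 ≈⟨ +-cong (trans (*-congʳ (ι-+ k l)) (distribʳ _ _ _)) (h q) ⟩
        (ι k * m + ι l * m) + (z + ⟦ q ⟧ᵖ ρ)         ≈⟨ +-interchange _ _ _ _ ⟩
        (ι k * m + z) + (ι l * m + ⟦ q ⟧ᵖ ρ)         ∎
        where m = ⟦ s ⟧ᵐ ρ

      add-sound : ∀ {n} (p q : Poly n) ρ → ⟦ add p q ⟧ᵖ ρ ≈ ⟦ p ⟧ᵖ ρ + ⟦ q ⟧ᵖ ρ
      add-sound []            q ρ = sym (+-identityˡ _)
      add-sound ((s , k) ∷ p) q ρ = merge-sound s k (add p) (⟦ p ⟧ᵖ ρ) ρ (λ q → add-sound p q ρ) q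

      mulMon-sound : ∀ {n} (s t : Mon n) ρ → ⟦ mulMon s t ⟧ᵐ ρ ≈ ⟦ s ⟧ᵐ ρ * ⟦ t ⟧ᵐ ρ
      mulMon-sound []      []      []      = sym (*-identityˡ _)
      mulMon-sound (k ∷ s) (l ∷ t) (x ∷ ρ) =
        trans (*-cong (^-+ x k l) (mulMon-sound s t ρ)) (*-interchange _ _ _ _)

      mulTerm-sound : ∀ {n} s k (p : Poly n) ρ → ⟦ mulTerm (s , k) p ⟧ᵖ ρ ≈ (ι k * ⟦ s ⟧ᵐ ρ) * ⟦ p ⟧ᵖ ρ
      mulTerm-sound s k []            ρ = sym (zeroʳ _)
      mulTerm-sound s k ((t , l) ∷ p) ρ = begin
        ι (k ℤ.* l) * ⟦ mulMon s t ⟧ᵐ ρ + ⟦ mulTerm (s , k) p ⟧ᵖ ρ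
          ≈⟨ +-cong (trans (*-cong (ι-* k l) (mulMon-sound s t ρ)) (*-interchange _ _ _ _)) (mulTerm-sound s k p ρ) ⟩
        (ι k * ⟦ s ⟧ᵐ ρ) * (ι l * ⟦ t ⟧ᵐ ρ) + (ι k * ⟦ s ⟧ᵐ ρ) * ⟦ p ⟧ᵖ ρ
          ≈⟨ distribˡ _ _ _ ⟨
        (ι k * ⟦ s ⟧ᵐ ρ) * (ι l * ⟦ t ⟧ᵐ ρ + ⟦ p ⟧ᵖ ρ) ∎

      mul-sound : ∀ {n} (p q : Poly n) ρ → ⟦ mul p q ⟧ᵖ ρ ≈ ⟦ p ⟧ᵖ ρ * ⟦ q ⟧ᵖ ρ
      mul-sound []            q ρ = sym (zeroˡ _)
      mul-sound ((s , k) ∷ p) q ρ = begin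
        ⟦ add (mulTerm (s , k) q) (mul p q) ⟧ᵖ ρ          ≈⟨ add-sound (mulTerm (s , k) q) (mul p q) ρ ⟩
        ⟦ mulTerm (s , k) q ⟧ᵖ ρ + ⟦ mul p q ⟧ᵖ ρ         ≈⟨ +-cong (mulTerm-sound s k q ρ) (mul-sound p q ρ) ⟩
        (ι k * ⟦ s ⟧ᵐ ρ) * ⟦ q ⟧ᵖ ρ + ⟦ p ⟧ᵖ ρ * ⟦ q ⟧ᵖ ρ ≈⟨ distribʳ _ _ _ ⟨
        (ι k * ⟦ s ⟧ᵐ ρ + ⟦ p ⟧ᵖ ρ) * ⟦ q ⟧ᵖ ρ            ∎

      unit-sound : ∀ {n} (ρ : Vec Carrier n) → ⟦ unit ⟧ᵐ ρ ≈ 1#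
      unit-sound []      = refl
      unit-sound (x ∷ ρ) = trans (*-identityˡ _) (unit-sound ρ)

      single-sound : ∀ {n} (i : Fin n) ρ → ⟦ single i ⟧ᵐ ρ ≈ lookup ρ i
      single-sound zero    (x ∷ ρ) = trans (*-cong (*-identityʳ x) (unit-sound ρ)) (*-identityʳ x)
      single-sound (suc i) (x ∷ ρ) = trans (*-identityˡ _) (single-sound i ρ)

      one-sound : ∀ {n} (ρ : Vec Carrier n) → ⟦ (unit , + 1) ∷ [] ⟧ᵖ ρ ≈ 1#
      one-sound ρ = trans (+-identityʳ _) (trans (*-cong ι-1 (unit-sound ρ)) (*-identityˡ _))

      pow-sound : ∀ {n} (p : Poly n) k ρ → ⟦ pow p k ⟧ᵖ ρ ≈ ⟦ p ⟧ᵖ ρ ^ k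
      pow-sound p zero    ρ = one-sound ρ
      pow-sound p (suc k) ρ = trans (mul-sound p (pow p k) ρ) (*-congˡ (pow-sound p k ρ))

      ^-cong : ∀ {x y} k → x ≈ y → x ^ k ≈ y ^ k
      ^-cong zero    e = refl
      ^-cong (suc k) e = *-cong e (^-cong k e)

      sound : ∀ {n} (e : Expr n) ρ → ⟦ normalise e ⟧ᵖ ρ ≈ ⟦ e ⟧ ρ
      sound (con c)  ρ = trans (consTerm-sound unit c [] ρ)
                          (trans (+-identityʳ _) (trans (*-congˡ (unit-sound ρ)) (*-identityʳ _)))
      sound (# i)    ρ = trans (+-identityʳ _) (trans (*-cong ι-1 (single-sound i ρ)) (*-identityˡ _))
      sound (e :+ f) ρ = trans (add-sound (normalise e) (normalise f) ρ) (+-cong (sound e ρ) (sound f ρ))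
      sound (e :- f) ρ = trans (add-sound (normalise e) (mulTerm (unit , -[1+ 0 ]) (normalise f)) ρ) (+-cong (sound e ρ) (begin
        ⟦ mulTerm (unit , -[1+ 0 ]) (normalise f) ⟧ᵖ ρ ≈⟨ mulTerm-sound unit -[1+ 0 ] (normalise f) ρ ⟩
        (ι -[1+ 0 ] * ⟦ unit ⟧ᵐ ρ) * ⟦ normalise f ⟧ᵖ ρ ≈⟨ *-cong (trans (*-cong (trans (ι-neg (+ 1)) (-‿cong ι-1)) (unit-sound ρ)) (*-identityʳ _)) (sound f ρ) ⟩
        (- 1#) * ⟦ f ⟧ ρ                                ≈⟨ -1*x≈-x _ ⟩
        - ⟦ f ⟧ ρ                                       ∎))
      sound (e :* f) ρ = trans (mul-sound (normalise e) (normalise f) ρ) (*-cong (sound e ρ) (sound f ρ))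
      sound (c :· e) ρ = trans (mulTerm-sound unit c (normalise e) ρ)
        (trans (*-cong (trans (*-congˡ (unit-sound ρ)) (*-identityʳ _)) (sound e ρ)) (ι-· c _))
      sound (e :^ k) ρ = trans (pow-sound (normalise e) k ρ) (^-cong k (sound e ρ))

    ⟦⟧-cong : ∀ {n} (e : Expr n) {ρ σ} → (∀ i → lookup ρ i ≈ lookup σ i) → ⟦ e ⟧ ρ ≈ ⟦ e ⟧ σ
    ⟦⟧-cong (con c)  h = refl
    ⟦⟧-cong (# i)    h = h i
    ⟦⟧-cong (e :+ f) h = +-cong (⟦⟧-cong e h) (⟦⟧-cong f h)
    ⟦⟧-cong (e :- f) h = +-cong (⟦⟧-cong e h) (-‿cong (⟦⟧-cong f h))
    ⟦⟧-cong (e :* f) h = *-cong (⟦⟧-cong e h) (⟦⟧-cong f h)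
    ⟦⟧-cong (e :^ k) h = ^-cong k (⟦⟧-cong e h)
    ⟦⟧-cong (c :· e) h = trans (sym (ι-· c _)) (trans (*-congˡ (⟦⟧-cong e h)) (ι-· c _))

    x-y≈0⇒x≈y : ∀ {x y} → x - y ≈ 0# → x ≈ y
    x-y≈0⇒x≈y {x} {y} e = begin
      x             ≈⟨ +-identityʳ x ⟨
      x + 0#        ≈⟨ +-congˡ (-‿inverseˡ y) ⟨
      x + (- y + y) ≈⟨ +-assoc _ _ _ ⟨
      (x - y) + y   ≈⟨ +-congʳ e ⟩
      0# + y        ≈⟨ +-identityˡ y ⟩
      y             ∎

    poly : ∀ {n} (e f : Expr n) (ρ : Vec Carrier n) → {T (null (normalise (e :- f)))} → ⟦ e ⟧ ρ ≈ ⟦ f ⟧ ρ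
    poly e f ρ {t} = x-y≈0⇒x≈y (trans (sym (sound (e :- f) ρ)) (reflexive (≡.cong (λ p → ⟦ p ⟧ᵖ ρ) (toWit (normalise (e :- f)) t))))

    Regular : Carrier → Set
    Regular x = ∀ y → x * y ≈ 0# → y ≈ 0#

    combination : ∀ {n} → List (Expr n × Expr n) → Expr n
    combination []            = con (+ 0)
    combination ((c , h) ∷ l) = c :* h :+ combination l

    -- The substitute for division: m g = Σ cᵢ hᵢ is an identity of polynomials, the hᵢ vanish at ρ,
    -- and the regular factor m cancels. When m g is a difference of two squares, the regularity of
    -- the conjugate m decides between the two roots.
    certify : ∀ {n} (ρ : Vec Carrier n) (m g : Expr n) (hs : List (Expr n × Expr n)) →
              {T (null (normalise (m :* g :- combination hs)))} →
              Regular (⟦ m ⟧ ρ) → All (λ h → ⟦ proj₂ h ⟧ ρ ≈ 0#) hs → ⟦ g ⟧ ρ ≈ 0#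
    certify ρ m g hs {t} r zs = r _ (trans (poly (m :* g) (combination hs) ρ {t}) (vanish hs zs))
      where
      vanish : ∀ hs → All (λ h → ⟦ proj₂ h ⟧ ρ ≈ 0#) hs → ⟦ combination hs ⟧ ρ ≈ 0#
      vanish []       []       = ι-0
      vanish (_ ∷ hs) (z ∷ zs) = trans (+-cong (trans (*-congˡ z) (zeroʳ _)) (vanish hs zs)) (+-identityˡ _)

-- Lambert terms as quotients of binary forms.

module Forms where

  open Polynomials
  open import Data.Integer using (ℤ; +_; -_)
  open import Data.List using (List; []; _∷_)
  open import Data.Nat using (ℕ; zero; suc)

  homE : ∀ {n} → List ℤ → ℕ → Expr n → Expr n → Expr n
  homE []      d       x y = con (+ 0)
  homE (c ∷ l) zero    x y = con c
  homE (c ∷ l) (suc d) x y = con c :* y :^ suc d :+ x :* homE l d x y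

  -- With x = q^i and y = q^j a rational function of x / y = q^(i ⊖ j) becomes a quotient of two forms
  -- in x and y, whatever the sign of i ⊖ j.
  numE denE : ∀ {n} → List ℤ → ℤ → ℕ → Expr n → Expr n → Expr n
  numE l ε d x y = homE l d x y
  denE l ε d x y = y :^ d :- con ε :* x :^ d

  formE : ∀ {n} → List ℤ → ℤ → ℕ → Expr n → Expr n → Expr n → Expr n
  formE l ε d F x y = F :* denE l ε d x y :- numE l ε d x y

  -- With y = e^(-t) the first five belong to sech t, cosh t / cosh 2t, sinh t / cosh 2t, tanh t and
  -- 1 / (2 sinh t). The next three list one antiperiod (10 or 20) of the expansions of the first
  -- three with the coefficient of y^k multiplied by χ₁(k). In the last four the coefficients of the
  -- odd characters `ψ₄` and `ψ₈` are multiplied by the odd functions `o₁`, `o₂` modulo 5 instead.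
  lc lg lv lτ ly lĉ lĜ lV lP₁ lP₂ lQ₁ lQ₂ : List ℤ
  lc = + 0 ∷ + 2 ∷ []
  lg = + 0 ∷ + 1 ∷ + 0 ∷ + 1 ∷ []
  lv = + 0 ∷ + 1 ∷ + 0 ∷ - + 1 ∷ []
  lτ  = + 1 ∷ + 0 ∷ - + 1 ∷ []
  ly = + 0 ∷ + 1 ∷ []
  lĉ = + 0 ∷ + 2 ∷ + 0 ∷ + 2 ∷ + 0 ∷ + 0 ∷ + 0 ∷ + 2 ∷ + 0 ∷ + 2 ∷ []
  lĜ = + 0 ∷ + 1 ∷ + 0 ∷ - + 1 ∷ + 0 ∷ + 0 ∷ + 0 ∷ + 1 ∷ + 0 ∷ + 1 ∷ + 0 ∷ + 1 ∷ + 0 ∷ + 1 ∷ + 0 ∷ + 0 ∷ + 0 ∷ - + 1 ∷ + 0 ∷ + 1 ∷ []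
  lV = + 0 ∷ + 1 ∷ + 0 ∷ + 1 ∷ + 0 ∷ + 0 ∷ + 0 ∷ - + 1 ∷ + 0 ∷ + 1 ∷ + 0 ∷ - + 1 ∷ + 0 ∷ + 1 ∷ + 0 ∷ + 0 ∷ + 0 ∷ - + 1 ∷ + 0 ∷ - + 1 ∷ []
  lP₁ = + 0 ∷ + 1 ∷ + 0 ∷ + 0 ∷ + 0 ∷ + 0 ∷ + 0 ∷ + 0 ∷ + 0 ∷ - + 1 ∷ []
  lP₂ = + 0 ∷ + 0 ∷ + 0 ∷ + 1 ∷ + 0 ∷ + 0 ∷ + 0 ∷ - + 1 ∷ + 0 ∷ + 0 ∷ []
  lQ₁ = + 0 ∷ + 1 ∷ + 0 ∷ + 0 ∷ + 0 ∷ + 0 ∷ + 0 ∷ + 0 ∷ + 0 ∷ - + 1 ∷ + 0 ∷ + 1 ∷ + 0 ∷ + 0 ∷ + 0 ∷ + 0 ∷ + 0 ∷ + 0 ∷ + 0 ∷ - + 1 ∷ []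
  lQ₂ = + 0 ∷ + 0 ∷ + 0 ∷ - + 1 ∷ + 0 ∷ + 0 ∷ + 0 ∷ - + 1 ∷ + 0 ∷ + 0 ∷ + 0 ∷ + 0 ∷ + 0 ∷ + 1 ∷ + 0 ∷ + 0 ∷ + 0 ∷ + 1 ∷ + 0 ∷ + 0 ∷ []

-- The ideal of relations between the eight theta values.

module ThetaAlgebra where

  open Polynomials
  open import Data.Bool using (T)
  open import Data.Fin using (suc)
  open import Data.Fin.Patterns
  open import Data.Integer using (+_)
  open import Data.List using (List; []; _∷_)
  open import Data.List.Relation.Unary.All using (All; []; _∷_)
  open import Data.Nat as ℕ using (ℕ)
  open import Data.Product using (_×_; _,_)
  open import Data.Vec using (Vec; []; _∷_)

  nat : ∀ {n} → ℕ → Expr n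
  nat k = con (+ k)

  vA va vB vb vC vD vc vd vw vx vy : Expr 12
  vA = # 0F
  va = # 1F
  vB = # 2F
  vb = # 3F
  vC = # 4F
  vD = # 5F
  vc = # 6F
  vd = # 7F
  vw = # 8F
  vx = # 9F
  vy = # suc 9F

  ep er eN eK eρ₁ eρ₅ eU eu eδ es : Expr 12
  ep  = vA :* va
  er  = vB :* vb
  eN  = vA :* vb :- va :* vB
  eK  = vA :* vb :+ va :* vB
  eρ₁ = er :- ep
  eρ₅ = nat 5 :* er :- ep
  eU  = nat 5 :* vB :^ 2 :- vA :^ 2
  eu  = nat 5 :* vb :^ 2 :- va :^ 2
  eδ  = vA :* vD :- vB :* vC
  es  = nat 5 :* vB :* vD :- vA :* vC

  gC gD gc gd gR₁ gR₂ gR₁′ gCD gY : Expr 12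
  gC   = nat 2 :* vC :^ 2 :- (vA :^ 2 :+ va :^ 2)
  gD   = nat 2 :* vD :^ 2 :- (vB :^ 2 :+ vb :^ 2)
  gc   = vc :^ 2 :- ep
  gd   = vd :^ 2 :- er
  gR₁  = eN :^ 2 :- eρ₁ :* eρ₅
  gR₂  = (vA :^ 2 :- vB :^ 2) :* (vA :^ 2 :- nat 5 :* vB :^ 2) :+ (va :^ 2 :- vb :^ 2) :* (va :^ 2 :- nat 5 :* vb :^ 2)
  gR₁′ = (vC :* vd :- vc :* vD) :^ 2 :- (vD :* vd :- vC :* vc) :* (nat 5 :* vD :* vd :- vC :* vc)
  gCD  = nat 2 :* eK :* vC :* vD :- (vC :^ 2 :* eρ₁ :+ vD :^ 2 :* eρ₅)
  gY   = nat 4 :* vC :* vD :* vc :* vd :- (vD :^ 2 :* eρ₅ :- vC :^ 2 :* eρ₁)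

  -- The shapes in which the series first appear: `fE₁₂`, `fE₀₃`, `fD₁` are 4 times `E₁₂`, `E₀₃`,
  -- `D₁`; `fD₂` is 8 times `D₂`; `fD₃` and `fD₄` are 16 times `D₃`, `D₄`, with products c d already
  -- eliminated. `hE₃₀` is the part of 16 `E₃₀` that is free of the character sum w.
  fE₁₂ fE₀₃ hE₃₀ fD₁ fD₂ fD₃ fD₄ : Expr 12
  fE₁₂ = (nat 2 :* vB :^ 2 :- vC :^ 2 :+ vD :^ 2) :* eδ :- (vA :* vC :- vB :* vD) :* (nat 2 :* vC :* vD :- vA :* vB :- va :* vb)
  fE₀₃ = (nat 2 :* vA :^ 2 :- nat 5 :* vD :^ 2 :+ vC :^ 2) :* (vA :* vD :+ vB :* vC) :- (nat 5 :* vB :* vD :+ vA :* vC) :* (nat 2 :* vC :* vD :+ vA :* vB :+ va :* vb)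
  hE₃₀ = (vA :^ 2 :- vB :^ 2 :- nat 4 :* vD :^ 2) :* (vA :* vD :+ vB :* vC) :+ nat 4 :* vA :* vB :* (vA :* vC :+ vB :* vD)
  fD₁ = va :* vC :* eN
  fD₂ = vb :* (nat 2 :* vC :* er :- eK :* vD :+ vC :* eρ₁)
  fD₃ = nat 2 :* va :* vD :* er :- nat 2 :* vb :* vC :* ep :+ vb :* (eK :* vD :- vC :* eρ₁) :- va :* (vD :* eρ₅ :- eK :* vC)
  fD₄ = nat 5 :* vb :* (eK :* vD :- vC :* eρ₁) :- nat 10 :* va :* vD :* er :- nat 2 :* vb :* vC :* ep :+ va :* (vD :* eρ₅ :- eK :* vC)

  -- The eight forms as polynomials in A, B, C, D: the inverse of the linear system of the theorem.

  tE₁₂ : Expr 12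
  tE₁₂ = vA :^ 2 :* vB :* vC :- nat 2 :* vA :* vC :^ 2 :* vD :+ vA :* vB :^ 2 :* vD :- nat 2 :* vB :^ 3 :* vC :+ nat 2 :* vB :* vC :* vD :^ 2

  tE₀₃ : Expr 12
  tE₀₃ = nat 2 :* vA :^ 3 :* vD :+ vA :^ 2 :* vB :* vC :- nat 2 :* vA :* vC :^ 2 :* vD :- nat 5 :* vA :* vB :^ 2 :* vD :- nat 10 :* vB :* vC :* vD :^ 2

  tE₂₁ : Expr 12
  tE₂₁ = nat 0 :- vA :^ 2 :* vB :* vC :- vA :* vC :^ 2 :* vD :+ nat 5 :* vA :* vB :^ 2 :* vD :+ nat 2 :* vB :* vC :^ 3 :- nat 5 :* vB :* vC :* vD :^ 2

  tE₃₀ : Expr 12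
  tE₃₀ = vA :^ 2 :* vB :* vC :+ vA :* vC :^ 2 :* vD :+ vA :* vB :^ 2 :* vD :- nat 2 :* vA :* vD :^ 3 :- vB :* vC :* vD :^ 2

  tD₁ : Expr 12
  tD₁ = nat 0 :- vA :^ 3 :* vD :+ nat 5 :* vA :^ 2 :* vB :* vC :- vA :* vC :^ 2 :* vD :+ nat 5 :* vA :* vB :^ 2 :* vD :- nat 5 :* vA :* vD :^ 3 :- nat 8 :* vB :* vC :^ 3 :- nat 5 :* vB :^ 3 :* vC :+ nat 10 :* vB :* vC :* vD :^ 2

  tD₂ : Expr 12
  tD₂ = nat 2 :* vA :^ 3 :* vD :- vA :^ 2 :* vB :* vC :- vA :* vC :^ 2 :* vD :- nat 4 :* vA :* vB :^ 2 :* vD :+ vA :* vD :^ 3 :+ vB :* vC :^ 3 :- nat 5 :* vB :^ 3 :* vC :+ nat 7 :* vB :* vC :* vD :^ 2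

  tD₃ : Expr 12
  tD₃ = nat 0 :- vA :^ 3 :* vD :- vA :^ 2 :* vB :* vC :+ nat 2 :* vA :* vC :^ 2 :* vD :- nat 7 :* vA :* vB :^ 2 :* vD :+ nat 10 :* vA :* vD :^ 3 :+ nat 4 :* vB :* vC :^ 3 :+ vB :^ 3 :* vC :- nat 8 :* vB :* vC :* vD :^ 2

  tD₄ : Expr 12
  tD₄ = vA :^ 3 :* vD :+ nat 7 :* vA :^ 2 :* vB :* vC :- nat 8 :* vA :* vC :^ 2 :* vD :- nat 5 :* vA :* vB :^ 2 :* vD :+ nat 20 :* vA :* vD :^ 3 :- nat 10 :* vB :* vC :^ 3 :+ nat 5 :* vB :^ 3 :* vC :- nat 10 :* vB :* vC :* vD :^ 2

  -- The zero set of `gR₁` and `gR₂` contains planes such as A = B, a = b. On this plane N = 0, and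
  -- the identity for `D₁` fails there, since `fD₁` vanishes and `tD₁` does not. The factor `eN` in
  -- `oddM` discards such components; the integer factor clears denominators of the cofactors.
  evenM oddM : ℕ → Expr 12
  evenM k = nat (ℕ.suc k) :* (nat 4 :* eK)
  oddM  k = nat (ℕ.suc k) :* (nat 4 :* eK :* vD :* eN)

  -- 4 K C D = (A² + a²) ρ₁ + (B² + b²) ρ₅ turns the forms P + C D Q and C P + D Q, multiplied by
  -- 4 K and 4 K D, into forms in A, a, B, b alone; on these q₁ and q₂ are the cofactors of gR₁ and gR₂.
  evenHs : (Q s₁ s₂ q₁ q₂ : Expr 12) → List (Expr 12 × Expr 12)
  evenHs Q s₁ s₂ q₁ q₂ =
    (Q :* eρ₁ :+ nat 4 :* eK :* s₁ , gC) ∷ (Q :* eρ₅ :+ nat 4 :* eK :* s₂ , gD) ∷ (nat 2 :* Q , gCD) ∷ (q₁ , gR₁) ∷ (q₂ , gR₂) ∷ []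

  oddHs : (P Q s₁ s₂ q₁ q₂ : Expr 12) → List (Expr 12 × Expr 12)
  oddHs P Q s₁ s₂ q₁ q₂ =
    (eN :* (P :* eρ₁ :+ nat 4 :* eK :* vD :* s₁) , gC) ∷ (eN :* (P :* eρ₅ :+ nat 2 :* eK :* Q :+ nat 4 :* eK :* vD :* s₂) , gD)
      ∷ (eN :* (nat 2 :* P) , gCD) ∷ (q₁ , gR₁) ∷ (q₂ , gR₂) ∷ []
  module Relations (R : ℤ-Ring) (A a B b C D c d : ℤ-Ring.Carrier R) where
    open ℤ-Ring R
    open Solve R

    env : Carrier → Carrier → Carrier → Carrier → Vec Carrier 12
    env w x y z = A ∷ a ∷ B ∷ b ∷ C ∷ D ∷ c ∷ d ∷ w ∷ x ∷ y ∷ z ∷ []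

    Zero : Expr 12 → Set
    Zero e = ⟦ e ⟧ (env 0# 0# 0# 0#) ≈ 0#

    Reg : Expr 12 → Set
    Reg e = Regular (⟦ e ⟧ (env 0# 0# 0# 0#))

    module Products (zC : Zero gC) (zD : Zero gD) (zc : Zero gc) (zd : Zero gd) (zR₁ : Zero gR₁) (zR₁′ : Zero gR₁′)
                    (reg : Reg (nat 2 :* eK :* vC :* vD :+ (vC :^ 2 :* eρ₁ :+ vD :^ 2 :* eρ₅)))
                    (regC : Reg (nat 2 :* vC)) (regD : Reg (nat 2 :* vD)) (reg1 : Reg (nat 1)) where

      -- Expanding both sides of `gR₁′` isolates 4 C D c d; in what remains c² and d² become A a and
      -- B b.
      zY : Zero gY
      zY = certify (env 0# 0# 0# 0#) (nat 1) gY
        ((nat 1 , gR₁′) ∷ (vC :^ 2 :- vD :^ 2 , gc) ∷ (nat 5 :* vD :^ 2 :- vC :^ 2 , gd) ∷ [])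
        reg1 (zR₁′ ∷ zc ∷ zd ∷ [])

      -- By `gY` the square of C² ρ₁ + D² ρ₅ is 4 C² D² (4 A a B b + ρ₁ ρ₅), and `gR₁` with K² = N²
      -- + 4 A a B b makes it (2 K C D)². The multiplier is the conjugate factor; for the theta
      -- series its constant term is 8.
      zCD : Zero gCD
      zCD = certify (env 0# 0# 0# 0#) (nat 2 :* eK :* vC :* vD :+ (vC :^ 2 :* eρ₁ :+ vD :^ 2 :* eρ₅)) gCD
        ((nat 4 :* vC :^ 2 :* vD :^ 2 , gR₁) ∷ (nat 4 :* vC :* vD :* vc :* vd :+ (vD :^ 2 :* eρ₅ :- vC :^ 2 :* eρ₁) , gY)
          ∷ (nat 0 :- nat 16 :* vC :^ 2 :* vD :^ 2 :* vd :^ 2 , gc) ∷ (nat 0 :- nat 16 :* vC :^ 2 :* vD :^ 2 :* ep , gd) ∷ [])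
        reg (zR₁ ∷ zY ∷ zc ∷ zd ∷ [])

      -- The difference of `gY` and `gCD` is divisible by 2 C, as their sum is by 2 D. The two
      -- quotients make c d D and c d C free of c and d, which is how these two letters disappear
      -- from the eta quotients.
      zYD : Zero (nat 2 :* vc :* vd :* vD :- (eK :* vD :- vC :* eρ₁))
      zYD = certify (env 0# 0# 0# 0#) (nat 2 :* vC) (nat 2 :* vc :* vd :* vD :- (eK :* vD :- vC :* eρ₁))
        ((nat 1 , gY) ∷ (nat 0 :- nat 1 , gCD) ∷ []) regC (zY ∷ zCD ∷ [])

      zYC : Zero (nat 2 :* vc :* vd :* vC :- (vD :* eρ₅ :- eK :* vC))
      zYC = certify (env 0# 0# 0# 0#) (nat 2 :* vD) (nat 2 :* vc :* vd :* vC :- (vD :* eρ₅ :- eK :* vC))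
        ((nat 1 , gY) ∷ (nat 1 , gCD) ∷ []) regD (zY ∷ zCD ∷ [])

    module Quartics (zC : Zero gC) (zD : Zero gD) (zR₁ : Zero gR₁) (zR₂ : Zero gR₂) (zCD : Zero gCD)
                    (regK : ∀ k → Reg (evenM k)) (regN : ∀ k → Reg (oddM k)) where

      even : ∀ k X Q s₁ s₂ q₁ q₂ → {T (null (normalise (evenM k :* X :- combination (evenHs Q s₁ s₂ q₁ q₂))))} → Zero X
      even k X Q s₁ s₂ q₁ q₂ {t} =
        certify (env 0# 0# 0# 0#) (evenM k) X (evenHs Q s₁ s₂ q₁ q₂) {t} (regK k) (zC ∷ zD ∷ zCD ∷ zR₁ ∷ zR₂ ∷ [])

      odd : ∀ k X P Q s₁ s₂ q₁ q₂ → {T (null (normalise (oddM k :* X :- combination (oddHs P Q s₁ s₂ q₁ q₂))))} → Zero X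
      odd k X P Q s₁ s₂ q₁ q₂ {t} =
        certify (env 0# 0# 0# 0#) (oddM k) X (oddHs P Q s₁ s₂ q₁ q₂) {t} (regN k) (zC ∷ zD ∷ zCD ∷ zR₁ ∷ zR₂ ∷ [])

      z₁ : Zero (eN :* (eu :- eU) :- eρ₅ :* (nat 4 :* vC :* vD :- nat 2 :* vA :* vB :- nat 2 :* va :* vb))
      z₁ = even 0 (eN :* (eu :- eU) :- eρ₅ :* (nat 4 :* vC :* vD :- nat 2 :* vA :* vB :- nat 2 :* va :* vb))
        (nat 4 :* vA :* va :- nat 20 :* vB :* vb)
        (nat 0)
        (nat 0)
        (nat 4 :* vA :^ 2 :+ nat 4 :* va :^ 2 :+ nat 20 :* vB :^ 2 :+ nat 20 :* vb :^ 2)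
        (nat 0)

      z₂ : Zero (es :* eu :* eδ :- (eU :+ nat 4 :* vC :^ 2) :* ep :* eN)
      z₂ = even 1 (es :* eu :* eδ :- (eU :+ nat 4 :* vC :^ 2) :* ep :* eN)
        (nat 2 :* vA :^ 2 :* va :^ 2 :- nat 10 :* vA :^ 2 :* vb :^ 2 :+ nat 10 :* va :^ 2 :* vB :^ 2 :- nat 50 :* vB :^ 2 :* vb :^ 2)
        (nat 0 :- nat 4 :* vA :^ 2 :* va :* vb :+ nat 3 :* vA :* va :^ 2 :* vB :+ nat 5 :* vA :* vB :* vb :^ 2)
        (nat 0 :- nat 5 :* vA :* va :^ 2 :* vB :+ nat 25 :* vA :* vB :* vb :^ 2)
        (nat 2 :* vA :^ 3 :* va :+ nat 10 :* vA :^ 2 :* vB :* vb :+ nat 2 :* vA :* va :^ 3 :+ nat 10 :* vA :* va :* vB :^ 2 :+ nat 10 :* vA :* va :* vb :^ 2 :+ nat 10 :* va :^ 2 :* vB :* vb :+ nat 50 :* vB :^ 3 :* vb :+ nat 50 :* vB :* vb :^ 3)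
        (nat 0)

      zE₁₂ : Zero (fE₁₂ :- nat 2 :* tE₁₂)
      zE₁₂ = odd 1 (fE₁₂ :- nat 2 :* tE₁₂)
        (nat 0 :- vA :^ 2 :* vB :+ nat 2 :* vA :* va :* vb :+ va :^ 2 :* vB :+ vB :^ 3 :- nat 3 :* vB :* vb :^ 2)
        (vA :^ 3 :+ vA :* va :^ 2 :- vA :* vB :^ 2 :+ vA :* vb :^ 2 :- nat 2 :* va :* vB :* vb)
        (vA :* vD :+ vB :* vC)
        (vA :* vD :- nat 3 :* vB :* vC)
        (nat 2 :* vA :^ 3 :* vB :^ 2 :+ nat 2 :* vA :^ 3 :* vb :^ 2 :- nat 2 :* vA :^ 2 :* va :* vB :* vb :+ nat 2 :* vA :* va :^ 2 :* vb :^ 2 :- nat 2 :* vA :* vB :^ 4 :+ nat 2 :* vA :* vB :^ 2 :* vb :^ 2 :+ nat 2 :* vA :* vb :^ 4 :- nat 2 :* va :* vB :^ 3 :* vb :- nat 4 :* va :* vB :* vb :^ 3)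
        (vA :^ 2 :* va :* vB :* vb :+ vA :* va :^ 2 :* vB :^ 2 :- vA :* vB :^ 2 :* vb :^ 2 :- va :* vB :^ 3 :* vb)

      zE₀₃ : Zero (fE₀₃ :- nat 2 :* tE₀₃)
      zE₀₃ = odd 1 (fE₀₃ :- nat 2 :* tE₀₃)
        (nat 0 :- vA :^ 2 :* vB :- nat 2 :* vA :* va :* vb :+ va :^ 2 :* vB :+ nat 5 :* vB :^ 3 :+ nat 5 :* vB :* vb :^ 2)
        (nat 0 :- vA :^ 3 :+ nat 3 :* vA :* va :^ 2 :+ nat 5 :* vA :* vB :^ 2 :- nat 5 :* vA :* vb :^ 2 :- nat 10 :* va :* vB :* vb)
        (nat 3 :* vA :* vD :+ vB :* vC)
        (nat 0 :- nat 5 :* vA :* vD :+ nat 5 :* vB :* vC)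
        (nat 2 :* vA :^ 3 :* vB :^ 2 :- nat 2 :* vA :^ 3 :* vb :^ 2 :+ nat 2 :* vA :^ 2 :* va :* vB :* vb :- nat 2 :* vA :* va :^ 2 :* vb :^ 2 :- nat 10 :* vA :* vB :^ 4 :- nat 10 :* vA :* vB :^ 2 :* vb :^ 2 :- nat 10 :* vA :* vb :^ 4 :+ nat 4 :* va :^ 3 :* vB :* vb :+ nat 10 :* va :* vB :^ 3 :* vb)
        (vA :^ 2 :* va :* vB :* vb :+ vA :* va :^ 2 :* vB :^ 2 :- nat 5 :* vA :* vB :^ 2 :* vb :^ 2 :- nat 5 :* va :* vB :^ 3 :* vb)

      zE₂₁ : Zero (eu :* ((eU :- nat 4 :* vC :^ 2) :* eδ :- nat 4 :* tE₂₁) :+ nat 4 :* ep :* eN :* es)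
      zE₂₁ = odd 0 (eu :* ((eU :- nat 4 :* vC :^ 2) :* eδ :- nat 4 :* tE₂₁) :+ nat 4 :* ep :* eN :* es)
        (nat 0 :- nat 4 :* vA :^ 3 :* va :* vb :+ vA :^ 2 :* va :^ 2 :* vB :+ nat 15 :* vA :^ 2 :* vB :* vb :^ 2 :+ nat 2 :* va :^ 4 :* vB :- nat 5 :* va :^ 2 :* vB :^ 3 :- nat 20 :* va :^ 2 :* vB :* vb :^ 2 :+ nat 25 :* vB :^ 3 :* vb :^ 2 :+ nat 50 :* vB :* vb :^ 4)
        (vA :^ 3 :* va :^ 2 :- nat 5 :* vA :^ 3 :* vb :^ 2 :+ nat 20 :* vA :^ 2 :* va :* vB :* vb :- nat 5 :* vA :* va :^ 2 :* vB :^ 2 :- nat 75 :* vA :* vB :^ 2 :* vb :^ 2)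
        (nat 2 :* va :^ 2 :* vB :* vC :- nat 10 :* vB :* vb :^ 2 :* vC)
        (nat 0 :- nat 10 :* va :^ 2 :* vB :* vC :+ nat 50 :* vB :* vb :^ 2 :* vC)
        (nat 0 :- nat 4 :* vA :^ 5 :* vb :^ 2 :+ nat 5 :* vA :^ 4 :* va :* vB :* vb :+ vA :^ 3 :* va :^ 2 :* vB :^ 2 :- nat 4 :* vA :^ 3 :* va :^ 2 :* vb :^ 2 :- nat 21 :* vA :^ 3 :* vB :^ 2 :* vb :^ 2 :- nat 10 :* vA :^ 3 :* vb :^ 4 :+ nat 7 :* vA :^ 2 :* va :^ 3 :* vB :* vb :+ nat 6 :* vA :^ 2 :* va :* vB :^ 3 :* vb :- nat 5 :* vA :^ 2 :* va :* vB :* vb :^ 3 :- nat 3 :* vA :* va :^ 4 :* vB :^ 2 :- nat 5 :* vA :* va :^ 2 :* vB :^ 4 :+ nat 20 :* vA :* va :^ 2 :* vB :^ 2 :* vb :^ 2 :+ nat 4 :* vA :* va :^ 2 :* vb :^ 4 :+ nat 5 :* vA :* vB :^ 4 :* vb :^ 2 :- nat 75 :* vA :* vB :^ 2 :* vb :^ 4 :- nat 20 :* vA :* vb :^ 6 :+ nat 2 :* va :^ 5 :* vB :* vb :- nat 5 :* va :^ 3 :* vB :^ 3 :* vb :- nat 24 :* va :^ 3 :* vB :* vb :^ 3 :+ nat 45 :* va :* vB :^ 5 :* vb :+ nat 75 :* va :* vB :^ 3 :* vb :^ 3 :+ nat 70 :* va :* vB :* vb :^ 5)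
        (nat 4 :* vA :^ 3 :* vb :^ 4 :- nat 8 :* vA :^ 2 :* va :* vB :* vb :^ 3 :+ nat 2 :* vA :* va :^ 4 :* vB :^ 2 :- nat 12 :* vA :* va :^ 2 :* vB :^ 2 :* vb :^ 2 :+ nat 30 :* vA :* vB :^ 2 :* vb :^ 4 :- nat 4 :* va :^ 3 :* vB :^ 3 :* vb :+ nat 20 :* va :* vB :^ 3 :* vb :^ 3)

      zE₃₀ : Zero (eu :* (hE₃₀ :- nat 4 :* tE₃₀) :- nat 4 :* ep :* eN :* (vA :* vC :+ vB :* vD))
      zE₃₀ = odd 0 (eu :* (hE₃₀ :- nat 4 :* tE₃₀) :- nat 4 :* ep :* eN :* (vA :* vC :+ vB :* vD))
        (nat 0 :- nat 4 :* vA :^ 3 :* va :* vb :+ nat 3 :* vA :^ 2 :* va :^ 2 :* vB :+ nat 5 :* vA :^ 2 :* vB :* vb :^ 2 :+ va :^ 2 :* vB :^ 3 :- nat 5 :* vB :^ 3 :* vb :^ 2)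
        (vA :^ 3 :* va :^ 2 :- nat 5 :* vA :^ 3 :* vb :^ 2 :- nat 4 :* vA :^ 2 :* va :* vB :* vb :+ nat 2 :* vA :* va :^ 4 :+ nat 3 :* vA :* va :^ 2 :* vB :^ 2 :- nat 12 :* vA :* va :^ 2 :* vb :^ 2 :+ nat 5 :* vA :* vB :^ 2 :* vb :^ 2 :+ nat 10 :* vA :* vb :^ 4)
        (nat 2 :* vA :* va :^ 2 :* vD :- nat 10 :* vA :* vb :^ 2 :* vD)
        (nat 0 :- nat 2 :* vA :* va :^ 2 :* vD :+ nat 10 :* vA :* vb :^ 2 :* vD)
        (nat 0 :- nat 4 :* vA :^ 5 :* vb :^ 2 :+ nat 7 :* vA :^ 4 :* va :* vB :* vb :- nat 3 :* vA :^ 3 :* va :^ 2 :* vB :^ 2 :- nat 4 :* vA :^ 3 :* va :^ 2 :* vb :^ 2 :- vA :^ 3 :* vB :^ 2 :* vb :^ 2 :- nat 10 :* vA :^ 3 :* vb :^ 4 :+ nat 7 :* vA :^ 2 :* va :^ 3 :* vB :* vb :+ nat 6 :* vA :^ 2 :* va :* vB :^ 3 :* vb :+ nat 7 :* vA :^ 2 :* va :* vB :* vb :^ 3 :- nat 3 :* vA :* va :^ 4 :* vB :^ 2 :- nat 5 :* vA :* va :^ 2 :* vB :^ 4 :+ nat 4 :* vA :* va :^ 2 :* vB :^ 2 :* vb :^ 2 :+ nat 5 :* vA :* vB :^ 4 :* vb :^ 2 :+ nat 5 :* vA :* vB :^ 2 :* vb :^ 4 :- va :^ 3 :* vB :^ 3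 :* vb :- nat 5 :* va :* vB :^ 5 :* vb :- nat 5 :* va :* vB :^ 3 :* vb :^ 3)
        (nat 4 :* vA :^ 3 :* vb :^ 4 :- nat 4 :* vA :* va :^ 2 :* vB :^ 2 :* vb :^ 2)

      zD₁ : Zero (nat 3 :* fD₁ :- tD₁)
      zD₁ = odd 1 (nat 3 :* fD₁ :- tD₁)
        (nat 0 :- nat 2 :* vA :^ 2 :* vB :+ nat 6 :* vA :* va :* vb :+ nat 2 :* va :^ 2 :* vB :- nat 10 :* vB :* vb :^ 2)
        (nat 3 :* vA :^ 3 :+ vA :* va :^ 2 :- nat 5 :* vA :* vB :^ 2 :+ nat 5 :* vA :* vb :^ 2)
        (vA :* vD :+ nat 8 :* vB :* vC)
        (nat 5 :* vA :* vD :- nat 10 :* vB :* vC)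
        (nat 4 :* vA :^ 3 :* vB :^ 2 :+ nat 6 :* vA :^ 3 :* vb :^ 2 :- nat 6 :* vA :^ 2 :* va :* vB :* vb :+ nat 6 :* vA :* va :^ 2 :* vb :^ 2 :+ nat 10 :* vA :* vB :^ 2 :* vb :^ 2 :+ nat 10 :* vA :* vb :^ 4 :- nat 2 :* va :^ 3 :* vB :* vb :- nat 10 :* va :* vB :^ 3 :* vb :- nat 10 :* va :* vB :* vb :^ 3)
        (nat 2 :* vA :^ 2 :* va :* vB :* vb :+ nat 2 :* vA :* va :^ 2 :* vB :^ 2)

      zD₂ : Zero (nat 3 :* fD₂ :- tD₂)
      zD₂ = odd 1 (nat 3 :* fD₂ :- tD₂)
        (vA :^ 2 :* vB :- nat 6 :* vA :* va :* vb :- va :^ 2 :* vB :+ nat 3 :* vB :^ 3 :+ nat 11 :* vB :* vb :^ 2)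
        (nat 0 :- nat 3 :* vA :^ 3 :+ vA :* va :^ 2 :+ nat 7 :* vA :* vB :^ 2 :- nat 7 :* vA :* vb :^ 2 :- nat 6 :* va :* vB :* vb)
        (vA :* vD :- vB :* vC)
        (nat 0 :- vA :* vD :- nat 7 :* vB :* vC)
        (nat 0 :- nat 2 :* vA :^ 3 :* vB :^ 2 :- nat 6 :* vA :^ 3 :* vb :^ 2 :+ nat 6 :* vA :^ 2 :* va :* vB :* vb :- nat 6 :* vA :* va :^ 2 :* vb :^ 2 :- nat 6 :* vA :* vB :^ 4 :- nat 14 :* vA :* vB :^ 2 :* vb :^ 2 :- nat 14 :* vA :* vb :^ 4 :+ nat 4 :* va :^ 3 :* vB :* vb :+ nat 14 :* va :* vB :^ 3 :* vb :+ nat 8 :* va :* vB :* vb :^ 3)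
        (nat 0 :- vA :^ 2 :* va :* vB :* vb :- vA :* va :^ 2 :* vB :^ 2 :- nat 3 :* vA :* vB :^ 2 :* vb :^ 2 :- nat 3 :* va :* vB :^ 3 :* vb)

      zD₃ : Zero (nat 3 :* fD₃ :- tD₃)
      zD₃ = odd 0 (nat 3 :* fD₃ :- tD₃)
        (nat 0 :- vA :^ 2 :* vB :+ va :^ 2 :* vB :+ nat 3 :* vB :^ 3 :+ vB :* vb :^ 2)
        (nat 2 :* vA :* va :^ 2 :+ nat 2 :* vA :* vB :^ 2 :- nat 2 :* vA :* vb :^ 2 :- nat 6 :* va :* vB :* vb)
        (nat 0 :- vA :* vD :- nat 2 :* vB :* vC)
        (nat 0 :- nat 5 :* vA :* vD :+ nat 4 :* vB :* vC)
        (nat 2 :* vA :^ 3 :* vB :^ 2 :- nat 6 :* vA :* vB :^ 4 :- nat 4 :* vA :* vB :^ 2 :* vb :^ 2 :- nat 4 :* vA :* vb :^ 4 :+ nat 2 :* va :^ 3 :* vB :* vb :+ nat 4 :* va :* vB :^ 3 :* vb :- nat 2 :* va :* vB :* vb :^ 3)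
        (vA :^ 2 :* va :* vB :* vb :+ vA :* va :^ 2 :* vB :^ 2 :- nat 3 :* vA :* vB :^ 2 :* vb :^ 2 :- nat 3 :* va :* vB :^ 3 :* vb)

      zD₄ : Zero (nat 3 :* fD₄ :- tD₄)
      zD₄ = odd 0 (nat 3 :* fD₄ :- tD₄)
        (nat 0 :- nat 2 :* vA :^ 2 :* vB :+ nat 6 :* vA :* va :* vb :+ nat 2 :* va :^ 2 :* vB :- nat 10 :* vB :* vb :^ 2)
        (nat 3 :* vA :^ 3 :+ vA :* va :^ 2 :- nat 5 :* vA :* vB :^ 2 :+ nat 5 :* vA :* vb :^ 2)
        (nat 4 :* vA :* vD :+ nat 5 :* vB :* vC)
        (nat 0 :- nat 10 :* vA :* vD :+ nat 5 :* vB :* vC)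
        (nat 4 :* vA :^ 3 :* vB :^ 2 :+ nat 6 :* vA :^ 3 :* vb :^ 2 :- nat 6 :* vA :^ 2 :* va :* vB :* vb :+ nat 6 :* vA :* va :^ 2 :* vb :^ 2 :+ nat 10 :* vA :* vB :^ 2 :* vb :^ 2 :+ nat 10 :* vA :* vb :^ 4 :- nat 2 :* va :^ 3 :* vB :* vb :- nat 10 :* va :* vB :^ 3 :* vb :- nat 10 :* va :* vB :* vb :^ 3)
        (nat 2 :* vA :^ 2 :* va :* vB :* vb :+ nat 2 :* vA :* va :^ 2 :* vB :^ 2)

-- Character sums, Eisenstein series and eta quotients solved from their equations.

module ThetaUnknowns where

  open Polynomials
  open ThetaAlgebra
  open import Data.List using (List; []; _∷_)
  open import Data.List.Relation.Unary.All using (All; []; _∷_)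
  open import Data.Product using (_,_)
  open import Data.Vec using (Vec; []; _∷_)

  module Unknowns (R : ℤ-Ring) (A a B b C D c d w x y z : ℤ-Ring.Carrier R) where
    open ℤ-Ring R
    open Solve R
    open Relations R A a B b C D c d using (env; Zero; Reg)

    ρ : Vec Carrier 12
    ρ = env w x y z

    Z : Expr 12 → Set
    Z e = ⟦ e ⟧ ρ ≈ 0#

    -- w = Σ χ₅(m) c̄ₘ and x is its value at - q.
    c₅-value : Zero gR₁ → Z (eU :* vx :+ eu :* vw) → Z (eU :* eu :+ nat 5 :* vw :* vx :- nat 16 :* ep :^ 2) →
               Regular (⟦ nat 5 :* (vw :* eu :+ nat 4 :* ep :* eN) ⟧ ρ) → Z (vw :* eu :- nat 4 :* ep :* eN)
    c₅-value zR₁ z₁ z₂ r = certify ρ (nat 5 :* (vw :* eu :+ nat 4 :* ep :* eN)) (vw :* eu :- nat 4 :* ep :* eN)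
      ((nat 0 :- eu :* eU , eU :* eu :+ nat 5 :* vw :* vx :- nat 16 :* ep :^ 2) ∷ (nat 5 :* eu :* vw , eU :* vx :+ eu :* vw)
        ∷ (nat 25 :* gR₁ :- nat 40 :* ep :* eρ₅ , gR₁) ∷ [])
      r (z₂ ∷ z₁ ∷ zR₁ ∷ [])

    -- Modulo `gR₁` one has U u = 4 A a ρ₅. Multiplying w + x + 2 y = 0 by U u therefore gives 8 A a
    -- ρ₅ y = 4 A a N (u - U), and the second hypothesis evaluates N (u - U).
    c₅²-value : Zero gR₁ → Zero (eN :* (eu :- eU) :- eρ₅ :* (nat 4 :* vC :* vD :- nat 2 :* vA :* vB :- nat 2 :* va :* vb)) →
                Z (vw :+ vx :+ nat 2 :* vy) → Z (vw :* eu :- nat 4 :* ep :* eN) → Z (vx :* eU :+ nat 4 :* ep :* eN) →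
                Regular (⟦ nat 8 :* ep :* eρ₅ ⟧ ρ) → Z (vy :- (nat 2 :* vC :* vD :- vA :* vB :- va :* vb))
    c₅²-value zR₁ z₁ z₂ z₃ z₄ r = certify ρ (nat 8 :* ep :* eρ₅) (vy :- (nat 2 :* vC :* vD :- vA :* vB :- va :* vb))
      ((nat 10 :* vy , gR₁) ∷ (nat 4 :* ep , eN :* (eu :- eU) :- eρ₅ :* (nat 4 :* vC :* vD :- nat 2 :* vA :* vB :- nat 2 :* va :* vb))
        ∷ (eU :* eu , vw :+ vx :+ nat 2 :* vy) ∷ (nat 0 :- eU , vw :* eu :- nat 4 :* ep :* eN) ∷ (nat 0 :- eu , vx :* eU :+ nat 4 :* ep :* eN) ∷ [])
      r (zR₁ ∷ z₁ ∷ z₂ ∷ z₃ ∷ z₄ ∷ [])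

    g₅-value : Zero (es :* eu :* eδ :- (eU :+ nat 4 :* vC :^ 2) :* ep :* eN) →
               Z (nat 4 :* es :* vx :- (eU :+ nat 4 :* vC :^ 2) :* vw) → Z (vw :* eu :- nat 4 :* ep :* eN) →
               Regular (⟦ nat 4 :* es :* eu ⟧ ρ) → Z (vx :- eδ)
    g₅-value z₁ z₂ z₃ r = certify ρ (nat 4 :* es :* eu) (vx :- eδ)
      ((nat 0 :- nat 4 , es :* eu :* eδ :- (eU :+ nat 4 :* vC :^ 2) :* ep :* eN)
        ∷ (eu , nat 4 :* es :* vx :- (eU :+ nat 4 :* vC :^ 2) :* vw) ∷ (eU :+ nat 4 :* vC :^ 2 , vw :* eu :- nat 4 :* ep :* eN) ∷ [])
      r (z₁ ∷ z₂ ∷ z₃ ∷ [])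

    E₁₂-value : Zero (fE₁₂ :- nat 2 :* tE₁₂) → Z (nat 4 :* vx :- fE₁₂) → Regular (⟦ nat 2 ⟧ ρ) → Z (nat 2 :* vx :- tE₁₂)
    E₁₂-value z₁ z₂ r = certify ρ (nat 2) (nat 2 :* vx :- tE₁₂)
      ((nat 1 , fE₁₂ :- nat 2 :* tE₁₂) ∷ (nat 1 , nat 4 :* vx :- fE₁₂) ∷ []) r (z₁ ∷ z₂ ∷ [])

    E₀₃-value : Zero (fE₀₃ :- nat 2 :* tE₀₃) → Z (nat 4 :* vx :- fE₀₃) → Regular (⟦ nat 2 ⟧ ρ) → Z (nat 2 :* vx :- tE₀₃)
    E₀₃-value z₁ z₂ r = certify ρ (nat 2) (nat 2 :* vx :- tE₀₃)
      ((nat 1 , fE₀₃ :- nat 2 :* tE₀₃) ∷ (nat 1 , nat 4 :* vx :- fE₀₃) ∷ []) r (z₁ ∷ z₂ ∷ [])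

    E₂₁-value : Zero (eu :* ((eU :- nat 4 :* vC :^ 2) :* eδ :- nat 4 :* tE₂₁) :+ nat 4 :* ep :* eN :* es) →
                Z (nat 16 :* vx :- ((eU :- nat 4 :* vC :^ 2) :* eδ :+ vw :* es)) → Z (vw :* eu :- nat 4 :* ep :* eN) →
                Regular (⟦ nat 4 :* eu ⟧ ρ) → Z (nat 4 :* vx :- tE₂₁)
    E₂₁-value z₁ z₂ z₃ r = certify ρ (nat 4 :* eu) (nat 4 :* vx :- tE₂₁)
      ((nat 1 , eu :* ((eU :- nat 4 :* vC :^ 2) :* eδ :- nat 4 :* tE₂₁) :+ nat 4 :* ep :* eN :* es)
        ∷ (eu , nat 16 :* vx :- ((eU :- nat 4 :* vC :^ 2) :* eδ :+ vw :* es)) ∷ (es , vw :* eu :- nat 4 :* ep :* eN) ∷ [])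
      r (z₁ ∷ z₂ ∷ z₃ ∷ [])

    E₃₀-value : Zero (eu :* (hE₃₀ :- nat 4 :* tE₃₀) :- nat 4 :* ep :* eN :* (vA :* vC :+ vB :* vD)) →
                Z (nat 16 :* vx :- (hE₃₀ :- vw :* (vA :* vC :+ vB :* vD))) → Z (vw :* eu :- nat 4 :* ep :* eN) →
                Regular (⟦ nat 4 :* eu ⟧ ρ) → Z (nat 4 :* vx :- tE₃₀)
    E₃₀-value z₁ z₂ z₃ r = certify ρ (nat 4 :* eu) (nat 4 :* vx :- tE₃₀)
      ((nat 1 , eu :* (hE₃₀ :- nat 4 :* tE₃₀) :- nat 4 :* ep :* eN :* (vA :* vC :+ vB :* vD))
        ∷ (eu , nat 16 :* vx :- (hE₃₀ :- vw :* (vA :* vC :+ vB :* vD))) ∷ (nat 0 :- (vA :* vC :+ vB :* vD) , vw :* eu :- nat 4 :* ep :* eN) ∷ [])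
      r (z₁ ∷ z₂ ∷ z₃ ∷ [])

    gYD gYC : Expr 12
    gYD = nat 2 :* vc :* vd :* vD :- (eK :* vD :- vC :* eρ₁)
    gYC = nat 2 :* vc :* vd :* vC :- (vD :* eρ₅ :- eK :* vC)

    D₁-value : Zero (nat 3 :* fD₁ :- tD₁) → Z (nat 4 :* vx :- fD₁) → Regular (⟦ nat 1 ⟧ ρ) → Z (nat 12 :* vx :- tD₁)
    D₁-value z₁ z₂ r = certify ρ (nat 1) (nat 12 :* vx :- tD₁)
      ((nat 1 , nat 3 :* fD₁ :- tD₁) ∷ (nat 3 , nat 4 :* vx :- fD₁) ∷ []) r (z₁ ∷ z₂ ∷ [])

    D₂-value : Zero (nat 3 :* fD₂ :- tD₂) → Zero gd → Zero gYD → Z (nat 4 :* vx :- vb :* vd :* (vC :* vd :- vc :* vD)) →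
               Regular (⟦ nat 1 ⟧ ρ) → Z (nat 24 :* vx :- tD₂)
    D₂-value z₁ z₂ z₃ z₄ r = certify ρ (nat 1) (nat 24 :* vx :- tD₂)
      ((nat 1 , nat 3 :* fD₂ :- tD₂) ∷ (nat 6 :* vb :* vC , gd) ∷ (nat 0 :- nat 3 :* vb , gYD)
        ∷ (nat 6 , nat 4 :* vx :- vb :* vd :* (vC :* vd :- vc :* vD)) ∷ []) r (z₁ ∷ z₂ ∷ z₃ ∷ z₄ ∷ [])

    D₃-value : Zero (nat 3 :* fD₃ :- tD₃) → Zero gc → Zero gd → Zero gYD → Zero gYC →
               Z (nat 8 :* vx :- (vD :* vd :- vC :* vc) :* (vb :* vc :+ va :* vd)) → Regular (⟦ nat 1 ⟧ ρ) → Z (nat 48 :* vx :- tD₃)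
    D₃-value z₁ z₂ z₃ z₄ z₅ z₆ r = certify ρ (nat 1) (nat 48 :* vx :- tD₃)
      ((nat 1 , nat 3 :* fD₃ :- tD₃) ∷ (nat 0 :- nat 6 :* vb :* vC , gc) ∷ (nat 6 :* va :* vD , gd) ∷ (nat 3 :* vb , gYD) ∷ (nat 0 :- nat 3 :* va , gYC)
        ∷ (nat 6 , nat 8 :* vx :- (vD :* vd :- vC :* vc) :* (vb :* vc :+ va :* vd)) ∷ []) r (z₁ ∷ z₂ ∷ z₃ ∷ z₄ ∷ z₅ ∷ z₆ ∷ [])

    D₄-value : Zero (nat 3 :* fD₄ :- tD₄) → Zero gc → Zero gd → Zero gYD → Zero gYC →
               Z (nat 8 :* vx :- (nat 5 :* vD :* vd :- vC :* vc) :* (vb :* vc :- va :* vd)) → Regular (⟦ nat 1 ⟧ ρ) → Z (nat 48 :* vx :- tD₄)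
    D₄-value z₁ z₂ z₃ z₄ z₅ z₆ r = certify ρ (nat 1) (nat 48 :* vx :- tD₄)
      ((nat 1 , nat 3 :* fD₄ :- tD₄) ∷ (nat 0 :- nat 6 :* vb :* vC , gc) ∷ (nat 0 :- nat 30 :* va :* vD , gd) ∷ (nat 15 :* vb , gYD) ∷ (nat 3 :* va , gYC)
        ∷ (nat 6 , nat 8 :* vx :- (nat 5 :* vD :* vd :- vC :* vc) :* (vb :* vc :- va :* vd)) ∷ []) r (z₁ ∷ z₂ ∷ z₃ ∷ z₄ ∷ z₅ ∷ z₆ ∷ [])

-- Partial fractions of products of two Lambert terms.

module PairIdentities where

  open Polynomials
  open Forms
  open import Data.Bool using (T)
  open import Data.Fin.Patterns
  open import Data.Integer using (ℤ; +_; -1ℤ; -[1+_])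
  open import Data.List using (List; []; _∷_)
  open import Data.Nat using (ℕ)
  open import Data.Vec using (Vec; []; _∷_)

  lw₈ lw₄₀ : List ℤ
  lw₈  = + 0 ∷ + 1 ∷ + 0 ∷ -[1+ 2 ] ∷ []
  lw₄₀ = + 0 ∷ + 1 ∷ + 0 ∷ + 3 ∷ + 0 ∷ + 0 ∷ + 0 ∷ -[1+ 6 ] ∷ + 0 ∷ + 9 ∷ + 0 ∷ -[1+ 10 ] ∷ + 0 ∷ + 13 ∷ + 0 ∷ + 0 ∷ + 0 ∷ -[1+ 16 ] ∷ + 0 ∷ -[1+ 18 ] ∷ []

  module Fractions (R : ℤ-Ring) (x y z w : ℤ-Ring.Carrier R) where
    open ℤ-Ring R
    open Solve R
    open import Relation.Binary.Reasoning.Setoid setoid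

    ρ : Vec Carrier 4
    ρ = x ∷ y ∷ z ∷ w ∷ []

    record Frac (F X Y : Carrier) (l : List ℤ) (ε : ℤ) (d : ℕ) : Set where
      constructor mkFrac
      field
        form : ⟦ formE l ε d (# 0F) (# 1F) (# 2F) ⟧ (F ∷ X ∷ Y ∷ []) ≈ 0#

    -- The series v represents the fraction n / D. Sums and products of series then become formal
    -- operations on numerators, and an equality of series reduces to one of polynomials once the
    -- common denominator is known to be regular.
    record Over (D : Expr 4) (v : Carrier) (n : Expr 4) : Set where
      constructor mkOver
      field
        quotient : v * ⟦ D ⟧ ρ ≈ ⟦ n ⟧ ρ

    infixl 6 _⊞_ _⊟_
    infixl 7 _⊠_
    _⊞_ : ∀ {D a b m n} → Over D a m → Over D b n → Over D (a + b) (m :+ n)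
    mkOver p ⊞ mkOver q = mkOver (trans (distribʳ _ _ _) (+-cong p q))

    _⊟_ : ∀ {D a b m n} → Over D a m → Over D b n → Over D (a - b) (m :- n)
    _⊟_ {D} {a} {b} (mkOver p) (mkOver q) = mkOver (trans (distribʳ _ _ _) (+-cong p (trans (sym (-‿distribˡ-* b _)) (-‿cong q))))
      where open import Algebra.Properties.Ring ring using (-‿distribˡ-*)

    _⊠_ : ∀ {D E a b m n} → Over D a m → Over E b n → Over (D :* E) (a * b) (m :* n)
    mkOver p ⊠ mkOver q = mkOver (trans (interchange _ _ _ _) (*-cong p q))
      where open import Algebra.Properties.CommutativeSemigroup *-commutativeSemigroup using (interchange)

    scale : ∀ c {D a n} → Over D a n → Over D (ι c * a) (con c :* n)
    scale c (mkOver p) = mkOver (trans (*-assoc _ _ _) (*-congˡ p))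

    up : ∀ {D a n} e D′ → {T (null (normalise (D :* e :- D′)))} → Over D a n → Over D′ a (n :* e)
    up {D} {a} {n} e D′ {t} (mkOver p) = mkOver (trans (*-congˡ (sym (poly (D :* e) D′ ρ {t}))) (trans (sym (*-assoc _ _ _)) (*-congʳ p)))

    compare : ∀ {D a b m n} → Over D a m → Over D b n → {T (null (normalise (m :- n)))} → Regular (⟦ D ⟧ ρ) → a ≈ b
    compare {D} {a} {b} {m} {n} (mkOver p) (mkOver q) {t} r = x-y≈0⇒x≈y (r (a - b) (begin
      ⟦ D ⟧ ρ * (a - b)              ≈⟨ *-comm _ _ ⟩
      (a - b) * ⟦ D ⟧ ρ              ≈⟨ distribʳ _ _ _ ⟩
      a * ⟦ D ⟧ ρ + (- b) * ⟦ D ⟧ ρ  ≈⟨ +-cong p (trans (sym (-‿distribˡ-* b _)) (-‿cong q)) ⟩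
      ⟦ m ⟧ ρ - ⟦ n ⟧ ρ              ≈⟨ +-congʳ (poly m n ρ {t}) ⟩
      ⟦ n ⟧ ρ - ⟦ n ⟧ ρ              ≈⟨ -‿inverseʳ _ ⟩
      0#                             ∎))
      where open import Algebra.Properties.Ring ring using (-‿distribˡ-*)

    regular-* : ∀ {a b} → Regular a → Regular b → Regular (a * b)
    regular-* ra rb v h = rb v (ra _ (trans (sym (*-assoc _ _ _)) h))

    X Y Z W : Expr 4
    X = # 0F
    Y = # 1F
    Z = # 2F
    W = # 3F

    plus : ℕ → Expr 4 → Expr 4 → Expr 4
    plus d a b = b :^ d :- con -1ℤ :* a :^ d

    minus : ℕ → Expr 4 → Expr 4 → Expr 4
    minus d a b = b :^ d :- con (+ 1) :* a :^ d

    XZ YW : Expr 4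
    XZ = X :* Z
    YW = Y :* W

    DT₄ DT₂₀ DTy DTc : Expr 4
    DT₄  = plus 4 XZ YW
    DT₂₀ = plus 20 XZ YW
    DTy  = minus 2 XZ YW
    DTc  = plus 2 XZ YW

    ⟨1⟩ : Expr 4
    ⟨1⟩ = con (+ 1)

    -- In hyperbolic terms: sech s sech t = (tanh s + tanh t) / sinh (s + t), where y stands for 1 /
    -- (2 sinh).
    I₁ : ∀ {cm cn yM tm tn} → Frac cm x y lc -1ℤ 2 → Frac cn z w lc -1ℤ 2 → Frac yM (x * z) (y * w) ly (+ 1) 2 →
         Frac tm x y lτ -1ℤ 2 → Frac tn z w lτ -1ℤ 2 →
         Regular (⟦ plus 2 X Y ⟧ ρ) → Regular (⟦ plus 2 Z W ⟧ ρ) → Regular (⟦ DTy ⟧ ρ) →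
         cm * cn ≈ ι (+ 2) * (yM * (tm + tn))
    I₁ (mkFrac c) (mkFrac c′) (mkFrac yy) (mkFrac t) (mkFrac t′) r₁ r₂ r₃ = compare
      (up DTy D (fc ⊠ fc′)) (up ⟨1⟩ D (scale (+ 2) (fy ⊠ (up (plus 2 Z W) D₀ ft ⊞ up (plus 2 X Y) D₀ ft′)))) (regular-* (regular-* r₁ r₂) r₃)
      where
      D₀ = plus 2 X Y :* plus 2 Z W
      D  = D₀ :* DTy
      fc  = mkOver {plus 2 X Y} {_} {homE lc 2 X Y} (x-y≈0⇒x≈y c)
      fc′ = mkOver {plus 2 Z W} {_} {homE lc 2 Z W} (x-y≈0⇒x≈y c′)
      fy  = mkOver {DTy} {_} {homE ly 2 XZ YW} (x-y≈0⇒x≈y yy)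
      ft  = mkOver {plus 2 X Y} {_} {homE lτ 2 X Y} (x-y≈0⇒x≈y t)
      ft′ = mkOver {plus 2 Z W} {_} {homE lτ 2 Z W} (x-y≈0⇒x≈y t′)

    -- Over the denominator cosh 2s cosh 2t the two terms on the right are 2 cosh (s + t) and 2 cosh
    -- (s - t), whose sum is 4 cosh s cosh t.
    I₂ : ∀ {gm gn yM t2m t2n cM c2m c2n} → Frac gm x y lg -1ℤ 4 → Frac gn z w lg -1ℤ 4 → Frac yM (x * z) (y * w) ly (+ 1) 2 →
         Frac t2m (x ^ 2) (y ^ 2) lτ -1ℤ 2 → Frac t2n (z ^ 2) (w ^ 2) lτ -1ℤ 2 →
         Frac cM (x * z) (y * w) lc -1ℤ 2 → Frac c2m (x ^ 2) (y ^ 2) lc -1ℤ 2 → Frac c2n (z ^ 2) (w ^ 2) lc -1ℤ 2 →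
         Regular (⟦ plus 4 X Y ⟧ ρ) → Regular (⟦ plus 4 Z W ⟧ ρ) → Regular (⟦ DTy ⟧ ρ) → Regular (⟦ plus 2 XZ YW ⟧ ρ) →
         ι (+ 4) * (gm * gn) ≈ ι (+ 2) * (yM * (t2m + t2n)) + cM * (c2m + c2n)
    I₂ (mkFrac g) (mkFrac g′) (mkFrac yy) (mkFrac t) (mkFrac t′) (mkFrac cc) (mkFrac c) (mkFrac c′) r₁ r₂ r₃ r₄ = compare
      (up (DTy :* DTc) D (scale (+ 4) (fg ⊠ fg′)))
      (up DTc D (scale (+ 2) (fy ⊠ (up D₂ D₀ ft ⊞ up D₁ D₀ ft′))) ⊞ up DTy D (fcM ⊠ (up D₂ D₀ fc ⊞ up D₁ D₀ fc′)))
      (regular-* (regular-* r₁ r₂) (regular-* r₃ r₄))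
      where
      D₁ = plus 4 X Y
      D₂ = plus 4 Z W
      D₀ = D₁ :* D₂
      D  = D₀ :* (DTy :* DTc)
      fg  = mkOver {D₁} {_} {homE lg 4 X Y} (x-y≈0⇒x≈y g)
      fg′ = mkOver {D₂} {_} {homE lg 4 Z W} (x-y≈0⇒x≈y g′)
      fy  = mkOver {DTy} {_} {homE ly 2 XZ YW} (x-y≈0⇒x≈y yy)
      fcM = mkOver {DTc} {_} {homE lc 2 XZ YW} (x-y≈0⇒x≈y cc)
      ft  = up ⟨1⟩ D₁ (mkOver {plus 2 (X :^ 2) (Y :^ 2)} {_} {homE lτ 2 (X :^ 2) (Y :^ 2)} (x-y≈0⇒x≈y t))
      ft′ = up ⟨1⟩ D₂ (mkOver {plus 2 (Z :^ 2) (W :^ 2)} {_} {homE lτ 2 (Z :^ 2) (W :^ 2)} (x-y≈0⇒x≈y t′))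
      fc  = up ⟨1⟩ D₁ (mkOver {plus 2 (X :^ 2) (Y :^ 2)} {_} {homE lc 2 (X :^ 2) (Y :^ 2)} (x-y≈0⇒x≈y c))
      fc′ = up ⟨1⟩ D₂ (mkOver {plus 2 (Z :^ 2) (W :^ 2)} {_} {homE lc 2 (Z :^ 2) (W :^ 2)} (x-y≈0⇒x≈y c′))

    I₄ : ∀ {cm gn vM tm t2n gM c2n} → Frac cm x y lc -1ℤ 2 → Frac gn z w lg -1ℤ 4 → Frac vM (x * z) (y * w) lv -1ℤ 4 →
         Frac tm x y lτ -1ℤ 2 → Frac t2n (z ^ 2) (w ^ 2) lτ -1ℤ 2 → Frac gM (x * z) (y * w) lg -1ℤ 4 → Frac c2n (z ^ 2) (w ^ 2) lc -1ℤ 2 →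
         Regular (⟦ plus 2 X Y ⟧ ρ) → Regular (⟦ plus 4 Z W ⟧ ρ) → Regular (⟦ plus 4 XZ YW ⟧ ρ) →
         cm * gn ≈ vM * (tm + t2n) + gM * c2n
    I₄ (mkFrac c) (mkFrac g) (mkFrac v) (mkFrac t) (mkFrac t′) (mkFrac g′) (mkFrac c′) r₁ r₂ r₃ = compare
      (up DT₄ D (fc ⊠ fg)) (up ⟨1⟩ D (fv ⊠ (up D₂ D₀ ft ⊞ up D₁ D₀ ft′)) ⊞ up D₁ D (fgM ⊠ fc′)) (regular-* (regular-* r₁ r₂) r₃)
      where
      D₁ = plus 2 X Y
      D₂ = plus 4 Z W
      D₀ = D₁ :* D₂
      D  = D₀ :* DT₄
      fc  = mkOver {D₁} {_} {homE lc 2 X Y} (x-y≈0⇒x≈y c)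
      fg  = mkOver {D₂} {_} {homE lg 4 Z W} (x-y≈0⇒x≈y g)
      fv  = mkOver {DT₄} {_} {homE lv 4 XZ YW} (x-y≈0⇒x≈y v)
      fgM = mkOver {DT₄} {_} {homE lg 4 XZ YW} (x-y≈0⇒x≈y g′)
      ft  = mkOver {D₁} {_} {homE lτ 2 X Y} (x-y≈0⇒x≈y t)
      ft′ = up ⟨1⟩ D₂ (mkOver {plus 2 (Z :^ 2) (W :^ 2)} {_} {homE lτ 2 (Z :^ 2) (W :^ 2)} (x-y≈0⇒x≈y t′))
      fc′ = up ⟨1⟩ D₂ (mkOver {plus 2 (Z :^ 2) (W :^ 2)} {_} {homE lc 2 (Z :^ 2) (W :^ 2)} (x-y≈0⇒x≈y c′))

    I₅ : ∀ {gm c2n zM vm yM vn cM gn} → Frac gm x y lg -1ℤ 4 → Frac c2n (z ^ 2) (w ^ 2) lc -1ℤ 2 →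
         Frac zM ((x * z) ^ 2) ((y * w) ^ 2) ly (+ 1) 2 → Frac vm x y lv -1ℤ 4 → Frac yM (x * z) (y * w) ly (+ 1) 2 → Frac vn z w lv -1ℤ 4 →
         Frac cM (x * z) (y * w) lc -1ℤ 2 → Frac gn z w lg -1ℤ 4 →
         Regular (⟦ plus 4 X Y ⟧ ρ) → Regular (⟦ plus 4 Z W ⟧ ρ) → Regular (⟦ DTy ⟧ ρ) → Regular (⟦ plus 2 XZ YW ⟧ ρ) →
         ι (+ 2) * (gm * c2n) ≈ ι (+ 4) * (zM * vm) + ι (+ 2) * (yM * vn) + cM * gn
    I₅ (mkFrac g) (mkFrac c) (mkFrac zz) (mkFrac v) (mkFrac yy) (mkFrac v′) (mkFrac cc) (mkFrac g′) r₁ r₂ r₃ r₄ = compare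
      (up (DTy :* DTc) D (scale (+ 2) (fg ⊠ fc)))
      (up D₂ D (scale (+ 4) (fz ⊠ fv)) ⊞ up (D₁ :* DTc) D (scale (+ 2) (fy ⊠ fv′)) ⊞ up (D₁ :* DTy) D (fcM ⊠ fg′))
      (regular-* (regular-* r₁ r₂) (regular-* r₃ r₄))
      where
      D₁ = plus 4 X Y
      D₂ = plus 4 Z W
      D  = (D₁ :* D₂) :* (DTy :* DTc)
      fg  = mkOver {D₁} {_} {homE lg 4 X Y} (x-y≈0⇒x≈y g)
      fg′ = mkOver {D₂} {_} {homE lg 4 Z W} (x-y≈0⇒x≈y g′)
      fv  = mkOver {D₁} {_} {homE lv 4 X Y} (x-y≈0⇒x≈y v)
      fv′ = mkOver {D₂} {_} {homE lv 4 Z W} (x-y≈0⇒x≈y v′)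
      fy  = mkOver {DTy} {_} {homE ly 2 XZ YW} (x-y≈0⇒x≈y yy)
      fz  = up ⟨1⟩ (DTy :* DTc) (mkOver {minus 2 (XZ :^ 2) (YW :^ 2)} {_} {homE ly 2 (XZ :^ 2) (YW :^ 2)} (x-y≈0⇒x≈y zz))
      fcM = mkOver {DTc} {_} {homE lc 2 XZ YW} (x-y≈0⇒x≈y cc)
      fc  = up ⟨1⟩ D₂ (mkOver {plus 2 (Z :^ 2) (W :^ 2)} {_} {homE lc 2 (Z :^ 2) (W :^ 2)} (x-y≈0⇒x≈y c))

    -- The quotient of b^(5d) + a^(5d) by b^d + a^d, which brings untwisted terms to the denominator
    -- of the terms twisted modulo 5.
    cofactor : ℕ → Expr 4 → Expr 4 → Expr 4
    cofactor d a b = b :^ (4 Data.Nat.* d) :- b :^ (3 Data.Nat.* d) :* a :^ d :+ b :^ (2 Data.Nat.* d) :* a :^ (2 Data.Nat.* d) :- b :^ d :* a :^ (3 Data.Nat.* d) :+ a :^ (4 Data.Nat.* d)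

    -- The terms in P and Q complete the twisted products to an expression that decomposes along m +
    -- n. They are odd in each index separately, so they vanish when summed with weight 1.
    I₆ : ∀ {cm c5m Ĝn ĉm gn g5n P₁m P₂m Q₁n Q₂n VM t5m t10n ĜM c10n} →
         Frac cm x y lc -1ℤ 2 → Frac c5m (x ^ 5) (y ^ 5) lc -1ℤ 2 → Frac Ĝn z w lĜ -1ℤ 20 → Frac ĉm x y lĉ -1ℤ 10 →
         Frac gn z w lg -1ℤ 4 → Frac g5n (z ^ 5) (w ^ 5) lg -1ℤ 4 →
         Frac P₁m x y lP₁ -1ℤ 10 → Frac P₂m x y lP₂ -1ℤ 10 → Frac Q₁n z w lQ₁ -1ℤ 20 → Frac Q₂n z w lQ₂ -1ℤ 20 →
         Frac VM (x * z) (y * w) lV -1ℤ 20 → Frac t5m (x ^ 5) (y ^ 5) lτ -1ℤ 2 → Frac t10n (z ^ 10) (w ^ 10) lτ -1ℤ 2 →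
         Frac ĜM (x * z) (y * w) lĜ -1ℤ 20 → Frac c10n (z ^ 10) (w ^ 10) lc -1ℤ 2 →
         Regular (⟦ plus 10 X Y ⟧ ρ) → Regular (⟦ plus 20 Z W ⟧ ρ) → Regular (⟦ plus 20 XZ YW ⟧ ρ) →
         (cm - c5m) * Ĝn + ĉm * (gn + g5n) + ι (+ 4) * (P₁m * Q₁n - P₂m * Q₂n) ≈ ι (+ 4) * (VM * (t5m + t10n) + ĜM * c10n)
    I₆ (mkFrac c) (mkFrac c₅) (mkFrac Ĝ) (mkFrac ĉ) (mkFrac g) (mkFrac g₅) (mkFrac p₁) (mkFrac p₂) (mkFrac q₁) (mkFrac q₂) (mkFrac V) (mkFrac t₅) (mkFrac t₁₀) (mkFrac Ĝ′) (mkFrac c₁₀) r₁ r₂ r₃ = compare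
      (up DT₂₀ D ((fc ⊟ fc₅) ⊠ fĜ ⊞ fĉ ⊠ (fg ⊞ fg₅) ⊞ scale (+ 4) (fp₁ ⊠ fq₁ ⊟ fp₂ ⊠ fq₂)))
      (scale (+ 4) (up ⟨1⟩ D (fV ⊠ (up D₂ D₀ ft₅ ⊞ up D₁ D₀ ft₁₀)) ⊞ up D₁ D (fĜ′ ⊠ fc₁₀))) (regular-* (regular-* r₁ r₂) r₃)
      where
      D₁ = plus 10 X Y
      D₂ = plus 20 Z W
      D₀ = D₁ :* D₂
      D  = D₀ :* DT₂₀
      fc  = up (cofactor 2 X Y) D₁ (mkOver {plus 2 X Y} {_} {homE lc 2 X Y} (x-y≈0⇒x≈y c))
      fc₅ = up ⟨1⟩ D₁ (mkOver {plus 2 (X :^ 5) (Y :^ 5)} {_} {homE lc 2 (X :^ 5) (Y :^ 5)} (x-y≈0⇒x≈y c₅))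
      fĉ  = mkOver {D₁} {_} {homE lĉ 10 X Y} (x-y≈0⇒x≈y ĉ)
      fp₁ = mkOver {D₁} {_} {homE lP₁ 10 X Y} (x-y≈0⇒x≈y p₁)
      fp₂ = mkOver {D₁} {_} {homE lP₂ 10 X Y} (x-y≈0⇒x≈y p₂)
      ft₅ = up ⟨1⟩ D₁ (mkOver {plus 2 (X :^ 5) (Y :^ 5)} {_} {homE lτ 2 (X :^ 5) (Y :^ 5)} (x-y≈0⇒x≈y t₅))
      fĜ  = mkOver {D₂} {_} {homE lĜ 20 Z W} (x-y≈0⇒x≈y Ĝ)
      fg  = up (cofactor 4 Z W) D₂ (mkOver {plus 4 Z W} {_} {homE lg 4 Z W} (x-y≈0⇒x≈y g))
      fg₅ = up ⟨1⟩ D₂ (mkOver {plus 4 (Z :^ 5) (W :^ 5)} {_} {homE lg 4 (Z :^ 5) (W :^ 5)} (x-y≈0⇒x≈y g₅))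
      fq₁ = mkOver {D₂} {_} {homE lQ₁ 20 Z W} (x-y≈0⇒x≈y q₁)
      fq₂ = mkOver {D₂} {_} {homE lQ₂ 20 Z W} (x-y≈0⇒x≈y q₂)
      ft₁₀ = up ⟨1⟩ D₂ (mkOver {plus 2 (Z :^ 10) (W :^ 10)} {_} {homE lτ 2 (Z :^ 10) (W :^ 10)} (x-y≈0⇒x≈y t₁₀))
      fc₁₀ = up ⟨1⟩ D₂ (mkOver {plus 2 (Z :^ 10) (W :^ 10)} {_} {homE lc 2 (Z :^ 10) (W :^ 10)} (x-y≈0⇒x≈y c₁₀))
      fV  = mkOver {DT₂₀} {_} {homE lV 20 XZ YW} (x-y≈0⇒x≈y V)
      fĜ′ = mkOver {DT₂₀} {_} {homE lĜ 20 XZ YW} (x-y≈0⇒x≈y Ĝ′)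

    I₇ : ∀ {c10n c2n Ĝm ĉ2n g5m gm Q₁m Q₂m P₁2n P₂2n zM Vm yM Vn cM Ĝn} →
         Frac c10n (z ^ 10) (w ^ 10) lc -1ℤ 2 → Frac c2n (z ^ 2) (w ^ 2) lc -1ℤ 2 → Frac Ĝm x y lĜ -1ℤ 20 → Frac ĉ2n (z ^ 2) (w ^ 2) lĉ -1ℤ 10 →
         Frac g5m (x ^ 5) (y ^ 5) lg -1ℤ 4 → Frac gm x y lg -1ℤ 4 → Frac Q₁m x y lQ₁ -1ℤ 20 → Frac Q₂m x y lQ₂ -1ℤ 20 →
         Frac P₁2n (z ^ 2) (w ^ 2) lP₁ -1ℤ 10 → Frac P₂2n (z ^ 2) (w ^ 2) lP₂ -1ℤ 10 →
         Frac zM ((x * z) ^ 2) ((y * w) ^ 2) ly (+ 1) 2 → Frac Vm x y lV -1ℤ 20 → Frac yM (x * z) (y * w) ly (+ 1) 2 → Frac Vn z w lV -1ℤ 20 →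
         Frac cM (x * z) (y * w) lc -1ℤ 2 → Frac Ĝn z w lĜ -1ℤ 20 →
         Regular (⟦ plus 20 X Y ⟧ ρ) → Regular (⟦ plus 20 Z W ⟧ ρ) → Regular (⟦ DTy ⟧ ρ) → Regular (⟦ plus 2 XZ YW ⟧ ρ) →
         Ĝm * (ι (+ 5) * c10n - c2n) + (ι (+ 5) * g5m + gm) * ĉ2n
           + ι (+ 4) * (Q₁m * (ι (+ 2) * P₁2n - P₂2n) - Q₂m * (P₁2n + ι (+ 2) * P₂2n))
         ≈ ι (+ 8) * (zM * Vm) + ι (+ 4) * (yM * Vn) + ι (+ 2) * (cM * Ĝn)
    I₇ (mkFrac c₁₀) (mkFrac c₂) (mkFrac Ĝ) (mkFrac ĉ) (mkFrac g₅) (mkFrac g) (mkFrac q₁) (mkFrac q₂) (mkFrac p₁) (mkFrac p₂) (mkFrac zz) (mkFrac V) (mkFrac yy) (mkFrac V′) (mkFrac cc) (mkFrac Ĝ′) r₁ r₂ r₃ r₄ = compare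
      (up (DTy :* DTc) D (fĜ ⊠ (scale (+ 5) fc₁₀ ⊟ fc₂) ⊞ (scale (+ 5) fg₅ ⊞ fg) ⊠ fĉ
        ⊞ scale (+ 4) (fq₁ ⊠ (scale (+ 2) fp₁ ⊟ fp₂) ⊟ fq₂ ⊠ (fp₁ ⊞ scale (+ 2) fp₂))))
      (up D₂ D (scale (+ 8) (fz ⊠ fV)) ⊞ up (D₁ :* DTc) D (scale (+ 4) (fy ⊠ fV′)) ⊞ up (D₁ :* DTy) D (scale (+ 2) (fcM ⊠ fĜ′)))
      (regular-* (regular-* r₁ r₂) (regular-* r₃ r₄))
      where
      D₁ = plus 20 X Y
      D₂ = plus 20 Z W
      D  = (D₁ :* D₂) :* (DTy :* DTc)
      fc₁₀ = up ⟨1⟩ D₂ (mkOver {plus 2 (Z :^ 10) (W :^ 10)} {_} {homE lc 2 (Z :^ 10) (W :^ 10)} (x-y≈0⇒x≈y c₁₀))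
      fc₂ = up (cofactor 4 Z W) D₂ (mkOver {plus 2 (Z :^ 2) (W :^ 2)} {_} {homE lc 2 (Z :^ 2) (W :^ 2)} (x-y≈0⇒x≈y c₂))
      fĉ  = up ⟨1⟩ D₂ (mkOver {plus 10 (Z :^ 2) (W :^ 2)} {_} {homE lĉ 10 (Z :^ 2) (W :^ 2)} (x-y≈0⇒x≈y ĉ))
      fp₁ = up ⟨1⟩ D₂ (mkOver {plus 10 (Z :^ 2) (W :^ 2)} {_} {homE lP₁ 10 (Z :^ 2) (W :^ 2)} (x-y≈0⇒x≈y p₁))
      fp₂ = up ⟨1⟩ D₂ (mkOver {plus 10 (Z :^ 2) (W :^ 2)} {_} {homE lP₂ 10 (Z :^ 2) (W :^ 2)} (x-y≈0⇒x≈y p₂))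
      fĜ  = mkOver {D₁} {_} {homE lĜ 20 X Y} (x-y≈0⇒x≈y Ĝ)
      fg  = up (cofactor 4 X Y) D₁ (mkOver {plus 4 X Y} {_} {homE lg 4 X Y} (x-y≈0⇒x≈y g))
      fg₅ = up ⟨1⟩ D₁ (mkOver {plus 4 (X :^ 5) (Y :^ 5)} {_} {homE lg 4 (X :^ 5) (Y :^ 5)} (x-y≈0⇒x≈y g₅))
      fq₁ = mkOver {D₁} {_} {homE lQ₁ 20 X Y} (x-y≈0⇒x≈y q₁)
      fq₂ = mkOver {D₁} {_} {homE lQ₂ 20 X Y} (x-y≈0⇒x≈y q₂)
      fV  = mkOver {D₁} {_} {homE lV 20 X Y} (x-y≈0⇒x≈y V)
      fV′ = mkOver {D₂} {_} {homE lV 20 Z W} (x-y≈0⇒x≈y V′)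
      fĜ′ = mkOver {D₂} {_} {homE lĜ 20 Z W} (x-y≈0⇒x≈y Ĝ′)
      fy  = mkOver {DTy} {_} {homE ly 2 XZ YW} (x-y≈0⇒x≈y yy)
      fz  = up ⟨1⟩ (DTy :* DTc) (mkOver {minus 2 (XZ :^ 2) (YW :^ 2)} {_} {homE ly 2 (XZ :^ 2) (YW :^ 2)} (x-y≈0⇒x≈y zz))
      fcM = mkOver {DTc} {_} {homE lc 2 XZ YW} (x-y≈0⇒x≈y cc)

    -- The equation v (1 + x^d) = numerator after applying the Euler operator x d/dx, at y = 1: W is
    -- x dv/dx, and `lw₈`, `lw₄₀` carry the numerator coefficients multiplied by their exponents.
    record Deriv (W v : Carrier) (lw : List ℤ) (d : ℕ) : Set where
      constructor mkDeriv
      field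
        deriv : W * ⟦ plus d X Y ⟧ ρ + ι (+ d) * (x ^ d * v) ≈ ⟦ homE lw d X Y ⟧ ρ

    deriv-over : ∀ {W v lw l} d → Deriv W v lw d → Over (plus d X Y) v (homE l d X Y) →
                 Over (plus d X Y :* plus d X Y) W (homE lw d X Y :* plus d X Y :- con (+ d) :* X :^ d :* homE l d X Y)
    deriv-over {W} {v} {lw} {l} d (mkDeriv e) (mkOver f) = mkOver (begin
      W * (D * D)                                              ≈⟨ poly (# 0F :* (# 1F :* # 1F)) ((# 0F :* # 1F :+ # 2F :* (# 3F :* # 4F)) :* # 1F :- # 2F :* # 3F :* (# 4F :* # 1F)) (W ∷ D ∷ ι (+ d) ∷ x ^ d ∷ v ∷ []) ⟩
      (W * D + ι (+ d) * (x ^ d * v)) * D - ι (+ d) * x ^ d * (v * D) ≈⟨ +-cong (*-congʳ e) (-‿cong (*-congˡ f)) ⟩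
      ⟦ homE lw d X Y ⟧ ρ * D - ι (+ d) * x ^ d * ⟦ homE l d X Y ⟧ ρ ∎)
      where D = ⟦ plus d X Y ⟧ ρ

    -- The limit of `I₅` as n tends to -m: the poles of its first two terms cancel because v is odd,
    -- and the next order of the expansion leaves the derivative of v.
    I₅₀ : ∀ {g c2 v W} → Frac g x y lg -1ℤ 4 → Frac c2 (x ^ 2) (y ^ 2) lc -1ℤ 2 → Frac v x y lv -1ℤ 4 → Deriv W v lw₈ 4 →
          Regular (⟦ plus 4 X Y ⟧ ρ) → ι (+ 2) * (g * c2) ≈ g - W
    I₅₀ (mkFrac g) (mkFrac c) (mkFrac v) W r = compare (scale (+ 2) (fg ⊠ fc)) (up D₁ (D₁ :* D₁) fg ⊟ deriv-over {l = lv} 4 W fv) (regular-* r r)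
      where
      D₁ = plus 4 X Y
      fg = mkOver {D₁} {_} {homE lg 4 X Y} (x-y≈0⇒x≈y g)
      fv = mkOver {D₁} {_} {homE lv 4 X Y} (x-y≈0⇒x≈y v)
      fc = up ⟨1⟩ D₁ (mkOver {plus 2 (X :^ 2) (Y :^ 2)} {_} {homE lc 2 (X :^ 2) (Y :^ 2)} (x-y≈0⇒x≈y c))

    I₇₀ : ∀ {c10 c2 Ĝ ĉ2 g5 g Q₁ Q₂ P₁2 P₂2 V W} →
          Frac c10 (x ^ 10) (y ^ 10) lc -1ℤ 2 → Frac c2 (x ^ 2) (y ^ 2) lc -1ℤ 2 → Frac Ĝ x y lĜ -1ℤ 20 → Frac ĉ2 (x ^ 2) (y ^ 2) lĉ -1ℤ 10 →
          Frac g5 (x ^ 5) (y ^ 5) lg -1ℤ 4 → Frac g x y lg -1ℤ 4 → Frac Q₁ x y lQ₁ -1ℤ 20 → Frac Q₂ x y lQ₂ -1ℤ 20 →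
          Frac P₁2 (x ^ 2) (y ^ 2) lP₁ -1ℤ 10 → Frac P₂2 (x ^ 2) (y ^ 2) lP₂ -1ℤ 10 → Frac V x y lV -1ℤ 20 → Deriv W V lw₄₀ 20 →
          Regular (⟦ plus 20 X Y ⟧ ρ) →
          Ĝ * (ι (+ 5) * c10 - c2) + (ι (+ 5) * g5 + g) * ĉ2 - ι (+ 4) * (Q₁ * (ι (+ 2) * P₁2 - P₂2) - Q₂ * (P₁2 + ι (+ 2) * P₂2))
          ≈ ι (+ 2) * Ĝ - ι (+ 2) * W
    I₇₀ (mkFrac c₁₀) (mkFrac c₂) (mkFrac Ĝ) (mkFrac ĉ) (mkFrac g₅) (mkFrac g) (mkFrac q₁) (mkFrac q₂) (mkFrac p₁) (mkFrac p₂) (mkFrac V) W r = compare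
      (fĜ ⊠ (scale (+ 5) fc₁₀ ⊟ fc₂) ⊞ (scale (+ 5) fg₅ ⊞ fg) ⊠ fĉ ⊟ scale (+ 4) (fq₁ ⊠ (scale (+ 2) fp₁ ⊟ fp₂) ⊟ fq₂ ⊠ (fp₁ ⊞ scale (+ 2) fp₂)))
      (scale (+ 2) (up D₁ (D₁ :* D₁) fĜ) ⊟ scale (+ 2) (deriv-over {l = lV} 20 W fV)) (regular-* r r)
      where
      D₁ = plus 20 X Y
      fc₁₀ = up ⟨1⟩ D₁ (mkOver {plus 2 (X :^ 10) (Y :^ 10)} {_} {homE lc 2 (X :^ 10) (Y :^ 10)} (x-y≈0⇒x≈y c₁₀))
      fc₂ = up (cofactor 4 X Y) D₁ (mkOver {plus 2 (X :^ 2) (Y :^ 2)} {_} {homE lc 2 (X :^ 2) (Y :^ 2)} (x-y≈0⇒x≈y c₂))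
      fĉ  = up ⟨1⟩ D₁ (mkOver {plus 10 (X :^ 2) (Y :^ 2)} {_} {homE lĉ 10 (X :^ 2) (Y :^ 2)} (x-y≈0⇒x≈y ĉ))
      fp₁ = up ⟨1⟩ D₁ (mkOver {plus 10 (X :^ 2) (Y :^ 2)} {_} {homE lP₁ 10 (X :^ 2) (Y :^ 2)} (x-y≈0⇒x≈y p₁))
      fp₂ = up ⟨1⟩ D₁ (mkOver {plus 10 (X :^ 2) (Y :^ 2)} {_} {homE lP₂ 10 (X :^ 2) (Y :^ 2)} (x-y≈0⇒x≈y p₂))
      fĜ  = mkOver {D₁} {_} {homE lĜ 20 X Y} (x-y≈0⇒x≈y Ĝ)
      fg  = up (cofactor 4 X Y) D₁ (mkOver {plus 4 X Y} {_} {homE lg 4 X Y} (x-y≈0⇒x≈y g))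
      fg₅ = up ⟨1⟩ D₁ (mkOver {plus 4 (X :^ 5) (Y :^ 5)} {_} {homE lg 4 (X :^ 5) (Y :^ 5)} (x-y≈0⇒x≈y g₅))
      fq₁ = mkOver {D₁} {_} {homE lQ₁ 20 X Y} (x-y≈0⇒x≈y q₁)
      fq₂ = mkOver {D₁} {_} {homE lQ₂ 20 X Y} (x-y≈0⇒x≈y q₂)
      fV  = mkOver {D₁} {_} {homE lV 20 X Y} (x-y≈0⇒x≈y V)

    I₂₀ : ∀ {g c2} → Frac g x y lg -1ℤ 4 → Frac c2 (x ^ 2) (y ^ 2) lc -1ℤ 2 → Regular (⟦ plus 4 X Y ⟧ ρ) →
          ι (+ 4) * (g * g) ≈ ι (+ 2) * c2 + ι (+ 2) * (c2 * c2)
    I₂₀ (mkFrac g) (mkFrac c) r = compare (scale (+ 4) (fg ⊠ fg)) (up D₁ (D₁ :* D₁) (scale (+ 2) fc) ⊞ scale (+ 2) (fc ⊠ fc)) (regular-* r r)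
      where
      D₁ = plus 4 X Y
      fg = mkOver {D₁} {_} {homE lg 4 X Y} (x-y≈0⇒x≈y g)
      fc = up ⟨1⟩ D₁ (mkOver {plus 2 (X :^ 2) (Y :^ 2)} {_} {homE lc 2 (X :^ 2) (Y :^ 2)} (x-y≈0⇒x≈y c))

-- Elimination, extraction of roots, and cancellation for eta products.

module EtaAlgebra where

  open Polynomials
  open ThetaAlgebra using (nat)
  open import Data.Fin as Fin using (suc)
  open import Data.Fin.Patterns
  open import Data.Integer using (+_)
  open import Data.List using (List; []; _∷_)
  open import Data.List.Relation.Unary.All using (All; []; _∷_)
  open import Data.Nat as ℕ using (ℕ)
  open import Data.Product using (_×_; _,_)
  open import Data.Vec using (Vec; []; _∷_)

  module Resultants (R : ℤ-Ring) (e f p r : ℤ-Ring.Carrier R) where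
    open ℤ-Ring R
    open Solve R
    ρ : Vec Carrier 4
    ρ = e ∷ f ∷ p ∷ r ∷ []

    ve vf vp vr x₁ x₅ gF gG : Expr 4
    ve = # 0F
    vf = # 1F
    vp = # 2F
    vr = # 3F
    x₁ = vr :- vp
    x₅ = nat 5 :* vr :- vp
    gF = (ve :- vf) :* (ve :- nat 5 :* vf) :+ x₁ :* x₅
    gG = (vf :* x₅ :- ve :* x₁) :^ 2 :- nat 16 :* ve :* vf :* vp :* vr

    -- x₁ x₅ times these are the resultants of gF and gG in f and in e.
    g₁ g₂ : Expr 4
    g₁ = x₅ :^ 5 :* x₁ :- nat 256 :* (vp :* vr) :* ve :^ 2 :* (ve :^ 2 :- vp :^ 2)
    g₂ = x₁ :^ 5 :* x₅ :- nat 256 :* (vr :* vp) :* vf :^ 2 :* (vf :^ 2 :- vr :^ 2)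

    -- For two quadratics F and G in v, both a₂ G - c₂ F and (c₀ F - a₀ G) / v are linear in v.
    -- Eliminating v between these gives the Sylvester resultant; the undivided combination is v
    -- times it, whence the factor v in the multipliers of `z₁` and `z₂`.
    bezout : (v a₂ a₁ a₀ c₂ c₁ c₀ : Expr 4) → List (Expr 4 × Expr 4)
    bezout v a₂ a₁ a₀ c₂ c₁ c₀ = (nat 0 :- (m :* v :* c₂ :+ n :* c₀) , gF) ∷ (m :* v :* a₂ :+ n :* a₀ , gG) ∷ []
      where
      m = a₂ :* c₀ :- a₀ :* c₂
      n = a₂ :* c₁ :- a₁ :* c₂

    z₁ : ⟦ gF ⟧ ρ ≈ 0# → ⟦ gG ⟧ ρ ≈ 0# → Regular (⟦ vf :* (x₁ :* x₅) ⟧ ρ) → ⟦ g₁ ⟧ ρ ≈ 0#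
    z₁ zF zG reg = certify ρ (vf :* (x₁ :* x₅)) g₁
      (bezout vf (nat 5) (nat 0 :- nat 6 :* ve) (ve :^ 2 :+ x₁ :* x₅) (x₅ :^ 2) (nat 0 :- ve :* (nat 2 :* x₁ :* x₅ :+ nat 16 :* vp :* vr)) (x₁ :^ 2 :* ve :^ 2))
      reg (zF ∷ zG ∷ [])

    z₂ : ⟦ gF ⟧ ρ ≈ 0# → ⟦ gG ⟧ ρ ≈ 0# → Regular (⟦ ve :* (x₁ :* x₅) ⟧ ρ) → ⟦ g₂ ⟧ ρ ≈ 0#
    z₂ zF zG reg = certify ρ (ve :* (x₁ :* x₅)) g₂
      (bezout ve (nat 1) (nat 0 :- nat 6 :* vf) (nat 5 :* vf :^ 2 :+ x₁ :* x₅) (x₁ :^ 2) (nat 0 :- vf :* (nat 2 :* x₁ :* x₅ :+ nat 16 :* vp :* vr)) (x₅ :^ 2 :* vf :^ 2))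
      reg (zF ∷ zG ∷ [])

  module EtaProduct (R : ℤ-Ring) (r₅ r₁ c d C J e₂ e₄ e₈ e₁₀ e₂₀ q : ℤ-Ring.Carrier R) where
    open ℤ-Ring R
    open Solve R
    ρ : Vec Carrier 12
    ρ = r₅ ∷ r₁ ∷ c ∷ d ∷ C ∷ J ∷ e₂ ∷ e₄ ∷ e₈ ∷ e₁₀ ∷ e₂₀ ∷ q ∷ []

    v₅ v₁ vc vd vC vJ w₂ w₄ w₈ w₁₀ w₂₀ vq K L : Expr 12
    v₅ = # 0F
    v₁ = # 1F
    vc = # 2F
    vd = # 3F
    vC = # 4F
    vJ = # 5F
    w₂ = # 6F
    w₄ = # 7F
    w₈ = # 8F
    w₁₀ = # 9F
    w₂₀ = # suc 9F
    vq = # suc (suc 9F)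
    K = w₄ :^ 6 :* w₂₀ :^ 2 :* w₂ :^ 8 :* w₈ :^ 8
    L = w₂ :^ 5 :* w₂₀ :^ 5 :* w₄ :* w₁₀

    X₁ X₂ X₃ X₄ Y₁ Y₂ Y₃ Y₄ : Expr 12
    X₁ = (vc :* w₄) :^ 2
    X₂ = (vd :* w₂₀) :^ 2
    X₃ = (vC :* (w₂ :^ 2 :* w₈ :^ 2)) :^ 4
    X₄ = vJ :* w₄ :^ 4
    Y₁ = (w₂ :* w₂) :^ 2
    Y₂ = (w₁₀ :* w₁₀) :^ 2
    Y₃ = (w₄ :^ 5) :^ 4
    Y₄ = nat 16 :* (vq :* w₈ :^ 8)

    gP : Expr 12
    gP = v₅ :^ 5 :* v₁ :- nat 256 :* (vc :^ 2 :* vd :^ 2) :* vC :^ 4 :* vJ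

    -- The four X are replaced by the four Y one at a time, so the cofactors telescope X₁X₂X₃X₄ -
    -- Y₁Y₂Y₃Y₄. The factor K consists of the eta powers that clear the denominators of c², d², C⁴
    -- and of C⁴ - c⁴.
    sextic : ⟦ gP ⟧ ρ ≈ 0# → ⟦ X₁ :- Y₁ ⟧ ρ ≈ 0# → ⟦ X₂ :- Y₂ ⟧ ρ ≈ 0# → ⟦ X₃ :- Y₃ ⟧ ρ ≈ 0# → ⟦ X₄ :- Y₄ ⟧ ρ ≈ 0# → Regular (⟦ K ⟧ ρ) →
             ⟦ (v₅ :* (w₂ :* w₂₀)) :^ 5 :* (v₁ :* (w₄ :* w₁₀)) :- (nat 4 :* (w₄ :^ 3 :* w₁₀)) :^ 5 :* (nat 4 :* (vq :* (w₂ :* w₂₀ :^ 3))) ⟧ ρ ≈ 0#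
    sextic hP h₁ h₂ h₃ h₄ reg = certify ρ K ((v₅ :* (w₂ :* w₂₀)) :^ 5 :* (v₁ :* (w₄ :* w₁₀)) :- (nat 4 :* (w₄ :^ 3 :* w₁₀)) :^ 5 :* (nat 4 :* (vq :* (w₂ :* w₂₀ :^ 3))))
      ((K :* L , gP) ∷ (nat 256 :* L :* X₂ :* X₃ :* X₄ , X₁ :- Y₁) ∷ (nat 256 :* L :* Y₁ :* X₃ :* X₄ , X₂ :- Y₂)
        ∷ (nat 256 :* L :* Y₁ :* Y₂ :* X₄ , X₃ :- Y₃) ∷ (nat 256 :* L :* Y₁ :* Y₂ :* Y₃ , X₄ :- Y₄) ∷ [])
      reg (hP ∷ h₁ ∷ h₂ ∷ h₃ ∷ h₄ ∷ [])

  module Roots (R : ℤ-Ring) where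
    open ℤ-Ring R
    open Solve R

    -- The fifth power of the first equation is x²⁵ y⁵ = X²⁵ Y⁵; cancelling y⁵ x = Y⁵ X leaves the
    -- exponent 24.
    twenty-fourth : ∀ x y X Y → x ^ 5 * y ≈ X ^ 5 * Y → y ^ 5 * x ≈ Y ^ 5 * X → Regular (Y ^ 5 * X) → x ^ 24 ≈ X ^ 24
    twenty-fourth x y X Y h₁ h₂ reg = x-y≈0⇒x≈y (certify (x ∷ y ∷ X ∷ Y ∷ []) (Y′ :^ 5 :* X′) (x′ :^ 24 :- X′ :^ 24)
      ((s :^ 4 :+ s :^ 3 :* S :+ s :^ 2 :* S :^ 2 :+ s :* S :^ 3 :+ S :^ 4 , s :- S) ∷ (nat 0 :- x′ :^ 24 , y′ :^ 5 :* x′ :- Y′ :^ 5 :* X′) ∷ [])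
      reg (difference h₁ ∷ difference h₂ ∷ []))
      where
      difference : ∀ {u v} → u ≈ v → u - v ≈ 0#
      difference h = trans (+-congʳ h) (-‿inverseʳ _)
      x′ y′ X′ Y′ s S : Expr 4
      x′ = # 0F
      y′ = # 1F
      X′ = # 2F
      Y′ = # 3F
      s = x′ :^ 5 :* y′
      S = X′ :^ 5 :* Y′

    cofactor : Carrier → Carrier → ℕ → Carrier
    cofactor x y ℕ.zero    = ι (+ 1)
    cofactor x y (ℕ.suc k) = x * cofactor x y k + y ^ ℕ.suc k

    factor : ∀ x y k → x ^ ℕ.suc k - y ^ ℕ.suc k ≈ cofactor x y k * (x - y)
    factor x y ℕ.zero    = poly (# 0F :* con (+ 1) :- # 1F :* con (+ 1)) (con (+ 1) :* (# 0F :- # 1F)) (x ∷ y ∷ []) ⟨⟩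
      where
      infixl 1 _⟨⟩
      _⟨⟩ : (x * ι (+ 1)) - (y * ι (+ 1)) ≈ ι (+ 1) * (x - y) → x * 1# - y * 1# ≈ ι (+ 1) * (x - y)
      h ⟨⟩ = trans (+-cong (*-congˡ (sym ι-1)) (-‿cong (*-congˡ (sym ι-1)))) h
    factor x y (ℕ.suc k) = trans (poly (# 0F :* # 2F :- # 1F :* # 3F) (# 0F :* (# 2F :- # 3F) :+ # 3F :* (# 0F :- # 1F)) (x ∷ y ∷ x ^ ℕ.suc k ∷ y ^ ℕ.suc k ∷ []))
      (trans (+-congʳ (*-congˡ (factor x y k))) (poly (# 0F :* (# 2F :* (# 0F :- # 1F)) :+ # 3F :* (# 0F :- # 1F)) ((# 0F :* # 2F :+ # 3F) :* (# 0F :- # 1F)) (x ∷ y ∷ cofactor x y k ∷ y ^ ℕ.suc k ∷ [])))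

    root : ∀ x y k → Regular (cofactor x y k) → x ^ ℕ.suc k ≈ y ^ ℕ.suc k → x ≈ y
    root x y k reg h = x-y≈0⇒x≈y (reg (x - y) (trans (sym (factor x y k)) (trans (+-congʳ h) (-‿inverseʳ _))))

  module Quotients (R : ℤ-Ring) where
    open ℤ-Ring R
    open Solve R

    difference : ∀ {u v} → u ≈ v → u - v ≈ 0#
    difference h = trans (+-congʳ h) (-‿inverseʳ _)

    private
      x₀ x₁ x₂ x₃ x₄ x₅ x₆ x₇ x₈ x₉ x₁₀ x₁₁ x₁₂ x₁₃ x₁₄ x₁₅ : Expr 16
      x₀ = # (Fin.# 0)
      x₁ = # (Fin.# 1)
      x₂ = # (Fin.# 2)
      x₃ = # (Fin.# 3)
      x₄ = # (Fin.# 4)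
      x₅ = # (Fin.# 5)
      x₆ = # (Fin.# 6)
      x₇ = # (Fin.# 7)
      x₈ = # (Fin.# 8)
      x₉ = # (Fin.# 9)
      x₁₀ = # (Fin.# 10)
      x₁₁ = # (Fin.# 11)
      x₁₂ = # (Fin.# 12)
      x₁₃ = # (Fin.# 13)
      x₁₄ = # (Fin.# 14)
      x₁₅ = # (Fin.# 15)

    A-eta : ∀ A a c e₁ e₂ e₄ → a * e₂ ≈ e₁ * e₁ → c * e₄ ≈ e₂ * e₂ → A * a ≈ c * c → Regular (ι (+ 1)) → A * (e₁ ^ 2 * e₄ ^ 2) ≈ e₂ ^ 5
    A-eta A a c e₁ e₂ e₄ h₁ h₂ h₃ reg = x-y≈0⇒x≈y (certify (A ∷ a ∷ c ∷ e₁ ∷ e₂ ∷ e₄ ∷ []) (con (+ 1)) (# 0F :* (# 3F :^ 2 :* # 5F :^ 2) :- # 4F :^ 5)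
      ((nat 0 :- # 0F :* # 5F :^ 2 , # 1F :* # 4F :- # 3F :* # 3F) ∷ (# 4F :* (# 2F :* # 5F :+ # 4F :^ 2) , # 2F :* # 5F :- # 4F :* # 4F)
        ∷ (# 4F :* # 5F :^ 2 , # 0F :* # 1F :- # 2F :* # 2F) ∷ []) reg (difference h₁ ∷ difference h₂ ∷ difference h₃ ∷ []))

    -- A⁴ - a⁴ and 16 q e₄⁸ / e₂⁴ both satisfy J(q)² = 16 C⁴ J(q²).
    jacobi : ∀ A a C c e₂ e₄ e₈ q q² → A * A + a * a ≈ (+ 2) · (C * C) → A * a ≈ c * c → C * (e₂ ^ 2 * e₈ ^ 2) ≈ e₄ ^ 5 → q² ≈ q * q → Regular (ι (+ 1)) →
      ((A ^ 4 - a ^ 4) * e₂ ^ 4 - ι (+ 16) * (q * e₄ ^ 8)) * (((A ^ 4 - a ^ 4) * e₂ ^ 4 + ι (+ 16) * (q * e₄ ^ 8)) * e₄ ^ 4)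
      ≈ (ι (+ 16) * (C ^ 4 * e₂ ^ 8)) * ((C ^ 4 - c ^ 4) * e₄ ^ 4 - ι (+ 16) * (q² * e₈ ^ 8))
    jacobi A a C c e₂ e₄ e₈ q q² h₁ h₂ h₃ h₄ reg = x-y≈0⇒x≈y (certify (A ∷ a ∷ C ∷ c ∷ e₂ ∷ e₄ ∷ e₈ ∷ q ∷ q² ∷ []) (con (+ 1))
      (((# 0F :^ 4 :- # 1F :^ 4) :* # 4F :^ 4 :- nat 16 :* (# 7F :* # 5F :^ 8)) :* (((# 0F :^ 4 :- # 1F :^ 4) :* # 4F :^ 4 :+ nat 16 :* (# 7F :* # 5F :^ 8)) :* # 5F :^ 4)
        :- (nat 16 :* (# 2F :^ 4 :* # 4F :^ 8)) :* ((# 2F :^ 4 :- # 3F :^ 4) :* # 5F :^ 4 :- nat 16 :* (# 8F :* # 6F :^ 8)))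
      ((# 4F :^ 8 :* # 5F :^ 4 :* (S :+ nat 2 :* # 2F :^ 2) :* (S :^ 2 :+ nat 4 :* # 2F :^ 4 :- nat 4 :* # 3F :^ 4) , # 0F :* # 0F :+ # 1F :* # 1F :- (+ 2) :· (# 2F :* # 2F))
        ∷ (nat 0 :- nat 4 :* # 4F :^ 8 :* # 5F :^ 4 :* (# 0F :* # 1F :+ # 3F :^ 2) :* S :^ 2 , # 0F :* # 1F :- # 3F :* # 3F)
        ∷ (nat 256 :* # 8F :* (y :^ 3 :+ y :^ 2 :* z :+ y :* z :^ 2 :+ z :^ 3) , y :- z) ∷ (nat 256 :* # 5F :^ 20 , # 8F :- # 7F :* # 7F) ∷ [])
      reg (difference h₁ ∷ difference h₂ ∷ difference h₃ ∷ difference h₄ ∷ []))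
      where
      S y z : Expr 9
      S = # 0F :^ 2 :+ # 1F :^ 2
      y = # 2F :* (# 4F :^ 2 :* # 6F :^ 2)
      z = # 5F :^ 5

    N-eta : ∀ N ρ₁ ρ₅ e₂ e₄ e₁₀ e₂₀ q q² → N * N ≈ ρ₁ * ρ₅ → ρ₅ * (e₂ * e₂₀) ≈ ι (+ 4) * (e₄ ^ 3 * e₁₀) → ρ₁ * (e₄ * e₁₀) ≈ ι (+ 4) * (q² * (e₂ * e₂₀ ^ 3)) → q² ≈ q * q →
      Regular ((e₂ * e₂₀ * (e₄ * e₁₀)) * (N + ι (+ 4) * (q * (e₄ * e₂₀)))) → N ≈ ι (+ 4) * (q * (e₄ * e₂₀))
    N-eta N ρ₁ ρ₅ e₂ e₄ e₁₀ e₂₀ q q² hN h₅ h₁ hq reg = x-y≈0⇒x≈y (certify (N ∷ ρ₁ ∷ ρ₅ ∷ e₂ ∷ e₄ ∷ e₁₀ ∷ e₂₀ ∷ q ∷ q² ∷ [])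
      ((# 3F :* # 6F :* (# 4F :* # 5F)) :* (# 0F :+ nat 4 :* (# 7F :* (# 4F :* # 6F)))) (# 0F :- nat 4 :* (# 7F :* (# 4F :* # 6F)))
      ((# 3F :* # 6F :* # 4F :* # 5F , # 0F :* # 0F :- # 1F :* # 2F) ∷ (# 1F :* # 4F :* # 5F , # 2F :* (# 3F :* # 6F) :- nat 4 :* (# 4F :^ 3 :* # 5F))
        ∷ (nat 4 :* # 4F :^ 3 :* # 5F , # 1F :* (# 4F :* # 5F) :- nat 4 :* (# 8F :* (# 3F :* # 6F :^ 3))) ∷ (nat 16 :* # 4F :^ 3 :* # 6F :^ 3 :* # 3F :* # 5F , # 8F :- # 7F :* # 7F) ∷ [])
      reg (difference hN ∷ difference h₅ ∷ difference h₁ ∷ difference hq ∷ []))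

    -- The product formulas turn W² D = a b C ρ₁ into an equality of squares of the two sides; their
    -- sum, which is part of the regular factor, selects the sign.
    W-eta : ∀ W a b C D ρ₁ e₁ e₂ e₄ e₅ e₈ e₁₀ e₂₀ e₄₀ q q² → (W * W) * D ≈ (a * b) * (C * ρ₁) → a * e₂ ≈ e₁ * e₁ → b * e₁₀ ≈ e₅ * e₅ →
      C * (e₂ ^ 2 * e₈ ^ 2) ≈ e₄ ^ 5 → D * (e₁₀ ^ 2 * e₄₀ ^ 2) ≈ e₂₀ ^ 5 → ρ₁ * (e₄ * e₁₀) ≈ ι (+ 4) * (q² * (e₂ * e₂₀ ^ 3)) → q² ≈ q * q →
      Regular ((W * (e₂ * (e₈ * e₂₀)) + ι (+ 2) * (q * (e₁ * (e₅ * (e₄ ^ 2 * e₄₀))))) * (D * (e₂ * (e₁₀ ^ 2 * e₄)))) →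
      W * (e₂ * (e₈ * e₂₀)) ≈ ι (+ 2) * (q * (e₁ * (e₅ * (e₄ ^ 2 * e₄₀))))
    W-eta W a b C D ρ₁ e₁ e₂ e₄ e₅ e₈ e₁₀ e₂₀ e₄₀ q q² hW ha hb hC hD hρ hq reg = x-y≈0⇒x≈y (certify
      (W ∷ a ∷ b ∷ C ∷ D ∷ ρ₁ ∷ e₁ ∷ e₂ ∷ e₄ ∷ e₅ ∷ e₈ ∷ e₁₀ ∷ e₂₀ ∷ e₄₀ ∷ q ∷ q² ∷ [])
      ((y :+ Y) :* (x₄ :* (x₇ :* (x₁₁ :^ 2 :* x₈)))) (y :- Y)
      ((x₇ :* x₁₁ :^ 2 :* x₈ :* x₇ :^ 2 :* x₁₀ :^ 2 :* x₁₂ :^ 2 , (x₀ :* x₀) :* x₄ :- (x₁ :* x₂) :* (x₃ :* x₅))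
        ∷ (x₁₂ :^ 2 :* P₂ :* P₃ :* P₄ , P₁ :- T₁) ∷ (x₁₂ :^ 2 :* T₁ :* P₃ :* P₄ , P₂ :- T₂) ∷ (x₁₂ :^ 2 :* T₁ :* T₂ :* P₄ , P₃ :- T₃)
        ∷ (nat 0 :- nat 4 :* T₁ :* T₂ :* T₃ :* x₇ :* x₁₄ :* x₁₄ , x₄ :* (x₁₁ :^ 2 :* x₁₃ :^ 2) :- x₁₂ :^ 5)
        ∷ (x₁₂ :^ 2 :* T₁ :* T₂ :* T₃ , P₄ :- T₄) ∷ (nat 4 :* T₁ :* T₂ :* T₃ :* x₇ :* x₁₂ :^ 5 , x₁₅ :- x₁₄ :* x₁₄) ∷ [])
      reg (difference hW ∷ difference ha ∷ difference hb ∷ difference hC ∷ difference hD ∷ difference hρ ∷ difference hq ∷ []))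
      where
      y Y P₁ P₂ P₃ P₄ T₁ T₂ T₃ T₄ : Expr 16
      y = x₀ :* (x₇ :* (x₁₀ :* x₁₂))
      Y = nat 2 :* (x₁₄ :* (x₆ :* (x₉ :* (x₈ :^ 2 :* x₁₃))))
      P₁ = x₁ :* x₇
      P₂ = x₂ :* x₁₁
      P₃ = x₃ :* (x₇ :^ 2 :* x₁₀ :^ 2)
      P₄ = x₅ :* (x₈ :* x₁₁)
      T₁ = x₆ :* x₆
      T₂ = x₉ :* x₉
      T₃ = x₈ :^ 5
      T₄ = nat 4 :* (x₁₅ :* (x₇ :* x₁₂ :^ 3))

    W′-eta : ∀ W W′ a b N e₁ e₂ e₄ e₅ e₈ e₁₀ e₂₀ e₄₀ q → W * W′ ≈ (a * b) * N → a * e₂ ≈ e₁ * e₁ → b * e₁₀ ≈ e₅ * e₅ → N ≈ ι (+ 4) * (q * (e₄ * e₂₀)) →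
      W * (e₂ * (e₈ * e₂₀)) ≈ ι (+ 2) * (q * (e₁ * (e₅ * (e₄ ^ 2 * e₄₀)))) → Regular (ι (+ 2) * (q * (e₁ * (e₅ * (e₄ ^ 2 * e₄₀))))) →
      W′ * (e₁₀ * (e₄ * e₄₀)) ≈ ι (+ 2) * (e₁ * (e₅ * (e₈ * e₂₀ ^ 2)))
    W′-eta W W′ a b N e₁ e₂ e₄ e₅ e₈ e₁₀ e₂₀ e₄₀ q hW ha hb hN hy reg = x-y≈0⇒x≈y (certify
      (W ∷ a ∷ b ∷ W′ ∷ N ∷ e₁ ∷ e₁ ∷ e₂ ∷ e₄ ∷ e₅ ∷ e₈ ∷ e₁₀ ∷ e₂₀ ∷ e₄₀ ∷ q ∷ q ∷ [])
      Y (x₃ :* (x₁₁ :* (x₈ :* x₁₃)) :- nat 2 :* (x₆ :* (x₉ :* (x₁₀ :* x₁₂ :^ 2))))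
      ((nat 0 :- x₃ :* x₁₁ :* x₈ :* x₁₃ , y :- Y) ∷ (x₇ :* x₁₀ :* x₁₂ :* x₁₁ :* x₈ :* x₁₃ , x₀ :* x₃ :- (x₁ :* x₂) :* x₄)
        ∷ (x₂ :* x₁₁ :* x₄ :* x₁₀ :* x₁₂ :* x₈ :* x₁₃ , x₁ :* x₇ :- x₆ :* x₆) ∷ (x₆ :* x₆ :* x₄ :* x₁₀ :* x₁₂ :* x₈ :* x₁₃ , x₂ :* x₁₁ :- x₉ :* x₉)
        ∷ (x₆ :* x₆ :* x₉ :* x₉ :* x₁₀ :* x₁₂ :* x₈ :* x₁₃ , x₄ :- nat 4 :* (x₁₄ :* (x₈ :* x₁₂))) ∷ [])
      reg (difference hy ∷ difference hW ∷ difference ha ∷ difference hb ∷ difference hN ∷ []))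
      where
      y Y : Expr 16
      y = x₀ :* (x₇ :* (x₁₀ :* x₁₂))
      Y = nat 2 :* (x₁₄ :* (x₆ :* (x₉ :* (x₈ :^ 2 :* x₁₃))))

    D₁-eta : ∀ D₁ a C N e₁ e₂ e₄ e₈ e₂₀ q → D₁ * (e₂ ^ 3 * e₈ ^ 2) ≈ q * (e₁ ^ 2 * (e₄ ^ 6 * e₂₀)) → a * e₂ ≈ e₁ * e₁ → C * (e₂ ^ 2 * e₈ ^ 2) ≈ e₄ ^ 5 →
      N ≈ ι (+ 4) * (q * (e₄ * e₂₀)) → Regular (e₂ ^ 3 * e₈ ^ 2) → ι (+ 4) * D₁ ≈ a * C * N
    D₁-eta D₁ a C N e₁ e₂ e₄ e₈ e₂₀ q hD ha hC hN reg = x-y≈0⇒x≈y (certify (D₁ ∷ a ∷ C ∷ N ∷ e₁ ∷ e₂ ∷ e₄ ∷ e₈ ∷ e₂₀ ∷ q ∷ [])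
      (# 5F :^ 3 :* # 7F :^ 2) (nat 4 :* # 0F :- # 1F :* # 2F :* # 3F)
      ((nat 4 , # 0F :* (# 5F :^ 3 :* # 7F :^ 2) :- # 9F :* (# 4F :^ 2 :* (# 6F :^ 6 :* # 8F)))
        ∷ (nat 0 :- # 2F :* (# 5F :^ 2 :* # 7F :^ 2) :* # 3F , # 1F :* # 5F :- # 4F :* # 4F) ∷ (nat 0 :- # 4F :^ 2 :* # 3F , # 2F :* (# 5F :^ 2 :* # 7F :^ 2) :- # 6F :^ 5)
        ∷ (nat 0 :- # 4F :^ 2 :* # 6F :^ 5 , # 3F :- nat 4 :* (# 9F :* (# 6F :* # 8F))) ∷ [])
      reg (difference hD ∷ difference ha ∷ difference hC ∷ difference hN ∷ []))

    D₂-eta : ∀ D₂ b d M e₅ e₈ e₁₀ e₂₀ e₄₀ q² → D₂ * e₂₀ ≈ q² * (e₅ ^ 2 * (e₈ * (e₁₀ * e₄₀))) → b * e₁₀ ≈ e₅ * e₅ → d * e₂₀ ≈ e₁₀ * e₁₀ →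
      M ≈ ι (+ 4) * (q² * (e₈ * e₄₀)) → Regular (e₂₀ * e₁₀) → ι (+ 4) * D₂ ≈ b * d * M
    D₂-eta D₂ b d M e₅ e₈ e₁₀ e₂₀ e₄₀ q² hD hb hd hM reg = x-y≈0⇒x≈y (certify (D₂ ∷ b ∷ d ∷ M ∷ e₅ ∷ e₈ ∷ e₁₀ ∷ e₂₀ ∷ e₄₀ ∷ q² ∷ [])
      (# 7F :* # 6F) (nat 4 :* # 0F :- # 1F :* # 2F :* # 3F)
      ((nat 4 :* # 6F , # 0F :* # 7F :- # 9F :* (# 4F :^ 2 :* (# 5F :* (# 6F :* # 8F)))) ∷ (nat 0 :- # 2F :* # 7F :* # 3F , # 1F :* # 6F :- # 4F :* # 4F)
        ∷ (nat 0 :- # 4F :^ 2 :* # 3F , # 2F :* # 7F :- # 6F :* # 6F) ∷ (nat 0 :- # 4F :^ 2 :* # 6F :^ 2 , # 3F :- nat 4 :* (# 9F :* (# 5F :* # 8F))) ∷ [])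
      reg (difference hD ∷ difference hb ∷ difference hd ∷ difference hM ∷ []))

    D₃-eta : ∀ D₃ R W′ e₁ e₄ e₅ e₈ e₁₀ e₂₀ e₄₀ q⁴ → D₃ * e₁₀ ≈ q⁴ * (e₁ * (e₅ * (e₂₀ * e₄₀ ^ 2))) → R * (e₈ * e₂₀) ≈ ι (+ 4) * (q⁴ * (e₄ * e₄₀ ^ 3)) →
      W′ * (e₁₀ * (e₄ * e₄₀)) ≈ ι (+ 2) * (e₁ * (e₅ * (e₈ * e₂₀ ^ 2))) → Regular ((e₁₀ * (e₄ * e₄₀)) * (e₈ * e₂₀)) → ι (+ 8) * D₃ ≈ R * W′
    D₃-eta D₃ R W′ e₁ e₄ e₅ e₈ e₁₀ e₂₀ e₄₀ q⁴ hD hR hW reg = x-y≈0⇒x≈y (certify (D₃ ∷ R ∷ W′ ∷ e₁ ∷ e₄ ∷ e₅ ∷ e₈ ∷ e₁₀ ∷ e₂₀ ∷ e₄₀ ∷ q⁴ ∷ [])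
      ((# 7F :* (# 4F :* # 9F)) :* (# 6F :* # 8F)) (nat 8 :* # 0F :- # 1F :* # 2F)
      ((nat 8 :* # 4F :* # 9F :* # 6F :* # 8F , # 0F :* # 7F :- # suc 9F :* (# 3F :* (# 5F :* (# 8F :* # 9F :^ 2))))
        ∷ (nat 0 :- # 2F :* (# 7F :* (# 4F :* # 9F)) , # 1F :* (# 6F :* # 8F) :- nat 4 :* (# suc 9F :* (# 4F :* # 9F :^ 3)))
        ∷ (nat 0 :- nat 4 :* # suc 9F :* # 4F :* # 9F :^ 3 , # 2F :* (# 7F :* (# 4F :* # 9F)) :- nat 2 :* (# 3F :* (# 5F :* (# 6F :* # 8F :^ 2)))) ∷ [])
      reg (difference hD ∷ difference hR ∷ difference hW ∷ []))

    D₄-eta : ∀ D₄ R W e₁ e₂ e₄ e₅ e₈ e₂₀ e₄₀ q → D₄ * e₂ ≈ q * (e₁ * (e₄ * (e₅ * e₈ ^ 2))) → R * (e₄ * e₄₀) ≈ ι (+ 4) * (e₈ ^ 3 * e₂₀) →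
      W * (e₂ * (e₈ * e₂₀)) ≈ ι (+ 2) * (q * (e₁ * (e₅ * (e₄ ^ 2 * e₄₀)))) → Regular ((e₂ * (e₈ * e₂₀)) * (e₄ * e₄₀)) → ι (+ 8) * D₄ ≈ R * W
    D₄-eta D₄ R W e₁ e₂ e₄ e₅ e₈ e₂₀ e₄₀ q hD hR hW reg = x-y≈0⇒x≈y (certify (D₄ ∷ R ∷ W ∷ e₁ ∷ e₂ ∷ e₄ ∷ e₅ ∷ e₈ ∷ e₂₀ ∷ e₄₀ ∷ q ∷ [])
      ((# 4F :* (# 7F :* # 8F)) :* (# 5F :* # 9F)) (nat 8 :* # 0F :- # 1F :* # 2F)
      ((nat 8 :* # 7F :* # 8F :* # 5F :* # 9F , # 0F :* # 4F :- # suc 9F :* (# 3F :* (# 5F :* (# 6F :* # 7F :^ 2))))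
        ∷ (nat 0 :- # 2F :* (# 4F :* (# 7F :* # 8F)) , # 1F :* (# 5F :* # 9F) :- nat 4 :* (# 7F :^ 3 :* # 8F))
        ∷ (nat 0 :- nat 4 :* # 7F :^ 3 :* # 8F , # 2F :* (# 4F :* (# 7F :* # 8F)) :- nat 2 :* (# suc 9F :* (# 3F :* (# 6F :* (# 5F :^ 2 :* # 9F))))) ∷ [])
      reg (difference hD ∷ difference hR ∷ difference hW ∷ []))

open import Defs
open import Algebra.Bundles using (CommutativeRing)
open import Data.Bool using (Bool; true; false; if_then_else_; T)
open import Data.Empty using (⊥-elim)
open import Data.Fin as Fin using (Fin; toℕ; fromℕ<)
open import Data.Fin.Patterns
import Data.Fin.Properties as FinP
open import Data.Integer as ℤ using (ℤ; +_; -[1+_]; _+_; _*_; -_; ∣_∣; _⊖_)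
import Data.Integer.Properties as ℤP
open import Data.Integer.Tactic.RingSolver using (solve-∀)
open import Data.List using (List; []; _∷_; length)
import Data.List.Relation.Unary.All as All
open import Data.Nat as ℕ using (ℕ; zero; suc; _≤_; _<_; z≤n; s≤s; _/_; _%_; _≡ᵇ_)
open import Data.Nat.DivMod
open import Data.Nat.Divisibility using (_∣_; _∣?_; divides; m∣m*n; *-cancelˡ-∣; ∣-trans; n∣m⇒m%n≡0; m%n≡0⇒n∣m; *-pres-∣; ∣m∣n⇒∣m+n; ∣m+n∣m⇒∣n; ∣-refl)
open import Data.Nat.Induction using (<-wellFounded)
import Data.Nat.Properties as ℕP
import Data.Nat.Tactic.RingSolver as ℕR
open import Data.Product using (_×_; _,_; proj₁; proj₂; ∃)
open import Data.Sum using (inj₁; inj₂; _⊎_)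
open import Data.Vec using (Vec; []; _∷_; lookup)
open import Function using (_∘_)
open import Induction.WellFounded using (Acc; acc)
open import Level using (0ℓ)
open import Relation.Binary.PropositionalEquality using (_≡_; _≢_; cong; cong₂; module ≡-Reasoning; refl; sym; trans; subst; subst₂)
open import Relation.Nullary using (¬_; yes; no; Dec)
open import Relation.Nullary.Decidable using (⌊_⌋; True; toWitness)

-- The ring of formal power series, regular elements and orders.

module SeriesRing where

  open Polynomials

  tl : Series → Series
  tl f n = f (suc n)

  zeroS : Series
  zeroS _ = + 0

  ⊝_ : Series → Series
  (⊝ f) n = - f n

  sumTo-cong≤ : ∀ n {f g : ℕ → ℤ} → (∀ i → i ≤ n → f i ≡ g i) → sumTo n f ≡ sumTo n g
  sumTo-cong≤ zero    h = h 0 z≤n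
  sumTo-cong≤ (suc n) h = cong₂ _+_ (sumTo-cong≤ n (λ i i≤n → h i (ℕP.m≤n⇒m≤1+n i≤n))) (h (suc n) ℕP.≤-refl)

  sumTo-cong : ∀ n {f g : ℕ → ℤ} → (∀ i → f i ≡ g i) → sumTo n f ≡ sumTo n g
  sumTo-cong n h = sumTo-cong≤ n (λ i _ → h i)

  sumTo-suc : ∀ n (f : ℕ → ℤ) → sumTo (suc n) f ≡ f 0 + sumTo n (f ∘ suc)
  sumTo-suc zero    f = refl
  sumTo-suc (suc n) f = trans (cong (_+ f (suc (suc n))) (sumTo-suc n f)) (ℤP.+-assoc (f 0) _ _)

  sumTo-+ : ∀ n (f g : ℕ → ℤ) → sumTo n (λ i → f i + g i) ≡ sumTo n f + sumTo n g
  sumTo-+ zero    f g = refl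
  sumTo-+ (suc n) f g = trans (cong (_+ (f (suc n) + g (suc n))) (sumTo-+ n f g)) (interchange (sumTo n f) (sumTo n g) (f (suc n)) (g (suc n)))
    where interchange : ∀ a b c d → (a + b) + (c + d) ≡ (a + c) + (b + d)
          interchange = solve-∀

  sumTo-*ˡ : ∀ n c (f : ℕ → ℤ) → sumTo n (λ i → c * f i) ≡ c * sumTo n f
  sumTo-*ˡ zero    c f = refl
  sumTo-*ˡ (suc n) c f = trans (cong (_+ c * f (suc n)) (sumTo-*ˡ n c f)) (sym (ℤP.*-distribˡ-+ c _ _))

  sumTo-0 : ∀ n → sumTo n (λ _ → + 0) ≡ + 0
  sumTo-0 zero    = refl
  sumTo-0 (suc n) = cong (_+ + 0) (sumTo-0 n)

  ≋-refl : ∀ {f} → f ≋ f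
  ≋-refl _ = refl

  ≋-sym : ∀ {f g} → f ≋ g → g ≋ f
  ≋-sym e n = sym (e n)

  ≋-trans : ∀ {f g h} → f ≋ g → g ≋ h → f ≋ h
  ≋-trans e e′ n = trans (e n) (e′ n)

  ⊛-cong≤ : ∀ {f f′ g g′} n → (∀ i → i ≤ n → f i ≡ f′ i) → (∀ i → i ≤ n → g i ≡ g′ i) → (f ⊛ g) n ≡ (f′ ⊛ g′) n
  ⊛-cong≤ n e e′ = sumTo-cong≤ n (λ i i≤n → cong₂ _*_ (e i i≤n) (e′ (n ℕ.∸ i) (ℕP.m∸n≤m n i)))

  ⊛-cong : ∀ {f f′ g g′} → f ≋ f′ → g ≋ g′ → f ⊛ g ≋ f′ ⊛ g′
  ⊛-cong e e′ n = ⊛-cong≤ n (λ i _ → e i) (λ i _ → e′ i)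

  ⊛-suc : ∀ f g n → (f ⊛ g) (suc n) ≡ f 0 * g (suc n) + (tl f ⊛ g) n
  ⊛-suc f g n = sumTo-suc n (λ i → f i * g (suc n ℕ.∸ i))

  ⊛-sucʳ : ∀ f g n → (f ⊛ g) (suc n) ≡ (f ⊛ tl g) n + f (suc n) * g 0
  ⊛-sucʳ f g n = cong₂ _+_
    (sumTo-cong≤ n (λ i i≤n → cong (λ k → f i * g k) (ℕP.+-∸-assoc 1 i≤n)))
    (cong (λ k → f (suc n) * g k) (ℕP.n∸n≡0 (suc n)))

  ⊛-comm : ∀ f g → f ⊛ g ≋ g ⊛ f
  ⊛-comm f g zero    = ℤP.*-comm (f 0) (g 0)
  ⊛-comm f g (suc n) = begin
    (f ⊛ g) (suc n)                   ≡⟨ ⊛-suc f g n ⟩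
    f 0 * g (suc n) + (tl f ⊛ g) n    ≡⟨ cong₂ _+_ (ℤP.*-comm (f 0) _) (⊛-comm (tl f) g n) ⟩
    g (suc n) * f 0 + (g ⊛ tl f) n    ≡⟨ ℤP.+-comm (g (suc n) * f 0) _ ⟩
    (g ⊛ tl f) n + g (suc n) * f 0    ≡⟨ ⊛-sucʳ g f n ⟨
    (g ⊛ f) (suc n)                   ∎
    where open ≡-Reasoning

  ⊛-distribʳ : ∀ h f g → (f ⊕ g) ⊛ h ≋ (f ⊛ h) ⊕ (g ⊛ h)
  ⊛-distribʳ h f g n = trans (sumTo-cong n (λ i → ℤP.*-distribʳ-+ (h (n ℕ.∸ i)) (f i) (g i))) (sumTo-+ n _ _)

  ⊙-⊛ : ∀ c f g → (c ⊙ f) ⊛ g ≋ c ⊙ (f ⊛ g)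
  ⊙-⊛ c f g n = trans (sumTo-cong n (λ i → ℤP.*-assoc c (f i) _)) (sumTo-*ˡ n c _)

  ⊛-assoc : ∀ f g h → (f ⊛ g) ⊛ h ≋ f ⊛ (g ⊛ h)
  ⊛-assoc f g h zero    = ℤP.*-assoc (f 0) (g 0) (h 0)
  ⊛-assoc f g h (suc n) = begin
    ((f ⊛ g) ⊛ h) (suc n)
      ≡⟨ ⊛-suc (f ⊛ g) h n ⟩
    (f 0 * g 0) * h (suc n) + (tl (f ⊛ g) ⊛ h) n
      ≡⟨ cong (λ z → (f 0 * g 0) * h (suc n) + z) (trans (⊛-cong (⊛-suc f g) (≋-refl {h}) n)
          (trans (⊛-distribʳ h (f 0 ⊙ tl g) (tl f ⊛ g) n)
            (cong₂ _+_ (⊙-⊛ (f 0) (tl g) h n) (⊛-assoc (tl f) g h n)))) ⟩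
    (f 0 * g 0) * h (suc n) + (f 0 * (tl g ⊛ h) n + (tl f ⊛ (g ⊛ h)) n)
      ≡⟨ regroup (f 0) (g 0) (h (suc n)) _ _ ⟩
    f 0 * (g 0 * h (suc n) + (tl g ⊛ h) n) + (tl f ⊛ (g ⊛ h)) n
      ≡⟨ cong (λ z → f 0 * z + (tl f ⊛ (g ⊛ h)) n) (⊛-suc g h n) ⟨
    f 0 * (g ⊛ h) (suc n) + (tl f ⊛ (g ⊛ h)) n
      ≡⟨ ⊛-suc f (g ⊛ h) n ⟨
    (f ⊛ (g ⊛ h)) (suc n) ∎
    where
    open ≡-Reasoning
    regroup : ∀ a b c x y → (a * b) * c + (a * x + y) ≡ a * (b * c + x) + y
    regroup = solve-∀

  zeroS-⊛ : ∀ f → zeroS ⊛ f ≋ zeroS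
  zeroS-⊛ f n = sumTo-0 n

  oneS-⊛ : ∀ f → oneS ⊛ f ≋ f
  oneS-⊛ f zero    = ℤP.*-identityˡ (f 0)
  oneS-⊛ f (suc n) = trans (⊛-suc oneS f n)
    (trans (cong₂ _+_ (ℤP.*-identityˡ (f (suc n))) (zeroS-⊛ f n)) (ℤP.+-identityʳ _))

  seriesRing : CommutativeRing 0ℓ 0ℓ
  seriesRing = record
    { Carrier = Series ; _≈_ = _≋_ ; _+_ = _⊕_ ; _*_ = _⊛_ ; -_ = ⊝_ ; 0# = zeroS ; 1# = oneS
    ; isCommutativeRing = record
      { isRing = record
        { +-isAbelianGroup = record
          { isGroup = record
            { isMonoid = record
              { isSemigroup = record
                { isMagma = record
                  { isEquivalence = record { refl = ≋-refl ; sym = ≋-sym ; trans = ≋-trans }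
                  ; ∙-cong = λ e e′ n → cong₂ _+_ (e n) (e′ n) }
                ; assoc = λ f g h n → ℤP.+-assoc (f n) (g n) (h n) }
              ; identity = (λ f n → ℤP.+-identityˡ (f n)) , (λ f n → ℤP.+-identityʳ (f n)) }
            ; inverse = (λ f n → ℤP.+-inverseˡ (f n)) , (λ f n → ℤP.+-inverseʳ (f n))
            ; ⁻¹-cong = λ e n → cong -_ (e n) }
          ; comm = λ f g n → ℤP.+-comm (f n) (g n) }
        ; *-cong = ⊛-cong
        ; *-assoc = ⊛-assoc
        ; *-identity = oneS-⊛ , (λ f → ≋-trans (⊛-comm f oneS) (oneS-⊛ f))
        ; distrib = (λ h f g → ≋-trans (⊛-comm h (f ⊕ g)) (≋-trans (⊛-distribʳ h f g)
                       (λ n → cong₂ _+_ (⊛-comm f h n) (⊛-comm g h n)))) , ⊛-distribʳ }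
      ; *-comm = ⊛-comm } }

  constS : ℤ → Series
  constS c = c ⊙ oneS

  constS-⊛ : ∀ c f → constS c ⊛ f ≋ c ⊙ f
  constS-⊛ c f n = trans (⊙-⊛ c oneS f n) (cong (c *_) (oneS-⊛ f n))

  𝕊 : ℤ-Ring
  𝕊 = record
    { cring = seriesRing ; ι = constS ; _·_ = _⊙_
    ; ι-+ = λ i j n → ℤP.*-distribʳ-+ (oneS n) i j
    ; ι-* = λ i j n → trans (ℤP.*-assoc i j (oneS n)) (sym (constS-⊛ i (constS j) n))
    ; ι-neg = λ i n → sym (ℤP.neg-distribˡ-* i (oneS n))
    ; ι-0 = λ n → refl
    ; ι-1 = λ n → ℤP.*-identityˡ (oneS n)
    ; ι-· = constS-⊛ }

  ⊛-congˡ : ∀ f {g h} → g ≋ h → f ⊛ g ≋ f ⊛ h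
  ⊛-congˡ f e = ⊛-cong (≋-refl {f}) e

  ⊛-congʳ : ∀ f {g h} → g ≋ h → g ⊛ f ≋ h ⊛ f
  ⊛-congʳ f e = ⊛-cong e (≋-refl {f})

  ⊕-cong : ∀ {f f′ g g′} → f ≋ f′ → g ≋ g′ → f ⊕ g ≋ f′ ⊕ g′
  ⊕-cong e e′ n = cong₂ _+_ (e n) (e′ n)

  ⊕-congʳ : ∀ f {g h} → g ≋ h → g ⊕ f ≋ h ⊕ f
  ⊕-congʳ f e n = cong (_+ f n) (e n)

  ⊕-congˡ : ∀ f {g h} → g ≋ h → f ⊕ g ≋ f ⊕ h
  ⊕-congˡ f e n = cong (λ z → f n + z) (e n)

  ⊝-cong : ∀ {f g} → f ≋ g → ⊝ f ≋ ⊝ g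
  ⊝-cong e n = cong -_ (e n)

  ⊙-cong : ∀ c {f g} → f ≋ g → c ⊙ f ≋ c ⊙ g
  ⊙-cong c e n = cong (c *_) (e n)

  ⊛-distribˡ : ∀ h f g → h ⊛ (f ⊕ g) ≋ (h ⊛ f) ⊕ (h ⊛ g)
  ⊛-distribˡ h f g = ≋-trans (⊛-comm h (f ⊕ g)) (≋-trans (⊛-distribʳ h f g) (⊕-cong (⊛-comm f h) (⊛-comm g h)))

  ⊛-⊙ : ∀ c f g → f ⊛ (c ⊙ g) ≋ c ⊙ (f ⊛ g)
  ⊛-⊙ c f g = ≋-trans (⊛-comm f (c ⊙ g)) (≋-trans (⊙-⊛ c g f) (⊙-cong c (⊛-comm g f)))


  Regular : Series → Set
  Regular f = ∀ g → f ⊛ g ≋ zeroS → g ≋ zeroS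

  -- ℤ is a domain, so the lowest coefficient of the other factor vanishes; its tail satisfies the
  -- same hypothesis.
  regular₀ : ∀ {f} → f 0 ≢ + 0 → Regular f
  regular₀ {f} f₀ g h = go g h
    where
    g0≡0 : ∀ g → f ⊛ g ≋ zeroS → g 0 ≡ + 0
    g0≡0 g h with ℤP.i*j≡0⇒i≡0∨j≡0 (f 0) (h 0)
    ... | inj₁ e = ⊥-elim (f₀ e)
    ... | inj₂ e = e
    go : ∀ g → f ⊛ g ≋ zeroS → g ≋ zeroS
    go g h zero    = g0≡0 g h
    go g h (suc n) = go (tl g) h′ n
      where
      h′ : f ⊛ tl g ≋ zeroS
      h′ m = begin
        (f ⊛ tl g) m                     ≡⟨ ℤP.+-identityʳ _ ⟨
        (f ⊛ tl g) m + + 0               ≡⟨ cong (λ z → (f ⊛ tl g) m + z) (ℤP.*-zeroʳ (f (suc m))) ⟨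
        (f ⊛ tl g) m + f (suc m) * + 0   ≡⟨ cong (λ z → (f ⊛ tl g) m + f (suc m) * z) (g0≡0 g h) ⟨
        (f ⊛ tl g) m + f (suc m) * g 0   ≡⟨ ⊛-sucʳ f g m ⟨
        (f ⊛ g) (suc m)                  ≡⟨ h (suc m) ⟩
        + 0                              ∎
        where open ≡-Reasoning

  regular-tl : ∀ {f} → f 0 ≡ + 0 → Regular (tl f) → Regular f
  regular-tl {f} f₀ r g h = r g (λ n → trans (sym (ℤP.+-identityˡ _))
    (trans (cong (_+ (tl f ⊛ g) n) (trans (sym (ℤP.*-zeroˡ (g (suc n)))) (cong (_* g (suc n)) (sym f₀))))
      (trans (sym (⊛-suc f g n)) (h (suc n)))))


  Ord : ℕ → Series → Set
  Ord k f = ∀ i → i < k → f i ≡ + 0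

  ord-⊛ : ∀ k l {f g} → Ord k f → Ord l g → Ord (k ℕ.+ l) (f ⊛ g)
  ord-⊛ zero l {f} {g} of og n n<l =
    trans (sumTo-cong≤ n (λ i i≤n → trans (cong (f i *_) (og (n ℕ.∸ i) (ℕP.≤-<-trans (ℕP.m∸n≤m n i) n<l))) (ℤP.*-zeroʳ (f i)))) (sumTo-0 n)
  ord-⊛ (suc k) l {f} {g} of og zero    _         = trans (cong (_* g 0) (of 0 (s≤s z≤n))) (ℤP.*-zeroˡ (g 0))
  ord-⊛ (suc k) l {f} {g} of og (suc n) (s≤s n<k+l) = trans (⊛-suc f g n)
    (cong₂ _+_ (trans (cong (_* g (suc n)) (of 0 (s≤s z≤n))) (ℤP.*-zeroˡ (g (suc n))))
               (ord-⊛ k l {tl f} {g} (λ i i<k → of (suc i) (s≤s i<k)) og n n<k+l))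

  -- A factor divisible by q^k raises the precision of the other one by k. This is what makes
  -- truncated sums usable below.
  ⊛-cong-ord : ∀ k l {f g g′} → Ord k f → (∀ i → i < l → g i ≡ g′ i) → ∀ n → n < k ℕ.+ l → (f ⊛ g) n ≡ (f ⊛ g′) n
  ⊛-cong-ord zero l {f} of e n n<l = sumTo-cong≤ n (λ i i≤n → cong (f i *_) (e (n ℕ.∸ i) (ℕP.≤-<-trans (ℕP.m∸n≤m n i) n<l)))
  ⊛-cong-ord (suc k) l {f} {g} {g′} of e zero    _           = trans (cong (_* g 0) (of 0 (s≤s z≤n)))
    (trans (ℤP.*-zeroˡ (g 0)) (sym (trans (cong (_* g′ 0) (of 0 (s≤s z≤n))) (ℤP.*-zeroˡ (g′ 0)))))
  ⊛-cong-ord (suc k) l {f} {g} {g′} of e (suc n) (s≤s n<k+l) = trans (⊛-suc f g n) (trans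
    (cong₂ _+_ (vanish g (suc n)) (⊛-cong-ord k l {tl f} (λ i i<k → of (suc i) (s≤s i<k)) e n n<k+l))
    (trans (cong (_+ (tl f ⊛ g′) n) (sym (vanish g′ (suc n)))) (sym (⊛-suc f g′ n))))
    where
    vanish : ∀ h m → f 0 * h m ≡ + 0
    vanish h m = trans (cong (_* h m) (of 0 (s≤s z≤n))) (ℤP.*-zeroˡ (h m))

-- Sums over symmetric windows of integers.

module IntegerSums where

  open SeriesRing

  sumℤ : ℕ → (ℤ → ℤ) → ℤ
  sumℤ zero    f = f (+ 0)
  sumℤ (suc N) f = sumℤ N f + (f (+ suc N) + f -[1+ N ])

  sumℤ-cong≤ : ∀ N {f g : ℤ → ℤ} → (∀ k → ∣ k ∣ ≤ N → f k ≡ g k) → sumℤ N f ≡ sumℤ N g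
  sumℤ-cong≤ zero    h = h (+ 0) z≤n
  sumℤ-cong≤ (suc N) h = cong₂ _+_ (sumℤ-cong≤ N (λ k k≤N → h k (ℕP.m≤n⇒m≤1+n k≤N)))
    (cong₂ _+_ (h (+ suc N) ℕP.≤-refl) (h -[1+ N ] ℕP.≤-refl))

  sumℤ-cong : ∀ N {f g : ℤ → ℤ} → (∀ k → f k ≡ g k) → sumℤ N f ≡ sumℤ N g
  sumℤ-cong N h = sumℤ-cong≤ N (λ k _ → h k)

  sumℤ-+ : ∀ N (f g : ℤ → ℤ) → sumℤ N (λ k → f k + g k) ≡ sumℤ N f + sumℤ N g
  sumℤ-+ zero    f g = refl
  sumℤ-+ (suc N) f g = trans (cong₂ _+_ (sumℤ-+ N f g) refl) (shuffle (sumℤ N f) (sumℤ N g) (f (+ suc N)) (g (+ suc N)) (f -[1+ N ]) (g -[1+ N ]))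
    where shuffle : ∀ s t u v w x → (s + t) + ((u + v) + (w + x)) ≡ (s + (u + w)) + (t + (v + x))
          shuffle = solve-∀

  sumℤ-*ˡ : ∀ N c (f : ℤ → ℤ) → sumℤ N (λ k → c * f k) ≡ c * sumℤ N f
  sumℤ-*ˡ zero    c f = refl
  sumℤ-*ˡ (suc N) c f = trans (cong₂ _+_ (sumℤ-*ˡ N c f) refl) (factor c (sumℤ N f) (f (+ suc N)) (f -[1+ N ]))
    where factor : ∀ c s u v → c * s + (c * u + c * v) ≡ c * (s + (u + v))
          factor = solve-∀

  sumℤ-*ʳ : ∀ N c (f : ℤ → ℤ) → sumℤ N (λ k → f k * c) ≡ sumℤ N f * c
  sumℤ-*ʳ N c f = trans (sumℤ-cong N (λ k → ℤP.*-comm (f k) c)) (trans (sumℤ-*ˡ N c f) (ℤP.*-comm c _))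

  sumℤ-zero : ∀ N {f : ℤ → ℤ} → (∀ k → ∣ k ∣ ≤ N → f k ≡ + 0) → sumℤ N f ≡ + 0
  sumℤ-zero zero    h = h (+ 0) z≤n
  sumℤ-zero (suc N) h = cong₂ _+_ (sumℤ-zero N (λ k k≤N → h k (ℕP.m≤n⇒m≤1+n k≤N)))
    (cong₂ _+_ (h (+ suc N) ℕP.≤-refl) (h -[1+ N ] ℕP.≤-refl))

  sumℤ-sumTo : ∀ N n (f : ℤ → ℕ → ℤ) → sumℤ N (λ k → sumTo n (f k)) ≡ sumTo n (λ i → sumℤ N (λ k → f k i))
  sumℤ-sumTo N zero    f = refl
  sumℤ-sumTo N (suc n) f = trans (sumℤ-+ N (λ k → sumTo n (f k)) (λ k → f k (suc n))) (cong₂ _+_ (sumℤ-sumTo N n f) refl)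

  sumℤ-swap : ∀ N M (f : ℤ → ℤ → ℤ) → sumℤ N (λ k → sumℤ M (f k)) ≡ sumℤ M (λ l → sumℤ N (λ k → f k l))
  sumℤ-swap N zero    f = refl
  sumℤ-swap N (suc M) f = trans (sumℤ-+ N (λ k → sumℤ M (f k)) (λ k → f k (+ suc M) + f k -[1+ M ]))
    (cong₂ _+_ (sumℤ-swap N M f) (sumℤ-+ N (λ k → f k (+ suc M)) (λ k → f k -[1+ M ])))

  sumℤ-neg : ∀ N (f : ℤ → ℤ) → sumℤ N (λ k → f (- k)) ≡ sumℤ N f
  sumℤ-neg zero    f = refl
  sumℤ-neg (suc N) f = cong₂ _+_ (sumℤ-neg N f) (ℤP.+-comm (f -[1+ N ]) (f (+ suc N)))

  sumℤ-odd : ∀ N (f : ℤ → ℤ) → (∀ k → f (- k) ≡ - f k) → sumℤ N f ≡ + 0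
  sumℤ-odd zero    f h = self (f (+ 0)) (h (+ 0))
    where
    self : ∀ x → x ≡ - x → x ≡ + 0
    self (+ 0)     _ = refl
    self (+ suc n) ()
    self -[1+ n ]  ()
  sumℤ-odd (suc N) f h = cong₂ _+_ (sumℤ-odd N f h)
    (trans (cong (λ z → f (+ suc N) + z) (h (+ suc N))) (ℤP.+-inverseʳ (f (+ suc N))))

  when : Bool → ℤ → ℤ
  when b x = if b then x else + 0

  sumℤ-δ : ∀ N j x → ∣ j ∣ ≤ N → sumℤ N (λ k → when ⌊ k ℤ.≟ j ⌋ x) ≡ x
  sumℤ-δ-out : ∀ N j x → N < ∣ j ∣ → sumℤ N (λ k → when ⌊ k ℤ.≟ j ⌋ x) ≡ + 0

  sumℤ-δ-out N j x N<j = sumℤ-zero N miss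
    where
    miss : ∀ k → ∣ k ∣ ≤ N → when ⌊ k ℤ.≟ j ⌋ x ≡ + 0
    miss k k≤N with k ℤ.≟ j
    ... | yes refl = ⊥-elim (ℕP.<⇒≱ N<j k≤N)
    ... | no  _      = refl

  sumℤ-δ zero (+ 0) x j≤N = refl
  sumℤ-δ (suc N) j x j≤N with ∣ j ∣ ℕ.≤? N
  ... | yes j≤N′ = trans (cong₂ _+_ (sumℤ-δ N j x j≤N′) (cong₂ _+_ (miss (+ suc N) refl) (miss -[1+ N ] refl))) (ℤP.+-identityʳ x)
    where
    miss : ∀ k → ∣ k ∣ ≡ suc N → when ⌊ k ℤ.≟ j ⌋ x ≡ + 0
    miss k e with k ℤ.≟ j
    ... | yes refl = ⊥-elim (ℕP.<⇒≱ (ℕP.n<1+n N) (subst (_≤ N) e j≤N′))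
    ... | no  _      = refl
  ... | no j≰N = trans (cong₂ _+_ (sumℤ-δ-out N j x (ℕP.≰⇒> j≰N)) refl) (trans (ℤP.+-identityˡ _) (hit j (ℕP.≤-antisym j≤N (ℕP.≰⇒> j≰N))))
    where
    hit : ∀ j → ∣ j ∣ ≡ suc N → when ⌊ + suc N ℤ.≟ j ⌋ x + when ⌊ -[1+ N ] ℤ.≟ j ⌋ x ≡ x
    hit j@(+ _) refl with j ℤ.≟ j
    ... | yes _ = ℤP.+-identityʳ x
    ... | no  n = ⊥-elim (n refl)
    hit j@(-[1+ _ ]) refl with j ℤ.≟ j
    ... | yes _ = ℤP.+-identityˡ x
    ... | no  n = ⊥-elim (n refl)

  -- σ need only be injective, provided that f vanishes off its image.
  sumℤ-reindex : ∀ N N′ (σ ρ : ℤ → ℤ) (f : ℤ → ℤ) → (∀ k → ρ (σ k) ≡ k) →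
                 (∀ j → f j ≢ + 0 → ∣ j ∣ ≤ N × ∣ ρ j ∣ ≤ N′ × σ (ρ j) ≡ j) →
                 sumℤ N′ (f ∘ σ) ≡ sumℤ N f
  sumℤ-reindex N N′ σ ρ f ρσ h = begin
    sumℤ N′ (f ∘ σ)                                             ≡⟨ sumℤ-cong N′ spread ⟩
    sumℤ N′ (λ k → sumℤ N (λ j → when ⌊ j ℤ.≟ σ k ⌋ (f j)))      ≡⟨ sumℤ-swap N′ N _ ⟩
    sumℤ N (λ j → sumℤ N′ (λ k → when ⌊ j ℤ.≟ σ k ⌋ (f j)))      ≡⟨ sumℤ-cong N collect ⟩
    sumℤ N f                                                    ∎
    where
    open ≡-Reasoning
    rename : ∀ k j → when ⌊ j ℤ.≟ σ k ⌋ (f j) ≡ when ⌊ j ℤ.≟ σ k ⌋ (f (σ k))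
    rename k j with j ℤ.≟ σ k
    ... | yes refl = refl
    ... | no  _      = refl
    spread : ∀ k → f (σ k) ≡ sumℤ N (λ j → when ⌊ j ℤ.≟ σ k ⌋ (f j))
    spread k = sym (trans (sumℤ-cong N (rename k)) value)
      where
      value : sumℤ N (λ j → when ⌊ j ℤ.≟ σ k ⌋ (f (σ k))) ≡ f (σ k)
      value with ∣ σ k ∣ ℕ.≤? N
      ... | yes p = sumℤ-δ N (σ k) _ p
      ... | no  p with f (σ k) ℤ.≟ + 0
      ...   | yes z = trans (sumℤ-δ-out N (σ k) _ (ℕP.≰⇒> p)) (sym z)
      ...   | no  z = ⊥-elim (p (proj₁ (h (σ k) z)))
    collect : ∀ j → sumℤ N′ (λ k → when ⌊ j ℤ.≟ σ k ⌋ (f j)) ≡ f j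
    collect j with f j ℤ.≟ + 0
    ... | yes z = trans (sumℤ-zero N′ (λ k _ → all0 k)) (sym z)
      where
      all0 : ∀ k → when ⌊ j ℤ.≟ σ k ⌋ (f j) ≡ + 0
      all0 k with j ℤ.≟ σ k
      ... | yes _ = z
      ... | no  _ = refl
    ... | no z = trans (sumℤ-cong N′ invert) (sumℤ-δ N′ (ρ j) (f j) (proj₁ (proj₂ (h j z))))
      where
      invert : ∀ k → when ⌊ j ℤ.≟ σ k ⌋ (f j) ≡ when ⌊ k ℤ.≟ ρ j ⌋ (f j)
      invert k with j ℤ.≟ σ k | k ℤ.≟ ρ j
      ... | yes _ | yes _ = refl
      ... | no  _ | no  _ = refl
      ... | yes e | no  n = ⊥-elim (n (trans (sym (ρσ k)) (cong ρ (sym e))))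
      ... | no  n | yes e = ⊥-elim (n (trans (sym (proj₂ (proj₂ (h j z)))) (cong σ (sym e))))

  sumℤ-extend : ∀ N N′ (f : ℤ → ℤ) → (∀ j → f j ≢ + 0 → ∣ j ∣ ≤ N × ∣ j ∣ ≤ N′) → sumℤ N′ f ≡ sumℤ N f
  sumℤ-extend N N′ f h = sumℤ-reindex N N′ (λ k → k) (λ k → k) f (λ _ → refl) (λ j z → proj₁ (h j z) , proj₂ (h j z) , refl)

  sumℤ-reflect : ∀ N N′ M (f : ℤ → ℤ) → (∀ j → f j ≢ + 0 → ∣ j ∣ ≤ N × ∣ M + - j ∣ ≤ N′) →
                 sumℤ N′ (λ k → f (M + - k)) ≡ sumℤ N f
  sumℤ-reflect N N′ M f h = sumℤ-reindex N N′ (λ k → M + - k) (λ k → M + - k) f (invol M) (λ j z → proj₁ (h j z) , proj₂ (h j z) , invol M j)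
    where invol : ∀ M k → M + - (M + - k) ≡ k
          invol = solve-∀

-- The substitutions q ↦ q^k and q ↦ - q.

module Substitution where

  open Polynomials
  open SeriesRing

  mono : ℕ → Series
  mono zero            = oneS
  mono (suc k) zero    = + 0
  mono (suc k) (suc n) = mono k n

  mono-⊛-+ : ∀ k f n → (mono k ⊛ f) (k ℕ.+ n) ≡ f n
  mono-⊛-+ zero    f n = oneS-⊛ f n
  mono-⊛-+ (suc k) f n = trans (⊛-suc (mono (suc k)) f (k ℕ.+ n))
    (trans (cong₂ _+_ (ℤP.*-zeroˡ (f (suc (k ℕ.+ n)))) (mono-⊛-+ k f n)) (ℤP.+-identityˡ (f n)))

  mono-ord : ∀ k → Ord k (mono k)
  mono-ord (suc k) zero    _         = refl
  mono-ord (suc k) (suc i) (s≤s i<k) = mono-ord k i i<k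

  mono-⊛-< : ∀ k f n → n < k → (mono k ⊛ f) n ≡ + 0
  mono-⊛-< k f n n<k = ord-⊛ k 0 {mono k} {f} (mono-ord k) (λ _ ()) n (subst (n <_) (sym (ℕP.+-identityʳ k)) n<k)

  mono-+ : ∀ k l → mono (k ℕ.+ l) ≋ mono k ⊛ mono l
  mono-+ zero    l n       = sym (oneS-⊛ (mono l) n)
  mono-+ (suc k) l zero    = sym (ℤP.*-zeroˡ (mono l 0))
  mono-+ (suc k) l (suc n) = trans (mono-+ k l n) (sym (trans (⊛-suc (mono (suc k)) (mono l) n)
    (trans (cong (_+ (mono k ⊛ mono l) n) (ℤP.*-zeroˡ (mono l (suc n)))) (ℤP.+-identityˡ _))))

  pick : Series → ℕ → ℕ → ℤ
  pick f r j = if r ≡ᵇ 0 then f j else + 0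

  sub : (k : ℕ) → .{{_ : ℕ.NonZero k}} → Series → Series
  sub k f n = pick f (n % k) (n / k)

  sub-+ : ∀ k .{{_ : ℕ.NonZero k}} f n → sub k f (k ℕ.+ n) ≡ sub k (tl f) n
  sub-+ k f n = cong₂ (pick f)
    (trans (cong (_% k) (ℕP.+-comm k n)) ([m+n]%n≡m%n n k))
    (trans (m/n≡1+[m∸n]/n (ℕP.m≤m+n k n)) (cong (λ i → suc (i / k)) (ℕP.m+n∸m≡n k n)))

  sub-< : ∀ k .{{_ : ℕ.NonZero k}} f n → n < k → sub k f n ≡ constS (f 0) n
  sub-< k f n n<k = trans (cong₂ (pick f) (m<n⇒m%n≡m n<k) (m<n⇒m/n≡0 n<k)) (value n)
    where
    value : ∀ n → pick f n 0 ≡ constS (f 0) n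
    value zero    = sym (ℤP.*-identityʳ (f 0))
    value (suc n) = sym (ℤP.*-zeroʳ (f 0))

  sub-eq : ∀ k .{{_ : ℕ.NonZero k}} f → sub k f ≋ constS (f 0) ⊕ mono k ⊛ sub k (tl f)
  sub-eq k f n with n ℕ.<? k
  ... | yes n<k = trans (sub-< k f n n<k) (sym (trans (cong (λ z → constS (f 0) n + z) (mono-⊛-< k (sub k (tl f)) n n<k)) (ℤP.+-identityʳ _)))
  ... | no  n≮k = subst (λ m → sub k f m ≡ (constS (f 0) ⊕ mono k ⊛ sub k (tl f)) m) (ℕP.m+[n∸m]≡n (ℕP.≮⇒≥ n≮k)) (at (n ℕ.∸ k))
    where
    const0 : ∀ k m .{{_ : ℕ.NonZero k}} → constS (f 0) (k ℕ.+ m) ≡ + 0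
    const0 (suc k) m = ℤP.*-zeroʳ (f 0)
    at : ∀ m → sub k f (k ℕ.+ m) ≡ (constS (f 0) ⊕ mono k ⊛ sub k (tl f)) (k ℕ.+ m)
    at m = trans (sub-+ k f m) (sym (trans (cong₂ _+_ (const0 k m) (mono-⊛-+ k (sub k (tl f)) m)) (ℤP.+-identityˡ _)))

  sub-cong : ∀ k .{{_ : ℕ.NonZero k}} {f g} → f ≋ g → sub k f ≋ sub k g
  sub-cong k e n with n % k ≡ᵇ 0
  ... | true  = e (n / k)
  ... | false = refl

  sub-⊕ : ∀ k .{{_ : ℕ.NonZero k}} f g → sub k (f ⊕ g) ≋ sub k f ⊕ sub k g
  sub-⊕ k f g n with n % k ≡ᵇ 0
  ... | true  = refl
  ... | false = refl

  sub-⊙ : ∀ k .{{_ : ℕ.NonZero k}} c f → sub k (c ⊙ f) ≋ c ⊙ sub k f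
  sub-⊙ k c f n with n % k ≡ᵇ 0
  ... | true  = refl
  ... | false = sym (ℤP.*-zeroʳ c)

  sub-⊝ : ∀ k .{{_ : ℕ.NonZero k}} f → sub k (⊝ f) ≋ ⊝ sub k f
  sub-⊝ k f n with n % k ≡ᵇ 0
  ... | true  = refl
  ... | false = refl

  -- Both sides obey the same recursion, which splits off the constant term of f and multiplies the
  -- rest by q^k; as k > 0 the exponent decreases.
  sub-⊛ : ∀ k .{{_ : ℕ.NonZero k}} f g → sub k (f ⊛ g) ≋ sub k f ⊛ sub k g
  sub-⊛ k f g n = go f g n (<-wellFounded n)
    where
    open ≡-Reasoning
    lhs : ∀ f g n → (sub k f ⊛ sub k g) n ≡ f 0 * sub k g n + (mono k ⊛ (sub k (tl f) ⊛ sub k g)) n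
    lhs f g n = begin
      (sub k f ⊛ sub k g) n
        ≡⟨ ⊛-cong {g = sub k g} (sub-eq k f) ≋-refl n ⟩
      ((constS (f 0) ⊕ mono k ⊛ sub k (tl f)) ⊛ sub k g) n
        ≡⟨ ⊛-distribʳ (sub k g) (constS (f 0)) (mono k ⊛ sub k (tl f)) n ⟩
      (constS (f 0) ⊛ sub k g) n + ((mono k ⊛ sub k (tl f)) ⊛ sub k g) n
        ≡⟨ cong₂ _+_ (constS-⊛ (f 0) (sub k g) n) (⊛-assoc (mono k) (sub k (tl f)) (sub k g) n) ⟩
      f 0 * sub k g n + (mono k ⊛ (sub k (tl f) ⊛ sub k g)) n ∎
    rhs : ∀ f g n → sub k (f ⊛ g) n ≡ f 0 * sub k g n + (mono k ⊛ sub k (tl f ⊛ g)) n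
    rhs f g n = begin
      sub k (f ⊛ g) n
        ≡⟨ sub-eq k (f ⊛ g) n ⟩
      constS (f 0 * g 0) n + (mono k ⊛ sub k (tl (f ⊛ g))) n
        ≡⟨ cong (λ z → constS (f 0 * g 0) n + z) (trans (⊛-congˡ (mono k) (≋-trans (sub-cong k (⊛-suc f g)) (≋-trans (sub-⊕ k (f 0 ⊙ tl g) (tl f ⊛ g)) (⊕-congʳ (sub k (tl f ⊛ g)) (sub-⊙ k (f 0) (tl g))))) n)
            (⊛-distribˡ (mono k) (f 0 ⊙ sub k (tl g)) (sub k (tl f ⊛ g)) n)) ⟩
      constS (f 0 * g 0) n + ((mono k ⊛ (f 0 ⊙ sub k (tl g))) n + (mono k ⊛ sub k (tl f ⊛ g)) n)
        ≡⟨ cong (λ z → constS (f 0 * g 0) n + (z + (mono k ⊛ sub k (tl f ⊛ g)) n)) (⊛-⊙ (f 0) (mono k) (sub k (tl g)) n) ⟩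
      (f 0 * g 0) * oneS n + (f 0 * (mono k ⊛ sub k (tl g)) n + (mono k ⊛ sub k (tl f ⊛ g)) n)
        ≡⟨ regroup (f 0) (g 0) (oneS n) _ _ ⟩
      f 0 * (g 0 * oneS n + (mono k ⊛ sub k (tl g)) n) + (mono k ⊛ sub k (tl f ⊛ g)) n
        ≡⟨ cong (λ z → f 0 * z + (mono k ⊛ sub k (tl f ⊛ g)) n) (sub-eq k g n) ⟨
      f 0 * sub k g n + (mono k ⊛ sub k (tl f ⊛ g)) n ∎
      where
      regroup : ∀ a b c x y → (a * b) * c + (a * x + y) ≡ a * (b * c + x) + y
      regroup = solve-∀
    go : ∀ f g n → Acc _<_ n → sub k (f ⊛ g) n ≡ (sub k f ⊛ sub k g) n
    go f g n (acc rec) = trans (rhs f g n) (trans (cong (λ z → f 0 * sub k g n + z) step) (sym (lhs f g n)))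
      where
      at : ∀ m → k ℕ.+ m ≡ n → sub k (tl f ⊛ g) m ≡ (sub k (tl f) ⊛ sub k g) m
      at m e = go (tl f) g m (rec (subst (m <_) e (ℕP.m<n+m m (ℕP.n≢0⇒n>0 (ℕ.≢-nonZero⁻¹ k)))))
      step : (mono k ⊛ sub k (tl f ⊛ g)) n ≡ (mono k ⊛ (sub k (tl f) ⊛ sub k g)) n
      step with n ℕ.<? k
      ... | yes n<k = trans (mono-⊛-< k (sub k (tl f ⊛ g)) n n<k) (sym (mono-⊛-< k (sub k (tl f) ⊛ sub k g) n n<k))
      ... | no  n≮k = subst (λ i → (mono k ⊛ sub k (tl f ⊛ g)) i ≡ (mono k ⊛ (sub k (tl f) ⊛ sub k g)) i) e
            (trans (mono-⊛-+ k (sub k (tl f ⊛ g)) m) (trans (at m e) (sym (mono-⊛-+ k (sub k (tl f) ⊛ sub k g) m))))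
        where
        m = n ℕ.∸ k
        e = ℕP.m+[n∸m]≡n (ℕP.≮⇒≥ n≮k)

  sub-oneS : ∀ k .{{_ : ℕ.NonZero k}} → sub k oneS ≋ oneS
  sub-oneS k n = trans (sub-eq k oneS n) (trans (cong₂ _+_ (ℤP.*-identityˡ (oneS n))
    (trans (⊛-cong {mono k} ≋-refl zero′ n) (trans (⊛-comm (mono k) zeroS n) (zeroS-⊛ (mono k) n)))) (ℤP.+-identityʳ _))
    where
    zero′ : sub k zeroS ≋ zeroS
    zero′ m with m % k ≡ᵇ 0
    ... | true  = refl
    ... | false = refl

  -- q ↦ - q

  sgn : ℕ → ℤ
  sgn zero    = + 1
  sgn (suc n) = - sgn n

  sgn-+ : ∀ m n → sgn (m ℕ.+ n) ≡ sgn m * sgn n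
  sgn-+ zero    n = sym (ℤP.*-identityˡ (sgn n))
  sgn-+ (suc m) n = trans (cong -_ (sgn-+ m n)) (ℤP.neg-distribˡ-* (sgn m) (sgn n))

  twist : Series → Series
  twist f n = sgn n * f n

  twist-⊛ : ∀ f g → twist (f ⊛ g) ≋ twist f ⊛ twist g
  twist-⊛ f g n = trans (sym (sumTo-*ˡ n (sgn n) _)) (sumTo-cong≤ n (λ i i≤n →
    trans (cong (λ m → m * (f i * g (n ℕ.∸ i))) (trans (cong sgn (sym (ℕP.m+[n∸m]≡n i≤n))) (sgn-+ i (n ℕ.∸ i))))
      (shuffle (sgn i) (sgn (n ℕ.∸ i)) (f i) (g (n ℕ.∸ i)))))
    where
    shuffle : ∀ s t a b → (s * t) * (a * b) ≡ (s * a) * (t * b)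
    shuffle = solve-∀

-- Locally finite families of series indexed by ℤ, and their double sums.

module Families where

  open Polynomials
  open SeriesRing
  open IntegerSums
  open Substitution

  Family : Set
  Family = ℤ → Series

  -- `Loc` is the form of convergence used throughout: a term of index m has no coefficient below
  -- |m|, so the window |m| ≤ i in `ΣZ` gives the exact coefficient of q^i.
  Loc Even Odd : Family → Set
  Loc  F = ∀ m → Ord ∣ m ∣ (F m)
  Even F = ∀ m → F (- m) ≋ F m
  Odd  F = ∀ m → F (- m) ≋ ⊝ F m

  win : ℕ → Family → Series
  win N F i = sumℤ N (λ m → F m i)

  ΣZ : Family → Series
  ΣZ F i = win i F i

  ≢0⇒≤ : ∀ {k f i} → Ord k f → f i ≢ + 0 → k ≤ i
  ≢0⇒≤ o z = ℕP.≮⇒≥ (λ i<k → z (o _ i<k))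

  win-loc : ∀ {F} → Loc F → ∀ N i → i ≤ N → win N F i ≡ ΣZ F i
  win-loc {F} l N i i≤N = sumℤ-extend i N (λ m → F m i) (λ m z → let m≤i = ≢0⇒≤ {f = F m} (l m) z in m≤i , ℕP.≤-trans m≤i i≤N)

  ΣZ-cong : ∀ {F G} → (∀ m → F m ≋ G m) → ΣZ F ≋ ΣZ G
  ΣZ-cong e i = sumℤ-cong i (λ m → e m i)

  ΣZ-⊕ : ∀ F G → ΣZ (λ m → F m ⊕ G m) ≋ ΣZ F ⊕ ΣZ G
  ΣZ-⊕ F G i = sumℤ-+ i (λ m → F m i) (λ m → G m i)

  ΣZ-⊙ : ∀ c F → ΣZ (λ m → c ⊙ F m) ≋ c ⊙ ΣZ F
  ΣZ-⊙ c F i = sumℤ-*ˡ i c (λ m → F m i)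

  wt : (ℤ → ℤ) → Family → Family
  wt α F m = α m ⊙ F m

  wt-loc : ∀ α {F} → Loc F → Loc (wt α F)
  wt-loc α l m i i<m = trans (cong (α m *_) (l m i i<m)) (ℤP.*-zeroʳ (α m))

  win-⊛ : ∀ N h G i → (h ⊛ win N G) i ≡ sumℤ N (λ n → (h ⊛ G n) i)
  win-⊛ N h G i = trans (sumTo-cong i (λ j → sym (sumℤ-*ˡ N (h j) (λ n → G n (i ℕ.∸ j)))))
    (sym (sumℤ-sumTo N i (λ n j → h j * G n (i ℕ.∸ j))))

  dsum : (ℤ → ℤ → ℤ) → Family → Family → Series
  dsum H F G i = sumℤ i (λ m → sumℤ i (λ n → H m n * (F m ⊛ G n) i))

  dsum-cong : ∀ {H H′} F G → (∀ m n → H m n ≡ H′ m n) → dsum H F G ≋ dsum H′ F G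
  dsum-cong F G e i = sumℤ-cong i (λ m → sumℤ-cong i (λ n → cong (_* (F m ⊛ G n) i) (e m n)))

  dsum-+ : ∀ H H′ F G → dsum (λ m n → H m n + H′ m n) F G ≋ dsum H F G ⊕ dsum H′ F G
  dsum-+ H H′ F G i = trans
    (sumℤ-cong i (λ m → trans (sumℤ-cong i (λ n → ℤP.*-distribʳ-+ ((F m ⊛ G n) i) (H m n) (H′ m n)))
      (sumℤ-+ i (λ n → H m n * (F m ⊛ G n) i) (λ n → H′ m n * (F m ⊛ G n) i))))
    (sumℤ-+ i (λ m → sumℤ i (λ n → H m n * (F m ⊛ G n) i)) (λ m → sumℤ i (λ n → H′ m n * (F m ⊛ G n) i)))

  dsum-*ˡ : ∀ c H F G → dsum (λ m n → c * H m n) F G ≋ c ⊙ dsum H F G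
  dsum-*ˡ c H F G i = trans
    (sumℤ-cong i (λ m → trans (sumℤ-cong i (λ n → ℤP.*-assoc c (H m n) ((F m ⊛ G n) i)))
      (sumℤ-*ˡ i c (λ n → H m n * (F m ⊛ G n) i))))
    (sumℤ-*ˡ i c (λ m → sumℤ i (λ n → H m n * (F m ⊛ G n) i)))

  dsum-prod : ∀ α β {F G} → Loc F → Loc G → dsum (λ m n → α m * β n) F G ≋ ΣZ (wt α F) ⊛ ΣZ (wt β G)
  dsum-prod α β {F} {G} lF lG i = sym (begin
    (ΣZ (wt α F) ⊛ ΣZ (wt β G)) i
      ≡⟨ ⊛-cong≤ {ΣZ (wt α F)} {win i (wt α F)} {ΣZ (wt β G)} {win i (wt β G)} i
           (λ j j≤i → sym (win-loc (wt-loc α lF) i j j≤i)) (λ j j≤i → sym (win-loc (wt-loc β lG) i j j≤i)) ⟩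
    (win i (wt α F) ⊛ win i (wt β G)) i
      ≡⟨ ⊛-comm (win i (wt α F)) (win i (wt β G)) i ⟩
    (win i (wt β G) ⊛ win i (wt α F)) i
      ≡⟨ win-⊛ i (win i (wt β G)) (wt α F) i ⟩
    sumℤ i (λ m → (win i (wt β G) ⊛ wt α F m) i)
      ≡⟨ sumℤ-cong i (λ m → trans (⊛-comm (win i (wt β G)) (wt α F m) i) (trans (win-⊛ i (wt α F m) (wt β G) i)
          (sumℤ-cong i (λ n → scal m n)))) ⟩
    dsum (λ m n → α m * β n) F G i ∎)
    where
    open ≡-Reasoning
    scal : ∀ m n → (wt α F m ⊛ wt β G n) i ≡ (α m * β n) * (F m ⊛ G n) i
    scal m n = trans (⊙-⊛ (α m) (F m) (β n ⊙ G n) i) (trans (cong (α m *_) (⊛-⊙ (β n) (F m) (G n) i))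
      (sym (ℤP.*-assoc (α m) (β n) _)))

  dsum-flip : ∀ H F {G} → Even G → dsum (λ m n → H m (- n)) F G ≋ dsum H F G
  dsum-flip H F {G} e i = sumℤ-cong i (λ m → trans
    (sumℤ-cong i (λ n → cong (H m (- n) *_) (⊛-congˡ (F m) (≋-sym (e n)) i)))
    (sumℤ-neg i (λ n → H m n * (F m ⊛ G n) i)))

  sgnℤ : ℤ → ℤ
  sgnℤ (+ 0)     = + 0
  sgnℤ (+ suc _) = + 1
  sgnℤ -[1+ _ ]  = - + 1

  -- After m ↦ M - m the indices that reach the exponent j satisfy |m| ≤ |M| + j, so the window i
  -- still contains all of them.
  win-reflect : ∀ {F} → Loc F → ∀ i M j → ∣ M ∣ ℕ.+ j ≤ i → win i (λ m → F (M + - m)) j ≡ ΣZ F j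
  win-reflect {F} l i M j b = sumℤ-reflect j i M (λ k → F k j) (λ k z →
    let k≤j = ≢0⇒≤ {f = F k} (l k) z in
    k≤j , ℕP.≤-trans (ℤP.∣i+j∣≤∣i∣+∣j∣ M (- k)) (ℕP.≤-trans (ℕP.+-monoʳ-≤ ∣ M ∣ (subst (_≤ j) (sym (ℤP.∣-i∣≡∣i∣ k)) k≤j)) b))

  -- V M is of order |M|, so only the exact part of the window sum enters the product.
  ⊛-win : ∀ (V : Series) i M (T : Family) (W : Series) → Ord ∣ M ∣ V → ∣ M ∣ ≤ i →
          (∀ j → ∣ M ∣ ℕ.+ j ≤ i → win i T j ≡ W j) → sumℤ i (λ m → (V ⊛ T m) i) ≡ (V ⊛ W) i
  ⊛-win V i M T W o b e = trans (sym (win-⊛ i V T i))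
    (⊛-cong-ord ∣ M ∣ (suc (i ℕ.∸ ∣ M ∣)) {V} {win i T} {W} o (λ j j< → e j (bound j j<)) i last)
    where
    bound : ∀ j → j < suc (i ℕ.∸ ∣ M ∣) → ∣ M ∣ ℕ.+ j ≤ i
    bound j (s≤s j≤) = subst (∣ M ∣ ℕ.+ j ≤_) (ℕP.m+[n∸m]≡n b) (ℕP.+-monoʳ-≤ ∣ M ∣ j≤)
    last : i < ∣ M ∣ ℕ.+ suc (i ℕ.∸ ∣ M ∣)
    last = subst (i <_) (sym (trans (ℕP.+-suc ∣ M ∣ (i ℕ.∸ ∣ M ∣)) (cong suc (ℕP.m+[n∸m]≡n b)))) (ℕP.n<1+n i)

  private
    -- When M passes from n to n + 1 the sign of M - m changes at two indices only: from 0 to 1 at m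
    -- = n, and from -1 to 0 at m = n + 1.
    step : ∀ (α : ℤ → ℤ) i n → suc n ≤ i →
           sumℤ i (λ m → α m * sgnℤ (+ suc n + - m)) ≡ sumℤ i (λ m → α m * sgnℤ (+ n + - m)) + (α (+ n) + α (+ suc n))
    step α i n sn≤i = begin
      sumℤ i (λ m → α m * sgnℤ (+ suc n + - m))
        ≡⟨ sumℤ-cong i jump ⟩
      sumℤ i (λ m → α m * sgnℤ (+ n + - m) + (when ⌊ m ℤ.≟ + n ⌋ (α (+ n)) + when ⌊ m ℤ.≟ + suc n ⌋ (α (+ suc n))))
        ≡⟨ trans (sumℤ-+ i _ _) (cong (λ z → sumℤ i (λ m → α m * sgnℤ (+ n + - m)) + z) (trans (sumℤ-+ i _ _)
             (cong₂ _+_ (sumℤ-δ i (+ n) (α (+ n)) (ℕP.<⇒≤ sn≤i)) (sumℤ-δ i (+ suc n) (α (+ suc n)) sn≤i)))) ⟩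
      sumℤ i (λ m → α m * sgnℤ (+ n + - m)) + (α (+ n) + α (+ suc n)) ∎
      where
      open ≡-Reasoning
      at : ∀ d → sgnℤ (+ 1 + d) ≡ sgnℤ d + (when ⌊ d ℤ.≟ + 0 ⌋ (+ 1) + when ⌊ d ℤ.≟ - + 1 ⌋ (+ 1))
      at (+ 0)          = refl
      at (+ suc k)      = refl
      at -[1+ 0 ]       = refl
      at -[1+ suc k ]   = refl
      δ : ∀ k c m (x : ℤ) → x * when ⌊ k + - m ℤ.≟ c ⌋ (+ 1) ≡ when ⌊ m ℤ.≟ k + - c ⌋ x
      δ k c m x with k + - m ℤ.≟ c | m ℤ.≟ k + - c
      ... | yes _ | yes _ = ℤP.*-identityʳ x
      ... | no  _ | no  _ = ℤP.*-zeroʳ x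
      ... | yes e | no  p = ⊥-elim (p (trans (inv m k) (cong (λ z → k + - z) e)))
        where inv : ∀ c k → c ≡ k + - (k + - c)
              inv = solve-∀
      ... | no  p | yes e = ⊥-elim (p (trans (cong (λ z → k + - z) e) (inv c k)))
        where inv : ∀ c k → k + - (k + - c) ≡ c
              inv = solve-∀
      fetch : ∀ m k → when ⌊ m ℤ.≟ k ⌋ (α m) ≡ when ⌊ m ℤ.≟ k ⌋ (α k)
      fetch m k with m ℤ.≟ k
      ... | yes refl = refl
      ... | no  _      = refl
      jump : ∀ m → α m * sgnℤ (+ suc n + - m) ≡ α m * sgnℤ (+ n + - m) + (when ⌊ m ℤ.≟ + n ⌋ (α (+ n)) + when ⌊ m ℤ.≟ + suc n ⌋ (α (+ suc n)))
      jump m = begin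
        α m * sgnℤ (+ suc n + - m)
          ≡⟨ cong (λ z → α m * sgnℤ z) (ℤP.+-assoc (+ 1) (+ n) (- m)) ⟩
        α m * sgnℤ (+ 1 + (+ n + - m))
          ≡⟨ cong (α m *_) (at (+ n + - m)) ⟩
        α m * (sgnℤ (+ n + - m) + (when ⌊ + n + - m ℤ.≟ + 0 ⌋ (+ 1) + when ⌊ + n + - m ℤ.≟ - + 1 ⌋ (+ 1)))
          ≡⟨ expand (α m) _ _ _ ⟩
        α m * sgnℤ (+ n + - m) + (α m * when ⌊ + n + - m ℤ.≟ + 0 ⌋ (+ 1) + α m * when ⌊ + n + - m ℤ.≟ - + 1 ⌋ (+ 1))
          ≡⟨ cong (λ z → α m * sgnℤ (+ n + - m) + z) (cong₂ _+_
               (trans (δ (+ n) (+ 0) m (α m)) (trans (cong (λ k → when ⌊ m ℤ.≟ k ⌋ (α m)) (ℤP.+-identityʳ (+ n))) (fetch m (+ n))))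
               (trans (δ (+ n) (- + 1) m (α m)) (trans (cong (λ k → when ⌊ m ℤ.≟ k ⌋ (α m)) (ℤP.+-comm (+ n) (+ 1))) (fetch m (+ suc n))))) ⟩
        α m * sgnℤ (+ n + - m) + (when ⌊ m ℤ.≟ + n ⌋ (α (+ n)) + when ⌊ m ℤ.≟ + suc n ⌋ (α (+ suc n))) ∎
        where
        expand : ∀ a x y z → a * (x + (y + z)) ≡ a * x + (a * y + a * z)
        expand = solve-∀

  sgnℤ-neg : ∀ k → sgnℤ (- k) ≡ - sgnℤ k
  sgnℤ-neg (+ 0)     = refl
  sgnℤ-neg (+ suc _) = refl
  sgnℤ-neg -[1+ _ ]  = refl

  private
    mirror : ∀ (α : ℤ → ℤ) → (∀ m → α (- m) ≡ α m) → ∀ i M →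
             sumℤ i (λ m → α m * sgnℤ (- M + - m)) ≡ - sumℤ i (λ m → α m * sgnℤ (M + - m))
    mirror α e i M = trans (sym (sumℤ-neg i (λ m → α m * sgnℤ (- M + - m)))) (trans (sumℤ-cong i at)
      (trans (sumℤ-*ˡ i (- + 1) (λ m → α m * sgnℤ (M + - m))) (ℤP.-1*i≡-i _)))
      where
      dist : ∀ M m → - M + - - m ≡ - (M + - m)
      dist = solve-∀
      pull : ∀ a s → a * - s ≡ - + 1 * (a * s)
      pull = solve-∀
      at : ∀ m → α (- m) * sgnℤ (- M + - - m) ≡ - + 1 * (α m * sgnℤ (M + - m))
      at m = trans (cong₂ _*_ (e m) (trans (cong sgnℤ (dist M m)) (sgnℤ-neg (M + - m)))) (pull (α m) _)

    base : ∀ (α : ℤ → ℤ) → (∀ m → α (- m) ≡ α m) → ∀ i → sumℤ i (λ m → α m * sgnℤ (+ 0 + - m)) ≡ + 0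
    base α e i = sumℤ-odd i _ (λ m → trans (cong₂ _*_ (e m) (trans (cong sgnℤ (ℤP.+-identityˡ (- - m)))
      (trans (sgnℤ-neg (- m)) (cong (λ z → - sgnℤ z) (sym (ℤP.+-identityˡ (- m))))))) (pull (α m) _))
      where
      pull : ∀ a s → a * - s ≡ - (a * s)
      pull = solve-∀

  -- This is the part of the sum of tanh over a line that does not converge absolutely. Its value
  -- depends on the window being symmetric, and it is the origin of the factor m in σ.
  sum-sgn : ∀ i M → ∣ M ∣ ≤ i → sumℤ i (λ m → sgnℤ (M + - m)) ≡ + 2 * M
  sum-sgn i M b = trans (sumℤ-cong i (λ m → sym (ℤP.*-identityˡ _))) (go M b)
    where
    one : ℤ → ℤ
    one _ = + 1
    nonneg : ∀ n → n ≤ i → sumℤ i (λ m → one m * sgnℤ (+ n + - m)) ≡ + 2 * + n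
    nonneg zero    _    = base one (λ _ → refl) i
    nonneg (suc n) sn≤i = trans (step one i n sn≤i) (trans (cong (_+ + 2) (nonneg n (ℕP.<⇒≤ sn≤i))) (next (+ n)))
      where next : ∀ x → + 2 * x + + 2 ≡ + 2 * (+ 1 + x)
            next = solve-∀
    go : ∀ M → ∣ M ∣ ≤ i → sumℤ i (λ m → one m * sgnℤ (M + - m)) ≡ + 2 * M
    go (+ n)    b = nonneg n b
    go -[1+ n ] b = trans (mirror one (λ _ → refl) i (+ suc n)) (trans (cong -_ (nonneg (suc n) b)) (ℤP.neg-distribʳ-* (+ 2) (+ suc n)))

  sgnᶻ : ℤ → ℤ
  sgnᶻ m = sgn ∣ m ∣

  -- With alternating weights the two contributions found in `step` cancel.
  sum-alt-sgn : ∀ i M → ∣ M ∣ ≤ i → sumℤ i (λ m → sgnᶻ m * sgnℤ (M + - m)) ≡ + 0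
  sum-alt-sgn i = go
    where
    even : ∀ m → sgnᶻ (- m) ≡ sgnᶻ m
    even m = cong sgn (ℤP.∣-i∣≡∣i∣ m)
    nonneg : ∀ n → n ≤ i → sumℤ i (λ m → sgnᶻ m * sgnℤ (+ n + - m)) ≡ + 0
    nonneg zero    _    = base sgnᶻ even i
    nonneg (suc n) sn≤i = trans (step sgnᶻ i n sn≤i) (cong₂ _+_ (nonneg n (ℕP.<⇒≤ sn≤i)) (ℤP.+-inverseʳ (sgn n)))
    go : ∀ M → ∣ M ∣ ≤ i → sumℤ i (λ m → sgnᶻ m * sgnℤ (M + - m)) ≡ + 0
    go (+ n)    b = nonneg n b
    go -[1+ n ] b = trans (mirror sgnᶻ even i (+ suc n)) (cong -_ (nonneg (suc n) b))

-- Characters modulo 5 and 8, and addition laws that separate two indices.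

module Characters where

  open Polynomials
  open SeriesRing
  open Families

  residues : ∀ k (f g : ℕ → ℤ) → {True (FinP.all? {k} (λ i → f (toℕ i) ℤ.≟ g (toℕ i)))} → ∀ r → r < k → f r ≡ g r
  residues k f g {t} r r<k = subst (λ i → f i ≡ g i) (FinP.toℕ-fromℕ< r<k) (toWitness t (fromℕ< r<k))

  Periodic : (k : ℕ) → .{{_ : ℕ.NonZero k}} → (ℕ → ℤ) → Set
  Periodic k f = ∀ n → f n ≡ f (n % k)

  private
    p₁ p₂ : ℕ → ℤ
    p₁ 1 = + 1
    p₁ 4 = + 1
    p₁ 2 = - + 1
    p₁ 3 = - + 1
    p₁ _ = + 0
    p₂ 1 = + 1
    p₂ 7 = + 1
    p₂ 3 = - + 1
    p₂ 5 = - + 1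
    p₂ _ = + 0

    χ₁-table : ∀ m → χ₁ m ≡ p₁ (m % 5)
    χ₁-table m with m % 5
    ... | 0 = refl
    ... | 1 = refl
    ... | 2 = refl
    ... | 3 = refl
    ... | 4 = refl
    ... | suc (suc (suc (suc (suc _)))) = refl

    χ₂-table : ∀ m → χ₂ m ≡ p₂ (m % 8)
    χ₂-table m with m % 8
    ... | 0 = refl
    ... | 1 = refl
    ... | 2 = refl
    ... | 3 = refl
    ... | 4 = refl
    ... | 5 = refl
    ... | 6 = refl
    ... | 7 = refl
    ... | suc (suc (suc (suc (suc (suc (suc (suc _))))))) = refl

  χ₁-periodic : Periodic 5 χ₁
  χ₁-periodic n = trans (χ₁-table n) (trans (cong p₁ (sym (m%n%n≡m%n n 5))) (sym (χ₁-table (n % 5))))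

  χ₂-periodic : Periodic 8 χ₂
  χ₂-periodic n = trans (χ₂-table n) (trans (cong p₂ (sym (m%n%n≡m%n n 8))) (sym (χ₂-table (n % 8))))

  periodic-+ : ∀ k .{{_ : ℕ.NonZero k}} {f} → Periodic k f → ∀ m n → f (m ℕ.+ n) ≡ f (m % k ℕ.+ n % k)
  periodic-+ k {f} p m n = trans (p (m ℕ.+ n)) (trans (cong f (%-distribˡ-+ m n k)) (sym (p (m % k ℕ.+ n % k))))

  periodic-* : ∀ k .{{_ : ℕ.NonZero k}} {f} → Periodic k f → ∀ m n → f (m ℕ.* n) ≡ f ((m % k) ℕ.* (n % k))
  periodic-* k {f} p m n = trans (p (m ℕ.* n)) (trans (cong f (%-distribˡ-* m n k)) (sym (p ((m % k) ℕ.* (n % k)))))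

  χ₁-+5 : ∀ n → χ₁ (5 ℕ.+ n) ≡ χ₁ n
  χ₁-+5 n = trans (χ₁-periodic (5 ℕ.+ n)) (trans (cong χ₁ (trans (cong (_% 5) (ℕP.+-comm 5 n)) ([m+n]%n≡m%n n 5))) (sym (χ₁-periodic n)))

  χ₂-+4 : ∀ n → χ₂ (4 ℕ.+ n) ≡ - χ₂ n
  χ₂-+4 n = trans (periodic-+ 8 χ₂-periodic 4 n) (trans (residues 8 (λ r → χ₂ (4 ℕ.+ r)) (λ r → - χ₂ r) (n % 8) (m%n<n n 8)) (cong -_ (sym (χ₂-periodic n))))

  χ₁-* : ∀ m n → χ₁ (m ℕ.* n) ≡ χ₁ m * χ₁ n
  χ₁-* m n = trans (periodic-* 5 χ₁-periodic m n) (trans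
    (subst₂ (λ i j → χ₁ (i ℕ.* j) ≡ χ₁ i * χ₁ j) (FinP.toℕ-fromℕ< (m%n<n m 5)) (FinP.toℕ-fromℕ< (m%n<n n 5)) (check (fromℕ< (m%n<n m 5)) (fromℕ< (m%n<n n 5))))
    (cong₂ _*_ (sym (χ₁-periodic m)) (sym (χ₁-periodic n))))
    where
    check : ∀ (i j : Fin 5) → χ₁ (toℕ i ℕ.* toℕ j) ≡ χ₁ (toℕ i) * χ₁ (toℕ j)
    check = toWitness {a? = FinP.all? (λ i → FinP.all? (λ j → χ₁ (toℕ i ℕ.* toℕ j) ℤ.≟ χ₁ (toℕ i) * χ₁ (toℕ j)))} _

  -- The characters of conductor 4 and 8 with value - 1 at - 1.

  ψ₄ ψ₈ : ℕ → ℤ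
  ψ₄ 0             = + 0
  ψ₄ 1             = + 1
  ψ₄ (suc (suc n)) = - ψ₄ n
  ψ₈ 0 = + 0
  ψ₈ 1 = + 1
  ψ₈ 2 = + 0
  ψ₈ 3 = + 1
  ψ₈ (suc (suc (suc (suc n)))) = - ψ₈ n

  -- The Ramanujan sum modulo 5, that is the sum of the n-th powers of the primitive fifth roots of
  -- unity. Hence s₅ + 1 detects multiples of 5, with value 5.
  s₅ : ℕ → ℤ
  s₅ n with n % 5
  ... | 0 = + 4
  ... | _ = - + 1

  private
    q₅ : ℕ → ℤ
    q₅ 0 = + 4
    q₅ _ = - + 1
    s₅-table : ∀ n → s₅ n ≡ q₅ (n % 5)
    s₅-table n with n % 5
    ... | 0     = refl
    ... | suc _ = refl

  s₅-periodic : Periodic 5 s₅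
  s₅-periodic n = trans (s₅-table n) (trans (cong q₅ (sym (m%n%n≡m%n n 5))) (sym (s₅-table (n % 5))))

  χᶻ sᶻ : ℤ → ℤ
  χᶻ m = χ₁ ∣ m ∣
  sᶻ m = s₅ ∣ m ∣

  sum-diff : ∀ (f : ℕ → ℤ) m n → f (∣ m + n ∣) + f (∣ m + - n ∣) ≡ f (∣ m ∣ ℕ.+ ∣ n ∣) + f (∣ ∣ m ∣ ⊖ ∣ n ∣ ∣)
  sum-diff f (+ a)    (+ b)        = cong (λ z → f (a ℕ.+ b) + f (∣ z ∣)) (ℤP.m-n≡m⊖n a b)
  sum-diff f (+ a)    -[1+ b ]     = ℤP.+-comm (f (∣ a ⊖ suc b ∣)) (f (a ℕ.+ suc b))
  sum-diff f -[1+ a ] (+ 0)        = cong₂ _+_ (cong f (cong suc (sym (ℕP.+-identityʳ a)))) refl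
  sum-diff f -[1+ a ] (+ suc b)    = trans (ℤP.+-comm (f (∣ suc b ⊖ suc a ∣)) (f (suc (suc (a ℕ.+ b)))))
    (cong₂ _+_ (cong f (cong suc (sym (ℕP.+-suc a b)))) (cong f (ℤP.∣m⊖n∣≡∣n⊖m∣ (suc b) (suc a))))
  sum-diff f -[1+ a ] -[1+ b ]     = cong₂ _+_ (cong f (cong suc (sym (ℕP.+-suc a b)))) (cong f (ℤP.∣m⊖n∣≡∣n⊖m∣ (suc b) (suc a)))

  -- The parallelogram laws reflect ζᵐ + ζ⁻ᵐ = (s(m) + √5 χ(m)) / 2 for a fifth root of unity ζ.
  parallelogram : ∀ (f : ℕ → ℤ) (g : ℕ → ℕ → ℤ) → Periodic 5 f → (∀ m n → g m n ≡ g n m) → (∀ m n → g m n ≡ g (m % 5) (n % 5)) →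
    {True (FinP.all? {5} (λ i → FinP.all? {5} (λ j → f (toℕ i ℕ.+ (toℕ i ℕ.+ toℕ j) % 5) + f (toℕ j) ℤ.≟ g (toℕ i) ((toℕ i ℕ.+ toℕ j) % 5))))} →
    ∀ m n → f (∣ m + n ∣) + f (∣ m + - n ∣) ≡ g (∣ m ∣) (∣ n ∣)
  parallelogram f g pf gs pg {t} m n = trans (sum-diff f m n) (go (∣ m ∣) (∣ n ∣))
    where
    table : ∀ b j → f (b ℕ.+ (b ℕ.+ j)) + f j ≡ g b (b ℕ.+ j)
    table b j = begin
      f (b ℕ.+ (b ℕ.+ j)) + f j
        ≡⟨ cong₂ _+_ (trans (periodic-+ 5 pf b (b ℕ.+ j)) (cong (λ x → f (b % 5 ℕ.+ x)) (%-distribˡ-+ b j 5))) (pf j) ⟩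
      f (b % 5 ℕ.+ (b % 5 ℕ.+ j % 5) % 5) + f (j % 5)
        ≡⟨ subst₂ (λ x y → f (x ℕ.+ (x ℕ.+ y) % 5) + f y ≡ g x ((x ℕ.+ y) % 5)) (FinP.toℕ-fromℕ< (m%n<n b 5)) (FinP.toℕ-fromℕ< (m%n<n j 5))
             (toWitness t (fromℕ< (m%n<n b 5)) (fromℕ< (m%n<n j 5))) ⟩
      g (b % 5) ((b % 5 ℕ.+ j % 5) % 5)
        ≡⟨ cong (g (b % 5)) (%-distribˡ-+ b j 5) ⟨
      g (b % 5) ((b ℕ.+ j) % 5)
        ≡⟨ pg b (b ℕ.+ j) ⟨
      g b (b ℕ.+ j) ∎
      where open ≡-Reasoning
    ordered : ∀ a b → a ≤ b → f (a ℕ.+ b) + f (∣ a ⊖ b ∣) ≡ g a b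
    ordered a b a≤b = subst (λ x → f (a ℕ.+ x) + f (∣ a ⊖ x ∣) ≡ g a x) (ℕP.m+[n∸m]≡n a≤b)
      (trans (cong (λ x → f (a ℕ.+ (a ℕ.+ j)) + f x) (trans (ℤP.∣⊖∣-≤ (ℕP.m≤m+n a j)) (ℕP.m+n∸m≡n a j))) (table a j))
      where j = b ℕ.∸ a
    go : ∀ a b → f (a ℕ.+ b) + f (∣ a ⊖ b ∣) ≡ g a b
    go a b with ℕP.≤-total a b
    ... | inj₁ a≤b = ordered a b a≤b
    ... | inj₂ b≤a = trans (cong₂ _+_ (cong f (ℕP.+-comm a b)) (cong f (ℤP.∣m⊖n∣≡∣n⊖m∣ a b))) (trans (ordered b a b≤a) (gs b a))

  χ-law : ∀ m n → + 2 * χᶻ (m + n) + + 2 * χᶻ (m + - n) ≡ sᶻ m * χᶻ n + χᶻ m * sᶻ n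
  χ-law m n = parallelogram (λ k → + 2 * χ₁ k) (λ a b → s₅ a * χ₁ b + χ₁ a * s₅ b)
    (λ k → cong (+ 2 *_) (χ₁-periodic k)) (λ a b → swap (s₅ a) (χ₁ b) (χ₁ a) (s₅ b))
    (λ a b → cong₂ _+_ (cong₂ _*_ (s₅-periodic a) (χ₁-periodic b)) (cong₂ _*_ (χ₁-periodic a) (s₅-periodic b))) m n
    where swap : ∀ a b c d → a * b + c * d ≡ d * c + b * a
          swap = solve-∀

  s-law : ∀ m n → + 2 * sᶻ (m + n) + + 2 * sᶻ (m + - n) ≡ sᶻ m * sᶻ n + + 5 * (χᶻ m * χᶻ n)
  s-law m n = parallelogram (λ k → + 2 * s₅ k) (λ a b → s₅ a * s₅ b + + 5 * (χ₁ a * χ₁ b))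
    (λ k → cong (+ 2 *_) (s₅-periodic k)) (λ a b → swap (s₅ a) (s₅ b) (χ₁ a) (χ₁ b))
    (λ a b → cong₂ (λ x y → x + + 5 * y) (cong₂ _*_ (s₅-periodic a) (s₅-periodic b)) (cong₂ _*_ (χ₁-periodic a) (χ₁-periodic b))) m n
    where swap : ∀ a b c d → a * b + + 5 * (c * d) ≡ b * a + + 5 * (d * c)
          swap = solve-∀

  private
    halve : ∀ (H : ℤ → ℤ) {F G} → Even G → (+ 4) ⊙ dsum (λ m n → H (m + n)) F G ≋ dsum (λ m n → + 2 * H (m + n) + + 2 * H (m + - n)) F G
    halve H {F} {G} e i = sym (begin
      dsum (λ m n → + 2 * H (m + n) + + 2 * H (m + - n)) F G i
        ≡⟨ dsum-+ (λ m n → + 2 * H (m + n)) (λ m n → + 2 * H (m + - n)) F G i ⟩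
      dsum (λ m n → + 2 * H (m + n)) F G i + dsum (λ m n → + 2 * H (m + - n)) F G i
        ≡⟨ cong₂ _+_ (dsum-*ˡ (+ 2) (λ m n → H (m + n)) F G i)
             (trans (dsum-*ˡ (+ 2) (λ m n → H (m + - n)) F G i) (cong (+ 2 *_) (dsum-flip (λ m n → H (m + n)) F e i))) ⟩
      + 2 * x + + 2 * x
        ≡⟨ four x ⟩
      + 4 * x ∎)
      where
      open ≡-Reasoning
      x = dsum (λ m n → H (m + n)) F G i
      four : ∀ x → + 2 * x + + 2 * x ≡ + 4 * x
      four = solve-∀

  -- Because G is even, the weights χ(m + n) and χ(m - n) give the same double sum, and by `χ-law`
  -- their sum is a sum of products of a function of m and a function of n.
  χ-product : ∀ {F G} → Loc F → Loc G → Even G →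
    (+ 4) ⊙ dsum (λ m n → χᶻ (m + n)) F G ≋ ΣZ (wt sᶻ F) ⊛ ΣZ (wt χᶻ G) ⊕ ΣZ (wt χᶻ F) ⊛ ΣZ (wt sᶻ G)
  χ-product {F} {G} lF lG e = ≋-trans (halve χᶻ {F} {G} e) (≋-trans (dsum-cong F G χ-law)
    (≋-trans (dsum-+ (λ m n → sᶻ m * χᶻ n) (λ m n → χᶻ m * sᶻ n) F G) (⊕-cong (dsum-prod sᶻ χᶻ lF lG) (dsum-prod χᶻ sᶻ lF lG))))

  s-product : ∀ {F G} → Loc F → Loc G → Even G →
    (+ 4) ⊙ dsum (λ m n → sᶻ (m + n)) F G ≋ ΣZ (wt sᶻ F) ⊛ ΣZ (wt sᶻ G) ⊕ (+ 5) ⊙ (ΣZ (wt χᶻ F) ⊛ ΣZ (wt χᶻ G))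
  s-product {F} {G} lF lG e = ≋-trans (halve sᶻ {F} {G} e) (≋-trans (dsum-cong F G s-law)
    (≋-trans (dsum-+ (λ m n → sᶻ m * sᶻ n) (λ m n → + 5 * (χᶻ m * χᶻ n)) F G)
      (⊕-cong (dsum-prod sᶻ sᶻ lF lG) (≋-trans (dsum-*ˡ (+ 5) (λ m n → χᶻ m * χᶻ n) F G) (⊙-cong (+ 5) (dsum-prod χᶻ χᶻ lF lG))))))

-- Series with periodic coefficients as rational functions of q^m.

module RationalFamilies where

  open Polynomials
  open SeriesRing
  open Substitution
  open Families
  open Forms

  open Solve 𝕊 public using (_^_; ⟦_⟧; poly; ⟦⟧-cong; x-y≈0⇒x≈y; certify)
  open ℤ-Ring 𝕊 using (setoid)

  look : List ℤ → Series
  look []      n       = + 0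
  look (x ∷ l) zero    = x
  look (x ∷ l) (suc n) = look l n

  tab : ℕ → (ℕ → ℤ) → List ℤ
  tab zero    f = []
  tab (suc d) f = f 0 ∷ tab d (f ∘ suc)

  look-tab-< : ∀ d f n → n < d → look (tab d f) n ≡ f n
  look-tab-< (suc d) f zero    _         = refl
  look-tab-< (suc d) f (suc n) (s≤s n<d) = look-tab-< d (f ∘ suc) n n<d

  look-tab-+ : ∀ d f n → look (tab d f) (d ℕ.+ n) ≡ + 0
  look-tab-+ zero    f n = refl
  look-tab-+ (suc d) f n = look-tab-+ d (f ∘ suc) n

  hor : List ℤ → Series → Series
  hor []      X = constS (+ 0)
  hor (x ∷ l) X = constS x ⊕ X ⊛ hor l X

  horE : ∀ {n} → List ℤ → Expr n → Expr n
  horE []      X = con (+ 0)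
  horE (x ∷ l) X = con x :+ X :* horE l X

  hor-horE : ∀ l X {n} (e : Expr n) ρ → ⟦ e ⟧ ρ ≡ X → hor l X ≋ ⟦ horE l e ⟧ ρ
  hor-horE []      X e ρ refl = ≋-refl
  hor-horE (x ∷ l) X e ρ refl = ⊕-congˡ (constS x) (⊛-congˡ X (hor-horE l X e ρ refl))

  look-hor : ∀ l → look l ≋ hor l (mono 1)
  look-hor []      n       = refl
  look-hor (x ∷ l) zero    = sym (trans (cong₂ _+_ (ℤP.*-identityʳ x) (ℤP.*-zeroˡ (hor l (mono 1) 0))) (ℤP.+-identityʳ x))
  look-hor (x ∷ l) (suc n) = trans (look-hor l n) (sym (trans (cong₂ _+_ (ℤP.*-zeroʳ x) (mono-⊛-+ 1 (hor l (mono 1)) n)) (ℤP.+-identityˡ _)))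

  mono-^ : ∀ d k → mono k ^ d ≋ mono (d ℕ.* k)
  mono-^ zero    k = ≋-refl
  mono-^ (suc d) k = ≋-trans (⊛-congˡ (mono k) (mono-^ d k)) (≋-sym (mono-+ k (d ℕ.* k)))

  sub-const : ∀ k .{{_ : ℕ.NonZero k}} c → sub k (constS c) ≋ constS c
  sub-const k c = ≋-trans (sub-⊙ k c oneS) (⊙-cong c (sub-oneS k))

  sub-mono₁ : ∀ k .{{_ : ℕ.NonZero k}} → sub k (mono 1) ≋ mono k
  sub-mono₁ k n = trans (sub-eq k (mono 1) n) (trans (cong (λ z → z + (mono k ⊛ sub k oneS) n) (ℤP.*-zeroˡ (oneS n)))
    (trans (ℤP.+-identityˡ _) (trans (⊛-congˡ (mono k) (sub-oneS k) n) (trans (⊛-comm (mono k) oneS n) (oneS-⊛ (mono k) n)))))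

  sub-^ : ∀ k .{{_ : ℕ.NonZero k}} X d → sub k (X ^ d) ≋ sub k X ^ d
  sub-^ k X zero    = sub-oneS k
  sub-^ k X (suc d) = ≋-trans (sub-⊛ k X (X ^ d)) (⊛-congˡ (sub k X) (sub-^ k X d))

  ^-cong : ∀ {f g} d → f ≋ g → f ^ d ≋ g ^ d
  ^-cong zero    e = ≋-refl
  ^-cong (suc d) e = ⊛-cong e (^-cong d e)

  sub-hor : ∀ k .{{_ : ℕ.NonZero k}} l X → sub k (hor l X) ≋ hor l (sub k X)
  sub-hor k []      X = sub-const k (+ 0)
  sub-hor k (x ∷ l) X = ≋-trans (sub-⊕ k (constS x) (X ⊛ hor l X)) (⊕-cong (sub-const k x)
    (≋-trans (sub-⊛ k X (hor l X)) (⊛-congˡ (sub k X) (sub-hor k l X))))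

  hor-cong : ∀ l {X Y} → X ≋ Y → hor l X ≋ hor l Y
  hor-cong []      e = ≋-refl
  hor-cong (x ∷ l) e = ⊕-congˡ (constS x) (⊛-cong e (hor-cong l e))

  den : ℤ → ℕ → Series → Series
  den ε d X = constS (+ 1) ⊕ ⊝ (constS ε ⊛ X ^ d)

  -- Shifting by d multiplies the coefficients by ε, so multiplication with 1 - ε q^d cancels
  -- everything from degree d on.
  rational : ∀ ε d (f : Series) → (∀ n → f (suc d ℕ.+ n) ≡ ε * f n) → f ⊛ den ε (suc d) (mono 1) ≋ hor (tab (suc d) f) (mono 1)
  rational ε d f h n = trans (expand n) (trans (value n) (look-hor (tab (suc d) f) n))
    where
    D = suc d
    expand : f ⊛ den ε D (mono 1) ≋ f ⊕ (- ε) ⊙ (mono D ⊛ f)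
    expand = ≋-trans (poly (# 0F :* (con (+ 1) :- # 2F :* # 1F)) (# 0F :- # 2F :* (# 1F :* # 0F)) (f ∷ mono 1 ^ D ∷ constS ε ∷ []))
      (⊕-congˡ f (≋-trans (⊝-cong (≋-trans (constS-⊛ ε (mono 1 ^ D ⊛ f)) (⊙-cong ε (⊛-congʳ f (≋-trans (mono-^ D 1) (λ i → cong (λ k → mono k i) (ℕP.*-identityʳ D)))))))
        (λ i → ℤP.neg-distribˡ-* ε ((mono D ⊛ f) i))))
    value : ∀ n → f n + - ε * (mono D ⊛ f) n ≡ look (tab D f) n
    value n with n ℕ.<? D
    ... | yes n<D = trans (cong (λ z → f n + - ε * z) (mono-⊛-< D f n n<D)) (trans (cong (λ z → f n + z) (ℤP.*-zeroʳ (- ε))) (trans (ℤP.+-identityʳ (f n)) (sym (look-tab-< D f n n<D))))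
    ... | no  n≮D = subst (λ i → f i + - ε * (mono D ⊛ f) i ≡ look (tab D f) i) (ℕP.m+[n∸m]≡n (ℕP.≮⇒≥ n≮D)) (at (n ℕ.∸ D))
      where
      cancel : ∀ e x → e * x + - e * x ≡ + 0
      cancel = solve-∀
      at : ∀ m → f (D ℕ.+ m) + - ε * (mono D ⊛ f) (D ℕ.+ m) ≡ look (tab D f) (D ℕ.+ m)
      at m = trans (cong₂ (λ x y → x + - ε * y) (h m) (mono-⊛-+ D f m)) (trans (cancel ε (f m)) (sym (look-tab-+ D f m)))

  sub-rational : ∀ ε d (f : Series) → (∀ n → f (suc d ℕ.+ n) ≡ ε * f n) → ∀ a .{{_ : ℕ.NonZero a}} →
                 sub a f ⊛ den ε (suc d) (mono a) ≋ hor (tab (suc d) f) (mono a)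
  sub-rational ε d f h a = ≋-trans (⊛-congˡ (sub a f) (≋-sym subden)) (≋-trans (≋-sym (sub-⊛ a f (den ε D (mono 1))))
    (≋-trans (sub-cong a (rational ε d f h)) (≋-trans (sub-hor a (tab D f) (mono 1)) (hor-cong (tab D f) (sub-mono₁ a)))))
    where
    D = suc d
    subden : sub a (den ε D (mono 1)) ≋ den ε D (mono a)
    subden = ≋-trans (sub-⊕ a (constS (+ 1)) (⊝ (constS ε ⊛ mono 1 ^ D))) (⊕-cong (sub-const a (+ 1))
      (≋-trans (sub-⊝ a (constS ε ⊛ mono 1 ^ D)) (⊝-cong (≋-trans (sub-⊛ a (constS ε) (mono 1 ^ D))
        (⊛-cong (sub-const a ε) (≋-trans (sub-^ a (mono 1) D) (^-cong D (sub-mono₁ a))))))))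

  baseFam : ℤ → Series → ℕ → Series
  baseFam c f zero    = constS c
  baseFam c f (suc a) = sub (suc a) f

  evF : ℤ → Series → Family
  evF c f m = baseFam c f ∣ m ∣

  odF : Series → Family
  odF f (+ a)    = baseFam (+ 0) f a
  odF f -[1+ a ] = ⊝ sub (suc a) f

  sub-ord : ∀ k .{{_ : ℕ.NonZero k}} f → f 0 ≡ + 0 → Ord k (sub k f)
  sub-ord k f e n n<k = trans (sub-< k f n n<k) (trans (cong (_* oneS n) e) (ℤP.*-zeroˡ (oneS n)))

  baseFam-ord : ∀ c f → f 0 ≡ + 0 → ∀ a → Ord a (baseFam c f a)
  baseFam-ord c f e zero    _ ()
  baseFam-ord c f e (suc a) = sub-ord (suc a) f e

  evF-loc : ∀ c f → f 0 ≡ + 0 → Loc (evF c f)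
  evF-loc c f e m = baseFam-ord c f e ∣ m ∣

  odF-loc : ∀ f → f 0 ≡ + 0 → Loc (odF f)
  odF-loc f e (+ a)        = baseFam-ord (+ 0) f e a
  odF-loc f e -[1+ a ] n h = cong -_ (sub-ord (suc a) f e n h)

  evF-even : ∀ c f → Even (evF c f)
  evF-even c f m n = cong (λ a → baseFam c f a n) (ℤP.∣-i∣≡∣i∣ m)

  odF-odd : ∀ f → Odd (odF f)
  odF-odd f (+ 0) n     = refl
  odF-odd f (+ suc a) n = refl
  odF-odd f -[1+ a ] n  = sym (ℤP.neg-involutive (sub (suc a) f n))

  sumL : List ℤ → ℤ
  sumL []      = + 0
  sumL (x ∷ l) = x + sumL l

  one^ : ∀ d → oneS ^ d ≋ oneS
  one^ zero    = ≋-refl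
  one^ (suc d) = ≋-trans (oneS-⊛ (oneS ^ d)) (one^ d)

  hor-one : ∀ l → hor l oneS ≋ constS (sumL l)
  hor-one []      = ≋-refl
  hor-one (x ∷ l) = ≋-trans (⊕-congˡ (constS x) (≋-trans (oneS-⊛ (hor l oneS)) (hor-one l)))
    (λ n → sym (ℤP.*-distribʳ-+ (oneS n) x (sumL l)))

  Base : ℤ → ℕ → List ℤ → (ℕ → Series) → ℕ → Set
  Base ε d l B a = B a ⊛ den ε d (mono a) ≋ hor l (mono a)

  -- At index 0 the variable q^a is 1 and the denominator is 2. The value c there is therefore half
  -- the sum of the numerator coefficients, which is the hypothesis on c + c.
  baseFam-rational : ∀ c d (f : Series) → (∀ n → f (suc d ℕ.+ n) ≡ - + 1 * f n) → c + c ≡ sumL (tab (suc d) f) →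
                     ∀ a → Base (- + 1) (suc d) (tab (suc d) f) (baseFam c f) a
  baseFam-rational c d f h e (suc a) = sub-rational (- + 1) d f h (suc a)
  baseFam-rational c d f h e zero    = ≋-trans (⊛-congˡ (constS c) (⊕-congˡ (constS (+ 1)) (⊝-cong (⊛-congˡ (constS (- + 1)) (one^ (suc d))))))
    (≋-trans (poly (# 0F :* (con (+ 1) :- con (- + 1) :* # 1F)) (# 0F :* (con (+ 1) :+ # 1F)) (constS c ∷ oneS ∷ []))
      (≋-trans (≋-trans (constS-⊛ c (constS (+ 1) ⊕ oneS)) double) (≋-sym (hor-one (tab (suc d) f)))))
    where
    double : c ⊙ (constS (+ 1) ⊕ oneS) ≋ constS (sumL (tab (suc d) f))
    double n = trans (twice c (oneS n)) (cong (_* oneS n) e)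
      where twice : ∀ c x → c * (+ 1 * x + x) ≡ (c + c) * x
            twice = solve-∀

  data Split (i j : ℕ) : Set where
    above : ∀ a → i ≡ j ℕ.+ a → i ⊖ j ≡ + a → Split i j
    below : ∀ a → j ≡ i ℕ.+ suc a → i ⊖ j ≡ -[1+ a ] → Split i j

  split : ∀ i j → Split i j
  split i j with j ℕ.≤? i
  ... | yes j≤i = above (i ℕ.∸ j) (sym (ℕP.m+[n∸m]≡n j≤i)) (ℤP.⊖-≥ j≤i)
  ... | no  j≰i = below (j ℕ.∸ suc i) e (trans (ℤP.⊖-< i<j) (cong (λ k → - + k) (trans (cong (ℕ._∸ i) e) (ℕP.m+n∸m≡n i _))))
    where
    i<j = ℕP.≰⇒> j≰i
    e : j ≡ i ℕ.+ suc (j ℕ.∸ suc i)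
    e = trans (sym (ℕP.m+[n∸m]≡n i<j)) (sym (ℕP.+-suc i (j ℕ.∸ suc i)))

  baseE : List ℤ → ℤ → ℕ → Expr 3
  baseE l ε d = # 0F :* (con (+ 1) :- con ε :* # 1F :^ d) :- horE l (# 1F)

  record Form (l : List ℤ) (ε : ℤ) (d : ℕ) (F : Family) (i j : ℕ) : Set where
    constructor mkForm
    field
      vanish : ⟦ formE l ε d (# 0F) (# 1F) (# 2F) ⟧ (F (i ⊖ j) ∷ mono i ∷ mono j ∷ []) ≋ zeroS

  x≋y⇒x-y≋0 : ∀ {f g} → f ≋ g → f ⊕ ⊝ g ≋ zeroS
  x≋y⇒x-y≋0 {f} {g} e n = trans (cong (_+ - g n) (e n)) (ℤP.+-inverseʳ (g n))

  regular₁ : ∀ f → constS (+ 1) ⊛ f ≋ zeroS → f ≋ zeroS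
  regular₁ f h n = trans (sym (ℤP.*-identityˡ (f n))) (trans (sym (constS-⊛ (+ 1) f n)) (h n))

  private
    triple : ∀ {x y z x′ y′ z′ : Series} → x ≋ x′ → y ≋ y′ → z ≋ z′ → (i : Fin 3) → lookup (x ∷ y ∷ z ∷ []) i ≋ lookup (x′ ∷ y′ ∷ z′ ∷ []) i
    triple p q r 0F = p
    triple p q r 1F = q
    triple p q r 2F = r

    base-zero : ∀ ε d l B a → Base ε d l B a → ∀ z → ⟦ baseE l ε d ⟧ (B a ∷ mono a ∷ z ∷ []) ≋ zeroS
    base-zero ε d l B a b z = x≋y⇒x-y≋0 (≋-trans b (hor-horE l (mono a) (# 1F) (B a ∷ mono a ∷ z ∷ []) refl))

  form-above : ∀ ε d l B i j a → Base ε d l B a → i ≡ j ℕ.+ a →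
    {T (null (normalise {3} (con (+ 1) :* formE l ε d (# 0F) (# 2F :* # 1F) (# 2F) :- (# 2F :^ d :* baseE l ε d :+ con (+ 0)))))} →
    ⟦ formE l ε d (# 0F) (# 1F) (# 2F) ⟧ (B a ∷ mono i ∷ mono j ∷ []) ≋ zeroS
  form-above ε d l B i j a b e {t} = ≋-trans {g = ⟦ formE l ε d (# 0F) (# 1F) (# 2F) ⟧ (B a ∷ mono j ⊛ mono a ∷ mono j ∷ [])}
    (⟦⟧-cong (formE l ε d (# 0F) (# 1F) (# 2F)) (triple ≋-refl (≋-trans (λ n → cong (λ k → mono k n) e) (mono-+ j a)) ≋-refl))
    (≋-trans (move l) (certify (B a ∷ mono a ∷ mono j ∷ []) (con (+ 1)) (formE l ε d (# 0F) (# 2F :* # 1F) (# 2F)) ((# 2F :^ d , baseE l ε d) ∷ []) {t}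
      regular₁ (base-zero ε d l B a b (mono j) All.∷ All.[])))
    where
    num : ∀ l d → ⟦ homE l d (# 1F) (# 2F) ⟧ (B a ∷ mono j ⊛ mono a ∷ mono j ∷ []) ≋ ⟦ homE l d (# 2F :* # 1F) (# 2F) ⟧ (B a ∷ mono a ∷ mono j ∷ [])
    num []      d       = ≋-refl
    num (c ∷ l) zero    = ≋-refl
    num (c ∷ l) (suc d) = ⊕-congˡ (constS c ⊛ mono j ^ suc d) (⊛-congˡ (mono j ⊛ mono a) (num l d))
    move : ∀ l → ⟦ formE l ε d (# 0F) (# 1F) (# 2F) ⟧ (B a ∷ mono j ⊛ mono a ∷ mono j ∷ []) ≋ ⟦ formE l ε d (# 0F) (# 2F :* # 1F) (# 2F) ⟧ (B a ∷ mono a ∷ mono j ∷ [])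
    move l = ⊕-congˡ (B a ⊛ (mono j ^ d ⊕ ⊝ (constS ε ⊛ (mono j ⊛ mono a) ^ d))) (⊝-cong (num l d))

  form-below : ∀ ε d l (σ s : ℤ) B i j a → Base ε d l B a → j ≡ i ℕ.+ a →
    {T (null (normalise {3} (con (+ 1) :* formE l ε d (con σ :* # 0F) (# 2F) (# 2F :* # 1F) :- (con s :* # 2F :^ d :* baseE l ε d :+ con (+ 0)))))} →
    ⟦ formE l ε d (# 0F) (# 1F) (# 2F) ⟧ (constS σ ⊛ B a ∷ mono i ∷ mono j ∷ []) ≋ zeroS
  form-below ε d l σ s B i j a b e {t} = ≋-trans {g = ⟦ formE l ε d (# 0F) (# 1F) (# 2F) ⟧ (constS σ ⊛ B a ∷ mono i ∷ mono i ⊛ mono a ∷ [])}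
    (⟦⟧-cong (formE l ε d (# 0F) (# 1F) (# 2F)) (triple ≋-refl ≋-refl (≋-trans (λ n → cong (λ k → mono k n) e) (mono-+ i a))))
    (≋-trans (⊕-congˡ ((constS σ ⊛ B a) ⊛ ((mono i ⊛ mono a) ^ d ⊕ ⊝ (constS ε ⊛ mono i ^ d))) (⊝-cong (num l d))) (certify (B a ∷ mono a ∷ mono i ∷ []) (con (+ 1)) (formE l ε d (con σ :* # 0F) (# 2F) (# 2F :* # 1F)) ((con s :* # 2F :^ d , baseE l ε d) ∷ []) {t}
      regular₁ (base-zero ε d l B a b (mono i) All.∷ All.[])))
    where
    num : ∀ l d → ⟦ homE l d (# 1F) (# 2F) ⟧ (constS σ ⊛ B a ∷ mono i ∷ mono i ⊛ mono a ∷ []) ≋ ⟦ homE l d (# 2F) (# 2F :* # 1F) ⟧ (B a ∷ mono a ∷ mono i ∷ [])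
    num []      d       = ≋-refl
    num (c ∷ l) zero    = ≋-refl
    num (c ∷ l) (suc d) = ⊕-congˡ (constS c ⊛ (mono i ⊛ mono a) ^ suc d) (⊛-congˡ (mono i) (num l d))

-- The Lambert families and their rational forms at all integer indices.

module LambertFamilies where

  open Polynomials
  open SeriesRing
  open Substitution
  open Families
  open Characters
  open RationalFamilies
  open Forms

  private
    retarget : ∀ {l ε d F G x y} → F ≋ G → ⟦ formE l ε d (# 0F) (# 1F) (# 2F) ⟧ (F ∷ x ∷ y ∷ []) ≋ zeroS →
               ⟦ formE l ε d (# 0F) (# 1F) (# 2F) ⟧ (G ∷ x ∷ y ∷ []) ≋ zeroS
    retarget {l} {ε} {d} {F} {G} {x} {y} e h = ≋-trans (⟦⟧-cong (formE l ε d (# 0F) (# 1F) (# 2F)) {G ∷ x ∷ y ∷ []} {F ∷ x ∷ y ∷ []} same) h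
      where
      same : ∀ i → lookup (G ∷ x ∷ y ∷ []) i ≋ lookup (F ∷ x ∷ y ∷ []) i
      same 0F = ≋-sym e
      same 1F = ≋-refl
      same 2F = ≋-refl

  -- σ is the parity of the family in m. Exchanging x and y multiplies the denominator by - ε, so
  -- the numerator must be multiplied by s = - ε σ.
  gen-form : ∀ ε d l (F : Family) (B : ℕ → Series) (σ s : ℤ) → (∀ a → F (+ a) ≋ B a) → (∀ a → F -[1+ a ] ≋ constS σ ⊛ B (suc a)) →
    ∀ i j → (∀ a → i ≡ j ℕ.+ a → Base ε d l B a) → (∀ a → Base ε d l B (suc a)) →
    {T (null (normalise {3} (con (+ 1) :* formE l ε d (# 0F) (# 2F :* # 1F) (# 2F) :- (# 2F :^ d :* baseE l ε d :+ con (+ 0)))))} →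
    {T (null (normalise {3} (con (+ 1) :* formE l ε d (con σ :* # 0F) (# 2F) (# 2F :* # 1F) :- (con s :* # 2F :^ d :* baseE l ε d :+ con (+ 0)))))} →
    Form l ε d F i j
  gen-form ε d l F B σ s F⁺ F⁻ i j b b⁺ {t} {u} with split i j
  ... | above a e e′ = mkForm (subst (λ m → ⟦ formE l ε d (# 0F) (# 1F) (# 2F) ⟧ (F m ∷ mono i ∷ mono j ∷ []) ≋ zeroS) (sym e′)
          (retarget {l} {ε} {d} (≋-sym (F⁺ a)) (form-above ε d l B i j a (b a e) e {t})))
  ... | below a e e′ = mkForm (subst (λ m → ⟦ formE l ε d (# 0F) (# 1F) (# 2F) ⟧ (F m ∷ mono i ∷ mono j ∷ []) ≋ zeroS) (sym e′)
          (retarget {l} {ε} {d} (≋-sym (F⁻ a)) (form-below ε d l σ s B i j (suc a) (b⁺ a) e {u})))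

  ev-form : ∀ c d f l → tab (suc d) f ≡ l → (∀ n → f (suc d ℕ.+ n) ≡ - + 1 * f n) → c + c ≡ sumL l →
    {T (null (normalise {3} (con (+ 1) :* formE l (- + 1) (suc d) (# 0F) (# 2F :* # 1F) (# 2F) :- (# 2F :^ (suc d) :* baseE l (- + 1) (suc d) :+ con (+ 0)))))} →
    {T (null (normalise {3} (con (+ 1) :* formE l (- + 1) (suc d) (con (+ 1) :* # 0F) (# 2F) (# 2F :* # 1F) :- (con (+ 1) :* # 2F :^ (suc d) :* baseE l (- + 1) (suc d) :+ con (+ 0)))))} →
    ∀ i j → Form l (- + 1) (suc d) (evF c f) i j
  ev-form c d f l refl h e {t} {u} i j = gen-form (- + 1) (suc d) (tab (suc d) f) (evF c f) (baseFam c f) (+ 1) (+ 1)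
    (λ a → ≋-refl) (λ a → ≋-sym (≋-trans (constS-⊛ (+ 1) (sub (suc a) f)) (λ n → ℤP.*-identityˡ _))) i j
    (λ a _ → baseFam-rational c d f h e a) (λ a → baseFam-rational c d f h e (suc a)) {t} {u}

  od-form : ∀ d f l → tab (suc d) f ≡ l → (∀ n → f (suc d ℕ.+ n) ≡ - + 1 * f n) → + 0 ≡ sumL l →
    {T (null (normalise {3} (con (+ 1) :* formE l (- + 1) (suc d) (# 0F) (# 2F :* # 1F) (# 2F) :- (# 2F :^ (suc d) :* baseE l (- + 1) (suc d) :+ con (+ 0)))))} →
    {T (null (normalise {3} (con (+ 1) :* formE l (- + 1) (suc d) (con (- + 1) :* # 0F) (# 2F) (# 2F :* # 1F) :- (con (- + 1) :* # 2F :^ (suc d) :* baseE l (- + 1) (suc d) :+ con (+ 0)))))} →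
    ∀ i j → Form l (- + 1) (suc d) (odF f) i j
  od-form d f l refl h e {t} {u} i j = gen-form (- + 1) (suc d) (tab (suc d) f) (odF f) (baseFam (+ 0) f) (- + 1) (- + 1)
    (λ a → ≋-refl) (λ a → ≋-sym (≋-trans (constS-⊛ (- + 1) (sub (suc a) f)) (λ n → ℤP.-1*i≡-i _))) i j
    (λ a _ → baseFam-rational (+ 0) d f h e a) (λ a → baseFam-rational (+ 0) d f h e (suc a)) {t} {u}

  -- The real and imaginary parts of the quartic character modulo 5 that sends 2 to the imaginary
  -- unit.
  o₁ o₂ : ℕ → ℤ
  o₁ 0 = + 0
  o₁ 1 = + 1
  o₁ 2 = + 0
  o₁ 3 = + 0
  o₁ 4 = - + 1
  o₁ (suc (suc (suc (suc (suc n))))) = o₁ n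
  o₂ 0 = + 0
  o₂ 1 = + 0
  o₂ 2 = + 1
  o₂ 3 = - + 1
  o₂ 4 = + 0
  o₂ (suc (suc (suc (suc (suc n))))) = o₂ n

  kc kĉ kĜ kP₁ kP₂ kQ₁ kQ₂ kt ky : ℕ → ℤ
  kc  k = + 2 * ψ₄ k
  kĉ  k = + 2 * (ψ₄ k * χ₁ k)
  kĜ  k = ψ₈ k * χ₁ k
  kP₁ k = ψ₄ k * o₁ k
  kP₂ k = ψ₄ k * o₂ k
  kQ₁ k = ψ₈ k * o₁ k
  kQ₂ k = ψ₈ k * o₂ k
  ky 0             = + 0
  ky 1             = + 1
  ky (suc (suc n)) = ky n

  private
    kt₂ : ℕ → ℤ
    kt₂ 0             = - + 2
    kt₂ 1             = + 0
    kt₂ (suc (suc n)) = - kt₂ n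
  kt 0             = + 0
  kt 1             = + 0
  kt (suc (suc n)) = kt₂ n

  -- The families whose value at m is the rational function
  -- 2y/(1+y²), (y+y³)/(1+y⁴), (y-y³)/(1+y⁴), (1-y²)/(1+y²), y/(1-y²) of y = qᵐ, and their twists by characters modulo 5.
  cF gF vF τ° τF yF ĉF ĜF VF P₁F P₂F Q₁F Q₂F : Family
  cF  = evF (+ 1) kc
  gF  = evF (+ 1) ψ₈
  vF  = odF χ₂
  τ°  = odF kt
  τF m = constS (sgnℤ m) ⊕ τ° m
  yF  = odF ky
  ĉF  = evF (+ 4) kĉ
  ĜF  = evF (+ 2) kĜ
  VF  = odF χ₃
  P₁F = odF kP₁
  P₂F = odF kP₂
  Q₁F = odF kQ₁
  Q₂F = odF kQ₂

  private
    neg1 : ∀ x → - x ≡ - + 1 * x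
    neg1 x = sym (ℤP.-1*i≡-i x)

    kc-anti : ∀ n → kc (2 ℕ.+ n) ≡ - + 1 * kc n
    kc-anti n = lem (ψ₄ n)
      where lem : ∀ x → + 2 * - x ≡ - + 1 * (+ 2 * x)
            lem = solve-∀
    five₄ : ∀ n → ψ₄ (10 ℕ.+ n) ≡ - ψ₄ n
    five₄ n = lem (ψ₄ n)
      where lem : ∀ x → - - - - - x ≡ - x
            lem = solve-∀
    five₈ : ∀ n → ψ₈ (20 ℕ.+ n) ≡ - ψ₈ n
    five₈ n = lem (ψ₈ n)
      where lem : ∀ x → - - - - - x ≡ - x
            lem = solve-∀
    χ₁-+10 : ∀ n → χ₁ (10 ℕ.+ n) ≡ χ₁ n
    χ₁-+10 n = trans (χ₁-+5 (5 ℕ.+ n)) (χ₁-+5 n)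
    χ₁-+20 : ∀ n → χ₁ (20 ℕ.+ n) ≡ χ₁ n
    χ₁-+20 n = trans (χ₁-+10 (10 ℕ.+ n)) (χ₁-+10 n)
    twist⁻ : ∀ {x x′ y y′} → x ≡ - x′ → y ≡ y′ → x * y ≡ - + 1 * (x′ * y′)
    twist⁻ {x′ = a} {y′ = b} refl refl = lem a b
      where lem : ∀ a b → - a * b ≡ - + 1 * (a * b)
            lem = solve-∀
    kĉ-anti : ∀ n → kĉ (10 ℕ.+ n) ≡ - + 1 * kĉ n
    kĉ-anti n = trans (cong (+ 2 *_) (twist⁻ (five₄ n) (χ₁-+10 n))) (lem (ψ₄ n * χ₁ n))
      where lem : ∀ x → + 2 * (- + 1 * x) ≡ - + 1 * (+ 2 * x)
            lem = solve-∀
    χ₂-+20 : ∀ n → χ₂ (20 ℕ.+ n) ≡ - χ₂ n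
    χ₂-+20 n = trans (χ₂-+4 (16 ℕ.+ n)) (trans (cong -_ (χ₂-+4 (12 ℕ.+ n))) (trans (cong (λ x → - - x) (χ₂-+4 (8 ℕ.+ n)))
      (trans (cong (λ x → - - - x) (χ₂-+4 (4 ℕ.+ n))) (trans (cong (λ x → - - - - x) (χ₂-+4 n)) (lem (χ₂ n))))))
      where lem : ∀ x → - - - - - x ≡ - x
            lem = solve-∀

  c-form : ∀ i j → Form lc (- + 1) 2 cF i j
  c-form = ev-form (+ 1) 1 kc lc refl kc-anti refl

  g-form : ∀ i j → Form lg (- + 1) 4 gF i j
  g-form = ev-form (+ 1) 3 ψ₈ lg refl (λ n → neg1 (ψ₈ n)) refl

  v-form : ∀ i j → Form lv (- + 1) 4 vF i j
  v-form = od-form 3 χ₂ lv refl (λ n → trans (χ₂-+4 n) (neg1 (χ₂ n))) refl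

  ĉ-form : ∀ i j → Form lĉ (- + 1) 10 ĉF i j
  ĉ-form = ev-form (+ 4) 9 kĉ lĉ refl kĉ-anti refl

  Ĝ-form : ∀ i j → Form lĜ (- + 1) 20 ĜF i j
  Ĝ-form = ev-form (+ 2) 19 kĜ lĜ refl (λ n → twist⁻ (five₈ n) (χ₁-+20 n)) refl

  V-form : ∀ i j → Form lV (- + 1) 20 VF i j
  V-form = od-form 19 χ₃ lV refl (λ n → twist⁻ (χ₂-+20 n) (χ₁-+20 n)) refl

  P₁-form : ∀ i j → Form lP₁ (- + 1) 10 P₁F i j
  P₁-form = od-form 9 kP₁ lP₁ refl (λ n → twist⁻ (five₄ n) refl) refl

  P₂-form : ∀ i j → Form lP₂ (- + 1) 10 P₂F i j
  P₂-form = od-form 9 kP₂ lP₂ refl (λ n → twist⁻ (five₄ n) refl) refl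

  Q₁-form : ∀ i j → Form lQ₁ (- + 1) 20 Q₁F i j
  Q₁-form = od-form 19 kQ₁ lQ₁ refl (λ n → twist⁻ (five₈ n) refl) refl

  Q₂-form : ∀ i j → Form lQ₂ (- + 1) 20 Q₂F i j
  Q₂-form = od-form 19 kQ₂ lQ₂ refl (λ n → twist⁻ (five₈ n) refl) refl

  -- The condition i ≢ j avoids the pole of y / (1 - y²) at y = 1; at index 0 the family is 0 by
  -- convention.
  y-form : ∀ i j → i ≢ j → Form ly (+ 1) 2 yF i j
  y-form i j i≢j = gen-form (+ 1) 2 ly yF (baseFam (+ 0) ky) (- + 1) (+ 1) (λ a → ≋-refl)
    (λ a → ≋-sym (≋-trans (constS-⊛ (- + 1) (sub (suc a) ky)) (λ n → ℤP.-1*i≡-i _))) i j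
    (λ { zero e → ⊥-elim (i≢j (trans e (ℕP.+-identityʳ j))) ; (suc a) _ → base a }) base
    where
    base : ∀ a → Base (+ 1) 2 ly (baseFam (+ 0) ky) (suc a)
    base a = sub-rational (+ 1) 1 ky (λ n → sym (ℤP.*-identityˡ (ky n))) (suc a)

  private
    B-τ : ℕ → Series
    B-τ a = constS (sgnℤ (+ a)) ⊕ baseFam (+ 0) kt a

    -- The coefficients of tanh are antiperiodic only from degree 2 on. Hence the decomposition (1 -
    -- y²) / (1 + y²) = 1 + y² · (-2 / (1 + y²)) with `kt₂` as the last fraction; at index 0 both
    -- sides are 0.
    τ-base : ∀ a → Base (- + 1) 2 lτ B-τ a
    τ-base zero    n = lem (oneS n) n
      where
      lem : ∀ x n → (B-τ 0 ⊛ den (- + 1) 2 oneS) n ≡ hor lτ oneS n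
      lem x n = trans (trans (⊛-congʳ (den (- + 1) 2 oneS) {B-τ 0} {zeroS} (λ _ → refl) n) (zeroS-⊛ (den (- + 1) 2 oneS) n)) (sym (hor-one lτ n))
    τ-base (suc a) = ≋-trans (⊛-congʳ D (⊕-congˡ (constS (+ 1)) split₂))
      (x-y≈0⇒x≈y (certify (sub k kt₂ ∷ mono k ∷ []) (con (+ 1))
        ((con (+ 1) :+ # 1F :^ 2 :* # 0F) :* (con (+ 1) :- con (- + 1) :* # 1F :^ 2) :- horE lτ (# 1F))
        ((# 1F :^ 2 , # 0F :* (con (+ 1) :- con (- + 1) :* # 1F :^ 2) :- horE (tab 2 kt₂) (# 1F)) ∷ [])
        (λ f h n → trans (sym (ℤP.*-identityˡ (f n))) (trans (sym (constS-⊛ (+ 1) f n)) (h n)))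
        ((λ n → trans (cong (_+ - hor (tab 2 kt₂) (mono k) n) (sub-rational (- + 1) 1 kt₂ (λ n → neg1 (kt₂ n)) k n)) (ℤP.+-inverseʳ (hor (tab 2 kt₂) (mono k) n))) All.∷ All.[])))
      where
      k = suc a
      D = den (- + 1) 2 (mono k)
      shifted : kt ≋ mono 1 ^ 2 ⊛ kt₂
      shifted n = sym (trans (⊛-congʳ kt₂ (mono-^ 2 1) n) (at n))
        where
        at : ∀ n → (mono 2 ⊛ kt₂) n ≡ kt n
        at 0             = refl
        at 1             = refl
        at (suc (suc n)) = mono-⊛-+ 2 kt₂ n
      split₂ : sub k kt ≋ mono k ^ 2 ⊛ sub k kt₂
      split₂ = ≋-trans (sub-cong k shifted) (≋-trans (sub-⊛ k (mono 1 ^ 2) kt₂) (⊛-congʳ (sub k kt₂) (≋-trans (sub-^ k (mono 1) 2) (^-cong 2 (sub-mono₁ k)))))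

  τ-form : ∀ i j → Form lτ (- + 1) 2 τF i j
  τ-form i j = gen-form (- + 1) 2 lτ τF B-τ (- + 1) (- + 1) (λ a → ≋-refl) neg i j (λ a _ → τ-base a) (λ a → τ-base (suc a))
    where
    neg : ∀ a → τF -[1+ a ] ≋ constS (- + 1) ⊛ B-τ (suc a)
    neg a n = trans (lem (oneS n) (sub (suc a) kt n)) (sym (constS-⊛ (- + 1) (B-τ (suc a)) n))
      where lem : ∀ x y → - + 1 * x + - y ≡ - + 1 * (+ 1 * x + y)
            lem = solve-∀

-- The pair identities at arbitrary integer indices.

module LambertPairs where

  open Polynomials
  open SeriesRing
  open Substitution
  open RationalFamilies
  open LambertFamilies
  open PairIdentities
  open Forms

  regular-≋ : ∀ {f g} → f ≋ g → Regular f → Regular g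
  regular-≋ {f} {g} e r h z = r h (≋-trans (⊛-congʳ h e) z)

  regular-mono+ : ∀ a b → Regular (mono a ⊕ mono b)
  regular-mono+ zero    zero    = regular₀ {mono 0 ⊕ mono 0} (λ ())
  regular-mono+ zero    (suc b) = regular₀ {mono 0 ⊕ mono (suc b)} (λ ())
  regular-mono+ (suc a) zero    = regular₀ {mono (suc a) ⊕ mono 0} (λ ())
  regular-mono+ (suc a) (suc b) = regular-tl {mono (suc a) ⊕ mono (suc b)} refl (regular-mono+ a b)

  regular-mono- : ∀ a b → a ≢ b → Regular (mono a ⊕ ⊝ mono b)
  regular-mono- zero    zero    n = ⊥-elim (n refl)
  regular-mono- zero    (suc b) n = regular₀ {mono 0 ⊕ ⊝ mono (suc b)} (λ ())
  regular-mono- (suc a) zero    n = regular₀ {mono (suc a) ⊕ ⊝ mono 0} (λ ())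
  regular-mono- (suc a) (suc b) n = regular-tl {mono (suc a) ⊕ ⊝ mono (suc b)} refl (regular-mono- a b (λ e → n (cong suc e)))

  regular-plus : ∀ d p q {x y} → x ≋ mono p → y ≋ mono q → Regular (y ^ d ⊕ ⊝ (constS (- + 1) ⊛ x ^ d))
  regular-plus d p q {x} {y} ex ey = regular-≋ (⊕-cong (≋-sym (≋-trans (^-cong d ey) (mono-^ d q)))
    (≋-sym (≋-trans (⊝-cong (constS-⊛ (- + 1) (x ^ d))) (λ n → trans (lem (((x ^ d)) n)) (≋-trans (^-cong d ex) (mono-^ d p) n)))))
    (regular-mono+ (d ℕ.* q) (d ℕ.* p))
    where lem : ∀ x → - (- + 1 * x) ≡ x
          lem = solve-∀

  regular-minus : ∀ p q {x y} → p ≢ q → x ≋ mono p → y ≋ mono q → Regular (y ^ 2 ⊕ ⊝ (constS (+ 1) ⊛ x ^ 2))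
  regular-minus p q {x} {y} p≢q ex ey = regular-≋ (⊕-cong (≋-sym (≋-trans (^-cong 2 ey) (mono-^ 2 q)))
    (⊝-cong (≋-sym (≋-trans (≋-trans (constS-⊛ (+ 1) (x ^ 2)) (λ n → ℤP.*-identityˡ _)) (≋-trans (^-cong 2 ex) (mono-^ 2 p))))))
    (regular-mono- (2 ℕ.* q) (2 ℕ.* p) (λ e → p≢q (sym (ℕP.*-cancelˡ-≡ q p 2 e))))

  pos neg : ℤ → ℕ
  pos (+ a)    = a
  pos -[1+ a ] = 0
  neg (+ a)    = 0
  neg -[1+ a ] = suc a

  pos⊖neg : ∀ m → m ≡ pos m ⊖ neg m
  pos⊖neg (+ a)    = refl
  pos⊖neg -[1+ a ] = refl

  ⊖-+ : ∀ i j k l → (i ⊖ j) + (k ⊖ l) ≡ (i ℕ.+ k) ⊖ (j ℕ.+ l)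
  ⊖-+ i j k l = trans (cong₂ _+_ (sym (ℤP.m-n≡m⊖n i j)) (sym (ℤP.m-n≡m⊖n k l))) (trans (shuffle (+ i) (+ j) (+ k) (+ l)) (ℤP.m-n≡m⊖n (i ℕ.+ k) (j ℕ.+ l)))
    where shuffle : ∀ a b c d → (a + - b) + (c + - d) ≡ (a + c) + - (b + d)
          shuffle = solve-∀

  ⊖-* : ∀ c k l → + c * (k ⊖ l) ≡ (c ℕ.* k) ⊖ (c ℕ.* l)
  ⊖-* c k l = trans (cong (+ c *_) (sym (ℤP.m-n≡m⊖n k l))) (trans (expand (+ c) (+ k) (+ l))
    (trans (cong₂ (λ a b → a + - b) (sym (ℤP.pos-* c k)) (sym (ℤP.pos-* c l))) (ℤP.m-n≡m⊖n (c ℕ.* k) (c ℕ.* l))))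
    where expand : ∀ a b c → a * (b + - c) ≡ a * b + - (a * c)
          expand = solve-∀

  -- Each index is a difference of two natural numbers, one of them 0, so that q^m is a ratio of
  -- monomials also for negative m and no Laurent series occur.
  module At (m n : ℤ) where
    i = pos m
    j = neg m
    k = pos n
    l = neg n
    x = mono i
    y = mono j
    z = mono k
    w = mono l
    open Fractions 𝕊 x y z w using (Frac; mkFrac; Deriv; mkDeriv; I₁; I₂; I₄; I₅; I₆; I₇; I₂₀; I₅₀; I₇₀)

    toFrac : ∀ {ls ε d F p q r U V} → r ≡ p ⊖ q → U ≋ mono p → V ≋ mono q → Form ls ε d F p q → Frac (F r) U V ls ε d
    toFrac {ls} {ε} {d} {F} {p} {q} {r} {U} {V} refl ex ey f = mkFrac (≋-trans
      (⟦⟧-cong (formE ls ε d (# 0F) (# 1F) (# 2F)) {F r ∷ U ∷ V ∷ []} {F r ∷ mono p ∷ mono q ∷ []} same) (Form.vanish f))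
      where
      same : ∀ t → lookup (F r ∷ U ∷ V ∷ []) t ≋ lookup (F r ∷ mono p ∷ mono q ∷ []) t
      same 0F = ≋-refl
      same 1F = ex
      same 2F = ey

    eM : m + n ≡ (i ℕ.+ k) ⊖ (j ℕ.+ l)
    eM = trans (cong₂ _+_ (pos⊖neg m) (pos⊖neg n)) (⊖-+ i j k l)

    at-m : ∀ {ls ε d F} → (∀ p q → Form ls ε d F p q) → Frac (F m) x y ls ε d
    at-m f = toFrac (pos⊖neg m) ≋-refl ≋-refl (f i j)

    at-n : ∀ {ls ε d F} → (∀ p q → Form ls ε d F p q) → Frac (F n) z w ls ε d
    at-n f = toFrac (pos⊖neg n) ≋-refl ≋-refl (f k l)

    at-M : ∀ {ls ε d F} → Form ls ε d F (i ℕ.+ k) (j ℕ.+ l) → Frac (F (m + n)) (x ⊛ z) (y ⊛ w) ls ε d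
    at-M f = toFrac eM (≋-sym (mono-+ i k)) (≋-sym (mono-+ j l)) f

    at-cm : ∀ c {ls ε d F} → (∀ p q → Form ls ε d F p q) → Frac (F (+ c * m)) (Solve._^_ 𝕊 x c) (Solve._^_ 𝕊 y c) ls ε d
    at-cm c f = toFrac (trans (cong (+ c *_) (pos⊖neg m)) (⊖-* c i j)) (mono-^ c i) (mono-^ c j) (f (c ℕ.* i) (c ℕ.* j))

    at-cn : ∀ c {ls ε d F} → (∀ p q → Form ls ε d F p q) → Frac (F (+ c * n)) (Solve._^_ 𝕊 z c) (Solve._^_ 𝕊 w c) ls ε d
    at-cn c f = toFrac (trans (cong (+ c *_) (pos⊖neg n)) (⊖-* c k l)) (mono-^ c k) (mono-^ c l) (f (c ℕ.* k) (c ℕ.* l))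

    at-2M : ∀ {ls ε d F} → Form ls ε d F (2 ℕ.* (i ℕ.+ k)) (2 ℕ.* (j ℕ.+ l)) → Frac (F (+ 2 * (m + n))) (Solve._^_ 𝕊 (x ⊛ z) 2) (Solve._^_ 𝕊 (y ⊛ w) 2) ls ε d
    at-2M f = toFrac (trans (cong (+ 2 *_) eM) (⊖-* 2 (i ℕ.+ k) (j ℕ.+ l)))
      (≋-trans (^-cong 2 (≋-sym (mono-+ i k))) (mono-^ 2 (i ℕ.+ k))) (≋-trans (^-cong 2 (≋-sym (mono-+ j l))) (mono-^ 2 (j ℕ.+ l))) f

    rm : ∀ d → Solve.Regular 𝕊 (Solve.⟦_⟧ 𝕊 (Fractions.plus 𝕊 x y z w d (Fractions.X 𝕊 x y z w) (Fractions.Y 𝕊 x y z w)) (Fractions.ρ 𝕊 x y z w))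
    rm d = regular-plus d i j ≋-refl ≋-refl
    rn : ∀ d → Solve.Regular 𝕊 (Solve.⟦_⟧ 𝕊 (Fractions.plus 𝕊 x y z w d (Fractions.Z 𝕊 x y z w) (Fractions.W 𝕊 x y z w)) (Fractions.ρ 𝕊 x y z w))
    rn d = regular-plus d k l ≋-refl ≋-refl
    rM : ∀ d → Solve.Regular 𝕊 (Solve.⟦_⟧ 𝕊 (Fractions.plus 𝕊 x y z w d (Fractions.XZ 𝕊 x y z w) (Fractions.YW 𝕊 x y z w)) (Fractions.ρ 𝕊 x y z w))
    rM d = regular-plus d (i ℕ.+ k) (j ℕ.+ l) (≋-sym (mono-+ i k)) (≋-sym (mono-+ j l))

    module _ (M≢0 : m + n ≢ + 0) where
      ne : i ℕ.+ k ≢ j ℕ.+ l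
      ne e = M≢0 (trans eM (trans (cong (_⊖ (j ℕ.+ l)) e) (ℤP.n⊖n≡0 (j ℕ.+ l))))
      rM- : Regular ((y ⊛ w) ^ 2 ⊕ ⊝ (constS (+ 1) ⊛ (x ⊛ z) ^ 2))
      rM- = regular-minus (i ℕ.+ k) (j ℕ.+ l) ne (≋-sym (mono-+ i k)) (≋-sym (mono-+ j l))
      at-y : Frac (yF (m + n)) (x ⊛ z) (y ⊛ w) ly (+ 1) 2
      at-y = at-M (y-form (i ℕ.+ k) (j ℕ.+ l) ne)
      at-2y : Frac (yF (+ 2 * (m + n))) (Solve._^_ 𝕊 (x ⊛ z) 2) (Solve._^_ 𝕊 (y ⊛ w) 2) ly (+ 1) 2
      at-2y = at-2M (y-form (2 ℕ.* (i ℕ.+ k)) (2 ℕ.* (j ℕ.+ l)) (λ e → ne (ℕP.*-cancelˡ-≡ (i ℕ.+ k) (j ℕ.+ l) 2 e)))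

      cc : cF m ⊛ cF n ≋ constS (+ 2) ⊛ (yF (m + n) ⊛ (τF m ⊕ τF n))
      cc = I₁ (at-m c-form) (at-n c-form) at-y (at-m τ-form) (at-n τ-form) (rm 2) (rn 2) rM-

      gg : constS (+ 4) ⊛ (gF m ⊛ gF n) ≋ constS (+ 2) ⊛ (yF (m + n) ⊛ (τF (+ 2 * m) ⊕ τF (+ 2 * n))) ⊕ cF (m + n) ⊛ (cF (+ 2 * m) ⊕ cF (+ 2 * n))
      gg = I₂ (at-m g-form) (at-n g-form) at-y (at-cm 2 τ-form) (at-cn 2 τ-form) (at-M (c-form _ _)) (at-cm 2 c-form) (at-cn 2 c-form) (rm 4) (rn 4) rM- (rM 2)

      gc : constS (+ 2) ⊛ (gF m ⊛ cF (+ 2 * n)) ≋ constS (+ 4) ⊛ (yF (+ 2 * (m + n)) ⊛ vF m) ⊕ constS (+ 2) ⊛ (yF (m + n) ⊛ vF n) ⊕ cF (m + n) ⊛ gF n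
      gc = I₅ (at-m g-form) (at-cn 2 c-form) at-2y (at-m v-form) at-y (at-n v-form) (at-M (c-form _ _)) (at-n g-form) (rm 4) (rn 4) rM- (rM 2)

      Ĝc : ĜF m ⊛ (constS (+ 5) ⊛ cF (+ 10 * n) ⊕ ⊝ cF (+ 2 * n)) ⊕ (constS (+ 5) ⊛ gF (+ 5 * m) ⊕ gF m) ⊛ ĉF (+ 2 * n)
             ⊕ constS (+ 4) ⊛ (Q₁F m ⊛ (constS (+ 2) ⊛ P₁F (+ 2 * n) ⊕ ⊝ P₂F (+ 2 * n)) ⊕ ⊝ (Q₂F m ⊛ (P₁F (+ 2 * n) ⊕ constS (+ 2) ⊛ P₂F (+ 2 * n))))
           ≋ constS (+ 8) ⊛ (yF (+ 2 * (m + n)) ⊛ VF m) ⊕ constS (+ 4) ⊛ (yF (m + n) ⊛ VF n) ⊕ constS (+ 2) ⊛ (cF (m + n) ⊛ ĜF n)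
      Ĝc = I₇ (at-cn 10 c-form) (at-cn 2 c-form) (at-m Ĝ-form) (at-cn 2 ĉ-form) (at-cm 5 g-form) (at-m g-form) (at-m Q₁-form) (at-m Q₂-form)
        (at-cn 2 P₁-form) (at-cn 2 P₂-form) at-2y (at-m V-form) at-y (at-n V-form) (at-M (c-form _ _)) (at-n Ĝ-form) (rm 20) (rn 20) rM- (rM 2)

    cg : cF m ⊛ gF n ≋ vF (m + n) ⊛ (τF m ⊕ τF (+ 2 * n)) ⊕ gF (m + n) ⊛ cF (+ 2 * n)
    cg = I₄ (at-m c-form) (at-n g-form) (at-M (v-form _ _)) (at-m τ-form) (at-cn 2 τ-form) (at-M (g-form _ _)) (at-cn 2 c-form) (rm 2) (rn 4) (rM 4)

    cĜ : (cF m ⊕ ⊝ cF (+ 5 * m)) ⊛ ĜF n ⊕ ĉF m ⊛ (gF n ⊕ gF (+ 5 * n)) ⊕ constS (+ 4) ⊛ (P₁F m ⊛ Q₁F n ⊕ ⊝ (P₂F m ⊛ Q₂F n))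
         ≋ constS (+ 4) ⊛ (VF (m + n) ⊛ (τF (+ 5 * m) ⊕ τF (+ 10 * n)) ⊕ ĜF (m + n) ⊛ cF (+ 10 * n))
    cĜ = I₆ (at-m c-form) (at-cm 5 c-form) (at-n Ĝ-form) (at-m ĉ-form) (at-n g-form) (at-cn 5 g-form) (at-m P₁-form) (at-m P₂-form) (at-n Q₁-form) (at-n Q₂-form)
      (at-M (V-form _ _)) (at-cm 5 τ-form) (at-cn 10 τ-form) (at-M (Ĝ-form _ _)) (at-cn 10 c-form) (rm 10) (rn 20) (rM 20)

    gg₀ : constS (+ 4) ⊛ (gF m ⊛ gF m) ≋ constS (+ 2) ⊛ cF (+ 2 * m) ⊕ constS (+ 2) ⊛ (cF (+ 2 * m) ⊛ cF (+ 2 * m))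
    gg₀ = I₂₀ (at-m g-form) (at-cm 2 c-form) (rm 4)

    gc₀ : ∀ {W} → Deriv W (vF m) lw₈ 4 → constS (+ 2) ⊛ (gF m ⊛ cF (+ 2 * m)) ≋ gF m ⊕ ⊝ W
    gc₀ δ = I₅₀ (at-m g-form) (at-cm 2 c-form) (at-m v-form) δ (rm 4)

    Ĝc₀ : ∀ {W} → Deriv W (VF m) lw₄₀ 20 →
          ĜF m ⊛ (constS (+ 5) ⊛ cF (+ 10 * m) ⊕ ⊝ cF (+ 2 * m)) ⊕ (constS (+ 5) ⊛ gF (+ 5 * m) ⊕ gF m) ⊛ ĉF (+ 2 * m)
            ⊕ ⊝ (constS (+ 4) ⊛ (Q₁F m ⊛ (constS (+ 2) ⊛ P₁F (+ 2 * m) ⊕ ⊝ P₂F (+ 2 * m)) ⊕ ⊝ (Q₂F m ⊛ (P₁F (+ 2 * m) ⊕ constS (+ 2) ⊛ P₂F (+ 2 * m)))))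
          ≋ constS (+ 2) ⊛ ĜF m ⊕ ⊝ (constS (+ 2) ⊛ W)
    Ĝc₀ δ = I₇₀ (at-cm 10 c-form) (at-cm 2 c-form) (at-m Ĝ-form) (at-cm 2 ĉ-form) (at-cm 5 g-form) (at-m g-form) (at-m Q₁-form) (at-m Q₂-form)
      (at-cm 2 P₁-form) (at-cm 2 P₂-form) (at-m V-form) δ (rm 20)

-- Double sums rearranged along the lines m + n = M.

module Lines where

  open Polynomials
  open SeriesRing
  open IntegerSums
  open Families
  open RationalFamilies
  open LambertFamilies
  open LambertPairs
  open Forms

  Loc₂ : (ℤ → ℤ → Series) → Set
  Loc₂ X = ∀ m n → Ord (∣ m ∣ ℕ.+ ∣ n ∣) (X m n)

  loc-⊛ : ∀ {F G} → Loc F → Loc G → Loc₂ (λ m n → F m ⊛ G n)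
  loc-⊛ {F} {G} lF lG m n = ord-⊛ ∣ m ∣ ∣ n ∣ {F m} {G n} (lF m) (lG n)

  𝔻 : (ℤ → ℤ → ℤ) → (ℤ → ℤ → Series) → Series
  𝔻 H X i = sumℤ i (λ m → sumℤ i (λ n → H m n * X m n i))

  line : (ℤ → ℤ → ℤ) → (ℤ → ℤ → Series) → ℕ → ℤ → ℤ
  line H X i M = sumℤ i (λ m → H m (M + - m) * X m (M + - m) i)

  -- In the coordinates m and M = m + n the order of a term is still at least |m| and at least |M|,
  -- so one window serves before and after the change.
  𝔻-shear : ∀ H X → Loc₂ X → ∀ i → 𝔻 H X i ≡ sumℤ i (line H X i)
  𝔻-shear H X lX i = trans (sumℤ-cong i (λ m → sym (move m))) (sumℤ-swap i i _)
    where
    h : ℤ → ℤ → ℤ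
    h m n = H m n * X m n i
    cancel₁ : ∀ m k → (k + - m) + m ≡ k
    cancel₁ = solve-∀
    cancel₂ : ∀ m k → (k + m) + - m ≡ k
    cancel₂ = solve-∀
    bound : ∀ m n → h m n ≢ + 0 → ∣ m ∣ ℕ.+ ∣ n ∣ ≤ i
    bound m n z = ≢0⇒≤ {f = X m n} (lX m n) (λ e → z (trans (cong (H m n *_) e) (ℤP.*-zeroʳ (H m n))))
    move : ∀ m → sumℤ i (λ M → h m (M + - m)) ≡ sumℤ i (h m)
    move m = sumℤ-reindex i i (λ M → M + - m) (λ n → n + m) (h m) (cancel₁ m) (λ n z →
      ℕP.≤-trans (ℕP.m≤n+m ∣ n ∣ ∣ m ∣) (bound m n z) ,
      ℕP.≤-trans (ℤP.∣i+j∣≤∣i∣+∣j∣ n m) (subst (_≤ i) (ℕP.+-comm ∣ m ∣ ∣ n ∣) (bound m n z)) ,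
      cancel₂ m n)

  m+[M-m] : ∀ m M → m + (M + - m) ≡ M
  m+[M-m] = solve-∀

  ΣZ-⊛ : ∀ {F} → Loc F → ∀ W i → (ΣZ F ⊛ W) i ≡ sumℤ i (λ m → (F m ⊛ W) i)
  ΣZ-⊛ {F} l W i = begin
    (ΣZ F ⊛ W) i              ≡⟨ ⊛-cong≤ {ΣZ F} {win i F} {W} {W} i (λ j j≤i → sym (win-loc l i j j≤i)) (λ _ _ → refl) ⟩
    (win i F ⊛ W) i           ≡⟨ ⊛-comm (win i F) W i ⟩
    (W ⊛ win i F) i           ≡⟨ win-⊛ i W F i ⟩
    sumℤ i (λ m → (W ⊛ F m) i) ≡⟨ sumℤ-cong i (λ m → ⊛-comm W (F m) i) ⟩
    sumℤ i (λ m → (F m ⊛ W) i) ∎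
    where open ≡-Reasoning

  wt-⊛ : ∀ (h : ℤ → ℤ) {F} → Loc F → ∀ W i → sumℤ i (λ M → h M * (F M ⊛ W) i) ≡ (ΣZ (wt h F) ⊛ W) i
  wt-⊛ h {F} l W i = sym (trans (ΣZ-⊛ (wt-loc h l) W i) (sumℤ-cong i (λ M → ⊙-⊛ (h M) (F M) W i)))

  sumℤ-split0 : ∀ i (f a : ℤ → ℤ) b → (∀ M → M ≢ + 0 → ∣ M ∣ ≤ i → f M ≡ a M) → a (+ 0) ≡ + 0 → f (+ 0) ≡ b → sumℤ i f ≡ sumℤ i a + b
  sumℤ-split0 i f a b h a0 f0 = trans (sumℤ-cong≤ i at) (trans (sumℤ-+ i a (λ M → when ⌊ M ℤ.≟ + 0 ⌋ b)) (cong (λ z → sumℤ i a + z) (sumℤ-δ i (+ 0) b z≤n)))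
    where
    at : ∀ M → ∣ M ∣ ≤ i → f M ≡ a M + when ⌊ M ℤ.≟ + 0 ⌋ b
    at M M≤i with M ℤ.≟ + 0
    ... | yes refl = trans f0 (sym (trans (cong (_+ b) a0) (ℤP.+-identityˡ b)))
    ... | no  z      = trans (h M z M≤i) (sym (ℤP.+-identityʳ (a M)))

  sc : ℕ → Family → Family
  sc c F m = F (+ c * m)

  sc-loc : ∀ c .{{_ : ℕ.NonZero c}} {F} → Loc F → Loc (sc c F)
  sc-loc c {F} l m i i<m = l (+ c * m) i (ℕP.<-≤-trans i<m (subst (∣ m ∣ ≤_) (sym (ℤP.abs-* (+ c) m)) (ℕP.m≤n*m ∣ m ∣ c)))

  sc-even : ∀ c {F} → Even F → Even (sc c F)
  sc-even c {F} e m n = trans (cong (λ k → F k n) (sym (ℤP.neg-distribʳ-* (+ c) m))) (e (+ c * m) n)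

  sc-odd : ∀ c {F} → Odd F → Odd (sc c F)
  sc-odd c {F} e m n = trans (cong (λ k → F k n) (sym (ℤP.neg-distribʳ-* (+ c) m))) (e (+ c * m) n)

  wt-odd : ∀ α {F} → (∀ m → α (- m) ≡ α m) → Odd F → Odd (wt α F)
  wt-odd α {F} e o m n = trans (cong₂ _*_ (e m) (o m n)) (sym (ℤP.neg-distribʳ-* (α m) (F m n)))

  win-odd : ∀ {F} → Odd F → ∀ i j → win i F j ≡ + 0
  win-odd {F} o i j = sumℤ-odd i (λ m → F m j) (λ m → o m j)

  ΣZ-odd : ∀ {F} → Odd F → ΣZ F ≋ zeroS
  ΣZ-odd o i = win-odd o i i

  τ°-loc : Loc τ°
  τ°-loc = odF-loc kt refl

  τ°-odd : Odd τ°
  τ°-odd = odF-odd kt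

  τF-odd : Odd τF
  τF-odd m n = trans (cong₂ _+_ (cong (_* oneS n) (sgnℤ-neg m)) (τ°-odd m n)) (lem (sgnℤ m) (oneS n) (τ° m n))
    where lem : ∀ a b c → - a * b + - c ≡ - (a * b + c)
          lem = solve-∀

  sgnℤ-* : ∀ c .{{_ : ℕ.NonZero c}} k → sgnℤ (+ c * k) ≡ sgnℤ k
  sgnℤ-* (suc c) (+ 0)     = cong sgnℤ (ℤP.*-zeroʳ (+ suc c))
  sgnℤ-* (suc c) (+ suc k) = refl
  sgnℤ-* (suc c) -[1+ k ]  = refl

  -- `τF` is not in `Loc`, since its constant term is the sign of the index. The sign part
  -- contributes 2 M by `sum-sgn`; the remainder `τ°` is in `Loc` and odd, so its reflected sum is
  -- 0.
  τ-reflect : ∀ c .{{_ : ℕ.NonZero c}} i M j → ∣ M ∣ ℕ.+ j ≤ i → win i (λ m → sc c τF (M + - m)) j ≡ (+ 2 * M) * oneS j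
  τ-reflect c i M j b = begin
    sumℤ i (λ m → sgnℤ (+ c * (M + - m)) * oneS j + sc c τ° (M + - m) j)
      ≡⟨ trans (sumℤ-cong i (λ m → cong (λ z → z * oneS j + sc c τ° (M + - m) j) (sgnℤ-* c (M + - m)))) (sumℤ-+ i (λ m → sgnℤ (M + - m) * oneS j) (λ m → sc c τ° (M + - m) j)) ⟩
    sumℤ i (λ m → sgnℤ (M + - m) * oneS j) + win i (λ m → sc c τ° (M + - m)) j
      ≡⟨ cong₂ _+_ (trans (sumℤ-*ʳ i (oneS j) (λ m → sgnℤ (M + - m))) (cong (_* oneS j) (sum-sgn i M (ℕP.≤-trans (ℕP.m≤m+n ∣ M ∣ j) b))))
           (trans (win-reflect (sc-loc c {τ°} τ°-loc) i M j b) (ΣZ-odd (sc-odd c {τ°} τ°-odd) j)) ⟩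
    (+ 2 * M) * oneS j + + 0
      ≡⟨ ℤP.+-identityʳ _ ⟩
    (+ 2 * M) * oneS j ∎
    where open ≡-Reasoning

  private
    win-⊕ : ∀ i F G j → win i (λ m → F m ⊕ G m) j ≡ win i F j + win i G j
    win-⊕ i F G j = sumℤ-+ i (λ m → F m j) (λ m → G m j)

    pull : ∀ i c (f : ℤ → ℤ) → sumℤ i (λ m → c * f m) ≡ c * sumℤ i f
    pull = sumℤ-*ˡ

  τ-line : ∀ c c′ .{{_ : ℕ.NonZero c}} .{{_ : ℕ.NonZero c′}} (V : Series) i M → Ord ∣ M ∣ V → ∣ M ∣ ≤ i →
           sumℤ i (λ m → (V ⊛ (sc c τF m ⊕ sc c′ τF (M + - m))) i) ≡ (+ 2 * M) * V i
  τ-line c c′ V i M o b = trans (⊛-win V i M (λ m → sc c τF m ⊕ sc c′ τF (M + - m)) (constS (+ 2 * M)) o b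
      (λ j b′ → trans (win-⊕ i (sc c τF) (λ m → sc c′ τF (M + - m)) j)
        (trans (cong₂ _+_ (win-odd (sc-odd c {τF} τF-odd) i j) (τ-reflect c′ i M j b′)) (ℤP.+-identityˡ _))))
    (trans (⊛-comm V (constS (+ 2 * M)) i) (constS-⊛ (+ 2 * M) V i))

  moment : (ℤ → ℤ) → Family → Series
  moment h V = ΣZ (wt (λ M → h M * (+ 2 * M)) V)

  -- Lines of the shape V(M) (τ(c m) + τ(c′ n)) + G(M) κ(n).
  type-A : ∀ c c′ .{{_ : ℕ.NonZero c}} .{{_ : ℕ.NonZero c′}} h X V G κ → Loc₂ X → Loc V → Loc G → Loc κ →
           (∀ m n → X m n ≋ V (m + n) ⊛ (sc c τF m ⊕ sc c′ τF n) ⊕ G (m + n) ⊛ κ n) →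
           𝔻 (λ m n → h (m + n)) X ≋ moment h V ⊕ ΣZ (wt h G) ⊛ ΣZ κ
  type-A c c′ h X V G κ lX lV lG lκ e i = begin
    𝔻 (λ m n → h (m + n)) X i
      ≡⟨ 𝔻-shear (λ m n → h (m + n)) X lX i ⟩
    sumℤ i (line (λ m n → h (m + n)) X i)
      ≡⟨ sumℤ-cong≤ i at ⟩
    sumℤ i (λ M → (h M * (+ 2 * M)) * V M i + h M * (G M ⊛ ΣZ κ) i)
      ≡⟨ sumℤ-+ i (λ M → (h M * (+ 2 * M)) * V M i) (λ M → h M * (G M ⊛ ΣZ κ) i) ⟩
    moment h V i + sumℤ i (λ M → h M * (G M ⊛ ΣZ κ) i)
      ≡⟨ cong (λ z → moment h V i + z) (wt-⊛ h lG (ΣZ κ) i) ⟩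
    moment h V i + (ΣZ (wt h G) ⊛ ΣZ κ) i ∎
    where
    open ≡-Reasoning
    at : ∀ M → ∣ M ∣ ≤ i → line (λ m n → h (m + n)) X i M ≡ (h M * (+ 2 * M)) * V M i + h M * (G M ⊛ ΣZ κ) i
    at M b = begin
      sumℤ i (λ m → h (m + (M + - m)) * X m (M + - m) i)
        ≡⟨ sumℤ-cong i (λ m → cong₂ _*_ (cong h (m+[M-m] m M)) (trans (e m (M + - m) i) (cong (λ k → (V k ⊛ (sc c τF m ⊕ sc c′ τF (M + - m)) ⊕ G k ⊛ κ (M + - m)) i) (m+[M-m] m M)))) ⟩
      sumℤ i (λ m → h M * ((V M ⊛ (sc c τF m ⊕ sc c′ τF (M + - m))) i + (G M ⊛ κ (M + - m)) i))
        ≡⟨ trans (pull i (h M) _) (cong (h M *_) (sumℤ-+ i (λ m → (V M ⊛ (sc c τF m ⊕ sc c′ τF (M + - m))) i) (λ m → (G M ⊛ κ (M + - m)) i))) ⟩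
      h M * (sumℤ i (λ m → (V M ⊛ (sc c τF m ⊕ sc c′ τF (M + - m))) i) + sumℤ i (λ m → (G M ⊛ κ (M + - m)) i))
        ≡⟨ cong (h M *_) (cong₂ _+_ (τ-line c c′ (V M) i M (lV M) b) (⊛-win (G M) i M (λ m → κ (M + - m)) (ΣZ κ) (lG M) b (λ j → win-reflect lκ i M j))) ⟩
      h M * ((+ 2 * M) * V M i + (G M ⊛ ΣZ κ) i)
        ≡⟨ expand (h M) (+ 2 * M) (V M i) _ ⟩
      (h M * (+ 2 * M)) * V M i + h M * (G M ⊛ ΣZ κ) i ∎
      where
      expand : ∀ a b c d → a * (b * c + d) ≡ (a * b) * c + a * d
      expand = solve-∀

  cut : Family → Family
  cut F m with m ℤ.≟ + 0
  ... | yes _ = zeroS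
  ... | no  _ = F m

  cut-≢ : ∀ F M → M ≢ + 0 → F M ≋ cut F M
  cut-≢ F M z n with M ℤ.≟ + 0
  ... | yes e = ⊥-elim (z e)
  ... | no  _ = refl

  cut-loc : ∀ {F} → Loc F → Loc (cut F)
  cut-loc {F} l m i i<m with m ℤ.≟ + 0
  ... | yes _ = refl
  ... | no  _ = l m i i<m

  ΣZ-cut : ∀ h F → ΣZ (wt h F) ≋ ΣZ (wt h (cut F)) ⊕ h (+ 0) ⊙ F (+ 0)
  ΣZ-cut h F i = sumℤ-split0 i (λ m → h m * F m i) (λ m → h m * cut F m i) (h (+ 0) * F (+ 0) i)
    (λ M z _ → cong (h M *_) (cut-≢ F M z i)) (ℤP.*-zeroʳ (h (+ 0))) refl

  diagonal : (ℤ → ℤ) → (ℤ → ℤ → Series) → Series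
  diagonal a X = ΣZ (λ m → a m ⊙ X m (- m))

  -- Off M = 0 the lines have the shape Z(M) v(m) + Y(M) v(n) + C(M) G(n) with v odd.
  type-B : ∀ h a X Z Y C v G → (∀ m → a (- m) ≡ a m) → (∀ M m → h M * a m ≡ h M * a (M + - m)) →
           Loc₂ X → Loc Z → Loc Y → Loc C → Loc v → Loc G → Odd v →
           (∀ m n → m + n ≢ + 0 → X m n ≋ Z (m + n) ⊛ v m ⊕ Y (m + n) ⊛ v n ⊕ C (m + n) ⊛ G n) →
           𝔻 (λ m n → h (m + n) * a m) X ≋ ΣZ (wt h (cut C)) ⊛ ΣZ (wt a G) ⊕ h (+ 0) ⊙ diagonal a X
  type-B h a X Z Y C v G a-even ha lX lZ lY lC lv lG ov e i = begin
    𝔻 (λ m n → h (m + n) * a m) X i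
      ≡⟨ 𝔻-shear (λ m n → h (m + n) * a m) X lX i ⟩
    sumℤ i (line (λ m n → h (m + n) * a m) X i)
      ≡⟨ sumℤ-split0 i _ (λ M → h M * (cut C M ⊛ ΣZ (wt a G)) i) (h (+ 0) * diagonal a X i) off
           (trans (cong (h (+ 0) *_) (zeroS-⊛ (ΣZ (wt a G)) i)) (ℤP.*-zeroʳ (h (+ 0)))) on ⟩
    sumℤ i (λ M → h M * (cut C M ⊛ ΣZ (wt a G)) i) + h (+ 0) * diagonal a X i
      ≡⟨ cong (_+ h (+ 0) * diagonal a X i) (wt-⊛ h (cut-loc lC) (ΣZ (wt a G)) i) ⟩
    (ΣZ (wt h (cut C)) ⊛ ΣZ (wt a G)) i + h (+ 0) * diagonal a X i ∎
    where
    open ≡-Reasoning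
    on : line (λ m n → h (m + n) * a m) X i (+ 0) ≡ h (+ 0) * diagonal a X i
    on = trans (sumℤ-cong i (λ m → trans (cong₂ _*_ (cong (λ k → h k * a m) (m+[M-m] m (+ 0))) (cong (λ k → X m k i) (ℤP.+-identityˡ (- m))))
           (ℤP.*-assoc (h (+ 0)) (a m) (X m (- m) i)))) (pull i (h (+ 0)) (λ m → a m * X m (- m) i))
    off : ∀ M → M ≢ + 0 → ∣ M ∣ ≤ i → line (λ m n → h (m + n) * a m) X i M ≡ h M * (cut C M ⊛ ΣZ (wt a G)) i
    off M z b = begin
      sumℤ i (λ m → (h (m + (M + - m)) * a m) * X m (M + - m) i)
        ≡⟨ sumℤ-cong i term ⟩
      sumℤ i (λ m → h M * (((Z M ⊛ wt a v m) i + (Y M ⊛ wt a v (M + - m)) i) + (C M ⊛ wt a G (M + - m)) i))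
        ≡⟨ trans (pull i (h M) _) (cong (h M *_) (trans (sumℤ-+ i _ _) (cong (_+ _) (sumℤ-+ i (λ m → (Z M ⊛ wt a v m) i) (λ m → (Y M ⊛ wt a v (M + - m)) i))))) ⟩
      h M * ((sumℤ i (λ m → (Z M ⊛ wt a v m) i) + sumℤ i (λ m → (Y M ⊛ wt a v (M + - m)) i)) + sumℤ i (λ m → (C M ⊛ wt a G (M + - m)) i))
        ≡⟨ cong (h M *_) (cong₂ _+_ (cong₂ _+_
             (trans (⊛-win (Z M) i M (wt a v) zeroS (lZ M) b (λ j _ → win-odd ov′ i j)) (vanish (Z M)))
             (trans (⊛-win (Y M) i M (λ m → wt a v (M + - m)) zeroS (lY M) b (λ j b′ → trans (win-reflect (wt-loc a lv) i M j b′) (ΣZ-odd ov′ j))) (vanish (Y M))))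
             (⊛-win (C M) i M (λ m → wt a G (M + - m)) (ΣZ (wt a G)) (lC M) b (λ j → win-reflect (wt-loc a lG) i M j))) ⟩
      h M * ((+ 0 + + 0) + (C M ⊛ ΣZ (wt a G)) i)
        ≡⟨ cong (h M *_) (trans (ℤP.+-identityˡ _) (⊛-congʳ (ΣZ (wt a G)) (cut-≢ C M z) i)) ⟩
      h M * (cut C M ⊛ ΣZ (wt a G)) i ∎
      where
      ov′ = wt-odd a {v} a-even ov
      vanish : ∀ f → (f ⊛ zeroS) i ≡ + 0
      vanish f = trans (⊛-comm f zeroS i) (zeroS-⊛ f i)
      spread : ∀ H α β x y z → H * α ≡ H * β → (H * α) * ((x + y) + z) ≡ H * ((α * x + β * y) + β * z)
      spread H α β x y z q = trans (p₁ H α x y z) (trans (cong (λ k → (H * α) * x + (k * y + k * z)) q) (p₂ H α β x y z))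
        where
        p₁ : ∀ H α x y z → (H * α) * ((x + y) + z) ≡ (H * α) * x + ((H * α) * y + (H * α) * z)
        p₁ = solve-∀
        p₂ : ∀ H α β x y z → (H * α) * x + ((H * β) * y + (H * β) * z) ≡ H * ((α * x + β * y) + β * z)
        p₂ = solve-∀
      term : ∀ m → (h (m + (M + - m)) * a m) * X m (M + - m) i ≡ h M * (((Z M ⊛ wt a v m) i + (Y M ⊛ wt a v (M + - m)) i) + (C M ⊛ wt a G (M + - m)) i)
      term m = begin
        (h (m + (M + - m)) * a m) * X m (M + - m) i
          ≡⟨ cong₂ (λ k x → (h k * a m) * x) (m+[M-m] m M) (trans (e m (M + - m) (λ q → z (trans (sym (m+[M-m] m M)) q)) i)
               (cong (λ k → (Z k ⊛ v m ⊕ Y k ⊛ v (M + - m) ⊕ C k ⊛ G (M + - m)) i) (m+[M-m] m M))) ⟩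
        (h M * a m) * (((Z M ⊛ v m) i + (Y M ⊛ v (M + - m)) i) + (C M ⊛ G (M + - m)) i)
          ≡⟨ spread (h M) (a m) (a (M + - m)) _ _ _ (ha M m) ⟩
        h M * ((a m * (Z M ⊛ v m) i + a (M + - m) * (Y M ⊛ v (M + - m)) i) + a (M + - m) * (C M ⊛ G (M + - m)) i)
          ≡⟨ cong (h M *_) (cong₂ _+_ (cong₂ _+_ (⊛-⊙ (a m) (Z M) (v m) i) (⊛-⊙ (a (M + - m)) (Y M) (v (M + - m)) i)) (⊛-⊙ (a (M + - m)) (C M) (G (M + - m)) i)) ⟨
        h M * (((Z M ⊛ wt a v m) i + (Y M ⊛ wt a v (M + - m)) i) + (C M ⊛ wt a G (M + - m)) i) ∎

-- Lines with symmetric second factor, and alternating lines.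

module SymmetricLines where

  open Polynomials
  open SeriesRing
  open IntegerSums
  open Substitution
  open Families
  open RationalFamilies
  open LambertFamilies
  open LambertPairs
  open Lines
  open Forms

  -- As type-A, but with the line M = 0 apart and a second factor depending symmetrically on m and n.
  type-A′ : ∀ c .{{_ : ℕ.NonZero c}} h X V C κ → Loc₂ X → Loc V → Loc C → Loc κ →
            (∀ m n → m + n ≢ + 0 → X m n ≋ V (m + n) ⊛ (sc c τF m ⊕ sc c τF n) ⊕ C (m + n) ⊛ (κ m ⊕ κ n)) →
            𝔻 (λ m n → h (m + n)) X ≋ moment h V ⊕ ΣZ (wt h (cut C)) ⊛ (ΣZ κ ⊕ ΣZ κ) ⊕ h (+ 0) ⊙ diagonal (λ _ → + 1) X
  type-A′ c h X V C κ lX lV lC lκ e i = begin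
    𝔻 (λ m n → h (m + n)) X i
      ≡⟨ 𝔻-shear (λ m n → h (m + n)) X lX i ⟩
    sumℤ i (line (λ m n → h (m + n)) X i)
      ≡⟨ sumℤ-split0 i _ (λ M → (h M * (+ 2 * M)) * V M i + h M * (cut C M ⊛ (ΣZ κ ⊕ ΣZ κ)) i) (h (+ 0) * diagonal (λ _ → + 1) X i) off zero′ on ⟩
    sumℤ i (λ M → (h M * (+ 2 * M)) * V M i + h M * (cut C M ⊛ (ΣZ κ ⊕ ΣZ κ)) i) + h (+ 0) * diagonal (λ _ → + 1) X i
      ≡⟨ cong (_+ h (+ 0) * diagonal (λ _ → + 1) X i) (trans (sumℤ-+ i (λ M → (h M * (+ 2 * M)) * V M i) (λ M → h M * (cut C M ⊛ (ΣZ κ ⊕ ΣZ κ)) i))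
           (cong (λ z → moment h V i + z) (wt-⊛ h (cut-loc lC) (ΣZ κ ⊕ ΣZ κ) i))) ⟩
    (moment h V i + (ΣZ (wt h (cut C)) ⊛ (ΣZ κ ⊕ ΣZ κ)) i) + h (+ 0) * diagonal (λ _ → + 1) X i ∎
    where
    open ≡-Reasoning
    zero′ : (h (+ 0) * + 0) * V (+ 0) i + h (+ 0) * (cut C (+ 0) ⊛ (ΣZ κ ⊕ ΣZ κ)) i ≡ + 0
    zero′ = cong₂ _+_ (trans (cong (_* V (+ 0) i) (ℤP.*-zeroʳ (h (+ 0)))) (ℤP.*-zeroˡ (V (+ 0) i)))
      (trans (cong (h (+ 0) *_) (zeroS-⊛ (ΣZ κ ⊕ ΣZ κ) i)) (ℤP.*-zeroʳ (h (+ 0))))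
    on : line (λ m n → h (m + n)) X i (+ 0) ≡ h (+ 0) * diagonal (λ _ → + 1) X i
    on = trans (sumℤ-cong i (λ m → cong₂ _*_ (cong h (m+[M-m] m (+ 0))) (trans (cong (λ k → X m k i) (ℤP.+-identityˡ (- m))) (sym (ℤP.*-identityˡ (X m (- m) i))))))
      (sumℤ-*ˡ i (h (+ 0)) (λ m → + 1 * X m (- m) i))
    off : ∀ M → M ≢ + 0 → ∣ M ∣ ≤ i → line (λ m n → h (m + n)) X i M ≡ (h M * (+ 2 * M)) * V M i + h M * (cut C M ⊛ (ΣZ κ ⊕ ΣZ κ)) i
    off M z b = begin
      sumℤ i (λ m → h (m + (M + - m)) * X m (M + - m) i)
        ≡⟨ sumℤ-cong i (λ m → cong₂ _*_ (cong h (m+[M-m] m M)) (trans (e m (M + - m) (λ q → z (trans (sym (m+[M-m] m M)) q)) i)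
             (cong (λ k → (V k ⊛ (sc c τF m ⊕ sc c τF (M + - m)) ⊕ C k ⊛ (κ m ⊕ κ (M + - m))) i) (m+[M-m] m M)))) ⟩
      sumℤ i (λ m → h M * ((V M ⊛ (sc c τF m ⊕ sc c τF (M + - m))) i + (C M ⊛ (κ m ⊕ κ (M + - m))) i))
        ≡⟨ trans (sumℤ-*ˡ i (h M) _) (cong (h M *_) (sumℤ-+ i (λ m → (V M ⊛ (sc c τF m ⊕ sc c τF (M + - m))) i) (λ m → (C M ⊛ (κ m ⊕ κ (M + - m))) i))) ⟩
      h M * (sumℤ i (λ m → (V M ⊛ (sc c τF m ⊕ sc c τF (M + - m))) i) + sumℤ i (λ m → (C M ⊛ (κ m ⊕ κ (M + - m))) i))
        ≡⟨ cong (h M *_) (cong₂ _+_ (τ-line c c (V M) i M (lV M) b) (trans (⊛-win (C M) i M (λ m → κ m ⊕ κ (M + - m)) (ΣZ κ ⊕ ΣZ κ) (lC M) b both)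
             (⊛-congʳ (ΣZ κ ⊕ ΣZ κ) (cut-≢ C M z) i))) ⟩
      h M * ((+ 2 * M) * V M i + (cut C M ⊛ (ΣZ κ ⊕ ΣZ κ)) i)
        ≡⟨ expand (h M) (+ 2 * M) (V M i) _ ⟩
      (h M * (+ 2 * M)) * V M i + h M * (cut C M ⊛ (ΣZ κ ⊕ ΣZ κ)) i ∎
      where
      expand : ∀ a b c d → a * (b * c + d) ≡ (a * b) * c + a * d
      expand = solve-∀
      both : ∀ j → ∣ M ∣ ℕ.+ j ≤ i → win i (λ m → κ m ⊕ κ (M + - m)) j ≡ ΣZ κ j + ΣZ κ j
      both j b′ = trans (sumℤ-+ i (λ m → κ m j) (λ m → κ (M + - m) j)) (cong₂ _+_ (win-loc lκ i j (ℕP.≤-trans (ℕP.m≤n+m j ∣ M ∣) b′)) (win-reflect lκ i M j b′))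

  sgnᶻ-neg : ∀ m → sgnᶻ (- m) ≡ sgnᶻ m
  sgnᶻ-neg m = cong sgn (ℤP.∣-i∣≡∣i∣ m)

  private
    sgn² : ∀ n → sgn n * sgn n ≡ + 1
    sgn² zero    = refl
    sgn² (suc n) = trans (lem (sgn n)) (sgn² n)
      where lem : ∀ x → - x * - x ≡ x * x
            lem = solve-∀

    sgn-⊖ : ∀ a b → sgn ∣ a ℤ.⊖ b ∣ ≡ sgn a * sgn b
    sgn-⊖ a       zero    = sym (ℤP.*-identityʳ (sgn a))
    sgn-⊖ zero    (suc b) = sym (ℤP.*-identityˡ (sgn (suc b)))
    sgn-⊖ (suc a) (suc b) = trans (cong (λ k → sgn ∣ k ∣) (ℤP.[1+m]⊖[1+n]≡m⊖n a b)) (trans (sgn-⊖ a b) (lem (sgn a) (sgn b)))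
      where lem : ∀ x y → x * y ≡ - x * - y
            lem = solve-∀

  sgnᶻ-+ : ∀ m n → sgnᶻ (m + n) ≡ sgnᶻ m * sgnᶻ n
  sgnᶻ-+ (+ a)    (+ b)    = sgn-+ a b
  sgnᶻ-+ (+ a)    -[1+ b ] = sgn-⊖ a (suc b)
  sgnᶻ-+ -[1+ a ] (+ b)    = trans (sgn-⊖ b (suc a)) (ℤP.*-comm (sgn b) (sgn (suc a)))
  sgnᶻ-+ -[1+ a ] -[1+ b ] = trans (cong (λ k → sgn (suc k)) (sym (ℕP.+-suc a b))) (sgn-+ (suc a) (suc b))

  -- The sign makes the lines off M = 0 vanish.
  type-S : ∀ h X V → Loc₂ X → Loc V → (∀ m n → m + n ≢ + 0 → X m n ≋ V (m + n) ⊛ (τF m ⊕ τF n)) →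
           𝔻 (λ m n → h (m + n) * sgnᶻ n) X ≋ h (+ 0) ⊙ diagonal sgnᶻ X
  type-S h X V lX lV e i = begin
    𝔻 (λ m n → h (m + n) * sgnᶻ n) X i
      ≡⟨ 𝔻-shear (λ m n → h (m + n) * sgnᶻ n) X lX i ⟩
    sumℤ i (line (λ m n → h (m + n) * sgnᶻ n) X i)
      ≡⟨ sumℤ-split0 i _ (λ _ → + 0) (h (+ 0) * diagonal sgnᶻ X i) off refl on ⟩
    sumℤ i (λ _ → + 0) + h (+ 0) * diagonal sgnᶻ X i
      ≡⟨ trans (cong (_+ h (+ 0) * diagonal sgnᶻ X i) (sumℤ-zero i (λ _ _ → refl))) (ℤP.+-identityˡ _) ⟩
    h (+ 0) * diagonal sgnᶻ X i ∎
    where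
    open ≡-Reasoning
    on : line (λ m n → h (m + n) * sgnᶻ n) X i (+ 0) ≡ h (+ 0) * diagonal sgnᶻ X i
    on = trans (sumℤ-cong i (λ m → trans (cong₂ _*_ (cong₂ _*_ (cong h (m+[M-m] m (+ 0))) (trans (cong sgnᶻ (ℤP.+-identityˡ (- m))) (sgnᶻ-neg m)))
           (cong (λ k → X m k i) (ℤP.+-identityˡ (- m)))) (ℤP.*-assoc (h (+ 0)) (sgnᶻ m) (X m (- m) i)))) (sumℤ-*ˡ i (h (+ 0)) (λ m → sgnᶻ m * X m (- m) i))
    off : ∀ M → M ≢ + 0 → ∣ M ∣ ≤ i → line (λ m n → h (m + n) * sgnᶻ n) X i M ≡ + 0
    off M z b = begin
      sumℤ i (λ m → (h (m + (M + - m)) * sgnᶻ (M + - m)) * X m (M + - m) i)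
        ≡⟨ sumℤ-cong i term ⟩
      sumℤ i (λ m → (h M * sgnᶻ M) * (V M ⊛ W m) i)
        ≡⟨ sumℤ-*ˡ i (h M * sgnᶻ M) _ ⟩
      (h M * sgnᶻ M) * sumℤ i (λ m → (V M ⊛ W m) i)
        ≡⟨ cong ((h M * sgnᶻ M) *_) (trans (⊛-win (V M) i M W zeroS (lV M) b flat) (trans (⊛-comm (V M) zeroS i) (zeroS-⊛ (V M) i))) ⟩
      (h M * sgnᶻ M) * + 0
        ≡⟨ ℤP.*-zeroʳ (h M * sgnᶻ M) ⟩
      + 0 ∎
      where
      W : Family
      W m = sgnᶻ m ⊙ τF m ⊕ sgnᶻ m ⊙ τF (M + - m)
      term : ∀ m → (h (m + (M + - m)) * sgnᶻ (M + - m)) * X m (M + - m) i ≡ (h M * sgnᶻ M) * (V M ⊛ W m) i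
      term m = begin
        (h (m + (M + - m)) * sgnᶻ (M + - m)) * X m (M + - m) i
          ≡⟨ cong₂ _*_ (cong₂ _*_ (cong h (m+[M-m] m M)) (trans (sgnᶻ-+ M (- m)) (cong (sgnᶻ M *_) (sgnᶻ-neg m))))
               (trans (e m (M + - m) (λ q → z (trans (sym (m+[M-m] m M)) q)) i) (cong (λ k → (V k ⊛ (τF m ⊕ τF (M + - m))) i) (m+[M-m] m M))) ⟩
        (h M * (sgnᶻ M * sgnᶻ m)) * (V M ⊛ (τF m ⊕ τF (M + - m))) i
          ≡⟨ shuffle (h M) (sgnᶻ M) (sgnᶻ m) _ ⟩
        (h M * sgnᶻ M) * (sgnᶻ m * (V M ⊛ (τF m ⊕ τF (M + - m))) i)
          ≡⟨ cong ((h M * sgnᶻ M) *_) (trans (sym (⊛-⊙ (sgnᶻ m) (V M) (τF m ⊕ τF (M + - m)) i)) (⊛-congˡ (V M) (λ n → ℤP.*-distribˡ-+ (sgnᶻ m) (τF m n) (τF (M + - m) n)) i)) ⟩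
        (h M * sgnᶻ M) * (V M ⊛ W m) i ∎
        where
        shuffle : ∀ a b c d → (a * (b * c)) * d ≡ (a * b) * (c * d)
        shuffle = solve-∀
      flat : ∀ j → ∣ M ∣ ℕ.+ j ≤ i → win i W j ≡ + 0
      flat j b′ = trans (sumℤ-+ i (λ m → sgnᶻ m * τF m j) (λ m → sgnᶻ m * τF (M + - m) j)) (cong₂ _+_ (win-odd (wt-odd sgnᶻ {τF} sgnᶻ-neg τF-odd) i j) second)
        where
        o = oneS j
        -- Writing (-1)ᵐ as (-1)^M (-1)^(M - m) makes the remainder of tanh a reflected odd family,
        -- with sum 0; the signs vanish by `sum-alt-sgn`.
        second : sumℤ i (λ m → sgnᶻ m * τF (M + - m) j) ≡ + 0
        second = begin
          sumℤ i (λ m → sgnᶻ m * (sgnℤ (M + - m) * o + τ° (M + - m) j))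
            ≡⟨ trans (sumℤ-cong i part) (sumℤ-+ i (λ m → (sgnᶻ m * sgnℤ (M + - m)) * o) (λ m → sgnᶻ M * wt sgnᶻ τ° (M + - m) j)) ⟩
          sumℤ i (λ m → (sgnᶻ m * sgnℤ (M + - m)) * o) + sumℤ i (λ m → sgnᶻ M * wt sgnᶻ τ° (M + - m) j)
            ≡⟨ cong₂ _+_ (trans (sumℤ-*ʳ i o (λ m → sgnᶻ m * sgnℤ (M + - m))) (trans (cong (_* o) (sum-alt-sgn i M b)) (ℤP.*-zeroˡ o)))
                 (trans (sumℤ-*ˡ i (sgnᶻ M) (λ m → wt sgnᶻ τ° (M + - m) j)) (trans (cong (sgnᶻ M *_) (trans (win-reflect (wt-loc sgnᶻ τ°-loc) i M j b′)
                   (ΣZ-odd (wt-odd sgnᶻ {τ°} sgnᶻ-neg τ°-odd) j))) (ℤP.*-zeroʳ (sgnᶻ M)))) ⟩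
          + 0 ∎
          where
          part : ∀ m → sgnᶻ m * (sgnℤ (M + - m) * o + τ° (M + - m) j) ≡ (sgnᶻ m * sgnℤ (M + - m)) * o + sgnᶻ M * wt sgnᶻ τ° (M + - m) j
          part m = trans (expand (sgnᶻ m) (sgnℤ (M + - m)) o (τ° (M + - m) j)) (cong (λ z → (sgnᶻ m * sgnℤ (M + - m)) * o + z)
            (trans (cong (_* τ° (M + - m) j) (sym same)) (ℤP.*-assoc (sgnᶻ M) (sgnᶻ (M + - m)) (τ° (M + - m) j))))
            where
            expand : ∀ a b c d → a * (b * c + d) ≡ (a * b) * c + a * d
            expand = solve-∀
            same : sgnᶻ M * sgnᶻ (M + - m) ≡ sgnᶻ m
            same = trans (cong (sgnᶻ M *_) (trans (sgnᶻ-+ M (- m)) (cong (sgnᶻ M *_) (sgnᶻ-neg m))))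
              (trans (sym (ℤP.*-assoc (sgnᶻ M) (sgnᶻ M) (sgnᶻ m))) (trans (cong (_* sgnᶻ m) (sgn² ∣ M ∣)) (ℤP.*-identityˡ (sgnᶻ m))))

-- Multiples of an integer in indices and in exponents.

module Multiples where

  open Polynomials
  open SeriesRing
  open IntegerSums
  open Substitution
  open Families
  open Characters
  open RationalFamilies
  open Lines

  when-yes : ∀ {P : Set} (d : Dec P) x → P → when ⌊ d ⌋ x ≡ x
  when-yes (yes _) x p = refl
  when-yes (no ¬p) x p = ⊥-elim (¬p p)

  when-no : ∀ {P : Set} (d : Dec P) x → ¬ P → when ⌊ d ⌋ x ≡ + 0
  when-no (yes p) x ¬p = ⊥-elim (¬p p)
  when-no (no _)  x ¬p = refl

  when-≢ : ∀ {P : Set} (d : Dec P) x → when ⌊ d ⌋ x ≢ + 0 → P × x ≢ + 0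
  when-≢ (yes p) x z = p , z
  when-≢ (no _)  x z = ⊥-elim (z refl)

  quo : (k : ℕ) → .{{_ : ℕ.NonZero k}} → ℤ → ℤ
  quo k (+ a)    = + (a / k)
  quo k -[1+ a ] = - + (suc a / k)

  quo-neg : ∀ k .{{_ : ℕ.NonZero k}} j → quo k (- j) ≡ - quo k j
  quo-neg k (+ 0)     = trans (cong +_ (0/n≡0 k)) (cong (λ x → - + x) (sym (0/n≡0 k)))
  quo-neg k (+ suc a) = refl
  quo-neg k -[1+ a ]  = sym (ℤP.neg-involutive _)

  quo-* : ∀ k .{{_ : ℕ.NonZero k}} j → quo k (+ k * j) ≡ j
  quo-* k (+ a)    = trans (cong (quo k) (sym (ℤP.pos-* k a))) (cong +_ (trans (cong (_/ k) (ℕP.*-comm k a)) (m*n/n≡m a k)))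
  quo-* k -[1+ a ] = trans (cong (quo k) (sym (ℤP.neg-distribʳ-* (+ k) (+ suc a)))) (trans (quo-neg k (+ k * + suc a)) (cong -_ (quo-* k (+ suc a))))

  *-quo : ∀ k .{{_ : ℕ.NonZero k}} j → k ∣ ∣ j ∣ → + k * quo k j ≡ j
  *-quo k (+ a)    d = trans (sym (ℤP.pos-* k (a / k))) (cong +_ (m*[n/m]≡n d))
  *-quo k -[1+ a ] d = trans (sym (ℤP.neg-distribʳ-* (+ k) (+ (suc a / k)))) (cong -_ (*-quo k (+ suc a) d))

  ∣quo∣ : ∀ k .{{_ : ℕ.NonZero k}} j → ∣ quo k j ∣ ≤ ∣ j ∣
  ∣quo∣ k (+ a)    = m/n≤m a k
  ∣quo∣ k -[1+ a ] = subst (_≤ suc a) (sym (ℤP.∣-i∣≡∣i∣ (+ (suc a / k)))) (m/n≤m (suc a) k)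

  sumℤ-multiples : ∀ k .{{_ : ℕ.NonZero k}} N (f : ℤ → ℤ) → (∀ j → f j ≢ + 0 → ∣ j ∣ ≤ N) →
                   sumℤ N (λ m → when ⌊ k ∣? ∣ m ∣ ⌋ (f m)) ≡ sumℤ N (λ x → f (+ k * x))
  sumℤ-multiples k N f h = sym (trans (sumℤ-cong N (λ x → sym (when-yes (k ∣? ∣ + k * x ∣) _ (subst (k ∣_) (sym (ℤP.abs-* (+ k) x)) (m∣m*n ∣ x ∣)))))
    (sumℤ-reindex N N (λ x → + k * x) (quo k) (λ m → when ⌊ k ∣? ∣ m ∣ ⌋ (f m)) (quo-* k)
      (λ j z → let (d , z′) = when-≢ (k ∣? ∣ j ∣) (f j) z in h j z′ , ℕP.≤-trans (∣quo∣ k j) (h j z′) , *-quo k j d)))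

  sumℤ-shift : ∀ N N′ t (f : ℤ → ℤ) → (∀ j → f j ≢ + 0 → ∣ j ∣ ≤ N × ∣ j + - t ∣ ≤ N′) → sumℤ N′ (λ m → f (m + t)) ≡ sumℤ N f
  sumℤ-shift N N′ t f h = sumℤ-reindex N N′ (λ m → m + t) (λ m → m + - t) f (cancel₁ t) (λ j z → proj₁ (h j z) , proj₂ (h j z) , cancel₂ t j)
    where
    cancel₁ : ∀ t m → (m + t) + - t ≡ m
    cancel₁ = solve-∀
    cancel₂ : ∀ t m → (m + - t) + t ≡ m
    cancel₂ = solve-∀

  ΣZ-multiples : ∀ k .{{_ : ℕ.NonZero k}} c α {F} → Loc F → (∀ m → α m + + 1 ≡ when ⌊ k ∣? ∣ m ∣ ⌋ c) →
                 ΣZ (wt α F) ⊕ ΣZ F ≋ c ⊙ ΣZ (sc k F)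
  ΣZ-multiples k c α {F} l e i = trans (sym (sumℤ-+ i (λ m → α m * F m i) (λ m → F m i)))
    (trans (sumℤ-cong i term) (trans (sumℤ-multiples k i (λ m → c * F m i) (λ m z → ≢0⇒≤ {f = F m} (l m) (λ q → z (trans (cong (c *_) q) (ℤP.*-zeroʳ c)))))
      (sumℤ-*ˡ i c (λ m → sc k F m i))))
    where
    collect : ∀ a x → a * x + x ≡ (a + + 1) * x
    collect = solve-∀
    pull : ∀ b x → when b c * x ≡ when b (c * x)
    pull true  x = refl
    pull false x = ℤP.*-zeroˡ x
    term : ∀ m → α m * F m i + F m i ≡ when ⌊ k ∣? ∣ m ∣ ⌋ (c * F m i)
    term m = trans (collect (α m) (F m i)) (trans (cong (_* F m i) (e m)) (pull ⌊ k ∣? ∣ m ∣ ⌋ (F m i)))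

  sᶻ-multiples : ∀ m → sᶻ m + + 1 ≡ when ⌊ 5 ∣? ∣ m ∣ ⌋ (+ 5)
  sᶻ-multiples m = go ∣ m ∣ (5 ∣? ∣ m ∣)
    where
    go : ∀ n (d : Dec (5 ∣ n)) → s₅ n + + 1 ≡ when ⌊ d ⌋ (+ 5)
    go n d with n % 5 in e
    ... | 0     = sym (when-yes d (+ 5) (m%n≡0⇒n∣m n 5 e))
    ... | suc r = sym (when-no d (+ 5) (λ p → ℕP.1+n≢0 (trans (sym e) (n∣m⇒m%n≡0 n 5 p))))

  sgn-even : ∀ n → sgn (2 ℕ.* n) ≡ + 1
  sgn-even zero    = refl
  sgn-even (suc n) = trans (cong sgn (cong suc (ℕP.+-suc n (n ℕ.+ 0)))) (trans (ℤP.neg-involutive _) (sgn-even n))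

  sgn-2∣ : ∀ n → sgn n + + 1 ≡ when ⌊ 2 ∣? n ⌋ (+ 2)
  sgn-2∣ zero          = refl
  sgn-2∣ (suc zero)    = refl
  sgn-2∣ (suc (suc n)) = trans (cong (_+ + 1) (ℤP.neg-involutive (sgn n))) (trans (sgn-2∣ n) (move (2 ∣? n)))
    where
    move : (d : Dec (2 ∣ n)) → when ⌊ d ⌋ (+ 2) ≡ when ⌊ 2 ∣? suc (suc n) ⌋ (+ 2)
    move (yes d) = sym (when-yes (2 ∣? suc (suc n)) (+ 2) (∣m∣n⇒∣m+n (m∣m*n 1) d))
    move (no ¬d) = sym (when-no (2 ∣? suc (suc n)) (+ 2) (λ d → ¬d (∣m+n∣m⇒∣n d (m∣m*n 1))))

  by-multiples : ∀ k .{{_ : ℕ.NonZero k}} (P : ℕ → Set) → (∀ j → P (k ℕ.* j)) → (∀ n → ¬ k ∣ n → P n) → ∀ n → P n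
  by-multiples k P f g n with k ∣? n
  ... | yes (divides q e) = subst P (sym (trans e (ℕP.*-comm q k))) (f q)
  ... | no  ¬d            = g n ¬d

  sub-at : ∀ k .{{_ : ℕ.NonZero k}} f n → sub k f (k ℕ.* n) ≡ f n
  sub-at k f n = trans (cong (sub k f) (ℕP.*-comm k n)) (cong₂ (pick f) (m*n%n≡0 n k) (m*n/n≡m n k))

  sub-∤ : ∀ k .{{_ : ℕ.NonZero k}} f n → ¬ k ∣ n → sub k f n ≡ + 0
  sub-∤ k f n ¬d with n % k in e
  ... | zero  = ⊥-elim (¬d (m%n≡0⇒n∣m n k e))
  ... | suc _ = refl

  sub-sub : ∀ k a l .{{_ : ℕ.NonZero k}} .{{_ : ℕ.NonZero a}} .{{_ : ℕ.NonZero l}} f → l ≡ k ℕ.* a → sub k (sub a f) ≋ sub l f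
  sub-sub k a l f refl = by-multiples k (λ n → sub k (sub a f) n ≡ sub l f n)
    (λ j → trans (sub-at k (sub a f) j) (by-multiples a (λ j → sub a f j ≡ sub l f (k ℕ.* j))
      (λ i → trans (sub-at a f i) (sym (trans (cong (sub l f) (sym (ℕP.*-assoc k a i))) (sub-at l f i))))
      (λ i ¬d → trans (sub-∤ a f i ¬d) (sym (sub-∤ l f (k ℕ.* i) (λ d → ¬d (*-cancelˡ-∣ k d))))) j))
    (λ n ¬d → trans (sub-∤ k (sub a f) n ¬d) (sym (sub-∤ l f n (λ d → ¬d (∣-trans (m∣m*n a) d)))))

  sub-inj : ∀ k .{{_ : ℕ.NonZero k}} {f g} → sub k f ≋ sub k g → f ≋ g
  sub-inj k {f} {g} e n = trans (sym (sub-at k f n)) (trans (e (k ℕ.* n)) (sub-at k g n))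

  mono-self : ∀ k → mono k k ≡ + 1
  mono-self zero    = refl
  mono-self (suc k) = mono-self k

  mono-≢ : ∀ k n → mono k n ≢ + 0 → k ≡ n
  mono-≢ zero    zero    z = refl
  mono-≢ zero    (suc n) z = ⊥-elim (z refl)
  mono-≢ (suc k) zero    z = ⊥-elim (z refl)
  mono-≢ (suc k) (suc n) z = cong suc (mono-≢ k n z)

  sub-mono : ∀ k .{{_ : ℕ.NonZero k}} j → sub k (mono j) ≋ mono (k ℕ.* j)
  sub-mono k j = ≋-trans (sub-cong k (≋-sym (≋-trans (mono-^ j 1) (λ i → cong (λ k → mono k i) (ℕP.*-identityʳ j)))))
    (≋-trans (sub-^ k (mono 1) j) (≋-trans (^-cong j (sub-mono₁ k)) (≋-trans (mono-^ j k) (λ i → cong (λ k → mono k i) (ℕP.*-comm j k)))))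

  sub-ΣZ : ∀ k .{{_ : ℕ.NonZero k}} {F} → Loc F → sub k (ΣZ F) ≋ ΣZ (λ m → sub k (F m))
  sub-ΣZ k {F} l = by-multiples k (λ n → sub k (ΣZ F) n ≡ ΣZ (λ m → sub k (F m)) n)
    (λ j → trans (sub-at k (ΣZ F) j) (trans (sym (win-loc l (k ℕ.* j) j (ℕP.m≤n*m j k))) (sumℤ-cong (k ℕ.* j) (λ m → sym (sub-at k (F m) j)))))
    (λ n ¬d → trans (sub-∤ k (ΣZ F) n ¬d) (sym (sumℤ-zero n (λ m _ → sub-∤ k (F m) n ¬d))))

  sub-baseFam : ∀ k .{{_ : ℕ.NonZero k}} c f a → sub k (baseFam c f a) ≋ baseFam c f (k ℕ.* a)
  sub-baseFam k       c f zero    n = trans (sub-const k c n) (cong (λ j → baseFam c f j n) (sym (ℕP.*-zeroʳ k)))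
  sub-baseFam (suc k) c f (suc a)   = sub-sub (suc k) (suc a) (suc k ℕ.* suc a) f refl

  sub-evF : ∀ k .{{_ : ℕ.NonZero k}} c f m → sub k (evF c f m) ≋ sc k (evF c f) m
  sub-evF k c f m n = trans (sub-baseFam k c f ∣ m ∣ n) (cong (λ j → baseFam c f j n) (sym (ℤP.abs-* (+ k) m)))

  ΣZ-sc : ∀ k .{{_ : ℕ.NonZero k}} α c f → f 0 ≡ + 0 → ΣZ (wt α (sc k (evF c f))) ≋ sub k (ΣZ (wt α (evF c f)))
  ΣZ-sc k α c f z = ≋-sym (≋-trans (sub-ΣZ k (wt-loc α (evF-loc c f z))) (ΣZ-cong (λ m → ≋-trans (sub-⊙ k (α m) (evF c f m)) (⊙-cong (α m) (sub-evF k c f m)))))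

  -- Support on odd exponents, as an equation. It makes q ↦ - q act on f(q^m) as multiplication by
  -- (-1)ᵐ, so twisting a Lambert sum only changes the weights of its indices.
  OddSupport : Series → Set
  OddSupport f = ∀ n → sgn n * f n ≡ - f n

  sgn-*-odd : ∀ {f} → OddSupport f → ∀ a n → sgn (a ℕ.* n) * f n ≡ sgn a * f n
  sgn-*-odd {f} o zero    n = refl
  sgn-*-odd {f} o (suc a) n = begin
    sgn (n ℕ.+ a ℕ.* n) * f n     ≡⟨ cong (_* f n) (sgn-+ n (a ℕ.* n)) ⟩
    (sgn n * sgn (a ℕ.* n)) * f n ≡⟨ ℤP.*-assoc (sgn n) _ _ ⟩
    sgn n * (sgn (a ℕ.* n) * f n) ≡⟨ cong (sgn n *_) (sgn-*-odd o a n) ⟩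
    sgn n * (sgn a * f n)         ≡⟨ swap (sgn n) (sgn a) (f n) ⟩
    sgn a * (sgn n * f n)         ≡⟨ cong (sgn a *_) (o n) ⟩
    sgn a * - f n                 ≡⟨ move (sgn a) (f n) ⟩
    - sgn a * f n                 ∎
    where
    open ≡-Reasoning
    swap : ∀ a b c → a * (b * c) ≡ b * (a * c)
    swap = solve-∀
    move : ∀ a b → a * - b ≡ - a * b
    move = solve-∀

  twist-cong : ∀ {f g} → f ≋ g → twist f ≋ twist g
  twist-cong e n = cong (sgn n *_) (e n)

  twist-⊕ : ∀ f g → twist (f ⊕ g) ≋ twist f ⊕ twist g
  twist-⊕ f g n = ℤP.*-distribˡ-+ (sgn n) (f n) (g n)

  twist-⊝ : ∀ f → twist (⊝ f) ≋ ⊝ twist f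
  twist-⊝ f n = sym (ℤP.neg-distribʳ-* (sgn n) (f n))

  twist-⊙ : ∀ c f → twist (c ⊙ f) ≋ c ⊙ twist f
  twist-⊙ c f n = swap (sgn n) c (f n)
    where swap : ∀ a b c → a * (b * c) ≡ b * (a * c)
          swap = solve-∀

  sgn-sgn : ∀ n → sgn n * sgn n ≡ + 1
  sgn-sgn zero    = refl
  sgn-sgn (suc n) = trans (lem (sgn n)) (sgn-sgn n)
    where lem : ∀ x → - x * - x ≡ x * x
          lem = solve-∀

  twist-twist : ∀ f → twist (twist f) ≋ f
  twist-twist f n = trans (sym (ℤP.*-assoc (sgn n) (sgn n) (f n))) (trans (cong (_* f n) (sgn-sgn n)) (ℤP.*-identityˡ (f n)))

  twist-const : ∀ c → twist (constS c) ≋ constS c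
  twist-const c zero    = ℤP.*-identityˡ _
  twist-const c (suc n) = lem (sgn (suc n)) c
    where lem : ∀ a c → a * (c * + 0) ≡ c * + 0
          lem = solve-∀

  twist-ΣZ : ∀ F → twist (ΣZ F) ≋ ΣZ (twist ∘ F)
  twist-ΣZ F n = sym (sumℤ-*ˡ n (sgn n) (λ m → F m n))

  twist-sub : ∀ k .{{_ : ℕ.NonZero k}} {f} → OddSupport f → twist (sub k f) ≋ sgn k ⊙ sub k f
  twist-sub k {f} o = by-multiples k (λ n → sgn n * sub k f n ≡ sgn k * sub k f n)
    (λ j → trans (cong (sgn (k ℕ.* j) *_) (sub-at k f j)) (trans (sgn-*-odd {f} o k j) (cong (sgn k *_) (sym (sub-at k f j)))))
    (λ n ¬d → trans (cong (sgn n *_) (sub-∤ k f n ¬d)) (trans (ℤP.*-zeroʳ (sgn n)) (sym (trans (cong (sgn k *_) (sub-∤ k f n ¬d)) (ℤP.*-zeroʳ (sgn k))))))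

  twist-baseFam : ∀ c {f} → OddSupport f → ∀ a → twist (baseFam c f a) ≋ sgn a ⊙ baseFam c f a
  twist-baseFam c {f} o zero    n = trans (twist-const c n) (sym (ℤP.*-identityˡ _))
  twist-baseFam c {f} o (suc a)   = twist-sub (suc a) {f} o

  twist-even-sub : ∀ f → twist (sub 2 f) ≋ sub 2 f
  twist-even-sub f = by-multiples 2 (λ n → sgn n * sub 2 f n ≡ sub 2 f n)
    (λ j → trans (cong (_* sub 2 f (2 ℕ.* j)) (sgn-even j)) (ℤP.*-identityˡ _))
    (λ n ¬d → trans (cong (sgn n *_) (sub-∤ 2 f n ¬d)) (trans (ℤP.*-zeroʳ (sgn n)) (sym (sub-∤ 2 f n ¬d))))

  twist-ΣZ-evF : ∀ α c {f} → OddSupport f → twist (ΣZ (wt α (evF c f))) ≋ ΣZ (wt α (wt sgnᶻ (evF c f)))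
  twist-ΣZ-evF α c {f} o = ≋-trans (twist-ΣZ (wt α (evF c f))) (ΣZ-cong (λ m → ≋-trans (twist-⊙ (α m) (evF c f m)) (⊙-cong (α m) (twist-baseFam c {f} o ∣ m ∣))))

  -- Taking the exponents divisible by k commutes with multiplication by a series in q^k.
  ⊛-sub-at : ∀ k .{{_ : ℕ.NonZero k}} f g n → (f ⊛ sub k g) (k ℕ.* n) ≡ ((λ j → f (k ℕ.* j)) ⊛ g) n
  ⊛-sub-at k f g n = trans (step f g (k ℕ.* n)) (go g n)
    where
    step : ∀ f g n → (f ⊛ sub k g) n ≡ g 0 * f n + (mono k ⊛ (f ⊛ sub k (tl g))) n
    step f g n = trans (⊛-congˡ f (sub-eq k g) n) (trans (⊛-distribˡ f (constS (g 0)) (mono k ⊛ sub k (tl g)) n)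
      (cong₂ _+_ (trans (⊛-comm f (constS (g 0)) n) (constS-⊛ (g 0) f n))
        (trans (sym (⊛-assoc f (mono k) (sub k (tl g)) n)) (trans (⊛-congʳ (sub k (tl g)) (⊛-comm f (mono k)) n) (⊛-assoc (mono k) f (sub k (tl g)) n)))))
    go : ∀ g n → g 0 * f (k ℕ.* n) + (mono k ⊛ (f ⊛ sub k (tl g))) (k ℕ.* n) ≡ ((λ j → f (k ℕ.* j)) ⊛ g) n
    go g zero = trans (cong (λ z → g 0 * f (k ℕ.* 0) + z) (mono-⊛-< k (f ⊛ sub k (tl g)) (k ℕ.* 0) (subst (_< k) (sym (ℕP.*-zeroʳ k)) (ℕ.>-nonZero⁻¹ k))))
      (trans (ℤP.+-identityʳ _) (ℤP.*-comm (g 0) (f (k ℕ.* 0))))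
    go g (suc n) = trans (cong₂ _+_ (ℤP.*-comm (g 0) (f (k ℕ.* suc n)))
        (trans (cong (mono k ⊛ (f ⊛ sub k (tl g))) (ℕP.*-suc k n)) (trans (mono-⊛-+ k (f ⊛ sub k (tl g)) (k ℕ.* n)) (trans (step f (tl g) (k ℕ.* n)) (go (tl g) n)))))
      (trans (ℤP.+-comm (f (k ℕ.* suc n) * g 0) (((λ j → f (k ℕ.* j)) ⊛ tl g) n)) (sym (⊛-sucʳ (λ j → f (k ℕ.* j)) g n)))

  -- A factor in q^k moves exponents by multiples of k only, and the weight does not see these.
  periodic-⊛ : ∀ k .{{_ : ℕ.NonZero k}} {w} → Periodic k w → ∀ f g n → w n * (f ⊛ sub k g) n ≡ ((λ i → w i * f i) ⊛ sub k g) n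
  periodic-⊛ k {w} p f g n = trans (sym (sumTo-*ˡ n (w n) (λ i → f i * sub k g (n ℕ.∸ i)))) (sumTo-cong≤ n term)
    where
    term : ∀ i → i ≤ n → w n * (f i * sub k g (n ℕ.∸ i)) ≡ (w i * f i) * sub k g (n ℕ.∸ i)
    term i i≤n with k ∣? (n ℕ.∸ i)
    ... | yes d = trans (cong (_* (f i * sub k g (n ℕ.∸ i))) same) (sym (ℤP.*-assoc (w i) (f i) (sub k g (n ℕ.∸ i))))
      where
      same : w n ≡ w i
      same = trans (cong w (sym (ℕP.m+[n∸m]≡n i≤n))) (trans (periodic-+ k {w} p i (n ℕ.∸ i))
        (trans (cong (λ r → w (i % k ℕ.+ r)) (n∣m⇒m%n≡0 (n ℕ.∸ i) k d)) (trans (cong w (ℕP.+-identityʳ (i % k))) (sym (p i)))))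
    ... | no ¬d = trans (cong (λ z → w n * (f i * z)) z) (trans (lem (w n) (f i)) (sym (trans (cong ((w i * f i) *_) z) (ℤP.*-zeroʳ (w i * f i)))))
      where
      z = sub-∤ k g (n ℕ.∸ i) ¬d
      lem : ∀ a b → a * (b * + 0) ≡ + 0
      lem = solve-∀

  sumℤ-even : ∀ N (f : ℤ → ℤ) → (∀ m → f (- m) ≡ f m) → sumℤ N f ≡ f (+ 0) + + 2 * sum1To N (λ m → f (+ m))
  sumℤ-even zero    f e = sym (ℤP.+-identityʳ (f (+ 0)))
  sumℤ-even (suc N) f e = trans (cong₂ (λ x y → x + (f (+ suc N) + y)) (sumℤ-even N f e) (e (+ suc N))) (lem (f (+ 0)) (sum1To N (λ m → f (+ m))) (f (+ suc N)))
    where lem : ∀ a b c → (a + + 2 * b) + (c + c) ≡ a + + 2 * (b + c)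
          lem = solve-∀

-- Uniqueness of the solution of the arithmetic-geometric mean recursion.

module ArithmeticGeometricMean where

  open Polynomials
  open SeriesRing
  open Substitution
  open RationalFamilies
  open Multiples

  ord-coefficient : ∀ k l {f g} → Ord k f → Ord l g → (f ⊛ g) (k ℕ.+ l) ≡ f k * g l
  ord-coefficient zero    zero    {f} {g} of og = refl
  ord-coefficient zero    (suc l) {f} {g} of og = trans (⊛-suc f g l) (trans (cong (λ z → f 0 * g (suc l) + z) (ord-⊛ 0 (suc l) {tl f} {g} (λ _ ()) og l ℕP.≤-refl)) (ℤP.+-identityʳ _))
  ord-coefficient (suc k) l       {f} {g} of og = trans (⊛-suc f g (k ℕ.+ l)) (trans
    (cong₂ (λ x y → x * g (suc (k ℕ.+ l)) + y) (of 0 (s≤s z≤n)) (ord-coefficient k l {tl f} {g} (λ i i<k → of (suc i) (s≤s i<k)) og))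
    (trans (cong (_+ f (suc k) * g l) (ℤP.*-zeroˡ (g (suc (k ℕ.+ l))))) (ℤP.+-identityˡ _)))

  ord-sub : ∀ k .{{_ : ℕ.NonZero k}} n {f} → Ord n f → Ord (k ℕ.* n) (sub k f)
  ord-sub k n {f} o = by-multiples k (λ i → i < k ℕ.* n → sub k f i ≡ + 0)
    (λ j h → trans (sub-at k f j) (o j (ℕP.*-cancelˡ-< k j n h))) (λ i ¬d _ → sub-∤ k f i ¬d)

  ord-⊛ʳ : ∀ k f {g} → Ord k g → Ord k (f ⊛ g)
  ord-⊛ʳ k f {g} o = ord-⊛ 0 k {f} {g} (λ _ ()) o

  ord-⊛ˡ : ∀ k {f} g → Ord k f → Ord k (f ⊛ g)
  ord-⊛ˡ k {f} g o n h = trans (⊛-comm f g n) (ord-⊛ʳ k g {f} o n h)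

  ord-⊖ : ∀ n {f g} → (∀ i → i < n → f i ≡ g i) → Ord n (f ⊕ ⊝ g)
  ord-⊖ n {f} {g} e i h = trans (cong (_+ - g i) (e i h)) (ℤP.+-inverseʳ (g i))

  n+1<2n : ∀ n → 2 ≤ n → n ℕ.+ 1 < 2 ℕ.* n
  n+1<2n n h = subst (n ℕ.+ 1 <_) (cong (n ℕ.+_) (sym (ℕP.+-identityʳ n))) (ℕP.+-monoʳ-< n h)

  nonzero-factor : ∀ x y → y ≢ + 0 → x * y ≡ + 0 → x ≡ + 0
  nonzero-factor x y y≢0 e with ℤP.i*j≡0⇒i≡0∨j≡0 x {y} e
  ... | inj₁ p = p
  ... | inj₂ p = ⊥-elim (y≢0 p)

  -- If E started at q^n with n ≥ 2, the left side would start at q^(n+1) with coefficient E n · S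
  -- 1, but the right side is of order at least 2n, which is larger.
  doubling-unique : ∀ E S H → E 0 ≡ + 0 → E 1 ≡ + 0 → Ord 1 S → S 1 ≢ + 0 → E ⊛ S ≋ H ⊛ sub 2 E → E ≋ zeroS
  doubling-unique E S H e₀ e₁ oS s₁ e n = go n n (s≤s (ℕP.n≤1+n n))
    where
    go : ∀ n → Ord (2 ℕ.+ n) E
    go zero 0 _ = e₀
    go zero 1 _ = e₁
    go zero (suc (suc _)) (s≤s (s≤s ()))
    go (suc n) m (s≤s m≤n) with ℕP.m≤n⇒m<n∨m≡n m≤n
    ... | inj₁ m<n    = go n m m<n
    ... | inj₂ refl = nonzero-factor (E (2 ℕ.+ n)) (S 1) s₁ (trans (sym (ord-coefficient (2 ℕ.+ n) 1 {E} {S} (go n) oS)) (trans (e ((2 ℕ.+ n) ℕ.+ 1))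
            (ord-⊛ʳ (2 ℕ.* (2 ℕ.+ n)) H {sub 2 E} (ord-sub 2 (2 ℕ.+ n) {E} (go n)) ((2 ℕ.+ n) ℕ.+ 1) (n+1<2n (2 ℕ.+ n) (s≤s (s≤s z≤n))))))

  -- X(q) and X(- q) have arithmetic mean X(q²) and geometric mean X(- q²).
  record AGM (X : Series) : Set where
    field
      at-0 : X 0 ≡ + 1
      at-1 : X 1 ≡ + 4
      arithmetic : X ⊕ twist X ≋ (+ 2) ⊙ sub 2 X
      geometric  : X ⊛ twist X ≋ sub 2 (twist X) ⊛ sub 2 (twist X)

  odd-sgn : ∀ n → ¬ 2 ∣ n → sgn n ≡ - + 1
  odd-sgn n ¬d = trans (lem (sgn n)) (cong (_+ - + 1) (trans (sgn-2∣ n) (when-no (2 ∣? n) (+ 2) ¬d)))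
    where lem : ∀ x → x ≡ (x + + 1) + - + 1
          lem = solve-∀

  module _ {X : Series} (agm : AGM X) where
    open AGM agm

    Δ : Series
    Δ = X ⊕ ⊝ twist X

    -- With X̂ for the twist, (X - X̂)² = (X + X̂)² - 4 X X̂ is four times the difference of the
    -- squares of X(q²) and X̂(q²). That difference factors into Δ(q²) and X(q²) + X̂(q²) = 2 X(q⁴).
    Δ-doubling : Δ ⊛ Δ ≋ (+ 8) ⊙ (sub 2 Δ ⊛ sub 2 (sub 2 X))
    Δ-doubling = x-y≈0⇒x≈y (certify (X ∷ twist X ∷ sub 2 X ∷ sub 2 (twist X) ∷ sub 2 Δ ∷ sub 2 (sub 2 X) ∷ []) (con (+ 1))
      ((# 0F :- # 1F) :* (# 0F :- # 1F) :- (+ 8) :· (# 4F :* # 5F))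
      ((# 0F :+ # 1F :+ con (+ 2) :* # 2F , # 0F :+ # 1F :- (+ 2) :· # 2F) ∷ (con (- + 4) , # 0F :* # 1F :- # 3F :* # 3F)
        ∷ (con (- + 4) :* (# 2F :+ # 3F) , # 4F :- (# 2F :- # 3F)) ∷ (con (+ 4) :* # 4F , # 2F :+ # 3F :- (+ 2) :· # 5F) ∷ [])
      regular₁ (x≋y⇒x-y≋0 arithmetic All.∷ x≋y⇒x-y≋0 geometric
        All.∷ x≋y⇒x-y≋0 (≋-trans (sub-⊕ 2 X (⊝ twist X)) (⊕-congˡ (sub 2 X) (sub-⊝ 2 (twist X))))
        All.∷ x≋y⇒x-y≋0 (≋-trans (≋-sym (sub-⊕ 2 X (twist X))) (≋-trans (sub-cong 2 arithmetic) (sub-⊙ 2 (+ 2) (sub 2 X)))) All.∷ All.[]))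

    even-coefficient : ∀ j → X (2 ℕ.* j) ≡ X j
    even-coefficient j = ℤP.*-cancelˡ-≡ (+ 2) _ _ (trans (double (X (2 ℕ.* j))) (trans (cong (λ s → X (2 ℕ.* j) + s * X (2 ℕ.* j)) (sym (sgn-even j)))
      (trans (arithmetic (2 ℕ.* j)) (cong (+ 2 *_) (sub-at 2 X j)))))
      where double : ∀ x → + 2 * x ≡ x + + 1 * x
            double = solve-∀

    Δ-odd : ∀ n → ¬ 2 ∣ n → Δ n ≡ + 2 * X n
    Δ-odd n ¬d = trans (cong (λ s → X n + - (s * X n)) (odd-sgn n ¬d)) (lem (X n))
      where lem : ∀ x → x + - (- + 1 * x) ≡ + 2 * x
            lem = solve-∀

    Δ-1 : Δ 1 ≡ + 8
    Δ-1 = cong (λ x → x + - (- + 1 * x)) at-1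

  -- The arithmetic mean gives X(2j) = X(j) for coefficients. For odd n, let E and S be the
  -- difference and the sum of the two Δ, so that E S is the difference of their squares. If X and Y
  -- agree below n, the coefficient of q^(n+1) in E S is E n · S 1, while by `Δ-doubling` that
  -- difference has order at least 2n.
  agm-unique : ∀ {X Y} → AGM X → AGM Y → X ≋ Y
  agm-unique {X} {Y} agX agY n = go (suc n) n ℕP.≤-refl
    where
    E S : Series
    E = Δ agX ⊕ ⊝ Δ agY
    S = Δ agX ⊕ Δ agY
    eq′ : E ⊛ S ≋ (+ 8) ⊙ (sub 2 E ⊛ sub 2 (sub 2 X) ⊕ sub 2 (Δ agY) ⊛ sub 2 (sub 2 (X ⊕ ⊝ Y)))
    eq′ = x-y≈0⇒x≈y (certify (Δ agX ∷ Δ agY ∷ sub 2 (Δ agX) ∷ sub 2 (Δ agY) ∷ sub 2 (sub 2 X) ∷ sub 2 (sub 2 Y) ∷ sub 2 E ∷ sub 2 (sub 2 (X ⊕ ⊝ Y)) ∷ []) (con (+ 1))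
      ((# 0F :- # 1F) :* (# 0F :+ # 1F) :- (+ 8) :· (# 6F :* # 4F :+ # 3F :* # 7F))
      ((con (+ 1) , # 0F :* # 0F :- (+ 8) :· (# 2F :* # 4F)) ∷ (con (- + 1) , # 1F :* # 1F :- (+ 8) :· (# 3F :* # 5F))
        ∷ (con (- + 8) :* # 4F , # 6F :- (# 2F :- # 3F)) ∷ (con (- + 8) :* # 3F , # 7F :- (# 4F :- # 5F)) ∷ [])
      regular₁ (x≋y⇒x-y≋0 (Δ-doubling agX) All.∷ x≋y⇒x-y≋0 (Δ-doubling agY)
        All.∷ x≋y⇒x-y≋0 (≋-trans (sub-⊕ 2 (Δ agX) (⊝ Δ agY)) (⊕-congˡ (sub 2 (Δ agX)) (sub-⊝ 2 (Δ agY))))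
        All.∷ x≋y⇒x-y≋0 (≋-trans (sub-cong 2 (≋-trans (sub-⊕ 2 X (⊝ Y)) (⊕-congˡ (sub 2 X) (sub-⊝ 2 Y)))) (≋-trans (sub-⊕ 2 (sub 2 X) (⊝ sub 2 Y)) (⊕-congˡ (sub 2 (sub 2 X)) (sub-⊝ 2 (sub 2 Y))))) All.∷ All.[]))
    oS : Ord 1 S
    oS 0 _ = cong₂ _+_ (ord-⊖ 1 {X} {twist X} (λ { 0 _ → sym (ℤP.*-identityˡ (X 0)) ; (suc _) (s≤s ()) }) 0 (s≤s z≤n))
      (ord-⊖ 1 {Y} {twist Y} (λ { 0 _ → sym (ℤP.*-identityˡ (Y 0)) ; (suc _) (s≤s ()) }) 0 (s≤s z≤n))
    oS (suc _) (s≤s ())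
    S₁ : S 1 ≢ + 0
    S₁ z with trans (sym (cong₂ _+_ (Δ-1 agX) (Δ-1 agY))) z
    ... | ()
    odd : ∀ n → (∀ m → m < n → X m ≡ Y m) → 2 ≤ n → ¬ 2 ∣ n → X n ≡ Y n
    odd n ih h ¬d = ℤP.*-cancelˡ-≡ (+ 2) _ _ (trans (sym (Δ-odd agX n ¬d)) (trans (ℤP.i-j≡0⇒i≡j (Δ agX n) (Δ agY n) zero′) (Δ-odd agY n ¬d)))
      where
      oE : Ord n E
      oE = ord-⊖ n {Δ agX} {Δ agY} (λ i i<n → cong₂ (λ x y → x + - (sgn i * y)) (ih i i<n) (ih i i<n))
      oD : Ord n (X ⊕ ⊝ Y)
      oD = ord-⊖ n {X} {Y} ih
      n<4n : n ℕ.+ 1 < 2 ℕ.* (2 ℕ.* n)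
      n<4n = ℕP.<-≤-trans (n+1<2n n h) (ℕP.m≤m+n (2 ℕ.* n) (2 ℕ.* n ℕ.+ 0))
      zero′ : E n ≡ + 0
      zero′ = nonzero-factor (E n) (S 1) S₁ (trans (sym (ord-coefficient n 1 {E} {S} oE oS)) (trans (eq′ (n ℕ.+ 1)) (cong (+ 8 *_) (cong₂ _+_
        (ord-⊛ˡ (2 ℕ.* n) {sub 2 E} (sub 2 (sub 2 X)) (ord-sub 2 n {E} oE) (n ℕ.+ 1) (n+1<2n n h))
        (ord-⊛ʳ (2 ℕ.* (2 ℕ.* n)) (sub 2 (Δ agY)) {sub 2 (sub 2 (X ⊕ ⊝ Y))} (ord-sub 2 (2 ℕ.* n) {sub 2 (X ⊕ ⊝ Y)} (ord-sub 2 n {X ⊕ ⊝ Y} oD)) (n ℕ.+ 1) n<4n)))))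
    step : ∀ n → (∀ m → m < n → X m ≡ Y m) → X n ≡ Y n
    step n ih = by-multiples 2 (λ n → (∀ m → m < n → X m ≡ Y m) → X n ≡ Y n) ev od n ih
      where
      ev : ∀ j → (∀ m → m < 2 ℕ.* j → X m ≡ Y m) → X (2 ℕ.* j) ≡ Y (2 ℕ.* j)
      ev zero    _  = trans (AGM.at-0 agX) (sym (AGM.at-0 agY))
      ev (suc j) ih = trans (even-coefficient agX (suc j)) (trans (ih (suc j) (ℕP.m<m+n (suc j) (s≤s z≤n))) (sym (even-coefficient agY (suc j))))
      od : ∀ n → ¬ 2 ∣ n → (∀ m → m < n → X m ≡ Y m) → X n ≡ Y n
      od 0             ¬d ih = ⊥-elim (¬d (divides 0 refl))
      od 1             ¬d ih = trans (AGM.at-1 agX) (sym (AGM.at-1 agY))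
      od (suc (suc n)) ¬d ih = odd (suc (suc n)) ih (s≤s (s≤s z≤n)) ¬d
    go : ∀ n m → m < n → X m ≡ Y m
    go (suc n) m (s≤s m≤n) with ℕP.m≤n⇒m<n∨m≡n m≤n
    ... | inj₁ m<n    = go n m m<n
    ... | inj₂ refl = step n (go n)

-- Theta series and sublattices of the Gaussian integers.

module Lattices where

  open Polynomials
  open SeriesRing
  open IntegerSums
  open Substitution
  open Families
  open Characters
  open RationalFamilies
  open Lines
  open SymmetricLines
  open Multiples

  sq : ℕ → Family
  sq k m = mono (k ℕ.* (∣ m ∣ ℕ.* ∣ m ∣))

  sq-loc : ∀ k .{{_ : ℕ.NonZero k}} → Loc (sq k)
  sq-loc k m i i<m = mono-ord (k ℕ.* (∣ m ∣ ℕ.* ∣ m ∣)) i (ℕP.<-≤-trans i<m (ℕP.≤-trans (m≤m² ∣ m ∣) (ℕP.m≤n*m (∣ m ∣ ℕ.* ∣ m ∣) k)))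
    where
    m≤m² : ∀ m → m ≤ m ℕ.* m
    m≤m² zero    = z≤n
    m≤m² (suc m) = ℕP.m≤m*n (suc m) (suc m)

  sq-even : ∀ k → Even (sq k)
  sq-even k m i = cong (λ j → mono (k ℕ.* (j ℕ.* j)) i) (ℤP.∣-i∣≡∣i∣ m)

  sub-sq : ∀ k .{{_ : ℕ.NonZero k}} m → sub k (sq 1 m) ≋ sq k m
  sub-sq k m i = trans (sub-mono k (1 ℕ.* (∣ m ∣ ℕ.* ∣ m ∣)) i) (cong (λ j → mono (k ℕ.* j) i) (ℕP.*-identityˡ (∣ m ∣ ℕ.* ∣ m ∣)))

  sub-ΣZ-sq : ∀ k .{{_ : ℕ.NonZero k}} α → sub k (ΣZ (wt α (sq 1))) ≋ ΣZ (wt α (sq k))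
  sub-ΣZ-sq k α = ≋-trans (sub-ΣZ k (wt-loc α (sq-loc 1))) (ΣZ-cong (λ m → ≋-trans (sub-⊙ k (α m) (sq 1 m)) (⊙-cong (α m) (sub-sq k m))))

  -- The Gaussian integers divisible by 1 + t i, in ℤ².
  module Lattice (t : ℕ) .{{_ : ℕ.NonZero t}} where
    k : ℕ
    k = 1 ℕ.+ t ℕ.* t

    norm : ℤ → ℤ → ℕ
    norm m n = ∣ m ∣ ℕ.* ∣ m ∣ ℕ.+ ∣ n ∣ ℕ.* ∣ n ∣

    +k : + k ≡ + 1 + + t * + t
    +k = cong (λ z → + 1 + z) (ℤP.pos-* t t)

    abs² : ∀ m → + (∣ m ∣ ℕ.* ∣ m ∣) ≡ m * m
    abs² (+ m)    = ℤP.pos-* m m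
    abs² -[1+ m ] = refl

    norm-lattice : ∀ x y → norm (x + - (+ t * y)) (+ t * x + y) ≡ k ℕ.* norm x y
    norm-lattice x y = ℤP.+-injective (trans (trans (cong₂ _+_ (abs² (x + - (+ t * y))) (abs² (+ t * x + y))) (ring (+ t) x y))
      (sym (trans (ℤP.pos-* k (norm x y)) (cong₂ _*_ +k (cong₂ _+_ (abs² x) (abs² y))))))
      where ring : ∀ t x y → (x + - (t * y)) * (x + - (t * y)) + (t * x + y) * (t * x + y) ≡ (+ 1 + t * t) * (x * x + y * y)
            ring = solve-∀

    square≤ : ∀ m n i → m ℕ.* m ℕ.+ n ℕ.* n ≡ i → m ≤ i × n ≤ i
    square≤ m n i refl = ℕP.≤-trans (m≤m² m) (ℕP.m≤m+n (m ℕ.* m) (n ℕ.* n)) , ℕP.≤-trans (m≤m² n) (ℕP.m≤n+m (n ℕ.* n) (m ℕ.* m))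
      where
      m≤m² : ∀ m → m ≤ m ℕ.* m
      m≤m² zero    = z≤n
      m≤m² (suc m) = ℕP.m≤m*n (suc m) (suc m)

    combine≤ : ∀ m n i → ∣ m ∣ ≤ i → ∣ n ∣ ≤ i → ∣ m + + t * n ∣ ≤ i ℕ.+ t ℕ.* i
    combine≤ m n i p q = ℕP.≤-trans (ℤP.∣i+j∣≤∣i∣+∣j∣ m (+ t * n)) (ℕP.+-mono-≤ p (subst (_≤ t ℕ.* i) (sym (ℤP.abs-* (+ t) n)) (ℕP.*-monoʳ-≤ t q)))

    k-cancel : ∀ x i → ∣ + k * x ∣ ≤ i ℕ.+ t ℕ.* i → ∣ x ∣ ≤ i
    k-cancel x i h = ℕP.*-cancelˡ-≤ k (ℕP.≤-trans (subst (_≤ i ℕ.+ t ℕ.* i) (ℤP.abs-* (+ k) x) h) (ℕP.+-monoʳ-≤ i (ℕP.*-monoˡ-≤ i (ℕP.m≤m*n t t))))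

    Q : ℕ → ℤ → ℤ → Series
    Q c m n = mono (c ℕ.* norm m n)

    -- In the row of a fixed n the admissible m are k x - t n. The shift n = y + t x then turns (m ,
    -- n) into (x - t y , t x + y), whose norm is k times that of (x , y). The window i + t i is
    -- large enough for m + t n before the division by k.
    lattice-sum : ∀ (H : ℤ → ℤ → ℤ) → 𝔻 (λ m n → when ⌊ k ∣? ∣ m + + t * n ∣ ⌋ (H m n)) (Q 1) ≋ 𝔻 (λ x y → H (x + - (+ t * y)) (+ t * x + y)) (Q k)
    lattice-sum H i = begin
      sumℤ i (λ m → sumℤ i (λ n → when ⌊ k ∣? ∣ m + + t * n ∣ ⌋ (H m n) * Q 1 m n i))
        ≡⟨ trans (sumℤ-cong i (λ m → sumℤ-cong i (λ n → pull ⌊ k ∣? ∣ m + + t * n ∣ ⌋ (H m n) (Q 1 m n i)))) (sumℤ-swap i i _) ⟩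
      sumℤ i (λ n → sumℤ i (λ m → when ⌊ k ∣? ∣ m + + t * n ∣ ⌋ (f m n)))
        ≡⟨ sumℤ-cong i row ⟩
      sumℤ i (λ n → sumℤ i (λ x → f (+ k * x + - (+ t * n)) n))
        ≡⟨ sumℤ-swap i i _ ⟩
      sumℤ i (λ x → sumℤ i (λ n → f (+ k * x + - (+ t * n)) n))
        ≡⟨ sumℤ-cong i (λ x → sym (sumℤ-shift i i (+ t * x) (λ n → f (+ k * x + - (+ t * n)) n) (λ n z → proj₂ (bound _ n z) , column x n z))) ⟩
      sumℤ i (λ x → sumℤ i (λ y → f (+ k * x + - (+ t * (y + + t * x))) (y + + t * x)))
        ≡⟨ sumℤ-cong i (λ x → sumℤ-cong i (λ y → trans (cong₂ f (trans (cong (λ K → K * x + - (+ t * (y + + t * x))) +k) (ring₁ (+ t) x y)) (ℤP.+-comm y (+ t * x)))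
             (cong (λ j → H (x + - (+ t * y)) (+ t * x + y) * mono j i) (trans (ℕP.*-identityˡ _) (norm-lattice x y))))) ⟩
      sumℤ i (λ x → sumℤ i (λ y → H (x + - (+ t * y)) (+ t * x + y) * Q k x y i)) ∎
      where
      open ≡-Reasoning
      L = i ℕ.+ t ℕ.* i
      f : ℤ → ℤ → ℤ
      f m n = H m n * Q 1 m n i
      pull : ∀ b h x → when b h * x ≡ when b (h * x)
      pull true  h x = refl
      pull false h x = ℤP.*-zeroˡ x
      ring₁ : ∀ t x y → (+ 1 + t * t) * x + - (t * (y + t * x)) ≡ x + - (t * y)
      ring₁ = solve-∀
      ring₂ : ∀ t x n → n + t * - ((+ 1 + t * t) * x + - (t * n)) ≡ (+ 1 + t * t) * (n + - (t * x))
      ring₂ = solve-∀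
      cancel₁ : ∀ m s → (m + s) + - s ≡ m
      cancel₁ = solve-∀
      cancel₂ : ∀ m s → (m + - s) + s ≡ m
      cancel₂ = solve-∀
      bound : ∀ m n → f m n ≢ + 0 → ∣ m ∣ ≤ i × ∣ n ∣ ≤ i
      bound m n z = square≤ ∣ m ∣ ∣ n ∣ i (trans (sym (ℕP.*-identityˡ _)) (mono-≢ (1 ℕ.* norm m n) i (λ e → z (trans (cong (H m n *_) e) (ℤP.*-zeroʳ (H m n))))))
      column : ∀ x n → f (+ k * x + - (+ t * n)) n ≢ + 0 → ∣ n + - (+ t * x) ∣ ≤ i
      column x n z = k-cancel (n + - (+ t * x)) i (subst (λ j → ∣ j ∣ ≤ L) (trans (cong (λ K → n + + t * - (K * x + - (+ t * n))) +k) (trans (ring₂ (+ t) x n) (cong (_* (n + - (+ t * x))) (sym +k))))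
        (combine≤ n (- (+ k * x + - (+ t * n))) i (proj₂ (bound _ n z)) (subst (_≤ i) (sym (ℤP.∣-i∣≡∣i∣ (+ k * x + - (+ t * n)))) (proj₁ (bound _ n z)))))
      row : ∀ n → sumℤ i (λ m → when ⌊ k ∣? ∣ m + + t * n ∣ ⌋ (f m n)) ≡ sumℤ i (λ x → f (+ k * x + - (+ t * n)) n)
      row n = begin
        sumℤ i (λ m → when ⌊ k ∣? ∣ m + + t * n ∣ ⌋ (f m n))
          ≡⟨ sumℤ-cong i (λ m → cong (λ j → when ⌊ k ∣? ∣ m + + t * n ∣ ⌋ (f j n)) (sym (cancel₁ m (+ t * n)))) ⟩
        sumℤ i (λ m → g (m + + t * n))
          ≡⟨ sumℤ-shift L i (+ t * n) g (λ j z → wide j (proj₂ (when-≢ (k ∣? ∣ j ∣) _ z)) , proj₁ (bound _ n (proj₂ (when-≢ (k ∣? ∣ j ∣) _ z)))) ⟩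
        sumℤ L g
          ≡⟨ sumℤ-multiples k L (λ j → f (j + - (+ t * n)) n) wide ⟩
        sumℤ L (λ x → f (+ k * x + - (+ t * n)) n)
          ≡⟨ sumℤ-extend i L (λ x → f (+ k * x + - (+ t * n)) n) (λ x z → let b = k-cancel x i (wide (+ k * x) z) in b , ℕP.≤-trans b (ℕP.m≤m+n i (t ℕ.* i))) ⟩
        sumℤ i (λ x → f (+ k * x + - (+ t * n)) n) ∎
        where
        g : ℤ → ℤ
        g j = when ⌊ k ∣? ∣ j ∣ ⌋ (f (j + - (+ t * n)) n)
        wide : ∀ j → f (j + - (+ t * n)) n ≢ + 0 → ∣ j ∣ ≤ L
        wide j z = subst (λ l → ∣ l ∣ ≤ L) (cancel₂ j (+ t * n)) (combine≤ (j + - (+ t * n)) n i (proj₁ (bound _ n z)) (proj₂ (bound _ n z)))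

    Q-⊛ : ∀ c m n → Q c m n ≋ sq c m ⊛ sq c n
    Q-⊛ c m n = ≋-trans (λ i → cong (λ j → mono j i) (ℕP.*-distribˡ-+ c (∣ m ∣ ℕ.* ∣ m ∣) (∣ n ∣ ℕ.* ∣ n ∣))) (mono-+ (c ℕ.* (∣ m ∣ ℕ.* ∣ m ∣)) (c ℕ.* (∣ n ∣ ℕ.* ∣ n ∣)))

    lattice : ∀ (H : ℤ → ℤ → ℤ) → dsum (λ m n → when ⌊ k ∣? ∣ m + + t * n ∣ ⌋ (H m n)) (sq 1) (sq 1) ≋ dsum (λ x y → H (x + - (+ t * y)) (+ t * x + y)) (sq k) (sq k)
    lattice H = ≋-trans (λ i → sumℤ-cong i (λ m → sumℤ-cong i (λ n → cong (when ⌊ k ∣? ∣ m + + t * n ∣ ⌋ (H m n) *_) (sym (Q-⊛ 1 m n i)))))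
      (≋-trans (lattice-sum H) (λ i → sumℤ-cong i (λ x → sumℤ-cong i (λ y → cong (H (x + - (+ t * y)) (+ t * x + y) *_) (Q-⊛ k x y i)))))

  A a B b C D c d S X : Series
  A = ΣZ (sq 1)
  a = ΣZ (wt sgnᶻ (sq 1))
  B = sub 5 A
  b = sub 5 a
  C = sub 2 A
  D = sub 10 A
  c = sub 2 a
  d = sub 10 a
  S = ΣZ (wt sᶻ (sq 1))
  X = ΣZ (wt χᶻ (sq 1))

  dsum-swap : ∀ H F G → dsum H F G ≋ dsum (λ m n → H n m) G F
  dsum-swap H F G i = trans (sumℤ-swap i i _) (sumℤ-cong i (λ n → sumℤ-cong i (λ m → cong (H m n *_) (⊛-comm (F m) (G n) i))))

  dsum-wtʳ : ∀ H β F G → dsum H F (wt β G) ≋ dsum (λ m n → H m n * β n) F G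
  dsum-wtʳ H β F G i = sumℤ-cong i (λ m → sumℤ-cong i (λ n → trans (cong (H m n *_) (⊛-⊙ (β n) (F m) (G n) i)) (sym (ℤP.*-assoc (H m n) (β n) _))))

  wt-1 : ∀ F → ΣZ (wt (λ _ → + 1) F) ≋ ΣZ F
  wt-1 F = ΣZ-cong {wt (λ _ → + 1) F} {F} (λ m i → ℤP.*-identityˡ (F m i))

  sq-1 : ∀ α β → dsum (λ m n → α m * β n) (sq 1) (sq 1) ≋ ΣZ (wt α (sq 1)) ⊛ ΣZ (wt β (sq 1))
  sq-1 α β = dsum-prod α β (sq-loc 1) (sq-loc 1)

  sq-k : ∀ k .{{_ : ℕ.NonZero k}} α β → dsum (λ m n → α m * β n) (sq k) (sq k) ≋ sub k (ΣZ (wt α (sq 1))) ⊛ sub k (ΣZ (wt β (sq 1)))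
  sq-k k α β = ≋-trans (dsum-prod α β (sq-loc k) (sq-loc k)) (⊛-cong (≋-sym (sub-ΣZ-sq k α)) (≋-sym (sub-ΣZ-sq k β)))

  private
    cancel2 : ∀ {f g} → (+ 2) ⊙ f ≋ (+ 2) ⊙ g → f ≋ g
    cancel2 {f} {g} e n = ℤP.*-cancelˡ-≡ (+ 2) (f n) (g n) (e n)

    when-* : ∀ b x y → x * when b y ≡ when b (x * y)
    when-* true  x y = refl
    when-* false x y = ℤP.*-zeroʳ x

  -- Exchanging m and n replaces (-1)ⁿ by (-1)ᵐ = (-1)^(m+n) (-1)ⁿ. Twice the sum thus carries the
  -- factor 1 + (-1)^(m+n) and lives on the sublattice m + n even, where m + n = 2x, n = x + y and
  -- the weight separates.
  conv : ∀ (h : ℤ → ℤ) → dsum (λ m n → h (m + n) * sgnᶻ n) (sq 1) (sq 1) ≋ sub 2 (ΣZ (wt (λ x → h (+ 2 * x) * sgnᶻ x) (sq 1))) ⊛ c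
  conv h = cancel2 {dsum (λ m n → h (m + n) * sgnᶻ n) (sq 1) (sq 1)} {sub 2 (ΣZ (wt (λ x → h (+ 2 * x) * sgnᶻ x) (sq 1))) ⊛ c} (≋-trans
    (λ i → trans (two (Y i)) (cong (λ z → Y i + z) (dsum-swap (λ m n → h (m + n) * sgnᶻ n) (sq 1) (sq 1) i)))
    (≋-trans (≋-sym (dsum-+ (λ m n → h (m + n) * sgnᶻ n) (λ m n → h (n + m) * sgnᶻ m) (sq 1) (sq 1)))
    (≋-trans (dsum-cong (sq 1) (sq 1) collapse)
    (≋-trans (Lattice.lattice 1 (λ m n → (h (m + n) * sgnᶻ n) * + 2))
    (≋-trans (dsum-cong (sq 2) (sq 2) unfold)
    (≋-trans (dsum-*ˡ (+ 2) (λ x y → (h (+ 2 * x) * sgnᶻ x) * sgnᶻ y) (sq 2) (sq 2))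
      (⊙-cong (+ 2) (sq-k 2 (λ x → h (+ 2 * x) * sgnᶻ x) sgnᶻ))))))))
    where
    Y = dsum (λ m n → h (m + n) * sgnᶻ n) (sq 1) (sq 1)
    two : ∀ x → + 2 * x ≡ x + x
    two = solve-∀
    factor : ∀ h s t → h * t + h * (s * t) ≡ (h * t) * (s + + 1)
    factor = solve-∀
    flip : ∀ s t → (s * t) * t ≡ s * (t * t)
    flip = solve-∀
    collapse : ∀ m n → h (m + n) * sgnᶻ n + h (n + m) * sgnᶻ m ≡ when ⌊ 2 ∣? ∣ m + + 1 * n ∣ ⌋ ((h (m + n) * sgnᶻ n) * + 2)
    collapse m n = begin
      h (m + n) * sgnᶻ n + h (n + m) * sgnᶻ m
        ≡⟨ cong₂ (λ j s → h (m + n) * sgnᶻ n + h j * s) (ℤP.+-comm n m) (sym (trans (cong (_* sgnᶻ n) (sgnᶻ-+ m n)) (trans (flip (sgnᶻ m) (sgnᶻ n)) (trans (cong (sgnᶻ m *_) (sgn-sgn ∣ n ∣)) (ℤP.*-identityʳ (sgnᶻ m)))))) ⟩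
      h (m + n) * sgnᶻ n + h (m + n) * (sgnᶻ (m + n) * sgnᶻ n)
        ≡⟨ factor (h (m + n)) (sgnᶻ (m + n)) (sgnᶻ n) ⟩
      (h (m + n) * sgnᶻ n) * (sgnᶻ (m + n) + + 1)
        ≡⟨ cong ((h (m + n) * sgnᶻ n) *_) (sgn-2∣ ∣ m + n ∣) ⟩
      (h (m + n) * sgnᶻ n) * when ⌊ 2 ∣? ∣ m + n ∣ ⌋ (+ 2)
        ≡⟨ when-* ⌊ 2 ∣? ∣ m + n ∣ ⌋ (h (m + n) * sgnᶻ n) (+ 2) ⟩
      when ⌊ 2 ∣? ∣ m + n ∣ ⌋ ((h (m + n) * sgnᶻ n) * + 2)
        ≡⟨ cong (λ j → when ⌊ 2 ∣? ∣ m + j ∣ ⌋ ((h (m + n) * sgnᶻ n) * + 2)) (sym (ℤP.*-identityˡ n)) ⟩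
      when ⌊ 2 ∣? ∣ m + + 1 * n ∣ ⌋ ((h (m + n) * sgnᶻ n) * + 2) ∎
      where open ≡-Reasoning
    unfold : ∀ x y → (h ((x + - (+ 1 * y)) + (+ 1 * x + y)) * sgnᶻ (+ 1 * x + y)) * + 2 ≡ + 2 * ((h (+ 2 * x) * sgnᶻ x) * sgnᶻ y)
    unfold x y = trans (cong₂ (λ j s → (h j * s) * + 2) (ring x y) (trans (cong (λ j → sgnᶻ (j + y)) (ℤP.*-identityˡ x)) (sgnᶻ-+ x y))) (shuffle (h (+ 2 * x)) (sgnᶻ x) (sgnᶻ y))
      where
      ring : ∀ x y → (x + - (+ 1 * y)) + (+ 1 * x + y) ≡ + 2 * x
      ring = solve-∀
      shuffle : ∀ h s t → (h * (s * t)) * + 2 ≡ + 2 * ((h * s) * t)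
      shuffle = solve-∀

  -- 1 + (-1)^(m+n) is twice the indicator of the lattice generated by 1 + i, which is similar to ℤ²
  -- with ratio of norms 2.
  A²+a² : A ⊛ A ⊕ a ⊛ a ≋ (+ 2) ⊙ (C ⊛ C)
  A²+a² = ≋-trans (⊕-cong (≋-sym (≋-trans (sq-1 (λ _ → + 1) (λ _ → + 1)) (⊛-cong (wt-1 (sq 1)) (wt-1 (sq 1))))) (≋-sym (sq-1 sgnᶻ sgnᶻ)))
    (≋-trans (≋-sym (dsum-+ (λ _ _ → + 1) (λ m n → sgnᶻ m * sgnᶻ n) (sq 1) (sq 1)))
    (≋-trans (dsum-cong (sq 1) (sq 1) (λ m n → trans (ℤP.+-comm (+ 1) (sgnᶻ m * sgnᶻ n)) (trans (cong (_+ + 1) (sym (sgnᶻ-+ m n)))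
      (trans (sgn-2∣ ∣ m + n ∣) (cong (λ j → when ⌊ 2 ∣? ∣ m + j ∣ ⌋ (+ 2)) (sym (ℤP.*-identityˡ n)))))))
    (≋-trans (Lattice.lattice 1 (λ _ _ → + 2))
    (≋-trans (dsum-*ˡ (+ 2) (λ _ _ → + 1) (sq 2) (sq 2)) (⊙-cong (+ 2) (≋-trans (sq-k 2 (λ _ → + 1) (λ _ → + 1)) (⊛-cong (sub-cong 2 (wt-1 (sq 1))) (sub-cong 2 (wt-1 (sq 1))))))))))

  Aa : A ⊛ a ≋ c ⊛ c
  Aa = ≋-trans (⊛-congʳ a (≋-sym (wt-1 (sq 1)))) (≋-trans (≋-sym (sq-1 (λ _ → + 1) sgnᶻ)) (≋-trans (conv (λ _ → + 1))
    (⊛-congʳ c (sub-cong 2 (ΣZ-cong (λ m i → cong (_* sq 1 m i) (ℤP.*-identityˡ (sgnᶻ m))))))))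

  twist-sq : ∀ m → twist (sq 1 m) ≋ sgnᶻ m ⊙ sq 1 m
  twist-sq m n with n ℕ.≟ 1 ℕ.* (∣ m ∣ ℕ.* ∣ m ∣)
  ... | yes refl = cong (_* sq 1 m n) (trans (cong sgn (ℕP.*-identityˡ (∣ m ∣ ℕ.* ∣ m ∣))) (square ∣ m ∣))
    where
    square : ∀ j → sgn (j ℕ.* j) ≡ sgn j
    square zero    = refl
    square (suc j) = cong -_ (trans (cong (λ z → sgn (j ℕ.+ z)) (ℕP.*-suc j j)) (trans (sgn-+ j (j ℕ.+ j ℕ.* j)) (trans (cong (sgn j *_) (sgn-+ j (j ℕ.* j)))
      (trans (sym (ℤP.*-assoc (sgn j) (sgn j) (sgn (j ℕ.* j)))) (trans (cong (_* sgn (j ℕ.* j)) (sgn-sgn j)) (trans (ℤP.*-identityˡ _) (square j)))))))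
  ... | no  n≢ = trans (cong (sgn n *_) z) (trans (ℤP.*-zeroʳ (sgn n)) (sym (trans (cong (sgnᶻ m *_) z) (ℤP.*-zeroʳ (sgnᶻ m)))))
    where
    z : sq 1 m n ≡ + 0
    z with sq 1 m n ℤ.≟ + 0
    ... | yes e = e
    ... | no ¬e = ⊥-elim (n≢ (sym (mono-≢ (1 ℕ.* (∣ m ∣ ℕ.* ∣ m ∣)) n ¬e)))

  twist-ΣZ-sq : ∀ α → twist (ΣZ (wt α (sq 1))) ≋ ΣZ (wt α (wt sgnᶻ (sq 1)))
  twist-ΣZ-sq α = ≋-trans (twist-ΣZ (wt α (sq 1))) (ΣZ-cong (λ m → ≋-trans (twist-⊙ (α m) (sq 1 m)) (⊙-cong (α m) (twist-sq m))))

  twist-A : twist A ≋ a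
  twist-A = ≋-trans (twist-cong (≋-sym (wt-1 (sq 1)))) (≋-trans (twist-ΣZ-sq (λ _ → + 1)) (wt-1 (wt sgnᶻ (sq 1))))

-- Residues modulo 5 and the relation N² = ρ₁ ρ₅.

module ThetaNorms where

  open Polynomials
  open SeriesRing
  open Substitution
  open Families
  open Characters
  open RationalFamilies
  open SymmetricLines
  open Multiples
  open Lattices

  χ-double : ∀ m → χᶻ (+ 2 * m) ≡ - χᶻ m
  χ-double m = trans (cong χ₁ (ℤP.abs-* (+ 2) m)) (trans (χ₁-* 2 ∣ m ∣) (ℤP.-1*i≡-i (χ₁ ∣ m ∣)))

  s-double : ∀ m → sᶻ (+ 2 * m) ≡ sᶻ m
  s-double m = trans (cong s₅ (ℤP.abs-* (+ 2) m)) (trans (periodic-* 5 {s₅} s₅-periodic 2 ∣ m ∣)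
    (trans (residues 5 (λ r → s₅ (2 ℕ.* r)) s₅ (∣ m ∣ % 5) (m%n<n ∣ m ∣ 5)) (sym (s₅-periodic ∣ m ∣))))

  -- This is `s-law` at (m , 2n): χ(2n) = - χ(n) and s(2n) = s(n) turn + 5 into - 5. The two
  -- conditions 5 ∣ m ± 2n correspond to the two Gaussian primes above 5.
  norm-law : ∀ m n → (sᶻ m * sᶻ n + - + 5 * (χᶻ m * χᶻ n)) + + 4 * (+ 1 * + 1) ≡
             + 2 * (sᶻ (m + + 2 * n) + + 1) + + 2 * (sᶻ (m + + 2 * - n) + + 1)
  norm-law m n = trans (cong (_+ + 4) (sym (trans (trans (s-law m (+ 2 * n)) (cong₂ (λ x y → sᶻ m * x + + 5 * (χᶻ m * y)) (s-double n) (χ-double n))) (sign (sᶻ m * sᶻ n) (χᶻ m) (χᶻ n)))))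
    (trans (cong (λ j → + 2 * sᶻ (m + + 2 * n) + + 2 * sᶻ (m + j) + + 4) (ℤP.neg-distribʳ-* (+ 2) n)) (split₄ (sᶻ (m + + 2 * n)) (sᶻ (m + + 2 * - n))))
    where
    sign : ∀ a b c → a + + 5 * (b * - c) ≡ a + - + 5 * (b * c)
    sign = solve-∀
    split₄ : ∀ x y → (+ 2 * x + + 2 * y) + + 4 ≡ + 2 * (x + + 1) + + 2 * (y + + 1)
    split₄ = solve-∀

  -- The sublattice 5 ∣ m + 2n is similar to ℤ².
  A-norm : (S ⊛ S ⊕ (- + 5) ⊙ (X ⊛ X)) ⊕ (+ 4) ⊙ (A ⊛ A) ≋ (+ 20) ⊙ (B ⊛ B)
  A-norm = ≋-trans (≋-sym expand) (≋-trans (dsum-cong (sq 1) (sq 1) norm-law) (≋-trans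
      (dsum-+ (λ m n → + 2 * (sᶻ (m + + 2 * n) + + 1)) (λ m n → + 2 * (sᶻ (m + + 2 * - n) + + 1)) (sq 1) (sq 1))
      (≋-trans (⊕-cong (dsum-*ˡ (+ 2) (λ m n → sᶻ (m + + 2 * n) + + 1) (sq 1) (sq 1))
          (≋-trans (dsum-*ˡ (+ 2) (λ m n → sᶻ (m + + 2 * - n) + + 1) (sq 1) (sq 1)) (⊙-cong (+ 2) (dsum-flip (λ m n → sᶻ (m + + 2 * n) + + 1) (sq 1) (sq-even 1)))))
        (≋-trans (λ i → four (Y i)) (≋-trans (⊙-cong (+ 4) value) (λ i → sym (ℤP.*-assoc (+ 4) (+ 5) ((B ⊛ B) i))))))))
    where
    Y = dsum (λ m n → sᶻ (m + + 2 * n) + + 1) (sq 1) (sq 1)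
    four : ∀ x → + 2 * x + + 2 * x ≡ + 4 * x
    four = solve-∀
    expand : dsum (λ m n → (sᶻ m * sᶻ n + - + 5 * (χᶻ m * χᶻ n)) + + 4 * (+ 1 * + 1)) (sq 1) (sq 1) ≋ (S ⊛ S ⊕ (- + 5) ⊙ (X ⊛ X)) ⊕ (+ 4) ⊙ (A ⊛ A)
    expand = ≋-trans (dsum-+ (λ m n → sᶻ m * sᶻ n + - + 5 * (χᶻ m * χᶻ n)) (λ _ _ → + 4) (sq 1) (sq 1)) (⊕-cong
      (≋-trans (dsum-+ (λ m n → sᶻ m * sᶻ n) (λ m n → - + 5 * (χᶻ m * χᶻ n)) (sq 1) (sq 1))
        (⊕-cong (sq-1 sᶻ sᶻ) (≋-trans (dsum-*ˡ (- + 5) (λ m n → χᶻ m * χᶻ n) (sq 1) (sq 1)) (⊙-cong (- + 5) (sq-1 χᶻ χᶻ)))))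
      (≋-trans (dsum-*ˡ (+ 4) (λ _ _ → + 1 * + 1) (sq 1) (sq 1)) (⊙-cong (+ 4) (≋-trans (sq-1 (λ _ → + 1) (λ _ → + 1)) (⊛-cong (wt-1 (sq 1)) (wt-1 (sq 1)))))))
    value : Y ≋ (+ 5) ⊙ (B ⊛ B)
    value = ≋-trans (dsum-cong (sq 1) (sq 1) (λ m n → sᶻ-multiples (m + + 2 * n))) (≋-trans (Lattice.lattice 2 (λ _ _ → + 5))
      (≋-trans (dsum-*ˡ (+ 5) (λ _ _ → + 1) (sq 5) (sq 5)) (⊙-cong (+ 5) (≋-trans (sq-k 5 (λ _ → + 1) (λ _ → + 1)) (⊛-cong (sub-cong 5 (wt-1 (sq 1))) (sub-cong 5 (wt-1 (sq 1))))))))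

  Sa Xa : Series
  Sa = ΣZ (wt sᶻ (wt sgnᶻ (sq 1)))
  Xa = ΣZ (wt χᶻ (wt sgnᶻ (sq 1)))

  twist-sub₅ : ∀ f → twist (sub 5 f) ≋ sub 5 (twist f)
  twist-sub₅ f = by-multiples 5 (λ n → twist (sub 5 f) n ≡ sub 5 (twist f) n)
    (λ j → trans (cong (sgn (5 ℕ.* j) *_) (sub-at 5 f j)) (trans (cong (_* f j) (five j)) (sym (sub-at 5 (twist f) j))))
    (λ n ¬d → trans (cong (sgn n *_) (sub-∤ 5 f n ¬d)) (trans (ℤP.*-zeroʳ (sgn n)) (sym (sub-∤ 5 (twist f) n ¬d))))
    where
    five : ∀ j → sgn (5 ℕ.* j) ≡ sgn j
    five j = trans (sgn-+ j (4 ℕ.* j)) (trans (cong (sgn j *_) (trans (cong sgn (ℕP.*-assoc 2 2 j)) (sgn-even (2 ℕ.* j)))) (ℤP.*-identityʳ (sgn j)))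

  twist-B : twist B ≋ b
  twist-B = ≋-trans (twist-sub₅ A) (sub-cong 5 twist-A)

  a-norm : (Sa ⊛ Sa ⊕ (- + 5) ⊙ (Xa ⊛ Xa)) ⊕ (+ 4) ⊙ (a ⊛ a) ≋ (+ 20) ⊙ (b ⊛ b)
  a-norm = ≋-trans (≋-sym (≋-trans (twist-⊕ (S ⊛ S ⊕ (- + 5) ⊙ (X ⊛ X)) ((+ 4) ⊙ (A ⊛ A))) (⊕-cong
      (≋-trans (twist-⊕ (S ⊛ S) ((- + 5) ⊙ (X ⊛ X))) (⊕-cong (square S Sa (twist-ΣZ-sq sᶻ)) (≋-trans (twist-⊙ (- + 5) (X ⊛ X)) (⊙-cong (- + 5) (square X Xa (twist-ΣZ-sq χᶻ))))))
      (≋-trans (twist-⊙ (+ 4) (A ⊛ A)) (⊙-cong (+ 4) (square A a twist-A))))))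
    (≋-trans (twist-cong A-norm) (≋-trans (twist-⊙ (+ 20) (B ⊛ B)) (⊙-cong (+ 20) (square B b twist-B))))
    where
    square : ∀ f g → twist f ≋ g → twist (f ⊛ f) ≋ g ⊛ g
    square f g e = ≋-trans (twist-⊛ f f) (⊛-cong e e)

  sub2-b : sub 2 b ≋ d
  sub2-b = sub-sub 2 5 10 a refl

  sub2-B : sub 2 B ≋ D
  sub2-B = sub-sub 2 5 10 A refl

  c-norm : (sub 2 Sa ⊛ sub 2 Sa ⊕ (- + 5) ⊙ (sub 2 Xa ⊛ sub 2 Xa)) ⊕ (+ 4) ⊙ (c ⊛ c) ≋ (+ 20) ⊙ (d ⊛ d)
  c-norm = ≋-trans (≋-sym (≋-trans (sub-⊕ 2 (Sa ⊛ Sa ⊕ (- + 5) ⊙ (Xa ⊛ Xa)) ((+ 4) ⊙ (a ⊛ a))) (⊕-cong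
      (≋-trans (sub-⊕ 2 (Sa ⊛ Sa) ((- + 5) ⊙ (Xa ⊛ Xa))) (⊕-cong (sub-⊛ 2 Sa Sa) (≋-trans (sub-⊙ 2 (- + 5) (Xa ⊛ Xa)) (⊙-cong (- + 5) (sub-⊛ 2 Xa Xa)))))
      (≋-trans (sub-⊙ 2 (+ 4) (a ⊛ a)) (⊙-cong (+ 4) (sub-⊛ 2 a a))))))
    (≋-trans (sub-cong 2 a-norm) (≋-trans (sub-⊙ 2 (+ 20) (b ⊛ b)) (⊙-cong (+ 20) (≋-trans (sub-⊛ 2 b b) (⊛-cong sub2-b sub2-b)))))

  Bb : B ⊛ b ≋ d ⊛ d
  Bb = ≋-trans (≋-sym (sub-⊛ 5 A a)) (≋-trans (sub-cong 5 Aa) (≋-trans (sub-⊛ 5 c c) (⊛-cong (sub-sub 5 2 10 a refl) (sub-sub 5 2 10 a refl))))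

  B²+b² : B ⊛ B ⊕ b ⊛ b ≋ (+ 2) ⊙ (D ⊛ D)
  B²+b² = ≋-trans (≋-sym (≋-trans (sub-⊕ 5 (A ⊛ A) (a ⊛ a)) (⊕-cong (sub-⊛ 5 A A) (sub-⊛ 5 a a)))) (≋-trans (sub-cong 5 A²+a²)
    (≋-trans (sub-⊙ 5 (+ 2) (C ⊛ C)) (⊙-cong (+ 2) (≋-trans (sub-⊛ 5 C C) (⊛-cong (sub-sub 5 2 10 A refl) (sub-sub 5 2 10 A refl))))))

  private
    a-even : Even (wt sgnᶻ (sq 1))
    a-even m n = cong₂ _*_ (sgnᶻ-neg m) (sq-even 1 m n)
    a-loc : Loc (wt sgnᶻ (sq 1))
    a-loc = wt-loc sgnᶻ (sq-loc 1)

  conv-χ : S ⊛ Xa ⊕ X ⊛ Sa ≋ (- + 4) ⊙ (sub 2 Xa ⊛ c)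
  conv-χ = ≋-trans (≋-sym (χ-product (sq-loc 1) a-loc a-even)) (≋-trans (⊙-cong (+ 4) (≋-trans (dsum-wtʳ (λ m n → χᶻ (m + n)) sgnᶻ (sq 1) (sq 1)) (≋-trans (conv χᶻ)
    (≋-trans (⊛-congʳ c (≋-trans (sub-cong 2 (≋-trans (ΣZ-cong (λ m i → trans (cong (λ x → (x * sgnᶻ m) * sq 1 m i) (χ-double m)) (lem (χᶻ m) (sgnᶻ m) (sq 1 m i)))) (ΣZ-⊙ (- + 1) (wt χᶻ (wt sgnᶻ (sq 1)))))) (sub-⊙ 2 (- + 1) Xa)))
      (⊙-⊛ (- + 1) (sub 2 Xa) c))))) (λ i → sym (ℤP.*-assoc (+ 4) (- + 1) ((sub 2 Xa ⊛ c) i))))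
    where lem : ∀ x s q → (- x * s) * q ≡ - + 1 * (x * (s * q))
          lem = solve-∀

  conv-s : S ⊛ Sa ⊕ (+ 5) ⊙ (X ⊛ Xa) ≋ (+ 4) ⊙ (sub 2 Sa ⊛ c)
  conv-s = ≋-trans (≋-sym (s-product (sq-loc 1) a-loc a-even)) (⊙-cong (+ 4) (≋-trans (dsum-wtʳ (λ m n → sᶻ (m + n)) sgnᶻ (sq 1) (sq 1)) (≋-trans (conv sᶻ)
    (⊛-congʳ c (sub-cong 2 (ΣZ-cong (λ m i → trans (cong (λ x → (x * sgnᶻ m) * sq 1 m i) (s-double m)) (ℤP.*-assoc (sᶻ m) (sgnᶻ m) (sq 1 m i)))))))))

  const-regular : ∀ k → Regular (constS (+ suc k))
  const-regular k = regular₀ {constS (+ suc k)} (λ ())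

  -- S² - 5X² is a norm from ℤ[√5], hence multiplicative: by `conv-s` and `conv-χ` the product of
  -- `A-norm` and `a-norm` is 16 c² times `c-norm`. Divided by 16 this reads (5B² - A²)(5b² - a²) =
  -- 4 A a (5 B b - A a), of which the claim is a rearrangement.
  R₁ : (A ⊛ b ⊕ ⊝ (a ⊛ B)) ⊛ (A ⊛ b ⊕ ⊝ (a ⊛ B)) ≋ (B ⊛ b ⊕ ⊝ (A ⊛ a)) ⊛ ((+ 5) ⊙ (B ⊛ b) ⊕ ⊝ (A ⊛ a))
  R₁ = x-y≈0⇒x≈y (certify (A ∷ a ∷ B ∷ b ∷ c ∷ d ∷ S ∷ X ∷ Sa ∷ Xa ∷ sub 2 Sa ∷ sub 2 Xa ∷ []) (con (+ 80))
      ((vA :* vb :- va :* vB) :* (vA :* vb :- va :* vB) :- (vB :* vb :- vA :* va) :* ((+ 5) :· (vB :* vb) :- vA :* va))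
      ((vSa :* vSa :- con (+ 5) :* vXa :* vXa , e₁) ∷ (vS :* vS :- con (+ 5) :* vX :* vX :- e₁ , e₂)
        ∷ (con (- + 16) :* vc :* vc , e₃) ∷ (con (+ 5) :* (vS :* vXa :+ vX :* vSa :- con (+ 4) :* vXc :* vc) , e₄)
        ∷ (con (- + 1) :* (vS :* vSa :+ con (+ 5) :* vX :* vXa :+ con (+ 4) :* vSc :* vc) , e₅)
        ∷ (con (+ 64) :* (con (+ 5) :* vd :* vd :- vc :* vc :- vA :* va) , vA :* va :- vc :* vc)
        ∷ (con (+ 320) :* vA :* va , vB :* vb :- vd :* vd) ∷ [])
      (const-regular 79) (x≋y⇒x-y≋0 A-norm All.∷ x≋y⇒x-y≋0 a-norm All.∷ x≋y⇒x-y≋0 c-norm All.∷ x≋y⇒x-y≋0 conv-χ All.∷ x≋y⇒x-y≋0 conv-s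
        All.∷ x≋y⇒x-y≋0 Aa All.∷ x≋y⇒x-y≋0 Bb All.∷ All.[]))
    where
    vA = # 0F
    va = # 1F
    vB = # 2F
    vb = # 3F
    vc = # 4F
    vd = # 5F
    vS = # 6F
    vX = # 7F
    vSa = # 8F
    vXa = # 9F
    vSc vXc e₁ e₂ e₃ e₄ e₅ : Expr 12
    vSc = # Fin.suc 9F
    vXc = # Fin.suc (Fin.suc 9F)
    e₁ = (vS :* vS :+ (- + 5) :· (vX :* vX)) :+ (+ 4) :· (vA :* vA) :- (+ 20) :· (vB :* vB)
    e₂ = (vSa :* vSa :+ (- + 5) :· (vXa :* vXa)) :+ (+ 4) :· (va :* va) :- (+ 20) :· (vb :* vb)
    e₃ = (vSc :* vSc :+ (- + 5) :· (vXc :* vXc)) :+ (+ 4) :· (vc :* vc) :- (+ 20) :· (vd :* vd)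
    e₄ = vS :* vXa :+ vX :* vSa :- (- + 4) :· (vXc :* vc)
    e₅ = vS :* vSa :+ (+ 5) :· (vX :* vXa) :- (+ 4) :· (vSc :* vc)

-- Relations from residues of exponents modulo 4, and the link with φ.

module ThetaRelations where

  open Polynomials
  open SeriesRing
  open IntegerSums
  open Substitution
  open Families
  open RationalFamilies
  open Multiples
  open ArithmeticGeometricMean
  open Lattices
  open ThetaNorms

  sub-A : ∀ k .{{_ : ℕ.NonZero k}} → sub k A ≋ ΣZ (sq k)
  sub-A k = ≋-trans (sub-cong k (≋-sym (wt-1 (sq 1)))) (≋-trans (sub-ΣZ-sq k (λ _ → + 1)) (wt-1 (sq k)))

  A+a : a ⊕ A ≋ (+ 2) ⊙ sub 4 A
  A+a = ≋-trans (ΣZ-multiples 2 (+ 2) sgnᶻ (sq-loc 1) (λ m → sgn-2∣ ∣ m ∣)) (⊙-cong (+ 2) (≋-trans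
    (ΣZ-cong (λ m i → cong (λ j → mono j i) (trans (cong (λ p → 1 ℕ.* (p ℕ.* p)) (ℤP.abs-* (+ 2) m)) (ring ∣ m ∣)))) (≋-sym (sub-A 4))))
    where
    ring : ∀ p → 1 ℕ.* ((2 ℕ.* p) ℕ.* (2 ℕ.* p)) ≡ 4 ℕ.* (p ℕ.* p)
    ring p = trans (ℕP.*-identityˡ _) (ℕP.[m*n]*[o*p]≡[m*o]*[n*p] 2 p 2 p)

  parity : ∀ p → (∃ λ l → p ≡ 2 ℕ.* l) ⊎ (∃ λ l → p ≡ 1 ℕ.+ 2 ℕ.* l)
  parity zero    = inj₁ (0 , refl)
  parity (suc p) with parity p
  ... | inj₁ (l , e) = inj₂ (l , cong suc e)
  ... | inj₂ (l , e) = inj₁ (suc l , trans (cong suc e) (cong suc (sym (ℕP.+-suc l (l ℕ.+ 0)))))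

  A-coefficient-0 : ∀ n → (∀ p → p ℕ.* p ≢ n) → A n ≡ + 0
  A-coefficient-0 n h = sumℤ-zero n (λ m _ → zero′ m)
    where
    zero′ : ∀ m → sq 1 m n ≡ + 0
    zero′ m with sq 1 m n ℤ.≟ + 0
    ... | yes e = e
    ... | no ¬e = ⊥-elim (h ∣ m ∣ (trans (sym (ℕP.*-identityˡ _)) (mono-≢ (1 ℕ.* (∣ m ∣ ℕ.* ∣ m ∣)) n ¬e)))

  O : Series
  O n = A (1 ℕ.+ 4 ℕ.* n)

  -- Odd squares are 1 modulo 4.
  A-split : A ≋ sub 4 A ⊕ mono 1 ⊛ sub 4 O
  A-split zero    = refl
  A-split (suc j) = sym (trans (cong (λ z → sub 4 A (suc j) + z) (mono-⊛-+ 1 (sub 4 O) j)) (by-multiples 4 (λ j → sub 4 A (suc j) + sub 4 O j ≡ A (suc j)) on off j))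
    where
    on : ∀ l → sub 4 A (suc (4 ℕ.* l)) + sub 4 O (4 ℕ.* l) ≡ A (suc (4 ℕ.* l))
    on l = trans (cong₂ _+_ (sub-∤ 4 A (suc (4 ℕ.* l)) (λ d → one∤ (∣m+n∣m⇒∣n (subst (4 ∣_) (ℕP.+-comm 1 (4 ℕ.* l)) d) (m∣m*n l)))) (sub-at 4 O l)) (ℤP.+-identityˡ _)
      where
      one∤ : ¬ 4 ∣ 1
      one∤ d with n∣m⇒m%n≡0 1 4 d
      ... | ()
    off : ∀ j → ¬ 4 ∣ j → sub 4 A (suc j) + sub 4 O j ≡ A (suc j)
    off j ¬d = trans (cong (λ z → sub 4 A (suc j) + z) (sub-∤ 4 O j ¬d)) (trans (ℤP.+-identityʳ _) (value (2 ∣? suc j)))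
      where
      value : Dec (2 ∣ suc j) → sub 4 A (suc j) ≡ A (suc j)
      value (yes (divides q e)) = sym (ℤP.*-cancelˡ-≡ (+ 2) _ _ (trans (two (A (suc j))) (trans
          (cong (_+ A (suc j)) (sym (trans (sym (twist-A (suc j))) (cong (_* A (suc j)) (trans (cong sgn (trans e (ℕP.*-comm q 2))) (sgn-even q))))))
          (A+a (suc j)))))
        where two : ∀ x → + 2 * x ≡ + 1 * x + x
              two = solve-∀
      value (no ¬e) = trans (sub-∤ 4 A (suc j) (λ d → ¬e (∣-trans (divides 2 refl) d))) (sym (A-coefficient-0 (suc j) square))
        where
        square : ∀ p → p ℕ.* p ≢ suc j
        square p q with parity p
        ... | inj₁ (l , refl) = ¬e (subst (2 ∣_) q (∣-trans (m∣m*n l) (m∣m*n (2 ℕ.* l))))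
        ... | inj₂ (l , refl) = ¬d (divides (l ℕ.+ l ℕ.* l) (ℕP.suc-injective (trans (sym q) (ring l))))
          where
          ring : ∀ l → (1 ℕ.+ 2 ℕ.* l) ℕ.* (1 ℕ.+ 2 ℕ.* l) ≡ 1 ℕ.+ (l ℕ.+ l ℕ.* l) ℕ.* 4
          ring = ℕR.solve-∀

  mono-5 : mono 5 ≋ mono 1 ⊛ mono 4
  mono-5 = mono-+ 1 4

  T₅ Z₄ : Series
  T₅ = mono 1 ⊛ sub 5 O
  Z₄ = O ⊛ B ⊕ ⊝ (A ⊛ T₅)

  B-split : B ≋ sub 4 B ⊕ mono 1 ⊛ sub 4 T₅
  B-split = ≋-trans (sub-cong 5 A-split) (≋-trans (sub-⊕ 5 (sub 4 A) (mono 1 ⊛ sub 4 O)) (⊕-cong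
    (≋-trans (sub-sub 5 4 20 A refl) (≋-sym (sub-sub 4 5 20 A refl)))
    (≋-trans (sub-⊛ 5 (mono 1) (sub 4 O)) (≋-trans (⊛-cong (≋-trans (sub-mono₁ 5) mono-5) (≋-trans (sub-sub 5 4 20 O refl) (≋-sym (sub-sub 4 5 20 O refl))))
      (≋-trans (⊛-assoc (mono 1) (mono 4) (sub 4 (sub 5 O))) (⊛-congˡ (mono 1) (≋-sym (≋-trans (sub-⊛ 4 (mono 1) (sub 5 O)) (⊛-congʳ (sub 4 (sub 5 O)) (sub-mono₁ 4))))))))))

  B+b : b ⊕ B ≋ (+ 2) ⊙ sub 4 B
  B+b = ≋-trans (≋-sym (sub-⊕ 5 a A)) (≋-trans (sub-cong 5 A+a) (≋-trans (sub-⊙ 5 (+ 2) (sub 4 A)) (⊙-cong (+ 2) (≋-trans (sub-sub 5 4 20 A refl) (≋-sym (sub-sub 4 5 20 A refl))))))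

  N : Series
  N = A ⊛ b ⊕ ⊝ (a ⊛ B)

  -- Splitting A = α + q o with α and o series in q⁴, one has a = α - q o. Likewise B = β + q t and
  -- b = β - q t, because q⁵ = q · q⁴ puts the odd part of B into the same class. In A b - a B only
  -- the mixed products survive, doubled.
  N-support : N ≋ (+ 2) ⊙ (mono 1 ⊛ sub 4 Z₄)
  N-support = ≋-trans (x-y≈0⇒x≈y (certify (A ∷ a ∷ B ∷ b ∷ sub 4 A ∷ sub 4 B ∷ sub 4 O ∷ sub 4 T₅ ∷ mono 1 ∷ []) (con (+ 1))
      ((# 0F :* # 3F :- # 1F :* # 2F) :- (+ 2) :· (# 8F :* (# 6F :* # 5F :- # 4F :* # 7F)))
      ((# 0F , # 3F :+ # 2F :- (+ 2) :· # 5F) ∷ (con (- + 1) :* # 2F , # 1F :+ # 0F :- (+ 2) :· # 4F)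
        ∷ (con (+ 2) :* # 5F , # 0F :- (# 4F :+ # 8F :* # 6F)) ∷ (con (- + 2) :* # 4F , # 2F :- (# 5F :+ # 8F :* # 7F)) ∷ [])
      regular₁ (x≋y⇒x-y≋0 B+b All.∷ x≋y⇒x-y≋0 A+a All.∷ x≋y⇒x-y≋0 A-split All.∷ x≋y⇒x-y≋0 B-split All.∷ All.[])))
    (⊙-cong (+ 2) (⊛-congˡ (mono 1) (≋-sym (≋-trans (sub-⊕ 4 (O ⊛ B) (⊝ (A ⊛ T₅))) (⊕-cong (sub-⊛ 4 O B) (≋-trans (sub-⊝ 4 (A ⊛ T₅)) (⊝-cong (sub-⊛ 4 A T₅))))))))

  form : Series → Series → Series
  form x y = (y ⊛ y ⊕ ⊝ (x ⊛ x)) ⊛ ((+ 5) ⊙ (y ⊛ y) ⊕ ⊝ (x ⊛ x))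

  private
    form-cong : ∀ {x y x′ y′} → x ≋ x′ → y ≋ y′ → form x y ≋ form x′ y′
    form-cong e e′ = ⊛-cong (⊕-cong (⊛-cong e′ e′) (⊝-cong (⊛-cong e e))) (⊕-cong (⊙-cong (+ 5) (⊛-cong e′ e′)) (⊝-cong (⊛-cong e e)))

    sub-form : ∀ x y → sub 2 (form x y) ≋ form (sub 2 x) (sub 2 y)
    sub-form x y = ≋-trans (sub-⊛ 2 (y ⊛ y ⊕ ⊝ (x ⊛ x)) ((+ 5) ⊙ (y ⊛ y) ⊕ ⊝ (x ⊛ x))) (⊛-cong
      (≋-trans (sub-⊕ 2 (y ⊛ y) (⊝ (x ⊛ x))) (⊕-cong (sub-⊛ 2 y y) (≋-trans (sub-⊝ 2 (x ⊛ x)) (⊝-cong (sub-⊛ 2 x x)))))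
      (≋-trans (sub-⊕ 2 ((+ 5) ⊙ (y ⊛ y)) (⊝ (x ⊛ x))) (⊕-cong (≋-trans (sub-⊙ 2 (+ 5) (y ⊛ y)) (⊙-cong (+ 5) (sub-⊛ 2 y y))) (≋-trans (sub-⊝ 2 (x ⊛ x)) (⊝-cong (sub-⊛ 2 x x))))))

    twist-form : ∀ x y → twist (form x y) ≋ form (twist x) (twist y)
    twist-form x y = ≋-trans (twist-⊛ (y ⊛ y ⊕ ⊝ (x ⊛ x)) ((+ 5) ⊙ (y ⊛ y) ⊕ ⊝ (x ⊛ x))) (⊛-cong
      (≋-trans (twist-⊕ (y ⊛ y) (⊝ (x ⊛ x))) (⊕-cong (twist-⊛ y y) (≋-trans (twist-⊝ (x ⊛ x)) (⊝-cong (twist-⊛ x x)))))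
      (≋-trans (twist-⊕ ((+ 5) ⊙ (y ⊛ y)) (⊝ (x ⊛ x))) (⊕-cong (≋-trans (twist-⊙ (+ 5) (y ⊛ y)) (⊙-cong (+ 5) (twist-⊛ y y))) (≋-trans (twist-⊝ (x ⊛ x)) (⊝-cong (twist-⊛ x x))))))

  -- N is supported on exponents 1 modulo 4, so N² = ρ₁ ρ₅ = form(a, b)(q²) on exponents 2 modulo 4.
  form-odd : form a b ≋ (+ 4) ⊙ (mono 1 ⊛ sub 2 (Z₄ ⊛ Z₄))
  form-odd = sub-inj 2 (≋-trans (sub-form a b) (≋-trans (form-cong (≋-refl {c}) sub2-b) (≋-trans
      (x-y≈0⇒x≈y (certify (A ∷ a ∷ B ∷ b ∷ c ∷ d ∷ mono 1 ∷ sub 4 Z₄ ∷ []) (con (+ 1))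
        ((# 5F :* # 5F :- # 4F :* # 4F) :* ((+ 5) :· (# 5F :* # 5F) :- # 4F :* # 4F) :- (+ 4) :· ((# 6F :* # 6F) :* (# 7F :* # 7F)))
        ((con (+ 1) :* (# 0F :* # 3F :- # 1F :* # 2F :+ con (+ 2) :* # 6F :* # 7F) , (# 0F :* # 3F :- # 1F :* # 2F) :- (+ 2) :· (# 6F :* # 7F))
          ∷ (con (- + 1) , (# 0F :* # 3F :- # 1F :* # 2F) :* (# 0F :* # 3F :- # 1F :* # 2F) :- (# 2F :* # 3F :- # 0F :* # 1F) :* ((+ 5) :· (# 2F :* # 3F) :- # 0F :* # 1F))
          ∷ ((con (+ 5) :* # 2F :* # 3F :- # 0F :* # 1F) :+ (# 5F :* # 5F :- # 4F :* # 4F) , # 0F :* # 1F :- # 4F :* # 4F)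
          ∷ (con (- + 1) :* (con (+ 5) :* # 2F :* # 3F :- # 0F :* # 1F) :- con (+ 5) :* (# 5F :* # 5F :- # 4F :* # 4F) , # 2F :* # 3F :- # 5F :* # 5F) ∷ [])
        regular₁ (x≋y⇒x-y≋0 N-support All.∷ x≋y⇒x-y≋0 R₁ All.∷ x≋y⇒x-y≋0 Aa All.∷ x≋y⇒x-y≋0 Bb All.∷ All.[])))
      (≋-sym (≋-trans (sub-⊙ 2 (+ 4) (mono 1 ⊛ sub 2 (Z₄ ⊛ Z₄))) (⊙-cong (+ 4) (≋-trans (sub-⊛ 2 (mono 1) (sub 2 (Z₄ ⊛ Z₄))) (⊛-cong
        (≋-trans (sub-mono₁ 2) (mono-+ 1 1)) (≋-trans (sub-sub 2 2 4 (Z₄ ⊛ Z₄) refl) (sub-⊛ 4 Z₄ Z₄))))))))))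

  -- By `form-odd` the series form a b has odd exponents only, so its value at - q, which is form A
  -- B, is its negative.
  R₂ : form A B ⊕ form a b ≋ zeroS
  R₂ n = trans (cong (_+ form a b n) flipped) (ℤP.+-inverseˡ (form a b n))
    where
    odd : twist (form a b) ≋ ⊝ form a b
    odd = ≋-trans (twist-cong form-odd) (≋-trans (twist-⊙ (+ 4) (mono 1 ⊛ sub 2 (Z₄ ⊛ Z₄))) (≋-trans (⊙-cong (+ 4) (≋-trans (twist-⊛ (mono 1) (sub 2 (Z₄ ⊛ Z₄)))
      (⊛-cong {twist (mono 1)} {(- + 1) ⊙ mono 1} q-odd (twist-even-sub (Z₄ ⊛ Z₄))))) (λ i → trans (cong (+ 4 *_) (⊙-⊛ (- + 1) (mono 1) (sub 2 (Z₄ ⊛ Z₄)) i)) (trans (lem ((mono 1 ⊛ sub 2 (Z₄ ⊛ Z₄)) i)) (cong -_ (sym (form-odd i)))))))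
      where
      lem : ∀ x → + 4 * (- + 1 * x) ≡ - (+ 4 * x)
      lem = solve-∀
      q-odd : twist (mono 1) ≋ (- + 1) ⊙ mono 1
      q-odd 0             = refl
      q-odd 1             = refl
      q-odd (suc (suc n)) = ℤP.*-zeroʳ (sgn (suc (suc n)))
    flipped : form A B n ≡ - form a b n
    flipped = trans (sym (trans (twist-form a b n) (form-cong (≋-trans (twist-cong (≋-sym twist-A)) (twist-twist A)) (≋-trans (twist-cong (≋-sym twist-B)) (twist-twist B)) n))) (odd n)

  sum1To-cong : ∀ n {f g : ℕ → ℤ} → (∀ i → f (suc i) ≡ g (suc i)) → sum1To n f ≡ sum1To n g
  sum1To-cong zero    e = refl
  sum1To-cong (suc n) e = cong₂ _+_ (sum1To-cong n e) (e n)

  sum1To-*ˡ : ∀ n c (f : ℕ → ℤ) → sum1To n (λ i → c * f i) ≡ c * sum1To n f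
  sum1To-*ˡ zero    c f = sym (ℤP.*-zeroʳ c)
  sum1To-*ˡ (suc n) c f = trans (cong (_+ c * f (suc n)) (sum1To-*ˡ n c f)) (sym (ℤP.*-distribˡ-+ c _ _))

  sumTo-sum1To : ∀ n (f : ℕ → ℤ) → sumTo n f ≡ f 0 + sum1To n f
  sumTo-sum1To zero    f = sym (ℤP.+-identityʳ (f 0))
  sumTo-sum1To (suc n) f = trans (cong (_+ f (suc n)) (sumTo-sum1To n f)) (ℤP.+-assoc (f 0) _ _)

  when-mono : ∀ j n x → when ⌊ j ℕ.≟ n ⌋ x ≡ x * mono j n
  when-mono j n x = go (j ℕ.≟ n)
    where
    go : (d : Dec (j ≡ n)) → when ⌊ d ⌋ x ≡ x * mono j n
    go (yes refl) = sym (trans (cong (x *_) (mono-self j)) (ℤP.*-identityʳ x))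
    go (no j≢n) with mono j n ℤ.≟ + 0
    ... | yes e = sym (trans (cong (x *_) e) (ℤP.*-zeroʳ x))
    ... | no ¬e = ⊥-elim (j≢n (mono-≢ j n ¬e))

  φ-sq : ∀ k → φ[q^ k ] ≋ ΣZ (sq k)
  φ-sq k n = trans (sumTo-sum1To n _) (trans (cong₂ _+_ (term 0) (trans (sum1To-cong n (λ m → term (suc m))) (sum1To-*ˡ n (+ 2) (λ m → sq k (+ m) n))))
      (trans (cong (_+ + 2 * sum1To n (λ m → sq k (+ m) n)) (ℤP.*-identityˡ (sq k (+ 0) n))) (sym (sumℤ-even n (λ m → sq k m n) (λ m → sq-even k m n)))))
    where
    term : ∀ m → when ⌊ k ℕ.* m ℕ.* m ℕ.≟ n ⌋ (weight m) ≡ weight m * sq k (+ m) n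
    term m = trans (when-mono (k ℕ.* m ℕ.* m) n (weight m)) (cong (λ j → weight m * mono j n) (ℕP.*-assoc k m m))

  φ-A : φ[q^ 1 ] ≋ A
  φ-A = φ-sq 1

  φ-sub : ∀ k .{{_ : ℕ.NonZero k}} → φ[q^ k ] ≋ sub k A
  φ-sub k = ≋-trans (φ-sq k) (≋-sym (sub-A k))

  A²-agm : AGM (A ⊛ A)
  A²-agm = record
    { at-0 = refl
    ; at-1 = refl
    ; arithmetic = ≋-trans (⊕-congˡ (A ⊛ A) tw) (≋-trans A²+a² (⊙-cong (+ 2) (≋-sym (sub-⊛ 2 A A))))
    ; geometric = ≋-trans (⊛-congˡ (A ⊛ A) tw) (≋-trans (poly ((# 0F :* # 0F) :* (# 1F :* # 1F)) ((# 0F :* # 1F) :* (# 0F :* # 1F)) (A ∷ a ∷ []))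
        (≋-trans (⊛-cong Aa Aa) (≋-sym (⊛-cong (≋-trans (sub-cong 2 tw) (sub-⊛ 2 a a)) (≋-trans (sub-cong 2 tw) (sub-⊛ 2 a a))))))
    }
    where
    tw : twist (A ⊛ A) ≋ a ⊛ a
    tw = ≋-trans (twist-⊛ A A) (⊛-cong twist-A twist-A)

-- Products of Lambert sums evaluated along lines.

module LambertProducts where

  open Polynomials
  open SeriesRing
  open IntegerSums
  open Families
  open Characters
  open RationalFamilies
  open LambertFamilies
  open LambertPairs
  open Lines
  open SymmetricLines

  one : ℤ → ℤ
  one _ = + 1

  c-loc : Loc cF
  c-loc = evF-loc (+ 1) kc refl
  g-loc : Loc gF
  g-loc = evF-loc (+ 1) ψ₈ refl
  v-loc : Loc vF
  v-loc = odF-loc χ₂ refl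
  y-loc : Loc yF
  y-loc = odF-loc ky refl
  ĉ-loc : Loc ĉF
  ĉ-loc = evF-loc (+ 4) kĉ refl
  Ĝ-loc : Loc ĜF
  Ĝ-loc = evF-loc (+ 2) kĜ refl
  V-loc : Loc VF
  V-loc = odF-loc χ₃ refl

  const-loc : ∀ c {F} → Loc F → Loc (λ m → constS c ⊛ F m)
  const-loc c {F} l m i i<m = trans (constS-⊛ c (F m) i) (trans (cong (c *_) (l m i i<m)) (ℤP.*-zeroʳ c))

  const-loc₂ : ∀ c {X} → Loc₂ X → Loc₂ (λ m n → constS c ⊛ X m n)
  const-loc₂ c {X} l m n i b = trans (constS-⊛ c (X m n) i) (trans (cong (c *_) (l m n i b)) (ℤP.*-zeroʳ c))

  𝔻-const : ∀ c H X → 𝔻 H (λ m n → constS c ⊛ X m n) ≋ c ⊙ 𝔻 H X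
  𝔻-const c H X i = trans (sumℤ-cong i (λ m → trans (sumℤ-cong i (λ n → trans (cong (H m n *_) (constS-⊛ c (X m n) i)) (swap (H m n) c (X m n i))))
    (sumℤ-*ˡ i c (λ n → H m n * X m n i)))) (sumℤ-*ˡ i c (λ m → sumℤ i (λ n → H m n * X m n i)))
    where swap : ∀ a b c → a * (b * c) ≡ b * (a * c)
          swap = solve-∀

  𝔻-⊕ : ∀ H X Y → 𝔻 H (λ m n → X m n ⊕ Y m n) ≋ 𝔻 H X ⊕ 𝔻 H Y
  𝔻-⊕ H X Y i = trans (sumℤ-cong i (λ m → trans (sumℤ-cong i (λ n → ℤP.*-distribˡ-+ (H m n) (X m n i) (Y m n i)))
    (sumℤ-+ i (λ n → H m n * X m n i) (λ n → H m n * Y m n i)))) (sumℤ-+ i (λ m → sumℤ i (λ n → H m n * X m n i)) (λ m → sumℤ i (λ n → H m n * Y m n i)))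

  𝔻-⊝ : ∀ H X → 𝔻 H (λ m n → ⊝ X m n) ≋ ⊝ 𝔻 H X
  𝔻-⊝ H X i = trans (sumℤ-cong i (λ m → trans (sumℤ-cong i (λ n → swap (H m n) (X m n i))) (sumℤ-*ˡ i (- + 1) (λ n → H m n * X m n i))))
    (trans (sumℤ-*ˡ i (- + 1) (λ m → sumℤ i (λ n → H m n * X m n i))) (ℤP.-1*i≡-i _))
    where swap : ∀ a c → a * - c ≡ - + 1 * (a * c)
          swap = solve-∀

  wt-one : ∀ F → ΣZ (wt one F) ≋ ΣZ F
  wt-one F = ΣZ-cong {wt one F} {F} (λ m i → ℤP.*-identityˡ (F m i))

  𝔻-prod : ∀ {F G} → Loc F → Loc G → 𝔻 (λ _ _ → + 1) (λ m n → F m ⊛ G n) ≋ ΣZ F ⊛ ΣZ G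
  𝔻-prod {F} {G} lF lG = ≋-trans (dsum-prod one one lF lG) (⊛-cong (wt-one F) (wt-one G))

  private
    τ1 : ∀ m → τF m ≋ sc 1 τF m
    τ1 m n = cong (λ k → τF k n) (sym (ℤP.*-identityˡ m))

  Γ 𝒢 Γ′ c₅ c₅′ G₅ ĉ₅ Ĝ₅ K̄ Γ₂ : Series
  Γ   = ΣZ cF
  𝒢   = ΣZ gF
  Γ′  = ΣZ (wt sgnᶻ cF)
  c₅  = ΣZ (wt χᶻ cF)
  c₅′ = ΣZ (wt χᶻ (wt sgnᶻ cF))
  G₅  = ΣZ (wt χᶻ gF)
  ĉ₅  = ΣZ ĉF
  Ĝ₅  = ΣZ ĜF
  K̄   = diagonal sgnᶻ (λ m n → cF m ⊛ cF n)
  Γ₂  = ΣZ (sc 2 cF)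

  Sc Sc′ Sg : Series
  Sc  = ΣZ (wt sᶻ cF)
  Sc′ = ΣZ (wt sᶻ (wt sgnᶻ cF))
  Sg  = ΣZ (wt sᶻ gF)

  V₂ : Family
  V₂ M = constS (+ 2) ⊛ yF M

  private
    cc-eq : ∀ m n → m + n ≢ + 0 → cF m ⊛ cF n ≋ V₂ (m + n) ⊛ (τF m ⊕ τF n)
    cc-eq m n z = ≋-trans (At.cc m n z) (≋-sym (⊛-assoc (constS (+ 2)) (yF (m + n)) (τF m ⊕ τF n)))

    alternating : ∀ h → dsum (λ m n → h (m + n)) cF (wt sgnᶻ cF) ≋ h (+ 0) ⊙ K̄
    alternating h = ≋-trans (λ i → sumℤ-cong i (λ m → sumℤ-cong i (λ n → trans (cong (h (m + n) *_) (⊛-⊙ (sgnᶻ n) (cF m) (cF n) i)) (sym (ℤP.*-assoc (h (m + n)) (sgnᶻ n) _)))))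
      (type-S h (λ m n → cF m ⊛ cF n) V₂ (loc-⊛ c-loc c-loc) (const-loc (+ 2) y-loc) cc-eq)

  Γ-norm : Γ ⊛ Γ′ ≋ K̄
  Γ-norm = ≋-trans (⊛-congʳ Γ′ (≋-sym (wt-one cF))) (≋-trans (≋-sym (dsum-prod one sgnᶻ c-loc c-loc))
    (≋-trans (type-S one (λ m n → cF m ⊛ cF n) V₂ (loc-⊛ c-loc c-loc) (const-loc (+ 2) y-loc) cc-eq) (λ n → ℤP.*-identityˡ (K̄ n))))

  alt-even : Even (wt sgnᶻ cF)
  alt-even m n = cong₂ _*_ (sgnᶻ-neg m) (evF-even (+ 1) kc m n)

  -- With alternating signs only the line m + n = 0 survives, weighted here by χ(0) = 0. In
  -- `c₅-norm₂` its weight is s(0) = 4, whence 16.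
  c₅-norm₁ : Sc ⊛ c₅′ ⊕ c₅ ⊛ Sc′ ≋ zeroS
  c₅-norm₁ = ≋-trans (≋-sym (χ-product c-loc (wt-loc sgnᶻ c-loc) alt-even)) (≋-trans (⊙-cong (+ 4) (alternating χᶻ)) (λ n → zero′ (K̄ n)))
    where zero′ : ∀ x → + 4 * (+ 0 * x) ≡ + 0
          zero′ = solve-∀

  c₅-norm₂ : Sc ⊛ Sc′ ⊕ (+ 5) ⊙ (c₅ ⊛ c₅′) ≋ (+ 16) ⊙ K̄
  c₅-norm₂ = ≋-trans (≋-sym (s-product c-loc (wt-loc sgnᶻ c-loc) alt-even)) (≋-trans (⊙-cong (+ 4) (alternating sᶻ)) (λ n → sym (ℤP.*-assoc (+ 4) (+ 4) (K̄ n))))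

  none : Family
  none _ = zeroS

  none-loc : Loc none
  none-loc _ _ _ = refl

  cc-lines : ∀ h → dsum (λ m n → h (m + n)) cF cF ≋ moment h V₂ ⊕ h (+ 0) ⊙ diagonal one (λ m n → cF m ⊛ cF n)
  cc-lines h = ≋-trans (type-A′ 1 h (λ m n → cF m ⊛ cF n) V₂ none none (loc-⊛ c-loc c-loc) (const-loc (+ 2) y-loc) none-loc none-loc
      (λ m n z → ≋-trans (cc-eq m n z) (≋-trans (⊛-congˡ (V₂ (m + n)) (⊕-cong (τ1 m) (τ1 n)))
        (λ i → sym (trans (cong (λ z → (V₂ (m + n) ⊛ (sc 1 τF m ⊕ sc 1 τF n)) i + z) (zeroS-⊛ (zeroS ⊕ zeroS) i)) (ℤP.+-identityʳ _))))))
    (⊕-congʳ (h (+ 0) ⊙ diagonal one (λ m n → cF m ⊛ cF n)) {moment h V₂ ⊕ ΣZ (wt h (cut none)) ⊛ (ΣZ none ⊕ ΣZ none)} {moment h V₂} (λ i → trans (cong (λ z → moment h V₂ i + z) (trans (⊛-congʳ (ΣZ none ⊕ ΣZ none) {ΣZ (wt h (cut none))} {zeroS}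
        (λ j → sumℤ-zero j (λ m _ → trans (cong (h m *_) (cut-none m j)) (ℤP.*-zeroʳ (h m)))) i) (zeroS-⊛ (ΣZ none ⊕ ΣZ none) i))) (ℤP.+-identityʳ _)))
    where
    cut-none : ∀ m j → cut none m j ≡ + 0
    cut-none m j with m ℤ.≟ + 0
    ... | yes _ = refl
    ... | no  _ = refl

  gg-lines : ∀ h → (+ 4) ⊙ dsum (λ m n → h (m + n)) gF gF ≋
             moment h V₂ ⊕ ΣZ (wt h (cut cF)) ⊛ (Γ₂ ⊕ Γ₂) ⊕ h (+ 0) ⊙ diagonal one (λ m n → constS (+ 4) ⊛ (gF m ⊛ gF n))
  gg-lines h = ≋-trans (≋-sym (𝔻-const (+ 4) (λ m n → h (m + n)) (λ m n → gF m ⊛ gF n)))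
    (type-A′ 2 h (λ m n → constS (+ 4) ⊛ (gF m ⊛ gF n)) V₂ cF (sc 2 cF) (const-loc₂ (+ 4) (loc-⊛ g-loc g-loc)) (const-loc (+ 2) y-loc) c-loc (sc-loc 2 {cF} c-loc)
      (λ m n z → ≋-trans (At.gg m n z) (⊕-congʳ (cF (m + n) ⊛ (cF (+ 2 * m) ⊕ cF (+ 2 * n))) (≋-sym (⊛-assoc (constS (+ 2)) (yF (m + n)) (τF (+ 2 * m) ⊕ τF (+ 2 * n)))))))

  -- 4 (5BD - AC) G₅ = (5B² - A² + 4C²) c₅, once the sums are identified.
  c₅-G₅ : (+ 4) ⊙ (Sg ⊛ G₅) ≋ (Sc ⊕ (+ 4) ⊙ Γ₂) ⊛ c₅
  c₅-G₅ n = ℤP.*-cancelˡ-≡ (+ 2) _ _ (algebra n)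
    where
    m = moment χᶻ V₂
    cut-χ : ΣZ (wt χᶻ (cut cF)) ≋ c₅
    cut-χ = ≋-sym (≋-trans (ΣZ-cut χᶻ cF) (λ i → trans (cong (λ z → ΣZ (wt χᶻ (cut cF)) i + z) (ℤP.*-zeroˡ (cF (+ 0) i))) (ℤP.+-identityʳ _)))
    e₁ : Sg ⊛ G₅ ⊕ G₅ ⊛ Sg ≋ m ⊕ c₅ ⊛ (Γ₂ ⊕ Γ₂)
    e₁ = ≋-trans (≋-sym (χ-product g-loc g-loc (evF-even (+ 1) ψ₈))) (≋-trans (gg-lines χᶻ)
      (λ i → trans (cong (λ z → m i + (ΣZ (wt χᶻ (cut cF)) ⊛ (Γ₂ ⊕ Γ₂)) i + z) (ℤP.*-zeroˡ (diagonal one (λ m n → constS (+ 4) ⊛ (gF m ⊛ gF n)) i)))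
        (trans (ℤP.+-identityʳ _) (cong (λ z → m i + z) (⊛-congʳ (Γ₂ ⊕ Γ₂) cut-χ i)))))
    e₂ : Sc ⊛ c₅ ⊕ c₅ ⊛ Sc ≋ (+ 4) ⊙ m
    e₂ = ≋-trans (≋-sym (χ-product c-loc c-loc (evF-even (+ 1) kc))) (⊙-cong (+ 4) (≋-trans (cc-lines χᶻ)
      (λ i → trans (cong (λ z → m i + z) (ℤP.*-zeroˡ (diagonal one (λ m n → cF m ⊛ cF n) i))) (ℤP.+-identityʳ _))))
    algebra : (+ 2) ⊙ ((+ 4) ⊙ (Sg ⊛ G₅)) ≋ (+ 2) ⊙ ((Sc ⊕ (+ 4) ⊙ Γ₂) ⊛ c₅)
    algebra = x-y≈0⇒x≈y (certify (Sg ∷ G₅ ∷ Sc ∷ c₅ ∷ Γ₂ ∷ m ∷ []) (con (+ 1))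
      ((+ 2) :· ((+ 4) :· (# 0F :* # 1F)) :- (+ 2) :· ((# 2F :+ (+ 4) :· # 4F) :* # 3F))
      ((con (+ 4) , # 0F :* # 1F :+ # 1F :* # 0F :- (# 5F :+ # 3F :* (# 4F :+ # 4F))) ∷ (con (- + 1) , # 2F :* # 3F :+ # 3F :* # 2F :- (+ 4) :· # 5F) ∷ [])
      (λ f h n → trans (sym (ℤP.*-identityˡ (f n))) (trans (sym (constS-⊛ (+ 1) f n)) (h n)))
      (x≋y⇒x-y≋0 e₁ All.∷ x≋y⇒x-y≋0 e₂ All.∷ All.[]))

-- The untwisted Lambert sums: Γ = A² and 𝒢 = A C.

module LambertTotals where

  open Polynomials
  open SeriesRing
  open Substitution
  open Families
  open Characters
  open RationalFamilies
  open LambertFamilies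
  open Lines
  open Multiples
  open LambertPairs
  open ArithmeticGeometricMean
  open Lattices
  open ThetaNorms
  open ThetaRelations
  open LambertProducts

  ψ₄-odd : OddSupport ψ₄
  ψ₄-odd 0             = refl
  ψ₄-odd 1             = refl
  ψ₄-odd (suc (suc n)) = trans (lem (sgn n) (ψ₄ n)) (cong -_ (ψ₄-odd n))
    where lem : ∀ s x → - - s * - x ≡ - (s * x)
          lem = solve-∀

  ψ₈-odd : OddSupport ψ₈
  ψ₈-odd 0 = refl
  ψ₈-odd 1 = refl
  ψ₈-odd 2 = refl
  ψ₈-odd 3 = refl
  ψ₈-odd (suc (suc (suc (suc n)))) = trans (lem (sgn n) (ψ₈ n)) (cong -_ (ψ₈-odd n))
    where lem : ∀ s x → - - - - s * - x ≡ - (s * x)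
          lem = solve-∀

  kc-odd : OddSupport kc
  kc-odd n = trans (swap (sgn n) (ψ₄ n)) (trans (cong (+ 2 *_) (ψ₄-odd n)) (sym (ℤP.neg-distribʳ-* (+ 2) (ψ₄ n))))
    where swap : ∀ s x → s * (+ 2 * x) ≡ + 2 * (s * x)
          swap = solve-∀

  c² : Family
  c² m = cF m ⊛ cF m

  c²-loc : Loc c²
  c²-loc m i i<m = ord-⊛ ∣ m ∣ ∣ m ∣ {cF m} {cF m} (c-loc m) (c-loc m) i (ℕP.<-≤-trans i<m (ℕP.m≤m+n ∣ m ∣ ∣ m ∣))

  -- The lines of 4 𝒢² and of Γ² give 4 𝒢² = Γ² + 2 Γ Γ₂ + Γ Γ′, and Γ + Γ′ = 2 Γ₂.
  𝒢² : 𝒢 ⊛ 𝒢 ≋ Γ ⊛ Γ₂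
  𝒢² = x-y≈0⇒x≈y (certify (Γ ∷ Γ′ ∷ Γ₂ ∷ 𝒢 ∷ M ∷ Γc ∷ D₂′ ∷ Q₁ ∷ Q₂ ∷ K̄ ∷ []) (con (+ 4))
      (# 3F :* # 3F :- # 0F :* # 2F)
      ((con (- + 1) , # 0F :* # 0F :- (# 4F :+ (+ 1) :· # 7F)) ∷ (con (+ 1) , (+ 4) :· (# 3F :* # 3F) :- (# 4F :+ # 5F :* (# 2F :+ # 2F) :+ (+ 1) :· # 6F))
        ∷ (con (- + 2) :* # 2F , # 0F :- (# 5F :+ (+ 1) :· con (+ 1))) ∷ (con (+ 1) , # 6F :- ((+ 2) :· # 2F :+ (+ 2) :· # 8F))
        ∷ (con (- + 1) , # 9F :+ # 7F :- (+ 2) :· # 8F) ∷ (# 0F , # 1F :+ # 0F :- (+ 2) :· # 2F) ∷ (con (- + 1) , # 0F :* # 1F :- # 9F) ∷ [])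
      (const-regular 3) (x≋y⇒x-y≋0 e₁ All.∷ x≋y⇒x-y≋0 e₂ All.∷ x≋y⇒x-y≋0 e₃ All.∷ x≋y⇒x-y≋0 e₄ All.∷ x≋y⇒x-y≋0 e₅ All.∷ x≋y⇒x-y≋0 e₆ All.∷ x≋y⇒x-y≋0 Γ-norm All.∷ All.[]))
    where
    M Γc D₂′ Q₁ Q₂ : Series
    M  = moment one V₂
    Γc = ΣZ (wt one (cut cF))
    D₂′ = diagonal one (λ m n → constS (+ 4) ⊛ (gF m ⊛ gF n))
    Q₁ = ΣZ c²
    Q₂ = ΣZ (sc 2 c²)
    diag : ∀ m → cF m ⊛ cF (- m) ≋ c² m
    diag m = ⊛-congˡ (cF m) (evF-even (+ 1) kc m)
    e₁ : Γ ⊛ Γ ≋ M ⊕ (+ 1) ⊙ Q₁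
    e₁ = ≋-trans (≋-sym (𝔻-prod c-loc c-loc)) (≋-trans (cc-lines one) (⊕-congˡ M (⊙-cong (+ 1) (ΣZ-cong (λ m → ≋-trans (λ i → ℤP.*-identityˡ _) (diag m))))))
    e₂ : (+ 4) ⊙ (𝒢 ⊛ 𝒢) ≋ M ⊕ Γc ⊛ (Γ₂ ⊕ Γ₂) ⊕ (+ 1) ⊙ D₂′
    e₂ = ≋-trans (⊙-cong (+ 4) (≋-sym (𝔻-prod g-loc g-loc))) (gg-lines one)
    e₃ : Γ ≋ Γc ⊕ (+ 1) ⊙ constS (+ 1)
    e₃ = ≋-trans (≋-sym (wt-one cF)) (ΣZ-cut one cF)
    e₄ : D₂′ ≋ (+ 2) ⊙ Γ₂ ⊕ (+ 2) ⊙ Q₂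
    e₄ = ≋-trans (ΣZ-cong {λ m → one m ⊙ (constS (+ 4) ⊛ (gF m ⊛ gF (- m)))} {λ m → (+ 2) ⊙ sc 2 cF m ⊕ (+ 2) ⊙ sc 2 c² m}
        (λ m → ≋-trans (λ i → ℤP.*-identityˡ _) (≋-trans (⊛-congˡ (constS (+ 4)) (⊛-congˡ (gF m) (evF-even (+ 1) ψ₈ m)))
          (≋-trans (At.gg₀ m (+ 0)) (⊕-cong (constS-⊛ (+ 2) (cF (+ 2 * m))) (constS-⊛ (+ 2) (sc 2 c² m)))))))
      (≋-trans (ΣZ-⊕ (λ m → (+ 2) ⊙ sc 2 cF m) (λ m → (+ 2) ⊙ sc 2 c² m)) (⊕-cong (ΣZ-⊙ (+ 2) (sc 2 cF)) (ΣZ-⊙ (+ 2) (sc 2 c²))))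
    e₅ : K̄ ⊕ Q₁ ≋ (+ 2) ⊙ Q₂
    e₅ = ≋-trans (⊕-congʳ Q₁ (ΣZ-cong (λ m → ⊙-cong (sgnᶻ m) (diag m)))) (ΣZ-multiples 2 (+ 2) sgnᶻ c²-loc (λ m → sgn-2∣ ∣ m ∣))
    e₆ : Γ′ ⊕ Γ ≋ (+ 2) ⊙ Γ₂
    e₆ = ΣZ-multiples 2 (+ 2) sgnᶻ c-loc (λ m → sgn-2∣ ∣ m ∣)

  ΣZ-sc₁ : ∀ k .{{_ : ℕ.NonZero k}} c f → f 0 ≡ + 0 → ΣZ (sc k (evF c f)) ≋ sub k (ΣZ (evF c f))
  ΣZ-sc₁ k c f z = ≋-trans (≋-sym (wt-one (sc k (evF c f)))) (≋-trans (ΣZ-sc k one c f z) (sub-cong k (wt-one (evF c f))))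

  twist-ΣZ-evF₁ : ∀ c {f} → OddSupport f → twist (ΣZ (evF c f)) ≋ ΣZ (wt sgnᶻ (evF c f))
  twist-ΣZ-evF₁ c {f} o = ≋-trans (twist-cong (≋-sym (wt-one (evF c f)))) (≋-trans (twist-ΣZ-evF one c {f} o) (wt-one (wt sgnᶻ (evF c f))))

  Γ₂-sub : Γ₂ ≋ sub 2 Γ
  Γ₂-sub = ΣZ-sc₁ 2 (+ 1) kc refl

  twist-Γ : twist Γ ≋ Γ′
  twist-Γ = twist-ΣZ-evF₁ (+ 1) {kc} kc-odd

  even-odd : ∀ c f → f 0 ≡ + 0 → OddSupport f → ΣZ (evF c f) ⊕ twist (ΣZ (evF c f)) ≋ (+ 2) ⊙ sub 2 (ΣZ (evF c f))
  even-odd c f z o = ≋-trans (λ i → ℤP.+-comm (ΣZ (evF c f) i) _) (≋-trans (⊕-congʳ (ΣZ (evF c f)) (twist-ΣZ-evF₁ c {f} o))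
    (≋-trans (ΣZ-multiples 2 (+ 2) sgnᶻ (evF-loc c f z) (λ m → sgn-2∣ ∣ m ∣)) (⊙-cong (+ 2) (ΣZ-sc₁ 2 c f z))))

  Γ-agm : AGM Γ
  Γ-agm = record { at-0 = refl ; at-1 = refl ; arithmetic = t₅ ; geometric = geo }
    where
    Γ̂ 𝒢̂ : Series
    Γ̂ = twist Γ
    𝒢̂ = twist 𝒢
    t₁ : 𝒢 ⊛ 𝒢 ≋ Γ ⊛ sub 2 Γ
    t₁ = ≋-trans 𝒢² (⊛-congˡ Γ Γ₂-sub)
    t₂ : 𝒢̂ ⊛ 𝒢̂ ≋ Γ̂ ⊛ sub 2 Γ
    t₂ = ≋-trans (≋-sym (twist-⊛ 𝒢 𝒢)) (≋-trans (twist-cong t₁) (≋-trans (twist-⊛ Γ (sub 2 Γ)) (⊛-congˡ Γ̂ (twist-even-sub Γ))))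
    t₃ : sub 2 𝒢 ⊛ sub 2 𝒢 ≋ sub 2 Γ ⊛ sub 2 (sub 2 Γ)
    t₃ = ≋-trans (≋-sym (sub-⊛ 2 𝒢 𝒢)) (≋-trans (sub-cong 2 t₁) (sub-⊛ 2 Γ (sub 2 Γ)))
    t₄ : 𝒢 ⊕ 𝒢̂ ≋ (+ 2) ⊙ sub 2 𝒢
    t₄ = even-odd (+ 1) ψ₈ refl ψ₈-odd
    t₅ : Γ ⊕ Γ̂ ≋ (+ 2) ⊙ sub 2 Γ
    t₅ = even-odd (+ 1) kc refl kc-odd
    t₆ : sub 2 Γ ⊕ sub 2 Γ̂ ≋ (+ 2) ⊙ sub 2 (sub 2 Γ)
    t₆ = ≋-trans (≋-sym (sub-⊕ 2 Γ Γ̂)) (≋-trans (sub-cong 2 t₅) (sub-⊙ 2 (+ 2) (sub 2 Γ)))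
    -- Squaring 𝒢 + 𝒢̂ = 2 𝒢(q²) and inserting `t₁`, `t₂`, `t₃`, `t₅`, `t₆` gives 𝒢 𝒢̂ = Γ(q²)
    -- Γ̂(q²), where Γ̂(q²) is `sub 2 Γ̂`. Squaring once more produces Γ Γ̂ Γ(q²)² on the left, and
    -- Γ(q²)² cancels.
    geo : Γ ⊛ Γ̂ ≋ sub 2 Γ̂ ⊛ sub 2 Γ̂
    geo = x-y≈0⇒x≈y (certify (Γ ∷ Γ̂ ∷ sub 2 Γ ∷ sub 2 Γ̂ ∷ sub 2 (sub 2 Γ) ∷ 𝒢 ∷ 𝒢̂ ∷ sub 2 𝒢 ∷ []) (con (+ 4) :* # 2F :* # 2F)
      (# 0F :* # 1F :- # 3F :* # 3F)
      ((con (- + 1) :* W :- con (+ 4) :* # 6F :* # 6F , # 5F :* # 5F :- # 0F :* # 2F) ∷ (con (- + 1) :* W :- con (+ 4) :* # 0F :* # 2F , # 6F :* # 6F :- # 1F :* # 2F)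
        ∷ (con (+ 4) :* W , # 7F :* # 7F :- # 2F :* # 4F) ∷ (W :* (# 5F :+ # 6F :+ con (+ 2) :* # 7F) , # 5F :+ # 6F :- (+ 2) :· # 7F)
        ∷ (con (- + 1) :* W :* # 2F , # 0F :+ # 1F :- (+ 2) :· # 2F) ∷ (con (- + 2) :* W :* # 2F , # 2F :+ # 3F :- (+ 2) :· # 4F) ∷ [])
      (regular₀ {(constS (+ 4) ⊛ sub 2 Γ) ⊛ sub 2 Γ} (λ ())) (x≋y⇒x-y≋0 t₁ All.∷ x≋y⇒x-y≋0 t₂ All.∷ x≋y⇒x-y≋0 t₃ All.∷ x≋y⇒x-y≋0 t₄ All.∷ x≋y⇒x-y≋0 t₅ All.∷ x≋y⇒x-y≋0 t₆ All.∷ All.[]))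
      where
      W : Expr 8
      W = con (+ 2) :* # 5F :* # 6F :+ con (+ 2) :* # 2F :* # 3F

  Γ-value : Γ ≋ A ⊛ A
  Γ-value = agm-unique Γ-agm A²-agm

  Γ₂-value : Γ₂ ≋ C ⊛ C
  Γ₂-value = ≋-trans Γ₂-sub (≋-trans (sub-cong 2 Γ-value) (sub-⊛ 2 A A))

  -- 𝒢² and (A C)² agree, and 𝒢 + A C is regular because its constant term is 2.
  𝒢-value : 𝒢 ≋ A ⊛ C
  𝒢-value = x-y≈0⇒x≈y (certify (𝒢 ∷ A ∷ C ∷ Γ ∷ Γ₂ ∷ []) (# 0F :+ # 1F :* # 2F) (# 0F :- # 1F :* # 2F)
    ((con (+ 1) , # 0F :* # 0F :- # 3F :* # 4F) ∷ (# 4F , # 3F :- # 1F :* # 1F) ∷ (# 1F :* # 1F , # 4F :- # 2F :* # 2F) ∷ [])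
    (regular₀ {𝒢 ⊕ A ⊛ C} (λ ())) (x≋y⇒x-y≋0 𝒢² All.∷ x≋y⇒x-y≋0 Γ-value All.∷ x≋y⇒x-y≋0 Γ₂-value All.∷ All.[]))

-- Lambert sums with a character in the index.

module TwistedTotals where

  open Polynomials
  open SeriesRing
  open Substitution
  open Families
  open Characters
  open RationalFamilies
  open LambertFamilies
  open Lines
  open Multiples
  open LambertPairs
  open ArithmeticGeometricMean
  open Lattices
  open ThetaNorms
  open ThetaRelations
  open LambertProducts
  open LambertTotals
  open ThetaAlgebra
  open ThetaUnknowns

  regular-⊛ : ∀ {f g} → Regular f → Regular g → Regular (f ⊛ g)
  regular-⊛ {f} {g} rf rg h z = rg h (rf (g ⊛ h) (≋-trans (≋-sym (⊛-assoc f g h)) z))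

  private
    module Rel = Relations 𝕊 A a B b C D c d

  θ : Series → Series → Series → Series → Vec Series 12
  θ = Rel.env

  via : ∀ {n} (e f : Expr n) (ρ : Vec Series n) → {T (null (normalise (e :- f)))} → ⟦ f ⟧ ρ ≋ zeroS → ⟦ e ⟧ ρ ≋ zeroS
  via e f ρ {t} h = ≋-trans (poly e f ρ {t}) h

  θ₀ : Vec Series 12
  θ₀ = θ zeroS zeroS zeroS zeroS

  private
    from : ∀ g h → {T (null (normalise {12} (g :- h)))} → ⟦ h ⟧ θ₀ ≋ zeroS → ⟦ g ⟧ θ₀ ≋ zeroS
    from g h {t} = via g h θ₀ {t}

    neg-zero : ∀ {f g} → f ≋ g → g ⊕ ⊝ f ≋ zeroS
    neg-zero e = x≋y⇒x-y≋0 (≋-sym e)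

  zC : Rel.Zero gC
  zC = from gC ((+ 2) :· (vC :* vC) :- (vA :* vA :+ va :* va)) (neg-zero A²+a²)

  zD : Rel.Zero gD
  zD = from gD ((+ 2) :· (vD :* vD) :- (vB :* vB :+ vb :* vb)) (neg-zero B²+b²)

  zc : Rel.Zero gc
  zc = from gc (vc :* vc :- vA :* va) (neg-zero Aa)

  zd : Rel.Zero gd
  zd = from gd (vd :* vd :- vB :* vb) (neg-zero Bb)

  zR₁ : Rel.Zero gR₁
  zR₁ = from gR₁ ((vA :* vb :- va :* vB) :* (vA :* vb :- va :* vB) :- (vB :* vb :- vA :* va) :* ((+ 5) :· (vB :* vb) :- vA :* va)) (x≋y⇒x-y≋0 R₁)

  zR₂ : Rel.Zero gR₂
  zR₂ = from gR₂ ((vB :* vB :- vA :* vA) :* ((+ 5) :· (vB :* vB) :- vA :* vA) :+ (vb :* vb :- va :* va) :* ((+ 5) :· (vb :* vb) :- va :* va)) R₂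

  zR₁′ : Rel.Zero gR₁′
  zR₁′ = from gR₁′ ((vC :* vd :- vc :* vD) :* (vC :* vd :- vc :* vD) :- (vD :* vd :- vC :* vc) :* ((+ 5) :· (vD :* vd) :- vC :* vc))
    (x≋y⇒x-y≋0 (≋-trans (≋-sym (≋-trans (sub-⊛ 2 N N) (⊛-cong sN sN))) (≋-trans (sub-cong 2 R₁) (≋-trans (sub-⊛ 2 (B ⊛ b ⊕ ⊝ (A ⊛ a)) ((+ 5) ⊙ (B ⊛ b) ⊕ ⊝ (A ⊛ a))) (⊛-cong
      (≋-trans (sub-⊕ 2 (B ⊛ b) (⊝ (A ⊛ a))) (⊕-cong sBb sAa)) (≋-trans (sub-⊕ 2 ((+ 5) ⊙ (B ⊛ b)) (⊝ (A ⊛ a))) (⊕-cong (≋-trans (sub-⊙ 2 (+ 5) (B ⊛ b)) (⊙-cong (+ 5) sBb)) sAa)))))))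
    where
    sBb : sub 2 (B ⊛ b) ≋ D ⊛ d
    sBb = ≋-trans (sub-⊛ 2 B b) (⊛-cong sub2-B sub2-b)
    sAa : sub 2 (⊝ (A ⊛ a)) ≋ ⊝ (C ⊛ c)
    sAa = ≋-trans (sub-⊝ 2 (A ⊛ a)) (⊝-cong (sub-⊛ 2 A a))
    sN : sub 2 N ≋ C ⊛ d ⊕ ⊝ (c ⊛ D)
    sN = ≋-trans (sub-⊕ 2 (A ⊛ b) (⊝ (a ⊛ B))) (⊕-cong (≋-trans (sub-⊛ 2 A b) (⊛-congˡ C sub2-b)) (≋-trans (sub-⊝ 2 (a ⊛ B)) (⊝-cong (≋-trans (sub-⊛ 2 a B) (⊛-congˡ c sub2-B)))))

  private
    reg₁ : Rel.Reg (nat 2 :* eK :* vC :* vD :+ (vC :^ 2 :* eρ₁ :+ vD :^ 2 :* eρ₅))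
    reg₁ = regular₀ {⟦ nat 2 :* eK :* vC :* vD :+ (vC :^ 2 :* eρ₁ :+ vD :^ 2 :* eρ₅) ⟧ θ₀} (λ ())

    reg₂ : Rel.Reg (nat 2 :* vC)
    reg₂ = regular₀ {⟦ nat 2 :* vC ⟧ θ₀} (λ ())

    reg₃ : Rel.Reg (nat 2 :* vD)
    reg₃ = regular₀ {⟦ nat 2 :* vD ⟧ θ₀} (λ ())

    reg₄ : Rel.Reg (nat 1)
    reg₄ = const-regular 0

  module P = Rel.Products zC zD zc zd zR₁ zR₁′ reg₁ reg₂ reg₃ reg₄

  K : Series
  K = A ⊛ b ⊕ a ⊛ B

  N-regular : Regular N
  N-regular = regular-tl {N} refl (regular₀ {tl N} (λ ()))

  private
    reg-even : ∀ k → Rel.Reg (evenM k)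
    reg-even k = regular-⊛ {constS (+ suc k)} {constS (+ 4) ⊛ K} (const-regular k) (regular₀ {constS (+ 4) ⊛ K} (λ ()))

    reg-odd : ∀ k → Rel.Reg (oddM k)
    reg-odd k = regular-⊛ {constS (+ suc k)} {((constS (+ 4) ⊛ K) ⊛ D) ⊛ N} (const-regular k) (regular-⊛ {(constS (+ 4) ⊛ K) ⊛ D} {N} (regular₀ {(constS (+ 4) ⊛ K) ⊛ D} (λ ())) N-regular)

  module Q = Rel.Quartics zC zD zR₁ zR₂ P.zCD reg-even reg-odd

  sub5-C : sub 5 C ≋ D
  sub5-C = sub-sub 5 2 10 A refl

  sum-s : ∀ f → f 0 ≡ + 0 → ∀ c → ΣZ (wt sᶻ (evF c f)) ≋ (+ 5) ⊙ sub 5 (ΣZ (evF c f)) ⊕ ⊝ ΣZ (evF c f)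
  sum-s f z c n = trans (lem _ _) (cong (_+ - ΣZ (evF c f) n) (trans (ΣZ-multiples 5 (+ 5) sᶻ (evF-loc c f z) sᶻ-multiples n) (cong (+ 5 *_) (ΣZ-sc₁ 5 c f z n))))
    where lem : ∀ x y → x ≡ (x + y) + - y
          lem = solve-∀

  Sc-value : Sc ≋ (+ 5) ⊙ (B ⊛ B) ⊕ ⊝ (A ⊛ A)
  Sc-value = ≋-trans (sum-s kc refl (+ 1)) (⊕-cong (⊙-cong (+ 5) (≋-trans (sub-cong 5 Γ-value) (sub-⊛ 5 A A))) (⊝-cong Γ-value))

  Sg-value : Sg ≋ (+ 5) ⊙ (B ⊛ D) ⊕ ⊝ (A ⊛ C)
  Sg-value = ≋-trans (sum-s ψ₈ refl (+ 1)) (⊕-cong (⊙-cong (+ 5) (≋-trans (sub-cong 5 𝒢-value) (≋-trans (sub-⊛ 5 A C) (⊛-congˡ B sub5-C)))) (⊝-cong 𝒢-value))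

  Sc′-value : Sc′ ≋ (+ 5) ⊙ (b ⊛ b) ⊕ ⊝ (a ⊛ a)
  Sc′-value = ≋-trans (≋-sym (twist-ΣZ-evF sᶻ (+ 1) {kc} kc-odd)) (≋-trans (twist-cong Sc-value) (≋-trans (twist-⊕ ((+ 5) ⊙ (B ⊛ B)) (⊝ (A ⊛ A))) (⊕-cong
    (≋-trans (twist-⊙ (+ 5) (B ⊛ B)) (⊙-cong (+ 5) (≋-trans (twist-⊛ B B) (⊛-cong twist-B twist-B)))) (≋-trans (twist-⊝ (A ⊛ A)) (⊝-cong (≋-trans (twist-⊛ A A) (⊛-cong twist-A twist-A)))))))

  K̄-value : K̄ ≋ (A ⊛ A) ⊛ (a ⊛ a)
  K̄-value = ≋-trans (≋-sym Γ-norm) (⊛-cong Γ-value (≋-trans (≋-sym twist-Γ) (≋-trans (twist-cong Γ-value) (≋-trans (twist-⊛ A A) (⊛-cong twist-A twist-A)))))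

  c₅₂ : Series
  c₅₂ = ΣZ (wt χᶻ (sc 2 cF))

  c₅-even : c₅ ⊕ c₅′ ⊕ (+ 2) ⊙ c₅₂ ≋ zeroS
  c₅-even n = trans (cong (_+ + 2 * c₅₂ n) (trans (ℤP.+-comm (c₅ n) (c₅′ n)) (trans (cong (_+ c₅ n) (ΣZ-cong {wt χᶻ (wt sgnᶻ cF)} {wt sgnᶻ (wt χᶻ cF)} (λ m i → swap (χᶻ m) (sgnᶻ m) (cF m i)) n))
      (trans (ΣZ-multiples 2 (+ 2) sgnᶻ {wt χᶻ cF} (wt-loc χᶻ c-loc) (λ m → sgn-2∣ ∣ m ∣) n) (cong (+ 2 *_) (trans (ΣZ-cong {sc 2 (wt χᶻ cF)} {λ m → (- + 1) ⊙ wt χᶻ (sc 2 cF) m}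
        (λ m i → trans (cong (_* cF (+ 2 * m) i) (χ-double m)) (minus (χᶻ m) (cF (+ 2 * m) i))) n) (ΣZ-⊙ (- + 1) (wt χᶻ (sc 2 cF)) n)))))))
    (lem (c₅₂ n))
    where
    swap : ∀ a b c → a * (b * c) ≡ b * (a * c)
    swap = solve-∀
    minus : ∀ a b → - a * b ≡ - + 1 * (a * b)
    minus = solve-∀
    lem : ∀ x → + 2 * (- + 1 * x) + + 2 * x ≡ + 0
    lem = solve-∀

  private
    module W = Unknowns 𝕊 A a B b C D c d c₅ c₅′ c₅₂ zeroS
    module G = Unknowns 𝕊 A a B b C D c d c₅ G₅ zeroS zeroS

    sU su : ∀ {n} → Expr n → Expr n → Expr n
    sU x y = (+ 5) :· (y :* y) :- x :* x
    su = sU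

    zU : W.Z (eU :* vx :+ eu :* vw)
    zU = via (eU :* vx :+ eu :* vw) (sU vA vB :* vx :+ vw :* su va vb) (θ c₅ c₅′ c₅₂ zeroS)
      (≋-trans (≋-sym (⊕-cong (⊛-congʳ c₅′ Sc-value) (⊛-congˡ c₅ Sc′-value))) c₅-norm₁)

    zV : W.Z (eU :* eu :+ nat 5 :* vw :* vx :- nat 16 :* ep :^ 2)
    zV = via (eU :* eu :+ nat 5 :* vw :* vx :- nat 16 :* ep :^ 2) (sU vA vB :* su va vb :+ (+ 5) :· (vw :* vx) :- (+ 16) :· ((vA :* vA) :* (va :* va))) (θ c₅ c₅′ c₅₂ zeroS)
      (x≋y⇒x-y≋0 (≋-trans (≋-sym (⊕-congʳ ((+ 5) ⊙ (c₅ ⊛ c₅′)) (⊛-cong Sc-value Sc′-value))) (≋-trans c₅-norm₂ (⊙-cong (+ 16) K̄-value))))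

  -- Eliminating the twisted sum from the two norm relations and using (5B² - A²)(5b² - a²) = 4 A a
  -- ρ₅ gives (c₅ u)² = (4 A a N)². Both roots begin with 16 q, so their sum is regular and their
  -- difference vanishes.
  c₅-u : W.Z (vw :* eu :- nat 4 :* ep :* eN)
  c₅-u = W.c₅-value zR₁ zU zV (regular-⊛ {constS (+ 5)} {F} (const-regular 4) (regular-tl {F} refl (regular₀ {tl F} (λ ()))))
    where F = ⟦ vw :* eu :+ nat 4 :* ep :* eN ⟧ (θ c₅ c₅′ c₅₂ zeroS)

  c₅′-U : W.Z (vx :* eU :+ nat 4 :* ep :* eN)
  c₅′-U = certify (θ c₅ c₅′ c₅₂ zeroS) (con (+ 1)) (vx :* eU :+ nat 4 :* ep :* eN)
    ((con (+ 1) , eU :* vx :+ eu :* vw) ∷ (con (- + 1) , vw :* eu :- nat 4 :* ep :* eN) ∷ []) regular₁ (zU All.∷ c₅-u All.∷ All.[])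

  c₅₂-value : c₅₂ ≋ ((+ 2) ⊙ (C ⊛ D) ⊕ ⊝ (A ⊛ B)) ⊕ ⊝ (a ⊛ b)
  c₅₂-value = x-y≈0⇒x≈y (via (vy :- (((+ 2) :· (vC :* vD) :- vA :* vB) :- va :* vb)) (vy :- (nat 2 :* vC :* vD :- vA :* vB :- va :* vb)) (θ c₅ c₅′ c₅₂ zeroS)
    (W.c₅²-value zR₁ Q.z₁ (via (vw :+ vx :+ nat 2 :* vy) (vw :+ vx :+ (+ 2) :· vy) (θ c₅ c₅′ c₅₂ zeroS) c₅-even) c₅-u c₅′-U (regular₀ {⟦ nat 8 :* ep :* eρ₅ ⟧ (θ c₅ c₅′ c₅₂ zeroS)} (λ ()))))

  G₅-value : G₅ ≋ A ⊛ D ⊕ ⊝ (B ⊛ C)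
  G₅-value = x-y≈0⇒x≈y (G.g₅-value Q.z₂
    (via (nat 4 :* es :* vx :- (eU :+ nat 4 :* vC :^ 2) :* vw) ((+ 4) :· (((+ 5) :· (vB :* vD) :- vA :* vC) :* vx) :- (sU vA vB :+ (+ 4) :· (vC :* vC)) :* vw) (θ c₅ G₅ zeroS zeroS)
      (x≋y⇒x-y≋0 (≋-trans (≋-sym (⊙-cong (+ 4) (⊛-congʳ G₅ Sg-value))) (≋-trans c₅-G₅ (⊛-congʳ c₅ (⊕-cong Sc-value (⊙-cong (+ 4) Γ₂-value)))))))
    c₅-u (regular₀ {⟦ nat 4 :* es :* eu ⟧ (θ c₅ G₅ zeroS zeroS)} (λ ())))

-- The character moved from the index to the exponent.

module TwistedExponents where

  open Polynomials
  open SeriesRing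
  open IntegerSums
  open Substitution
  open Families
  open Characters
  open RationalFamilies
  open LambertFamilies
  open Multiples
  open LambertPairs
  open ArithmeticGeometricMean
  open Lattices
  open ThetaNorms
  open ThetaRelations
  open LambertProducts
  open TwistedTotals

  χ₁-∣ : ∀ n → 5 ∣ n → χ₁ n ≡ + 0
  χ₁-∣ n d = trans (χ₁-periodic n) (cong χ₁ (n∣m⇒m%n≡0 n 5 d))

  χ₁-unit : ∀ n → ¬ 5 ∣ n → χ₁ n * χ₁ n ≡ + 1
  χ₁-unit n ¬d = trans (cong (λ x → x * x) (χ₁-periodic n)) (go (n % 5) (m%n<n n 5) (λ e → ¬d (m%n≡0⇒n∣m n 5 e)))
    where
    go : ∀ r → r < 5 → r ≢ 0 → χ₁ r * χ₁ r ≡ + 1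
    go 0 _ z = ⊥-elim (z refl)
    go 1 _ _ = refl
    go 2 _ _ = refl
    go 3 _ _ = refl
    go 4 _ _ = refl
    go (suc (suc (suc (suc (suc _))))) (s≤s (s≤s (s≤s (s≤s (s≤s ()))))) _

  χ₁-cancel : ∀ m k → ¬ 5 ∣ m → 5 ∣ m ℕ.* k → χ₁ k ≡ + 0
  χ₁-cancel m k ¬d d = begin
    χ₁ k                     ≡⟨ sym (ℤP.*-identityˡ (χ₁ k)) ⟩
    + 1 * χ₁ k               ≡⟨ cong (_* χ₁ k) (sym (χ₁-unit m ¬d)) ⟩
    (χ₁ m * χ₁ m) * χ₁ k     ≡⟨ ℤP.*-assoc (χ₁ m) (χ₁ m) (χ₁ k) ⟩
    χ₁ m * (χ₁ m * χ₁ k)     ≡⟨ cong (χ₁ m *_) (trans (sym (χ₁-* m k)) (χ₁-∣ (m ℕ.* k) d)) ⟩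
    χ₁ m * + 0               ≡⟨ ℤP.*-zeroʳ (χ₁ m) ⟩
    + 0                      ∎
    where open ≡-Reasoning

  -- Moving χ from the index m to the exponent k multiplies the coefficient of qⁿ by χ(n), n = m k.
  module Twisted (c ĉ : ℤ) (f f̂ : Series) (f₀ : f 0 ≡ + 0) (e : ∀ k → f̂ k ≡ χ₁ k * f k) where
    f̂₀ : f̂ 0 ≡ + 0
    f̂₀ = trans (e 0) (trans (cong (χ₁ 0 *_) f₀) (ℤP.*-zeroʳ (χ₁ 0)))

    coprime : ∀ n → ¬ 5 ∣ n → ΣZ (evF ĉ f̂) n ≡ χ₁ n * ΣZ (wt χᶻ (evF c f)) n
    coprime n ¬d = sym (trans (sym (sumℤ-*ˡ n (χ₁ n) (λ m → χᶻ m * evF c f m n))) (sumℤ-cong n (λ m → term ∣ m ∣)))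
      where
      term : ∀ a → χ₁ n * (χ₁ a * baseFam c f a n) ≡ baseFam ĉ f̂ a n
      term zero    = trans (cong (χ₁ n *_) (ℤP.*-zeroˡ (baseFam c f 0 n))) (trans (ℤP.*-zeroʳ (χ₁ n)) (sym (const0 n (λ { refl → ¬d (divides 0 refl) }))))
        where
        const0 : ∀ n → n ≢ 0 → constS ĉ n ≡ + 0
        const0 zero    z = ⊥-elim (z refl)
        const0 (suc n) _ = ℤP.*-zeroʳ ĉ
      term (suc a) = by-multiples (suc a) (λ n → ¬ 5 ∣ n → χ₁ n * (χ₁ (suc a) * sub (suc a) f n) ≡ sub (suc a) f̂ n)
        (λ k ¬d → begin
          χ₁ (suc a ℕ.* k) * (χ₁ (suc a) * sub (suc a) f (suc a ℕ.* k)) ≡⟨ cong₂ (λ x y → x * (χ₁ (suc a) * y)) (χ₁-* (suc a) k) (sub-at (suc a) f k) ⟩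
          (χ₁ (suc a) * χ₁ k) * (χ₁ (suc a) * f k)                      ≡⟨ shuffle (χ₁ (suc a)) (χ₁ k) (f k) ⟩
          (χ₁ (suc a) * χ₁ (suc a)) * (χ₁ k * f k)                      ≡⟨ cong (_* (χ₁ k * f k)) (χ₁-unit (suc a) (λ d → ¬d (∣-trans d (m∣m*n k)))) ⟩
          + 1 * (χ₁ k * f k)                                            ≡⟨ ℤP.*-identityˡ _ ⟩
          χ₁ k * f k                                                    ≡⟨ sym (trans (sub-at (suc a) f̂ k) (e k)) ⟩
          sub (suc a) f̂ (suc a ℕ.* k)                                   ∎)
        (λ n ¬m _ → trans (cong (λ z → χ₁ n * (χ₁ (suc a) * z)) (sub-∤ (suc a) f n ¬m)) (trans (lem (χ₁ n) (χ₁ (suc a))) (sym (sub-∤ (suc a) f̂ n ¬m))))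
        n ¬d
        where
        open ≡-Reasoning
        shuffle : ∀ a k f → (a * k) * (a * f) ≡ (a * a) * (k * f)
        shuffle = solve-∀
        lem : ∀ a b → a * (b * + 0) ≡ + 0
        lem = solve-∀

    -- For an index m prime to 5, an exponent k with 5 ∣ m k has χ(k) = 0. Only indices divisible by
    -- 5 contribute to the coefficient of q^(5n), and these give the sum in q⁵ again.
    multiple : ∀ n → ΣZ (evF ĉ f̂) (5 ℕ.* n) ≡ ΣZ (evF ĉ f̂) n
    multiple n = begin
      sumℤ L (λ m → F m L)                              ≡⟨ sumℤ-cong L (λ m → sym (restrict m (5 ∣? ∣ m ∣))) ⟩
      sumℤ L (λ m → when ⌊ 5 ∣? ∣ m ∣ ⌋ (F m L))         ≡⟨ sumℤ-multiples 5 L (λ m → F m L) (λ m z → ≢0⇒≤ {f = F m} (evF-loc ĉ f̂ f̂₀ m) z) ⟩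
      sumℤ L (λ x → F (+ 5 * x) L)                      ≡⟨ sumℤ-cong L (λ x → trans (sym (sub-evF 5 ĉ f̂ x L)) (sub-at 5 (F x) n)) ⟩
      sumℤ L (λ x → F x n)                              ≡⟨ win-loc (evF-loc ĉ f̂ f̂₀) L n (ℕP.m≤n*m n 5) ⟩
      ΣZ F n                                            ∎
      where
      open ≡-Reasoning
      L = 5 ℕ.* n
      F = evF ĉ f̂
      zero′ : ∀ a → ¬ 5 ∣ a → baseFam ĉ f̂ a L ≡ + 0
      zero′ zero    ¬d = ⊥-elim (¬d (divides 0 refl))
      zero′ (suc a) ¬d = by-multiples (suc a) (λ L → 5 ∣ L → sub (suc a) f̂ L ≡ + 0)
        (λ k d → trans (sub-at (suc a) f̂ k) (trans (e k) (trans (cong (_* f k) (χ₁-cancel (suc a) k ¬d d)) (ℤP.*-zeroˡ (f k)))))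
        (λ L ¬m _ → sub-∤ (suc a) f̂ L ¬m) L (m∣m*n n)
      restrict : ∀ m (d : Dec (5 ∣ ∣ m ∣)) → when ⌊ d ⌋ (F m L) ≡ F m L
      restrict m (yes _) = refl
      restrict m (no ¬d) = sym (zero′ ∣ m ∣ ¬d)

    untwisted : ∀ ε → (∀ k → f (5 ℕ.* k) ≡ ε * f k) → ∀ n → ΣZ (wt χᶻ (evF c f)) (5 ℕ.* n) ≡ ε * ΣZ (wt χᶻ (evF c f)) n
    untwisted ε h n = trans (sumℤ-cong (5 ℕ.* n) (λ m → term ∣ m ∣)) (trans (sumℤ-*ˡ (5 ℕ.* n) ε (λ m → χᶻ m * evF c f m n))
      (cong (ε *_) (win-loc (wt-loc χᶻ (evF-loc c f f₀)) (5 ℕ.* n) n (ℕP.m≤n*m n 5))))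
      where
      term : ∀ a → χ₁ a * baseFam c f a (5 ℕ.* n) ≡ ε * (χ₁ a * baseFam c f a n)
      term zero    = trans (ℤP.*-zeroˡ (baseFam c f 0 (5 ℕ.* n))) (sym (trans (cong (ε *_) (ℤP.*-zeroˡ (baseFam c f 0 n))) (ℤP.*-zeroʳ ε)))
      term (suc a) with 5 ∣? suc a
      ... | yes d = trans (cong (_* sub (suc a) f (5 ℕ.* n)) (χ₁-∣ (suc a) d)) (trans (ℤP.*-zeroˡ (sub (suc a) f (5 ℕ.* n))) (sym (trans (cong (λ x → ε * (x * sub (suc a) f n)) (χ₁-∣ (suc a) d)) (trans (cong (ε *_) (ℤP.*-zeroˡ (sub (suc a) f n))) (ℤP.*-zeroʳ ε)))))
      ... | no ¬d = by-multiples (suc a) (λ n → χ₁ (suc a) * sub (suc a) f (5 ℕ.* n) ≡ ε * (χ₁ (suc a) * sub (suc a) f n))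
        (λ k → trans (cong (χ₁ (suc a) *_) (trans (cong (sub (suc a) f) (swap₅ (suc a) k)) (trans (sub-at (suc a) f (5 ℕ.* k)) (h k))))
          (trans (swap (χ₁ (suc a)) ε (f k)) (cong (λ z → ε * (χ₁ (suc a) * z)) (sym (sub-at (suc a) f k)))))
        (λ n ¬m → trans (by-multiples (suc a) (λ N → 5 ∣ N → ¬ (suc a ℕ.* 5 ∣ N) → χ₁ (suc a) * sub (suc a) f N ≡ + 0)
            (λ k d ¬p → ⊥-elim (¬p (*-pres-∣ (∣-refl {suc a}) (5∣ (suc a) k ¬d d))))
            (λ N ¬m′ _ _ → trans (cong (χ₁ (suc a) *_) (sub-∤ (suc a) f N ¬m′)) (ℤP.*-zeroʳ (χ₁ (suc a)))) (5 ℕ.* n) (m∣m*n n)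
            (λ p → ¬m (*-cancelˡ-∣ 5 (subst (_∣ 5 ℕ.* n) (ℕP.*-comm (suc a) 5) p))))
          (sym (trans (cong (λ z → ε * (χ₁ (suc a) * z)) (sub-∤ (suc a) f n ¬m)) (lem ε (χ₁ (suc a)))))) n
        where
        swap₅ : ∀ a k → 5 ℕ.* (a ℕ.* k) ≡ a ℕ.* (5 ℕ.* k)
        swap₅ = ℕR.solve-∀
        swap : ∀ a e f → a * (e * f) ≡ e * (a * f)
        swap = solve-∀
        lem : ∀ a b → a * (b * + 0) ≡ + 0
        lem = solve-∀
        5∣ : ∀ m k → ¬ 5 ∣ m → 5 ∣ m ℕ.* k → 5 ∣ k
        5∣ m k ¬d d with 5 ∣? k
        ... | yes p = p
        ... | no ¬p = ⊥-elim (absurd (trans (sym (χ₁-unit k ¬p)) (cong (λ x → x * x) (χ₁-cancel m k ¬d d))))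
          where absurd : + 1 ≢ + 0
                absurd ()

  sq-weight-0 : ∀ k (w : ℕ → ℤ) → (∀ p → w (k ℕ.* (p ℕ.* p)) ≡ + 0) → ∀ n → w n * ΣZ (sq k) n ≡ + 0
  sq-weight-0 k w h n = trans (sym (sumℤ-*ˡ n (w n) (λ m → sq k m n))) (sumℤ-zero n (λ m _ → term m))
    where
    term : ∀ m → w n * sq k m n ≡ + 0
    term m with sq k m n ℤ.≟ + 0
    ... | yes z = trans (cong (w n *_) z) (ℤP.*-zeroʳ (w n))
    ... | no ¬z = trans (cong (_* sq k m n) (trans (cong w (sym (mono-≢ (k ℕ.* (∣ m ∣ ℕ.* ∣ m ∣)) n ¬z))) (h ∣ m ∣))) (ℤP.*-zeroˡ (sq k m n))

  sq-multiple : ∀ k .{{_ : ℕ.NonZero k}} → ¬ 5 ∣ k → ∀ n → ΣZ (sq k) (5 ℕ.* n) ≡ sub 5 (ΣZ (sq k)) n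
  sq-multiple k ¬k n = begin
    sumℤ M (λ m → sq k m M)                      ≡⟨ sumℤ-cong M (λ m → sym (restrict m (5 ∣? ∣ m ∣))) ⟩
    sumℤ M (λ m → when ⌊ 5 ∣? ∣ m ∣ ⌋ (sq k m M)) ≡⟨ sumℤ-multiples 5 M (λ m → sq k m M) (λ m z → ≢0⇒≤ {f = sq k m} (sq-loc k m) z) ⟩
    sumℤ M (λ x → sq k (+ 5 * x) M)              ≡⟨ sumℤ-cong M (λ x → trans (cong (λ j → mono j M) (trans (cong (λ p → k ℕ.* (p ℕ.* p)) (ℤP.abs-* (+ 5) x)) (ring k ∣ x ∣)))
                                                      (trans (sym (sub-mono 5 (5 ℕ.* (k ℕ.* (∣ x ∣ ℕ.* ∣ x ∣))) M)) (trans (sub-at 5 (mono (5 ℕ.* (k ℕ.* (∣ x ∣ ℕ.* ∣ x ∣)))) n) (sym (sub-mono 5 (k ℕ.* (∣ x ∣ ℕ.* ∣ x ∣)) n))))) ⟩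
    sumℤ M (λ x → sub 5 (sq k x) n)              ≡⟨ win-loc {λ x → sub 5 (sq k x)} loc₅ M n (ℕP.m≤n*m n 5) ⟩
    ΣZ (λ x → sub 5 (sq k x)) n                  ≡⟨ sym (sub-ΣZ 5 (sq-loc k) n) ⟩
    sub 5 (ΣZ (sq k)) n                          ∎
    where
    open ≡-Reasoning
    M = 5 ℕ.* n
    ring : ∀ k p → k ℕ.* ((5 ℕ.* p) ℕ.* (5 ℕ.* p)) ≡ 5 ℕ.* (5 ℕ.* (k ℕ.* (p ℕ.* p)))
    ring = ℕR.solve-∀
    loc₅ : Loc (λ x → sub 5 (sq k x))
    loc₅ x i i<x = ord-sub 5 ∣ x ∣ {sq k x} (sq-loc k x) i (ℕP.<-≤-trans i<x (ℕP.m≤n*m ∣ x ∣ 5))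
    restrict : ∀ m (d : Dec (5 ∣ ∣ m ∣)) → when ⌊ d ⌋ (sq k m M) ≡ sq k m M
    restrict m (yes _) = refl
    restrict m (no ¬d) with sq k m M ℤ.≟ + 0
    ... | yes z = sym z
    ... | no ¬z = ⊥-elim (absurd (trans (sym (χ₁-unit ∣ m ∣ ¬d)) (trans (sym (χ₁-* ∣ m ∣ ∣ m ∣))
        (χ₁-cancel k (∣ m ∣ ℕ.* ∣ m ∣) ¬k (subst (5 ∣_) (sym (mono-≢ (k ℕ.* (∣ m ∣ ℕ.* ∣ m ∣)) M ¬z)) (m∣m*n n))))))
      where absurd : + 1 ≢ + 0
            absurd ()

  A-multiple : ∀ n → A (5 ℕ.* n) ≡ B n
  A-multiple = sq-multiple 1 (λ d → ℕP.1+n≢0 (n∣m⇒m%n≡0 1 5 d))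

  C-multiple : ∀ n → C (5 ℕ.* n) ≡ D n
  C-multiple n = trans (sub-A 2 (5 ℕ.* n)) (trans (sq-multiple 2 (λ d → ℕP.1+n≢0 (n∣m⇒m%n≡0 2 5 d)) n) (trans (sub-cong 5 (≋-sym (sub-A 2)) n) (sub5-C n)))

  AB-multiple : ∀ n → (A ⊛ B) (5 ℕ.* n) ≡ (A ⊛ B) n
  AB-multiple n = trans (⊛-sub-at 5 A A n) (trans (⊛-congʳ A A-multiple n) (⊛-comm B A n))

  AD-multiple : ∀ n → (A ⊛ D) (5 ℕ.* n) ≡ (B ⊛ C) n
  AD-multiple n = trans (⊛-congˡ A (≋-sym sub5-C) (5 ℕ.* n)) (trans (⊛-sub-at 5 A C n) (⊛-congʳ C A-multiple n))

  BC-multiple : ∀ n → (B ⊛ C) (5 ℕ.* n) ≡ (A ⊛ D) n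
  BC-multiple n = trans (⊛-comm B C (5 ℕ.* n)) (trans (⊛-sub-at 5 C A n) (trans (⊛-congʳ A C-multiple n) (⊛-comm D A n)))

  -- The weights χ² - χ and χ² + χ encode residue conditions multiplicatively: the first kills
  -- series whose exponents have χ in {0, 1}, as squares do, and the second those with χ in {0, -1},
  -- as twice a square does.
  w⁻ w⁺ : ℕ → ℤ
  w⁻ n = χ₁ n * χ₁ n + - χ₁ n
  w⁺ n = χ₁ n * χ₁ n + χ₁ n

  private
    periodic-w : ∀ (g : ℤ → ℤ) → Periodic 5 (λ n → g (χ₁ n))
    periodic-w g n = cong g (χ₁-periodic n)

    square-table : ∀ (g : ℤ → ℤ) → g (+ 0) ≡ + 0 → g (+ 1) ≡ + 0 → ∀ p → g (χ₁ p * χ₁ p) ≡ + 0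
    square-table g g₀ g₁ p with 5 ∣? p
    ... | yes d = trans (cong (λ x → g (x * x)) (χ₁-∣ p d)) g₀
    ... | no ¬d = trans (cong g (χ₁-unit p ¬d)) g₁

  A-residues : ∀ n → w⁻ n * A n ≡ + 0
  A-residues = sq-weight-0 1 w⁻ (λ p → trans (cong (λ x → x * x + - x) (trans (cong χ₁ (ℕP.*-identityˡ (p ℕ.* p))) (χ₁-* p p))) (square-table (λ x → x * x + - x) refl refl p))

  C-residues : ∀ n → w⁺ n * C n ≡ + 0
  C-residues n = trans (cong (w⁺ n *_) (sub-A 2 n)) (sq-weight-0 2 w⁺ (λ p → trans (cong (λ x → x * x + x) (trans (χ₁-* 2 (p ℕ.* p)) (cong (- + 1 *_) (χ₁-* p p))))
    (square-table (λ x → (- + 1 * x) * (- + 1 * x) + - + 1 * x) refl refl p)) n)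

  private
    product-residues : ∀ (g : ℤ → ℤ) f h → (∀ n → g (χ₁ n) * f n ≡ + 0) → ∀ n → g (χ₁ n) * (f ⊛ sub 5 h) n ≡ + 0
    product-residues g f h z n = trans (periodic-⊛ 5 {λ n → g (χ₁ n)} (periodic-w g) f h n) (trans (⊛-congʳ (sub 5 h) {λ i → g (χ₁ i) * f i} {zeroS} z n) (zeroS-⊛ (sub 5 h) n))

  AB-residues : ∀ n → w⁻ n * (A ⊛ B) n ≡ + 0
  AB-residues = product-residues (λ x → x * x + - x) A A A-residues

  AD-residues : ∀ n → w⁻ n * (A ⊛ D) n ≡ + 0
  AD-residues n = trans (cong (w⁻ n *_) (⊛-congˡ A (≋-sym sub5-C) n)) (product-residues (λ x → x * x + - x) A C A-residues n)

  BC-residues : ∀ n → w⁺ n * (B ⊛ C) n ≡ + 0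
  BC-residues n = trans (cong (w⁺ n *_) (⊛-comm B C n)) (product-residues (λ x → x * x + x) C A C-residues n)

  private
    fixed : ∀ x y → x * x ≡ + 1 → (x * x + - x) * y ≡ + 0 → x * y ≡ y
    fixed x y u z = trans (lem x y) (trans (cong₂ (λ p q → p * y + - q) u z) (tidy y))
      where
      lem : ∀ x y → x * y ≡ (x * x) * y + - ((x * x + - x) * y)
      lem = solve-∀
      tidy : ∀ y → + 1 * y + - + 0 ≡ y
      tidy = solve-∀
    negated : ∀ x y → x * x ≡ + 1 → (x * x + x) * y ≡ + 0 → x * y ≡ - y
    negated x y u z = trans (lem x y) (trans (cong₂ (λ p q → q + - (p * y)) u z) (tidy y))
      where
      lem : ∀ x y → x * y ≡ (x * x + x) * y + - ((x * x) * y)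
      lem = solve-∀
      tidy : ∀ y → + 0 + - (+ 1 * y) ≡ - y
      tidy = solve-∀

  c₅₂-sub : c₅₂ ≋ sub 2 c₅
  c₅₂-sub = ΣZ-sc 2 χᶻ (+ 1) kc refl

  -- The closed form is known for c₅(q²), so it is read at the exponent 2n, where a b and A B have
  -- equal coefficients.
  c₅-coefficient : ∀ n → c₅ n ≡ + 2 * (A ⊛ B) n + - (+ 2 * (A ⊛ B) (2 ℕ.* n))
  c₅-coefficient n = begin
    c₅ n ≡⟨ sym (trans (c₅₂-sub (2 ℕ.* n)) (sub-at 2 c₅ n)) ⟩
    c₅₂ (2 ℕ.* n) ≡⟨ c₅₂-value (2 ℕ.* n) ⟩
    (+ 2 * (C ⊛ D) (2 ℕ.* n) + - (A ⊛ B) (2 ℕ.* n)) + - (a ⊛ b) (2 ℕ.* n)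
      ≡⟨ cong₂ (λ x y → (+ 2 * x + - (A ⊛ B) (2 ℕ.* n)) + - y)
           (trans (sym (trans (sub-⊛ 2 A B (2 ℕ.* n)) (⊛-congˡ C sub2-B (2 ℕ.* n)))) (sub-at 2 (A ⊛ B) n))
           (trans (sym (trans (twist-⊛ A B (2 ℕ.* n)) (⊛-cong twist-A twist-B (2 ℕ.* n)))) (trans (cong (_* (A ⊛ B) (2 ℕ.* n)) (sgn-even n)) (ℤP.*-identityˡ _))) ⟩
    (+ 2 * (A ⊛ B) n + - (A ⊛ B) (2 ℕ.* n)) + - (A ⊛ B) (2 ℕ.* n) ≡⟨ lem ((A ⊛ B) n) ((A ⊛ B) (2 ℕ.* n)) ⟩
    + 2 * (A ⊛ B) n + - (+ 2 * (A ⊛ B) (2 ℕ.* n)) ∎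
    where
    open ≡-Reasoning
    lem : ∀ x y → (+ 2 * x + - y) + - y ≡ + 2 * x + - (+ 2 * y)
    lem = solve-∀

  by-fives : ∀ (P : ℕ → Set) → P 0 → (∀ n → P n → P (5 ℕ.* n)) → (∀ n → ¬ 5 ∣ n → P n) → ∀ n → P n
  by-fives P p₀ p₅ p n = go n n ℕP.≤-refl
    where
    go : ∀ N n → n ≤ N → P n
    go N n = by-multiples 5 (λ n → n ≤ N → P n) (on N) (λ n ¬d _ → p n ¬d) n
      where
      on : ∀ N j → 5 ℕ.* j ≤ N → P (5 ℕ.* j)
      on N       zero    _ = p₀
      on (suc N) (suc j) h = p₅ (suc j) (go N (suc j) (ℕP.≤-pred (ℕP.≤-trans (ℕP.m<m+n (suc j) (s≤s z≤n)) h)))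

  -- For n prime to 5, χ(n) = 1 wherever A B has a coefficient at n, and χ(n) = -1 wherever it has
  -- one at 2n. Multiplying `c₅-coefficient` by χ(n) thus only changes the sign of its second term.
  -- All the series involved are unchanged under n ↦ 5n, which reduces the remaining exponents to
  -- these.
  ĉ₅-value : ĉ₅ ≋ (+ 4) ⊙ (A ⊛ B) ⊕ ⊝ c₅
  ĉ₅-value = by-fives (λ n → ĉ₅ n ≡ + 4 * (A ⊛ B) n + - c₅ n) refl
    (λ n h → trans (T.multiple n) (trans h (cong₂ (λ x y → + 4 * x + - y) (sym (AB-multiple n)) (sym (trans (T.untwisted (+ 1) (λ k → trans (kc₅ k) (sym (ℤP.*-identityˡ (kc k)))) n) (ℤP.*-identityˡ _))))))
    off
    where
    swap : ∀ x y → + 2 * (x * y) ≡ y * (+ 2 * x)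
    swap = solve-∀
    module T = Twisted (+ 1) (+ 4) kc kĉ refl (λ k → swap (ψ₄ k) (χ₁ k))
    kc₅ : ∀ k → kc (5 ℕ.* k) ≡ kc k
    kc₅ 0             = refl
    kc₅ 1             = refl
    kc₅ (suc (suc k)) = trans (cong kc (ring k)) (trans (cong (+ 2 *_) (neg₅ (ψ₄ (5 ℕ.* k)))) (trans (sym (ℤP.neg-distribʳ-* (+ 2) (ψ₄ (5 ℕ.* k)))) (trans (cong -_ (kc₅ k)) (ℤP.neg-distribʳ-* (+ 2) (ψ₄ k)))))
      where
      ring : ∀ k → 5 ℕ.* (2 ℕ.+ k) ≡ 10 ℕ.+ 5 ℕ.* k
      ring = ℕR.solve-∀
      neg₅ : ∀ x → - - - - - x ≡ - x
      neg₅ = solve-∀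
    off : ∀ n → ¬ 5 ∣ n → ĉ₅ n ≡ + 4 * (A ⊛ B) n + - c₅ n
    off n ¬d = trans (T.coprime n ¬d) (trans (cong (χ₁ n *_) (c₅-coefficient n)) (trans (expand (χ₁ n) ((A ⊛ B) n) ((A ⊛ B) (2 ℕ.* n)))
      (trans (cong₂ (λ x y → + 2 * x + - (+ 2 * y)) (fixed (χ₁ n) ((A ⊛ B) n) (χ₁-unit n ¬d) (AB-residues n)) (negated (χ₁ n) ((A ⊛ B) (2 ℕ.* n)) (χ₁-unit n ¬d) second))
        (trans (collect ((A ⊛ B) n) ((A ⊛ B) (2 ℕ.* n))) (cong (λ z → + 4 * (A ⊛ B) n + - z) (sym (c₅-coefficient n)))))))
      where
      expand : ∀ x p q → x * (+ 2 * p + - (+ 2 * q)) ≡ + 2 * (x * p) + - (+ 2 * (x * q))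
      expand = solve-∀
      collect : ∀ p q → + 2 * p + - (+ 2 * - q) ≡ + 4 * p + - (+ 2 * p + - (+ 2 * q))
      collect = solve-∀
      second : (χ₁ n * χ₁ n + χ₁ n) * (A ⊛ B) (2 ℕ.* n) ≡ + 0
      second = trans (cong (_* (A ⊛ B) (2 ℕ.* n)) (sym (trans (cong (λ x → x * x + - x) (χ₁-* 2 n)) (flip (χ₁ n))))) (AB-residues (2 ℕ.* n))
        where flip : ∀ x → (- + 1 * x) * (- + 1 * x) + - (- + 1 * x) ≡ x * x + x
              flip = solve-∀

  -- At exponents prime to 5, χ is 1 on the support of A D and -1 on that of B C, so the difference
  -- A D - B C becomes the sum. Passing from n to 5n exchanges the two products, and the sum is
  -- invariant.
  Ĝ₅-value : Ĝ₅ ≋ A ⊛ D ⊕ B ⊛ C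
  Ĝ₅-value = by-fives (λ n → Ĝ₅ n ≡ (A ⊛ D) n + (B ⊛ C) n) refl
    (λ n h → trans (T.multiple n) (trans h (trans (ℤP.+-comm ((A ⊛ D) n) ((B ⊛ C) n)) (cong₂ _+_ (sym (AD-multiple n)) (sym (BC-multiple n)))))) off
    where
    module T = Twisted (+ 1) (+ 2) ψ₈ kĜ refl (λ k → ℤP.*-comm (ψ₈ k) (χ₁ k))
    off : ∀ n → ¬ 5 ∣ n → Ĝ₅ n ≡ (A ⊛ D) n + (B ⊛ C) n
    off n ¬d = trans (T.coprime n ¬d) (trans (cong (χ₁ n *_) (G₅-value n)) (trans (expand (χ₁ n) ((A ⊛ D) n) ((B ⊛ C) n))
      (trans (cong₂ (λ x y → x + - y) (fixed (χ₁ n) _ (χ₁-unit n ¬d) (AD-residues n)) (negated (χ₁ n) _ (χ₁-unit n ¬d) (BC-residues n))) (lem ((A ⊛ D) n) ((B ⊛ C) n)))))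
      where
      expand : ∀ x p q → x * (p + - q) ≡ x * p + - (x * q)
      expand = solve-∀
      lem : ∀ p q → p + - - q ≡ p + q
      lem = solve-∀

-- Moments and Euler derivatives of Lambert families as Eisenstein series.

module EisensteinSeries where

  open Polynomials
  open SeriesRing
  open IntegerSums
  open Substitution
  open Families
  open RationalFamilies
  open Lines
  open Multiples
  open LambertPairs
  open PairIdentities
  open ThetaRelations
  open Forms

  sum1To-zero : ∀ n {g : ℕ → ℤ} → (∀ k → k < n → g (suc k) ≡ + 0) → sum1To n g ≡ + 0
  sum1To-zero zero    h = refl
  sum1To-zero (suc n) h = cong₂ _+_ (sum1To-zero n (λ k k<n → h k (ℕP.m<n⇒m<1+n k<n))) (h n ℕP.≤-refl)

  sum1To-single : ∀ n j {g : ℕ → ℤ} → j < n → (∀ k → k ≢ j → g (suc k) ≡ + 0) → sum1To n g ≡ g (suc j)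
  sum1To-single (suc n) j {g} (s≤s j≤n) h with ℕP.m≤n⇒m<n∨m≡n j≤n
  ... | inj₁ j<n    = trans (cong₂ _+_ (sum1To-single n j {g} j<n h) (h n (λ e → ℕP.<-irrefl (sym e) j<n))) (ℤP.+-identityʳ _)
  ... | inj₂ refl = trans (cong (_+ g (suc n)) (sum1To-zero n {g} (λ k k<n → h k (λ e → ℕP.<-irrefl e k<n)))) (ℤP.+-identityˡ _)

  sum1To-+ : ∀ n (f g : ℕ → ℤ) → sum1To n (λ i → f i + g i) ≡ sum1To n f + sum1To n g
  sum1To-+ zero    f g = refl
  sum1To-+ (suc n) f g = trans (cong (_+ (f (suc n) + g (suc n))) (sum1To-+ n f g)) (lem (sum1To n f) (sum1To n g) (f (suc n)) (g (suc n)))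
    where lem : ∀ a b c d → (a + b) + (c + d) ≡ (a + c) + (b + d)
          lem = solve-∀

  sum1To-0 : ∀ n → sum1To n (λ _ → + 0) ≡ + 0
  sum1To-0 n = sum1To-zero n (λ _ _ → refl)

  sum1To-swap : ∀ m n (f : ℕ → ℕ → ℤ) → sum1To m (λ i → sum1To n (f i)) ≡ sum1To n (λ j → sum1To m (λ i → f i j))
  sum1To-swap zero    n f = sym (sum1To-0 n)
  sum1To-swap (suc m) n f = trans (cong (_+ sum1To n (f (suc m))) (sum1To-swap m n f)) (sym (sum1To-+ n (λ j → sum1To m (λ i → f i j)) (f (suc m))))

  divisor-term : ∀ a x (f : ℕ → ℤ) → f 0 ≡ + 0 → ∀ n → x * sub (suc a) f n ≡ sum1To n (λ k → when ⌊ suc a ℕ.* k ℕ.≟ n ⌋ (x * f k))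
  divisor-term a x f f₀ = by-multiples (suc a) (λ n → x * sub (suc a) f n ≡ sum1To n (λ k → when ⌊ suc a ℕ.* k ℕ.≟ n ⌋ (x * f k))) on off
    where
    on : ∀ j → x * sub (suc a) f (suc a ℕ.* j) ≡ sum1To (suc a ℕ.* j) (λ k → when ⌊ suc a ℕ.* k ℕ.≟ suc a ℕ.* j ⌋ (x * f k))
    on zero    = trans (cong (x *_) (trans (sub-at (suc a) f 0) f₀)) (trans (ℤP.*-zeroʳ x) (sym (cong (λ n → sum1To n (λ k → when ⌊ suc a ℕ.* k ℕ.≟ suc a ℕ.* 0 ⌋ (x * f k))) (ℕP.*-zeroʳ a))))
    on (suc j) = trans (cong (x *_) (sub-at (suc a) f (suc j))) (sym (trans
      (sum1To-single (suc a ℕ.* suc j) j (ℕP.m≤m+n (suc j) (a ℕ.* suc j)) (λ k k≢j → when-no (suc a ℕ.* suc k ℕ.≟ suc a ℕ.* suc j) _ (λ e → k≢j (ℕP.suc-injective (ℕP.*-cancelˡ-≡ (suc k) (suc j) (suc a) e)))))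
      (when-yes (suc a ℕ.* suc j ℕ.≟ suc a ℕ.* suc j) _ refl)))
    off : ∀ n → ¬ suc a ∣ n → x * sub (suc a) f n ≡ sum1To n (λ k → when ⌊ suc a ℕ.* k ℕ.≟ n ⌋ (x * f k))
    off n ¬d = trans (cong (x *_) (sub-∤ (suc a) f n ¬d)) (trans (ℤP.*-zeroʳ x) (sym (sum1To-zero n (λ k _ → when-no (suc a ℕ.* suc k ℕ.≟ n) _ (λ e → ¬d (subst (suc a ∣_) e (m∣m*n (suc k))))))))

  lambert : ∀ c (w f : ℕ → ℤ) → f 0 ≡ + 0 → ∀ n → sum1To n (λ m → w m * baseFam c f m n) ≡ sum1To n (λ m → sum1To n (λ k → when ⌊ m ℕ.* k ℕ.≟ n ⌋ (w m * f k)))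
  lambert c w f f₀ n = sum1To-cong n (λ a → divisor-term a (w (suc a)) f f₀ n)

  -- One factor 2 is that of 2 M; the other comes from M and - M, whose terms agree because both M
  -- and the family are odd.
  moment-Eis : ∀ (χ ψ : ℕ → ℤ) → χ 0 ≡ + 0 → moment (λ M → ψ ∣ M ∣) (odF χ) ≋ (+ 4) ⊙ Eis (+ 0) χ ψ
  moment-Eis χ ψ χ₀≡0 zero    = trans (cong (_* odF χ (+ 0) 0) (ℤP.*-zeroʳ (ψ 0))) (ℤP.*-zeroˡ (odF χ (+ 0) 0))
  moment-Eis χ ψ χ₀≡0 (suc j) = begin
    sumℤ n (λ M → (ψ ∣ M ∣ * (+ 2 * M)) * odF χ M n)
      ≡⟨ sumℤ-even n _ (λ M → trans (cong₂ (λ s x → (s * (+ 2 * - M)) * x) (cong ψ (ℤP.∣-i∣≡∣i∣ M)) (odF-odd χ M n)) (signs (ψ ∣ M ∣) M (odF χ M n))) ⟩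
    (ψ 0 * + 0) * odF χ (+ 0) n + + 2 * sum1To n (λ m → (ψ m * (+ 2 * + m)) * baseFam (+ 0) χ m n)
      ≡⟨ cong₂ (λ x y → x + + 2 * y) (trans (cong (_* odF χ (+ 0) n) (ℤP.*-zeroʳ (ψ 0))) (ℤP.*-zeroˡ (odF χ (+ 0) n)))
           (trans (sum1To-cong n (λ i → pull (ψ (suc i)) (+ suc i) (sub (suc i) χ n))) (sum1To-*ˡ n (+ 2) (λ m → (ψ m * + m) * baseFam (+ 0) χ m n))) ⟩
    + 0 + + 2 * (+ 2 * sum1To n (λ m → (ψ m * + m) * baseFam (+ 0) χ m n))
      ≡⟨ four _ ⟩
    + 4 * sum1To n (λ m → (ψ m * + m) * baseFam (+ 0) χ m n)
      ≡⟨ cong (+ 4 *_) (trans (lambert (+ 0) (λ m → ψ m * + m) χ χ₀≡0 n) (sum1To-cong n (λ m → sum1To-cong n (λ k → cong (when ⌊ suc m ℕ.* suc k ℕ.≟ n ⌋) (shuffle (ψ (suc m)) (+ suc m) (χ (suc k))))))) ⟩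
    + 4 * σ χ ψ n ∎
    where
    open ≡-Reasoning
    n = suc j
    signs : ∀ s M x → (s * (+ 2 * - M)) * - x ≡ (s * (+ 2 * M)) * x
    signs = solve-∀
    pull : ∀ s M x → (s * (+ 2 * M)) * x ≡ + 2 * ((s * M) * x)
    pull = solve-∀
    four : ∀ x → + 0 + + 2 * (+ 2 * x) ≡ + 4 * x
    four = solve-∀
    shuffle : ∀ a m x → (a * m) * x ≡ (a * x) * m
    shuffle = solve-∀

  θ′ : Series → Series
  θ′ f n = + n * f n

  -- The factor k now sits on the exponent, so the complementary divisor carries χ and the double
  -- sum is transposed. The hypothesis compares constant terms; for `E₀₃` it is -14 = 2 · (-7).
  derivative-Eis : ∀ (χ ψ : ℕ → ℤ) c e → χ 0 * c ≡ + 2 * e → ΣZ (wt (λ M → χ ∣ M ∣) (evF c (θ′ ψ))) ≋ (+ 2) ⊙ Eis e χ ψ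
  derivative-Eis χ ψ c e h zero    = trans (lem (χ 0) c) h
    where lem : ∀ x c → x * (c * + 1) ≡ x * c
          lem = solve-∀
  derivative-Eis χ ψ c e h (suc j) = begin
    sumℤ n (λ M → χ ∣ M ∣ * evF c (θ′ ψ) M n)
      ≡⟨ sumℤ-even n _ (λ M → cong (λ a → χ a * baseFam c (θ′ ψ) a n) (ℤP.∣-i∣≡∣i∣ M)) ⟩
    χ 0 * (c * + 0) + + 2 * sum1To n (λ m → χ m * baseFam c (θ′ ψ) m n)
      ≡⟨ cong₂ (λ x y → x + + 2 * y) (lem (χ 0) c) (lambert c χ (θ′ ψ) (ℤP.*-zeroˡ (ψ 0)) n) ⟩
    + 0 + + 2 * sum1To n (λ m → sum1To n (λ k → when ⌊ m ℕ.* k ℕ.≟ n ⌋ (χ m * (+ k * ψ k))))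
      ≡⟨ trans (ℤP.+-identityˡ _) (cong (+ 2 *_) (trans (sum1To-swap n n _) (sum1To-cong n (λ k → sum1To-cong n (λ m →
           cong₂ (λ i x → when ⌊ i ℕ.≟ n ⌋ x) (ℕP.*-comm (suc m) (suc k)) (shuffle (χ (suc m)) (+ suc k) (ψ (suc k)))))))) ⟩
    + 2 * σ χ ψ n ∎
    where
    open ≡-Reasoning
    n = suc j
    lem : ∀ x c → x * (c * + 0) ≡ + 0
    lem = solve-∀
    shuffle : ∀ x k y → x * (k * y) ≡ (y * x) * k
    shuffle = solve-∀

  private
    -- The equation of `rational` under q d/dq; the second term is the derivative of 1 + q^d.
    rational′ : ∀ d (f : Series) → (∀ n → f (suc d ℕ.+ n) ≡ - + 1 * f n) →
                θ′ f ⊛ den (- + 1) (suc d) (mono 1) ⊕ constS (+ suc d) ⊛ (mono 1 ^ suc d ⊛ f) ≋ hor (tab (suc d) (θ′ f)) (mono 1)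
    rational′ d f h n = trans (expand n) (trans (value n) (look-hor (tab (suc d) (θ′ f)) n))
      where
      D′ = suc d
      q^ : mono 1 ^ D′ ≋ mono D′
      q^ = ≋-trans (mono-^ D′ 1) (λ i → cong (λ k → mono k i) (ℕP.*-identityʳ D′))
      expand : θ′ f ⊛ den (- + 1) D′ (mono 1) ⊕ constS (+ D′) ⊛ (mono 1 ^ D′ ⊛ f) ≋ (θ′ f ⊕ mono D′ ⊛ θ′ f) ⊕ (+ D′) ⊙ (mono D′ ⊛ f)
      expand = ⊕-cong (≋-trans (poly (# 0F :* (con (+ 1) :- con (- + 1) :* # 1F)) (# 0F :+ # 1F :* # 0F) (θ′ f ∷ mono 1 ^ D′ ∷ [])) (⊕-congˡ (θ′ f) (⊛-congʳ (θ′ f) q^)))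
        (≋-trans (constS-⊛ (+ D′) (mono 1 ^ D′ ⊛ f)) (⊙-cong (+ D′) (⊛-congʳ f q^)))
      value : ∀ n → (θ′ f n + (mono D′ ⊛ θ′ f) n) + + D′ * (mono D′ ⊛ f) n ≡ look (tab D′ (θ′ f)) n
      value n with n ℕ.<? D′
      ... | yes n<D = trans (cong₂ (λ x y → (θ′ f n + x) + + D′ * y) (mono-⊛-< D′ (θ′ f) n n<D) (mono-⊛-< D′ f n n<D)) (trans (lem (θ′ f n) (+ D′)) (sym (look-tab-< D′ (θ′ f) n n<D)))
        where lem : ∀ x d → (x + + 0) + d * + 0 ≡ x
              lem = solve-∀
      ... | no n≮D = subst (λ i → (θ′ f i + (mono D′ ⊛ θ′ f) i) + + D′ * (mono D′ ⊛ f) i ≡ look (tab D′ (θ′ f)) i) (ℕP.m+[n∸m]≡n (ℕP.≮⇒≥ n≮D)) (at (n ℕ.∸ D′))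
        where
        cancel : ∀ d m x → (((d + m) * (- + 1 * x)) + m * x) + d * x ≡ + 0
        cancel = solve-∀
        at : ∀ m → (θ′ f (D′ ℕ.+ m) + (mono D′ ⊛ θ′ f) (D′ ℕ.+ m)) + + D′ * (mono D′ ⊛ f) (D′ ℕ.+ m) ≡ look (tab D′ (θ′ f)) (D′ ℕ.+ m)
        at m = trans (trans (cong₂ (λ x y → (+ (D′ ℕ.+ m) * x + (mono D′ ⊛ θ′ f) (D′ ℕ.+ m)) + + D′ * y) (h m) (mono-⊛-+ D′ f m)) (cong (λ z → (+ (D′ ℕ.+ m) * (- + 1 * f m) + z) + + D′ * f m) (mono-⊛-+ D′ (θ′ f) m)))
          (trans (cancel (+ D′) (+ m) (f m)) (sym (look-tab-+ D′ (θ′ f) m)))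

    sub-rational′ : ∀ d (f : Series) → (∀ n → f (suc d ℕ.+ n) ≡ - + 1 * f n) → ∀ a .{{_ : ℕ.NonZero a}} →
                    sub a (θ′ f) ⊛ den (- + 1) (suc d) (mono a) ⊕ constS (+ suc d) ⊛ (mono a ^ suc d ⊛ sub a f) ≋ hor (tab (suc d) (θ′ f)) (mono a)
    sub-rational′ d f h a = ≋-trans (≋-sym (≋-trans (sub-⊕ a (θ′ f ⊛ den (- + 1) D′ (mono 1)) (constS (+ D′) ⊛ (mono 1 ^ D′ ⊛ f))) (⊕-cong
        (≋-trans (sub-⊛ a (θ′ f) (den (- + 1) D′ (mono 1))) (⊛-congˡ (sub a (θ′ f)) subden))
        (≋-trans (sub-⊛ a (constS (+ D′)) (mono 1 ^ D′ ⊛ f)) (⊛-cong (sub-const a (+ D′)) (≋-trans (sub-⊛ a (mono 1 ^ D′) f) (⊛-congʳ (sub a f) subq)))))))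
      (≋-trans (sub-cong a (rational′ d f h)) (≋-trans (sub-hor a (tab D′ (θ′ f)) (mono 1)) (hor-cong (tab D′ (θ′ f)) (sub-mono₁ a))))
      where
      D′ = suc d
      subq : sub a (mono 1 ^ D′) ≋ mono a ^ D′
      subq = ≋-trans (sub-^ a (mono 1) D′) (^-cong D′ (sub-mono₁ a))
      subden : sub a (den (- + 1) D′ (mono 1)) ≋ den (- + 1) D′ (mono a)
      subden = ≋-trans (sub-⊕ a (constS (+ 1)) (⊝ (constS (- + 1) ⊛ mono 1 ^ D′))) (⊕-cong (sub-const a (+ 1))
        (≋-trans (sub-⊝ a (constS (- + 1) ⊛ mono 1 ^ D′)) (⊝-cong (≋-trans (sub-⊛ a (constS (- + 1)) (mono 1 ^ D′)) (⊛-cong (sub-const a (- + 1)) subq)))))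

  module _ (a : ℕ) (z w : Series) where
    open Fractions 𝕊 (mono (suc a)) oneS z w using (Deriv; mkDeriv)

    derivative : ∀ d (f : Series) l → tab (suc d) (θ′ f) ≡ l → length l ≤ suc d → (∀ n → f (suc d ℕ.+ n) ≡ - + 1 * f n) → Deriv (sub (suc a) (θ′ f)) (sub (suc a) f) l (suc d)
    derivative d f l refl b h = mkDeriv (≋-trans (⊕-congʳ (constS (+ suc d) ⊛ (mono (suc a) ^ suc d ⊛ sub (suc a) f))
        (⊛-congˡ (sub (suc a) (θ′ f)) (⊕-congʳ (⊝ (constS (- + 1) ⊛ mono (suc a) ^ suc d)) (≋-trans (one^ (suc d)) (λ n → sym (ℤP.*-identityˡ (oneS n)))))))
      (≋-trans (sub-rational′ d f h (suc a)) (≋-sym (homogeneous l (suc d) b))))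
      where
      homogeneous : ∀ l d → length l ≤ d → ⟦ homE l d (# 0F) (# 1F) ⟧ (mono (suc a) ∷ oneS ∷ z ∷ w ∷ []) ≋ hor l (mono (suc a))
      homogeneous []      d       _       = ≋-refl
      homogeneous (x ∷ l) (suc d) (s≤s b) = ⊕-cong (≋-trans (⊛-congˡ (constS x) (one^ (suc d))) (≋-trans (⊛-comm (constS x) oneS) (oneS-⊛ (constS x)))) (⊛-congˡ (mono (suc a)) (homogeneous l d b))

-- The four Eisenstein series as quartic forms.

module EisensteinValues where

  open Polynomials
  open SeriesRing
  open IntegerSums
  open Substitution
  open Families
  open Characters
  open RationalFamilies
  open LambertFamilies
  open Lines
  open Multiples
  open LambertPairs
  open PairIdentities
  open ArithmeticGeometricMean
  open Lattices
  open ThetaNorms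
  open LambertProducts
  open LambertTotals
  open TwistedTotals
  open TwistedExponents
  open ThetaAlgebra
  open ThetaUnknowns
  open EisensteinSeries

  loc-⊕ : ∀ {F G} → Loc F → Loc G → Loc (λ m → F m ⊕ G m)
  loc-⊕ l l′ m i h = cong₂ _+_ (l m i h) (l′ m i h)

  loc-⊝ : ∀ {F} → Loc F → Loc (λ m → ⊝ F m)
  loc-⊝ l m i h = cong -_ (l m i h)

  loc₂-⊕ : ∀ {X Y} → Loc₂ X → Loc₂ Y → Loc₂ (λ m n → X m n ⊕ Y m n)
  loc₂-⊕ l l′ m n i h = cong₂ _+_ (l m n i h) (l′ m n i h)

  loc₂-⊝ : ∀ {X} → Loc₂ X → Loc₂ (λ m n → ⊝ X m n)
  loc₂-⊝ l m n i h = cong -_ (l m n i h)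

  ΣZ-⊝ : ∀ F → ΣZ (λ m → ⊝ F m) ≋ ⊝ ΣZ F
  ΣZ-⊝ F i = trans (sumℤ-cong i (λ m → sym (ℤP.-1*i≡-i (F m i)))) (trans (sumℤ-*ˡ i (- + 1) (λ m → F m i)) (ℤP.-1*i≡-i _))

  ΣZ-const : ∀ c F → ΣZ (λ m → constS c ⊛ F m) ≋ c ⊙ ΣZ F
  ΣZ-const c F = ≋-trans (ΣZ-cong (λ m → constS-⊛ c (F m))) (ΣZ-⊙ c F)

  private
    𝔻₁ : (ℤ → ℤ → Series) → Series
    𝔻₁ = 𝔻 (λ _ _ → + 1)

    odd-product : ∀ {F G} → Loc F → Loc G → Odd F → 𝔻₁ (λ m n → F m ⊛ G n) ≋ zeroS
    odd-product {F} {G} lF lG o = ≋-trans (𝔻-prod lF lG) (≋-trans (⊛-congʳ (ΣZ G) (ΣZ-odd o)) (zeroS-⊛ (ΣZ G)))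

    odd-pair : ∀ {F G F′ G′} → Loc F → Loc G → Loc F′ → Loc G′ → Odd F → Odd F′ → 𝔻₁ (λ m n → constS (+ 4) ⊛ (F m ⊛ G n ⊕ ⊝ (F′ m ⊛ G′ n))) ≋ zeroS
    odd-pair {F} {G} {F′} {G′} lF lG lF′ lG′ o o′ = ≋-trans (𝔻-const (+ 4) (λ _ _ → + 1) (λ m n → F m ⊛ G n ⊕ ⊝ (F′ m ⊛ G′ n))) (λ i → trans (cong (+ 4 *_)
      (trans (𝔻-⊕ (λ _ _ → + 1) (λ m n → F m ⊛ G n) (λ m n → ⊝ (F′ m ⊛ G′ n)) i) (cong₂ _+_ (odd-product lF lG o i) (trans (𝔻-⊝ (λ _ _ → + 1) (λ m n → F′ m ⊛ G′ n) i) (cong -_ (odd-product lF′ lG′ o′ i)))))) refl)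

    P₁-loc : Loc P₁F
    P₁-loc = odF-loc kP₁ refl
    P₂-loc : Loc P₂F
    P₂-loc = odF-loc kP₂ refl
    Q₁-loc : Loc Q₁F
    Q₁-loc = odF-loc kQ₁ refl
    Q₂-loc : Loc Q₂F
    Q₂-loc = odF-loc kQ₂ refl

  moment-const : ∀ c h V → moment h (λ M → constS c ⊛ V M) ≋ c ⊙ moment h V
  moment-const c h V = ≋-trans (ΣZ-cong {wt (λ M → h M * (+ 2 * M)) (λ M → constS c ⊛ V M)} {λ M → c ⊙ wt (λ M → h M * (+ 2 * M)) V M}
    (λ M i → trans (cong ((h M * (+ 2 * M)) *_) (constS-⊛ c (V M) i)) (swap (h M * (+ 2 * M)) c (V M i)))) (ΣZ-⊙ c (wt (λ M → h M * (+ 2 * M)) V))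
    where swap : ∀ a b c → a * (b * c) ≡ b * (a * c)
          swap = solve-∀

  E₂₁-sum : Sc ⊛ G₅ ⊕ c₅ ⊛ Sg ≋ (+ 4) ⊙ ((+ 4) ⊙ E₂₁ ⊕ G₅ ⊛ Γ₂)
  E₂₁-sum = ≋-trans (≋-sym (χ-product c-loc g-loc (evF-even (+ 1) ψ₈))) (⊙-cong (+ 4) (≋-trans
    (type-A 1 2 χᶻ (λ m n → cF m ⊛ gF n) vF gF (sc 2 cF) (loc-⊛ c-loc g-loc) v-loc g-loc (sc-loc 2 {cF} c-loc)
      (λ m n → ≋-trans (At.cg m n) (⊕-congʳ (gF (m + n) ⊛ cF (+ 2 * n)) (⊛-congˡ (vF (m + n)) (⊕-congʳ (τF (+ 2 * n)) {τF m} {sc 1 τF m} (λ i → cong (λ k → τF k i) (sym (ℤP.*-identityˡ m))))))))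
    (⊕-congʳ (G₅ ⊛ Γ₂) (moment-Eis χ₂ χ₁ refl))))

  private
    F₁ G₁ : Family
    F₁ m = cF m ⊕ ⊝ cF (+ 5 * m)
    G₁ n = gF n ⊕ gF (+ 5 * n)

  sub5-Γ : ΣZ (sc 5 cF) ≋ B ⊛ B
  sub5-Γ = ≋-trans (ΣZ-sc₁ 5 (+ 1) kc refl) (≋-trans (sub-cong 5 Γ-value) (sub-⊛ 5 A A))

  sub10-Γ : ΣZ (sc 10 cF) ≋ D ⊛ D
  sub10-Γ = ≋-trans (ΣZ-sc₁ 10 (+ 1) kc refl) (≋-trans (sub-cong 10 Γ-value) (sub-⊛ 10 A A))

  sub5-𝒢 : ΣZ (sc 5 gF) ≋ B ⊛ D
  sub5-𝒢 = ≋-trans (ΣZ-sc₁ 5 (+ 1) ψ₈ refl) (≋-trans (sub-cong 5 𝒢-value) (≋-trans (sub-⊛ 5 A C) (⊛-congˡ B sub5-C)))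

  E₃₀-sum : (A ⊛ A ⊕ ⊝ (B ⊛ B)) ⊛ Ĝ₅ ⊕ ĉ₅ ⊛ (A ⊛ C ⊕ B ⊛ D) ≋ (+ 4) ⊙ ((+ 4) ⊙ E₃₀) ⊕ ((+ 4) ⊙ Ĝ₅) ⊛ (D ⊛ D)
  E₃₀-sum = ≋-trans (≋-sym left) (≋-trans (type-A 5 10 one X₃₀ (λ M → constS (+ 4) ⊛ VF M) (λ M → constS (+ 4) ⊛ ĜF M) (sc 10 cF) locX (const-loc (+ 4) V-loc) (const-loc (+ 4) Ĝ-loc) (sc-loc 10 {cF} c-loc)
      (λ m n → ≋-trans (At.cĜ m n) (poly (con (+ 4) :* (# 0F :* # 1F :+ # 2F :* # 3F)) ((con (+ 4) :* # 0F) :* # 1F :+ (con (+ 4) :* # 2F) :* # 3F) (VF (m + n) ∷ (τF (+ 5 * m) ⊕ τF (+ 10 * n)) ∷ ĜF (m + n) ∷ cF (+ 10 * n) ∷ []))))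
    (⊕-cong (≋-trans (moment-const (+ 4) one VF) (⊙-cong (+ 4) (moment-Eis χ₃ χ₀ refl))) (⊛-cong (≋-trans (wt-one (λ M → constS (+ 4) ⊛ ĜF M)) (ΣZ-const (+ 4) ĜF)) sub10-Γ)))
    where
    PQ : ℤ → ℤ → Series
    PQ m n = constS (+ 4) ⊛ (P₁F m ⊛ Q₁F n ⊕ ⊝ (P₂F m ⊛ Q₂F n))
    X₃₀ : ℤ → ℤ → Series
    X₃₀ m n = F₁ m ⊛ ĜF n ⊕ ĉF m ⊛ G₁ n ⊕ PQ m n
    lF : Loc F₁
    lF = loc-⊕ {cF} {λ m → ⊝ cF (+ 5 * m)} c-loc (loc-⊝ {sc 5 cF} (sc-loc 5 {cF} c-loc))
    lG : Loc G₁
    lG = loc-⊕ {gF} {sc 5 gF} g-loc (sc-loc 5 {gF} g-loc)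
    locX : Loc₂ X₃₀
    locX = loc₂-⊕ {λ m n → F₁ m ⊛ ĜF n ⊕ ĉF m ⊛ G₁ n} {PQ} (loc₂-⊕ {λ m n → F₁ m ⊛ ĜF n} {λ m n → ĉF m ⊛ G₁ n} (loc-⊛ {F₁} {ĜF} lF Ĝ-loc) (loc-⊛ {ĉF} {G₁} ĉ-loc lG))
      (const-loc₂ (+ 4) {λ m n → P₁F m ⊛ Q₁F n ⊕ ⊝ (P₂F m ⊛ Q₂F n)} (loc₂-⊕ {λ m n → P₁F m ⊛ Q₁F n} {λ m n → ⊝ (P₂F m ⊛ Q₂F n)} (loc-⊛ P₁-loc Q₁-loc) (loc₂-⊝ {λ m n → P₂F m ⊛ Q₂F n} (loc-⊛ P₂-loc Q₂-loc))))
    left : 𝔻₁ X₃₀ ≋ (A ⊛ A ⊕ ⊝ (B ⊛ B)) ⊛ Ĝ₅ ⊕ ĉ₅ ⊛ (A ⊛ C ⊕ B ⊛ D)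
    left i = trans (𝔻-⊕ (λ _ _ → + 1) (λ m n → F₁ m ⊛ ĜF n ⊕ ĉF m ⊛ G₁ n) PQ i) (trans (cong₂ _+_
        (trans (𝔻-⊕ (λ _ _ → + 1) (λ m n → F₁ m ⊛ ĜF n) (λ m n → ĉF m ⊛ G₁ n) i) (cong₂ _+_
          (trans (𝔻-prod {F₁} {ĜF} lF Ĝ-loc i) (⊛-congʳ Ĝ₅ (≋-trans (ΣZ-⊕ cF (λ m → ⊝ cF (+ 5 * m))) (⊕-cong Γ-value (≋-trans (ΣZ-⊝ (sc 5 cF)) (⊝-cong sub5-Γ)))) i))
          (trans (𝔻-prod {ĉF} {G₁} ĉ-loc lG i) (⊛-congˡ ĉ₅ (≋-trans (ΣZ-⊕ gF (sc 5 gF)) (⊕-cong 𝒢-value sub5-𝒢)) i))))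
        (odd-pair P₁-loc Q₁-loc P₂-loc Q₂-loc (odF-odd kP₁) (odF-odd kP₂) i)) (ℤP.+-identityʳ _))

  -- h₅ is 5 on multiples of 5 and 0 elsewhere. On lines with 5 ∣ M one has χ(m) = χ(M - m), so χ
  -- may serve as the inner weight of `type-B`. β₅ is 5 χ².
  h₅ β₅ : ℤ → ℤ
  h₅ M = sᶻ M + + 1
  β₅ n = + 4 + - sᶻ n

  private
    χᶻ-+5 : ∀ j → χᶻ (j + + 5) ≡ χᶻ j
    χᶻ-+5 (+ n)    = trans (cong χ₁ (ℕP.+-comm n 5)) (χ₁-+5 n)
    χᶻ-+5 -[1+ 0 ] = refl
    χᶻ-+5 -[1+ 1 ] = refl
    χᶻ-+5 -[1+ 2 ] = refl
    χᶻ-+5 -[1+ 3 ] = refl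
    χᶻ-+5 -[1+ 4 ] = refl
    χᶻ-+5 -[1+ suc (suc (suc (suc (suc n)))) ] = sym (χ₁-+5 (suc n))

    χᶻ-+5ℕ : ∀ k j → χᶻ (j + + 5 * + k) ≡ χᶻ j
    χᶻ-+5ℕ zero    j = cong χᶻ (ℤP.+-identityʳ j)
    χᶻ-+5ℕ (suc k) j = trans (cong χᶻ (ring j (+ k))) (trans (χᶻ-+5 (j + + 5 * + k)) (χᶻ-+5ℕ k j))
      where ring : ∀ j k → j + + 5 * (+ 1 + k) ≡ (j + + 5 * k) + + 5
            ring = solve-∀

    χᶻ-+5* : ∀ k j → χᶻ (j + + 5 * k) ≡ χᶻ j
    χᶻ-+5* (+ k)    j = χᶻ-+5ℕ k j
    χᶻ-+5* -[1+ k ] j = trans (sym (χᶻ-+5ℕ (suc k) (j + + 5 * -[1+ k ]))) (cong χᶻ (ring j (+ suc k)))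
      where ring : ∀ j k → (j + + 5 * - k) + + 5 * k ≡ j
            ring = solve-∀

    sχ : ∀ m → χᶻ m * sᶻ m ≡ - χᶻ m
    sχ m = trans (cong₂ _*_ (χ₁-periodic ∣ m ∣) (s₅-periodic ∣ m ∣)) (trans (residues 5 (λ r → χ₁ r * s₅ r) (λ r → - χ₁ r) (∣ m ∣ % 5) (m%n<n ∣ m ∣ 5)) (cong -_ (sym (χ₁-periodic ∣ m ∣))))

    χχ : ∀ m → + 5 * (χᶻ m * χᶻ m) ≡ β₅ m
    χχ m = trans (cong (λ x → + 5 * (x * x)) (χ₁-periodic ∣ m ∣)) (trans (residues 5 (λ r → + 5 * (χ₁ r * χ₁ r)) (λ r → + 4 + - s₅ r) (∣ m ∣ % 5) (m%n<n ∣ m ∣ 5)) (cong (λ x → + 4 + - x) (sym (s₅-periodic ∣ m ∣))))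

    law : ∀ m n → + 2 * (h₅ (m + n) * χᶻ m) + + 2 * (h₅ (m + - n) * χᶻ m) ≡ χᶻ m * β₅ n + β₅ m * χᶻ n
    law m n = begin
      + 2 * (h₅ (m + n) * χᶻ m) + + 2 * (h₅ (m + - n) * χᶻ m)
        ≡⟨ p₁ (sᶻ (m + n)) (sᶻ (m + - n)) (χᶻ m) ⟩
      χᶻ m * (+ 2 * sᶻ (m + n) + + 2 * sᶻ (m + - n)) + + 4 * χᶻ m
        ≡⟨ cong (λ x → χᶻ m * x + + 4 * χᶻ m) (s-law m n) ⟩
      χᶻ m * (sᶻ m * sᶻ n + + 5 * (χᶻ m * χᶻ n)) + + 4 * χᶻ m
        ≡⟨ p₂ (χᶻ m) (sᶻ m) (sᶻ n) (χᶻ n) ⟩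
      (χᶻ m * sᶻ m) * sᶻ n + (+ 5 * (χᶻ m * χᶻ m)) * χᶻ n + + 4 * χᶻ m
        ≡⟨ cong₂ (λ x y → x * sᶻ n + y * χᶻ n + + 4 * χᶻ m) (sχ m) (χχ m) ⟩
      (- χᶻ m) * sᶻ n + β₅ m * χᶻ n + + 4 * χᶻ m
        ≡⟨ p₃ (χᶻ m) (sᶻ n) (β₅ m * χᶻ n) ⟩
      χᶻ m * β₅ n + β₅ m * χᶻ n ∎
      where
      open ≡-Reasoning
      p₁ : ∀ s t x → + 2 * ((s + + 1) * x) + + 2 * ((t + + 1) * x) ≡ x * (+ 2 * s + + 2 * t) + + 4 * x
      p₁ = solve-∀
      p₂ : ∀ x s t y → x * (s * t + + 5 * (x * y)) + + 4 * x ≡ (x * s) * t + (+ 5 * (x * x)) * y + + 4 * x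
      p₂ = solve-∀
      p₃ : ∀ x t z → (- x) * t + z + + 4 * x ≡ x * (+ 4 + - t) + z
      p₃ = solve-∀

    law-h : ∀ M m → h₅ M * χᶻ m ≡ h₅ M * χᶻ (M + - m)
    law-h M m = go (5 ∣? ∣ M ∣) (sᶻ-multiples M)
      where
      go : (d : Dec (5 ∣ ∣ M ∣)) → h₅ M ≡ when ⌊ d ⌋ (+ 5) → h₅ M * χᶻ m ≡ h₅ M * χᶻ (M + - m)
      go (no _)  e = trans (cong (_* χᶻ m) e) (trans (ℤP.*-zeroˡ (χᶻ m)) (sym (trans (cong (_* χᶻ (M + - m)) e) (ℤP.*-zeroˡ (χᶻ (M + - m))))))
      go (yes d) _ = cong (h₅ M *_) (trans (sym (cong χ₁ (ℤP.∣-i∣≡∣i∣ m))) (same (- m)))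
        where
        M≡ : + 5 * quo 5 M ≡ M
        M≡ = *-quo 5 M d
        same : ∀ j → χᶻ j ≡ χᶻ (M + j)
        same j = sym (trans (cong χᶻ (trans (ℤP.+-comm M j) (cong (λ k → j + k) (sym M≡)))) (χᶻ-+5* (quo 5 M) j))

  wt-+1 : ∀ α F → ΣZ (wt (λ M → α M + + 1) F) ≋ ΣZ (wt α F) ⊕ ΣZ F
  wt-+1 α F = ≋-trans (ΣZ-cong {wt (λ M → α M + + 1) F} {λ M → wt α F M ⊕ F M} (λ M i → lem (α M) (F M i))) (ΣZ-⊕ (wt α F) F)
    where lem : ∀ a x → (a + + 1) * x ≡ a * x + x
          lem = solve-∀

  wt-β : ∀ F → ΣZ (wt β₅ F) ≋ (+ 4) ⊙ ΣZ F ⊕ ⊝ ΣZ (wt sᶻ F)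
  wt-β F = ≋-trans (ΣZ-cong {wt β₅ F} {λ M → (+ 4) ⊙ F M ⊕ ⊝ wt sᶻ F M} (λ M i → lem (sᶻ M) (F M i))) (≋-trans (ΣZ-⊕ (λ M → (+ 4) ⊙ F M) (λ M → ⊝ wt sᶻ F M)) (⊕-cong (ΣZ-⊙ (+ 4) F) (ΣZ-⊝ (wt sᶻ F))))
    where lem : ∀ a x → (+ 4 + - a) * x ≡ + 4 * x + - (a * x)
          lem = solve-∀

  -- The Euler derivatives of v and V. At y = 1 the latter is half of 1 + 3 - 7 + 9 - 11 + 13 - 17 -
  -- 19, which is -14 and accounts for the constant term of `E₀₃`. `W₈` is summed with the weight χ,
  -- which is 0 at index 0, and is set to 0 there.
  W₈ W₄₀ : Family
  W₈  = evF (+ 0) (θ′ χ₂)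
  W₄₀ = evF (- + 14) (θ′ χ₃)

  Y₁₂ H₁₂ : Series
  Y₁₂ = dsum (λ m n → h₅ (m + n) * χᶻ m) gF (sc 2 cF)
  H₁₂ = ΣZ (wt h₅ (cut cF))

  c₂-even : Even (sc 2 cF)
  c₂-even = sc-even 2 {cF} (evF-even (+ 1) kc)

  S₂-value : ΣZ (wt sᶻ (sc 2 cF)) ≋ (+ 5) ⊙ (D ⊛ D) ⊕ ⊝ (C ⊛ C)
  S₂-value = ≋-trans (ΣZ-sc 2 sᶻ (+ 1) kc refl) (≋-trans (sub-cong 2 Sc-value) (≋-trans (sub-⊕ 2 ((+ 5) ⊙ (B ⊛ B)) (⊝ (A ⊛ A))) (⊕-cong
    (≋-trans (sub-⊙ 2 (+ 5) (B ⊛ B)) (⊙-cong (+ 5) (≋-trans (sub-⊛ 2 B B) (⊛-cong sub2-B sub2-B)))) (≋-trans (sub-⊝ 2 (A ⊛ A)) (⊝-cong (sub-⊛ 2 A A))))))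

  E₁₂-product : (+ 4) ⊙ Y₁₂ ≋ G₅ ⊛ ((+ 4) ⊙ (C ⊛ C) ⊕ ⊝ ((+ 5) ⊙ (D ⊛ D) ⊕ ⊝ (C ⊛ C))) ⊕ ((+ 4) ⊙ (A ⊛ C) ⊕ ⊝ ((+ 5) ⊙ (B ⊛ D) ⊕ ⊝ (A ⊛ C))) ⊛ c₅₂
  E₁₂-product = ≋-trans (λ i → four (Y₁₂ i)) (≋-trans (⊕-cong (≋-sym (dsum-*ˡ (+ 2) (λ m n → h₅ (m + n) * χᶻ m) gF (sc 2 cF)))
      (≋-sym (≋-trans (dsum-*ˡ (+ 2) (λ m n → h₅ (m + - n) * χᶻ m) gF (sc 2 cF)) (⊙-cong (+ 2) (dsum-flip (λ m n → h₅ (m + n) * χᶻ m) gF {sc 2 cF} c₂-even)))))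
    (≋-trans (≋-sym (dsum-+ (λ m n → + 2 * (h₅ (m + n) * χᶻ m)) (λ m n → + 2 * (h₅ (m + - n) * χᶻ m)) gF (sc 2 cF))) (≋-trans (dsum-cong gF (sc 2 cF) law)
    (≋-trans (dsum-+ (λ m n → χᶻ m * β₅ n) (λ m n → β₅ m * χᶻ n) gF (sc 2 cF)) (⊕-cong
      (≋-trans (dsum-prod χᶻ β₅ g-loc (sc-loc 2 {cF} c-loc)) (⊛-congˡ G₅ (≋-trans (wt-β (sc 2 cF)) (⊕-cong (⊙-cong (+ 4) Γ₂-value) (⊝-cong S₂-value)))))
      (≋-trans (dsum-prod β₅ χᶻ g-loc (sc-loc 2 {cF} c-loc)) (⊛-congʳ c₅₂ (≋-trans (wt-β gF) (⊕-cong (⊙-cong (+ 4) 𝒢-value) (⊝-cong Sg-value))))))))))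
    where four : ∀ x → + 4 * x ≡ + 2 * x + + 2 * x
          four = solve-∀

  -- On m + n = 0 the identity `gc₀` leaves g minus the Euler derivative of v; with the weight χ
  -- these sum to G₅ and 2 `E₁₂`. The factor 5 is h₅(0).
  E₁₂-lines : (+ 2) ⊙ Y₁₂ ≋ H₁₂ ⊛ G₅ ⊕ (+ 5) ⊙ (G₅ ⊕ ⊝ ((+ 2) ⊙ E₁₂))
  E₁₂-lines = ≋-trans (≋-sym (𝔻-const (+ 2) (λ m n → h₅ (m + n) * χᶻ m) (λ m n → gF m ⊛ cF (+ 2 * n))))
    (≋-trans (type-B h₅ χᶻ X₁₂ (λ M → constS (+ 4) ⊛ yF (+ 2 * M)) V₂ cF vF gF (λ m → cong χ₁ (ℤP.∣-i∣≡∣i∣ m)) law-h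
        (const-loc₂ (+ 2) {λ m n → gF m ⊛ cF (+ 2 * n)} (loc-⊛ {gF} {sc 2 cF} g-loc (sc-loc 2 {cF} c-loc))) (const-loc (+ 4) {sc 2 yF} (sc-loc 2 {yF} y-loc)) (const-loc (+ 2) y-loc) c-loc v-loc g-loc (odF-odd χ₂)
        (λ m n z → ≋-trans (At.gc m n z) (⊕-congʳ (cF (m + n) ⊛ gF n) (⊕-cong (≋-sym (⊛-assoc (constS (+ 4)) (yF (+ 2 * (m + n))) (vF m))) (≋-sym (⊛-assoc (constS (+ 2)) (yF (m + n)) (vF n)))))))
      (⊕-congˡ (H₁₂ ⊛ G₅) (⊙-cong (+ 5) (≋-trans (ΣZ-cong {λ m → χᶻ m ⊙ X₁₂ m (- m)} {λ m → wt χᶻ gF m ⊕ ⊝ wt χᶻ W₈ m} diag)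
        (≋-trans (ΣZ-⊕ (wt χᶻ gF) (λ m → ⊝ wt χᶻ W₈ m)) (⊕-congˡ G₅ (≋-trans (ΣZ-⊝ (wt χᶻ W₈)) (⊝-cong (derivative-Eis χ₁ χ₂ (+ 0) (+ 0) refl)))))))))
    where
    X₁₂ : ℤ → ℤ → Series
    X₁₂ m n = constS (+ 2) ⊛ (gF m ⊛ cF (+ 2 * n))
    at : ∀ a → constS (+ 2) ⊛ (gF (+ suc a) ⊛ cF (+ 2 * + suc a)) ≋ gF (+ suc a) ⊕ ⊝ W₈ (+ suc a)
    at a = At.gc₀ (+ suc a) (+ 0) (derivative a (mono 0) (mono 0) 3 χ₂ lw₈ refl ℕP.≤-refl (λ n → trans (χ₂-+4 n) (sym (ℤP.-1*i≡-i (χ₂ n)))))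
    spread : ∀ x g w → x * (g + - w) ≡ x * g + - (x * w)
    spread = solve-∀
    diag : ∀ m → χᶻ m ⊙ X₁₂ m (- m) ≋ wt χᶻ gF m ⊕ ⊝ wt χᶻ W₈ m
    diag (+ 0) i     = refl
    diag (+ suc a) i = trans (cong (χᶻ (+ suc a) *_) (trans (⊛-congˡ (constS (+ 2)) (⊛-congˡ (gF (+ suc a)) (c₂-even (+ suc a))) i) (at a i))) (spread (χᶻ (+ suc a)) (gF (+ suc a) i) (W₈ (+ suc a) i))
    diag -[1+ a ] i  = trans (cong (χᶻ -[1+ a ] *_) (at a i)) (spread (χᶻ (+ suc a)) (gF (+ suc a) i) (W₈ (+ suc a) i))

  H₁₂-value : (+ 5) ⊙ (B ⊛ B) ≋ H₁₂ ⊕ (+ 5) ⊙ constS (+ 1)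
  H₁₂-value = ≋-trans (≋-sym (≋-trans (wt-+1 sᶻ cF) (≋-trans (⊕-cong Sc-value Γ-value) (λ i → lem (+ 5 * (B ⊛ B) i) ((A ⊛ A) i))))) (ΣZ-cut h₅ cF)
    where lem : ∀ x y → (x + - y) + y ≡ x
          lem = solve-∀

  private
    H₀ J₀ R₁F R₂F : Family
    H₀ n = constS (+ 5) ⊛ cF (+ 10 * n) ⊕ ⊝ cF (+ 2 * n)
    J₀ m = constS (+ 5) ⊛ gF (+ 5 * m) ⊕ gF m
    R₁F n = constS (+ 2) ⊛ P₁F (+ 2 * n) ⊕ ⊝ P₂F (+ 2 * n)
    R₂F n = P₁F (+ 2 * n) ⊕ constS (+ 2) ⊛ P₂F (+ 2 * n)
    QR X₀₃ : ℤ → ℤ → Series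
    QR m n = constS (+ 4) ⊛ (Q₁F m ⊛ R₁F n ⊕ ⊝ (Q₂F m ⊛ R₂F n))
    X₀₃ m n = ĜF m ⊛ H₀ n ⊕ J₀ m ⊛ ĉF (+ 2 * n) ⊕ QR m n

    lH : Loc H₀
    lH = loc-⊕ {λ n → constS (+ 5) ⊛ cF (+ 10 * n)} {λ n → ⊝ cF (+ 2 * n)} (const-loc (+ 5) {sc 10 cF} (sc-loc 10 {cF} c-loc)) (loc-⊝ {sc 2 cF} (sc-loc 2 {cF} c-loc))
    lJ : Loc J₀
    lJ = loc-⊕ {λ n → constS (+ 5) ⊛ gF (+ 5 * n)} {gF} (const-loc (+ 5) {sc 5 gF} (sc-loc 5 {gF} g-loc)) g-loc
    lR₁ : Loc R₁F
    lR₁ = loc-⊕ {λ n → constS (+ 2) ⊛ P₁F (+ 2 * n)} {λ n → ⊝ P₂F (+ 2 * n)} (const-loc (+ 2) {sc 2 P₁F} (sc-loc 2 {P₁F} P₁-loc)) (loc-⊝ {sc 2 P₂F} (sc-loc 2 {P₂F} P₂-loc))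
    lR₂ : Loc R₂F
    lR₂ = loc-⊕ {sc 2 P₁F} {λ n → constS (+ 2) ⊛ P₂F (+ 2 * n)} (sc-loc 2 {P₁F} P₁-loc) (const-loc (+ 2) {sc 2 P₂F} (sc-loc 2 {P₂F} P₂-loc))
    locX : Loc₂ X₀₃
    locX = loc₂-⊕ {λ m n → ĜF m ⊛ H₀ n ⊕ J₀ m ⊛ ĉF (+ 2 * n)} {QR} (loc₂-⊕ {λ m n → ĜF m ⊛ H₀ n} {λ m n → J₀ m ⊛ ĉF (+ 2 * n)} (loc-⊛ {ĜF} {H₀} Ĝ-loc lH) (loc-⊛ {J₀} {sc 2 ĉF} lJ (sc-loc 2 {ĉF} ĉ-loc)))
      (const-loc₂ (+ 4) {λ m n → Q₁F m ⊛ R₁F n ⊕ ⊝ (Q₂F m ⊛ R₂F n)} (loc₂-⊕ {λ m n → Q₁F m ⊛ R₁F n} {λ m n → ⊝ (Q₂F m ⊛ R₂F n)} (loc-⊛ {Q₁F} {R₁F} Q₁-loc lR₁) (loc₂-⊝ {λ m n → Q₂F m ⊛ R₂F n} (loc-⊛ {Q₂F} {R₂F} Q₂-loc lR₂))))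

    H₀-even : Even H₀
    H₀-even n = ⊕-cong (⊛-congˡ (constS (+ 5)) (sc-even 10 {cF} (evF-even (+ 1) kc) n)) (⊝-cong (c₂-even n))
    J₀-even : Even J₀
    J₀-even n = ⊕-cong (⊛-congˡ (constS (+ 5)) (sc-even 5 {gF} (evF-even (+ 1) ψ₈) n)) (evF-even (+ 1) ψ₈ n)
    R₁-odd : Odd R₁F
    R₁-odd n i = trans (cong₂ (λ x y → x + - y) (trans (constS-⊛ (+ 2) (P₁F (+ 2 * - n)) i) (cong (+ 2 *_) (sc-odd 2 {P₁F} (odF-odd kP₁) n i))) (sc-odd 2 {P₂F} (odF-odd kP₂) n i))
      (trans (lem (P₁F (+ 2 * n) i) (P₂F (+ 2 * n) i)) (cong (λ x → - (x + - P₂F (+ 2 * n) i)) (sym (constS-⊛ (+ 2) (P₁F (+ 2 * n)) i))))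
      where lem : ∀ p q → + 2 * - p + - - q ≡ - (+ 2 * p + - q)
            lem = solve-∀
    R₂-odd : Odd R₂F
    R₂-odd n i = trans (cong₂ _+_ (sc-odd 2 {P₁F} (odF-odd kP₁) n i) (trans (constS-⊛ (+ 2) (P₂F (+ 2 * - n)) i) (cong (+ 2 *_) (sc-odd 2 {P₂F} (odF-odd kP₂) n i))))
      (trans (lem (P₁F (+ 2 * n) i) (P₂F (+ 2 * n) i)) (cong (λ x → - (P₁F (+ 2 * n) i + x)) (sym (constS-⊛ (+ 2) (P₂F (+ 2 * n)) i))))
      where lem : ∀ p q → - p + + 2 * - q ≡ - (p + + 2 * q)
            lem = solve-∀

    ⊝-⊛-⊝ : ∀ {f f′ g g′} → f ≋ ⊝ f′ → g ≋ ⊝ g′ → f ⊛ g ≋ f′ ⊛ g′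
    ⊝-⊛-⊝ {f} {f′} {g} {g′} e e′ n = sumTo-cong n (λ i → trans (cong₂ _*_ (e i) (e′ (n ℕ.∸ i))) (lem (f′ i) (g′ (n ℕ.∸ i))))
      where lem : ∀ a b → - a * - b ≡ a * b
            lem = solve-∀

    ⊛-⊝ : ∀ f {g g′} → g ≋ ⊝ g′ → f ⊛ g ≋ ⊝ (f ⊛ g′)
    ⊛-⊝ f {g} {g′} e = ≋-trans (⊛-congˡ f {g} {(- + 1) ⊙ g′} (λ i → trans (e i) (sym (ℤP.-1*i≡-i (g′ i))))) (≋-trans (⊛-⊙ (- + 1) f g′) (λ i → ℤP.-1*i≡-i _))

    QR-flip : ∀ p → QR (- p) p ≋ QR p (- p)
    QR-flip p = ⊛-congˡ (constS (+ 4)) (⊕-cong (⊝-⊛-⊝ {Q₁F (- p)} {Q₁F p} {R₁F p} {R₁F (- p)} (odF-odd kQ₁ p) (flip (R₁-odd p))) (⊝-cong (⊝-⊛-⊝ {Q₂F (- p)} {Q₂F p} {R₂F p} {R₂F (- p)} (odF-odd kQ₂ p) (flip (R₂-odd p)))))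
      where
      flip : ∀ {f g} → f ≋ ⊝ g → g ≋ ⊝ f
      flip {f} {g} e i = trans (sym (ℤP.neg-involutive (g i))) (cong -_ (sym (e i)))

    QR-diag : ∀ p → QR p (- p) ≋ ⊝ QR p p
    QR-diag p = ⊛-⊝ (constS (+ 4)) {Q₁F p ⊛ R₁F (- p) ⊕ ⊝ (Q₂F p ⊛ R₂F (- p))} {Q₁F p ⊛ R₁F p ⊕ ⊝ (Q₂F p ⊛ R₂F p)}
      (λ i → trans (cong₂ (λ x y → x + - y) (⊛-⊝ (Q₁F p) {R₁F (- p)} {R₁F p} (R₁-odd p) i) (⊛-⊝ (Q₂F p) {R₂F (- p)} {R₂F p} (R₂-odd p) i)) (lem ((Q₁F p ⊛ R₁F p) i) ((Q₂F p ⊛ R₂F p) i)))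
      where lem : ∀ x y → - x + - - y ≡ - (x + - y)
            lem = solve-∀

    even-diag : ∀ p → ĜF p ⊛ H₀ (- p) ⊕ J₀ p ⊛ ĉF (+ 2 * - p) ≋ ĜF p ⊛ H₀ p ⊕ J₀ p ⊛ ĉF (+ 2 * p)
    even-diag p = ⊕-cong (⊛-congˡ (ĜF p) (H₀-even p)) (⊛-congˡ (J₀ p) (sc-even 2 {ĉF} (evF-even (+ 4) kĉ) p))

    even-flip : ∀ p → ĜF (- p) ⊛ H₀ p ⊕ J₀ (- p) ⊛ ĉF (+ 2 * p) ≋ ĜF p ⊛ H₀ p ⊕ J₀ p ⊛ ĉF (+ 2 * p)
    even-flip p = ⊕-cong (⊛-congʳ (H₀ p) (evF-even (+ 2) kĜ p)) (⊛-congʳ (ĉF (+ 2 * p)) (J₀-even p))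

    at₀₃ : ∀ a → ĜF (+ suc a) ⊛ H₀ (+ suc a) ⊕ J₀ (+ suc a) ⊛ ĉF (+ 2 * + suc a) ⊕ ⊝ QR (+ suc a) (+ suc a) ≋ constS (+ 2) ⊛ ĜF (+ suc a) ⊕ ⊝ (constS (+ 2) ⊛ W₄₀ (+ suc a))
    at₀₃ a = At.Ĝc₀ (+ suc a) (+ 0) (derivative a (mono 0) (mono 0) 19 χ₃ lw₄₀ refl ℕP.≤-refl χ₃-anti)
      where
      χ₃-anti : ∀ n → χ₃ (20 ℕ.+ n) ≡ - + 1 * χ₃ n
      χ₃-anti n = trans (cong₂ _*_ (trans (χ₂-+4 (16 ℕ.+ n)) (trans (cong -_ (χ₂-+4 (12 ℕ.+ n))) (trans (cong (λ x → - - x) (χ₂-+4 (8 ℕ.+ n))) (trans (cong (λ x → - - - x) (χ₂-+4 (4 ℕ.+ n))) (cong (λ x → - - - - x) (χ₂-+4 n))))))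
          (trans (χ₁-+5 (15 ℕ.+ n)) (trans (χ₁-+5 (10 ℕ.+ n)) (trans (χ₁-+5 (5 ℕ.+ n)) (χ₁-+5 n))))) (lem (χ₂ n) (χ₁ n))
        where lem : ∀ a b → (- - - - - a) * b ≡ - + 1 * (a * b)
              lem = solve-∀

    diag₀₃ : ∀ m → one m ⊙ X₀₃ m (- m) ≋ constS (+ 2) ⊛ ĜF m ⊕ ⊝ (constS (+ 2) ⊛ W₄₀ m)
    -- The values at index 0 are Ĝ = 2, H₀ = 4, J₀ = 6 and ĉ = 4, so the left side is 2 · 4 + 6 · 4
    -- = 32, and the right side is 2 · 2 + 2 · 14.
    diag₀₃ (+ 0)     = ≋-trans (λ i → ℤP.*-identityˡ (X₀₃ (+ 0) (+ 0) i))
      (poly {0} (con (+ 2) :* (con (+ 5) :* con (+ 1) :- con (+ 1)) :+ (con (+ 5) :* con (+ 1) :+ con (+ 1)) :* con (+ 4)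
          :+ con (+ 4) :* (con (+ 0) :* (con (+ 2) :* con (+ 0) :- con (+ 0)) :- con (+ 0) :* (con (+ 0) :+ con (+ 2) :* con (+ 0))))
        (con (+ 2) :* con (+ 2) :- con (+ 2) :* con (- + 14)) [])
    diag₀₃ (+ suc a) = ≋-trans (λ i → ℤP.*-identityˡ (X₀₃ (+ suc a) (- + suc a) i)) (≋-trans (⊕-cong (even-diag (+ suc a)) (QR-diag (+ suc a))) (at₀₃ a))
    diag₀₃ -[1+ a ]  = ≋-trans (λ i → ℤP.*-identityˡ (X₀₃ -[1+ a ] (+ suc a) i)) (≋-trans (⊕-cong (even-flip (+ suc a)) (≋-trans (QR-flip (+ suc a)) (QR-diag (+ suc a)))) (at₀₃ a))

  sub2-ĉ : ΣZ (sc 2 ĉF) ≋ ((+ 2) ⊙ (C ⊛ D) ⊕ A ⊛ B) ⊕ a ⊛ b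
  sub2-ĉ = ≋-trans (ΣZ-sc₁ 2 (+ 4) kĉ refl) (≋-trans (sub-cong 2 ĉ₅-value) (≋-trans (sub-⊕ 2 ((+ 4) ⊙ (A ⊛ B)) (⊝ c₅)) (≋-trans (⊕-cong
      (≋-trans (sub-⊙ 2 (+ 4) (A ⊛ B)) (⊙-cong (+ 4) (≋-trans (sub-⊛ 2 A B) (⊛-congˡ C sub2-B)))) (≋-trans (sub-⊝ 2 c₅) (⊝-cong (≋-trans (≋-sym c₅₂-sub) c₅₂-value))))
    (λ i → lem ((C ⊛ D) i) ((A ⊛ B) i) ((a ⊛ b) i)))))
    where lem : ∀ x y z → + 4 * x + - ((+ 2 * x + - y) + - z) ≡ (+ 2 * x + y) + z
          lem = solve-∀

  Γc : Series
  Γc = ΣZ (wt one (cut (λ M → constS (+ 2) ⊛ cF M)))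

  Γc-value : (+ 2) ⊙ (A ⊛ A) ≋ Γc ⊕ (+ 1) ⊙ (constS (+ 2) ⊛ constS (+ 1))
  Γc-value = ≋-trans (≋-sym (≋-trans (wt-one (λ M → constS (+ 2) ⊛ cF M)) (≋-trans (ΣZ-const (+ 2) cF) (⊙-cong (+ 2) Γ-value)))) (ΣZ-cut one (λ M → constS (+ 2) ⊛ cF M))

  E₀₃-sum : Ĝ₅ ⊛ ((+ 5) ⊙ (D ⊛ D) ⊕ ⊝ (C ⊛ C)) ⊕ ((+ 5) ⊙ (B ⊛ D) ⊕ A ⊛ C) ⊛ (((+ 2) ⊙ (C ⊛ D) ⊕ A ⊛ B) ⊕ a ⊛ b) ≋ Γc ⊛ Ĝ₅ ⊕ (+ 1) ⊙ ((+ 2) ⊙ Ĝ₅ ⊕ ⊝ ((+ 2) ⊙ ((+ 2) ⊙ E₀₃)))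
  E₀₃-sum = ≋-trans (≋-sym left) (≋-trans (type-B one one X₀₃ (λ M → constS (+ 8) ⊛ yF (+ 2 * M)) (λ M → constS (+ 4) ⊛ yF M) (λ M → constS (+ 2) ⊛ cF M) VF ĜF (λ _ → refl) (λ _ _ → refl)
        locX (const-loc (+ 8) {sc 2 yF} (sc-loc 2 {yF} y-loc)) (const-loc (+ 4) y-loc) (const-loc (+ 2) c-loc) V-loc Ĝ-loc (odF-odd χ₃)
        (λ m n z → ≋-trans (At.Ĝc m n z) (⊕-cong (⊕-cong (≋-sym (⊛-assoc (constS (+ 8)) (yF (+ 2 * (m + n))) (VF m))) (≋-sym (⊛-assoc (constS (+ 4)) (yF (m + n)) (VF n)))) (≋-sym (⊛-assoc (constS (+ 2)) (cF (m + n)) (ĜF n))))))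
      (⊕-cong (⊛-congˡ Γc (wt-one ĜF)) (⊙-cong (+ 1) (≋-trans (ΣZ-cong {λ m → one m ⊙ X₀₃ m (- m)} {λ m → constS (+ 2) ⊛ ĜF m ⊕ ⊝ (constS (+ 2) ⊛ W₄₀ m)} diag₀₃)
        (≋-trans (ΣZ-⊕ (λ m → constS (+ 2) ⊛ ĜF m) (λ m → ⊝ (constS (+ 2) ⊛ W₄₀ m))) (⊕-cong (ΣZ-const (+ 2) ĜF) (≋-trans (ΣZ-⊝ (λ m → constS (+ 2) ⊛ W₄₀ m)) (⊝-cong (≋-trans (ΣZ-const (+ 2) W₄₀) (⊙-cong (+ 2) (≋-trans (≋-sym (wt-one W₄₀)) (derivative-Eis χ₀ χ₃ (- + 14) (- + 7) refl))))))))))))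
    where
    left : 𝔻₁ X₀₃ ≋ Ĝ₅ ⊛ ((+ 5) ⊙ (D ⊛ D) ⊕ ⊝ (C ⊛ C)) ⊕ ((+ 5) ⊙ (B ⊛ D) ⊕ A ⊛ C) ⊛ (((+ 2) ⊙ (C ⊛ D) ⊕ A ⊛ B) ⊕ a ⊛ b)
    left i = trans (𝔻-⊕ (λ _ _ → + 1) (λ m n → ĜF m ⊛ H₀ n ⊕ J₀ m ⊛ ĉF (+ 2 * n)) QR i) (trans (cong₂ _+_
        (trans (𝔻-⊕ (λ _ _ → + 1) (λ m n → ĜF m ⊛ H₀ n) (λ m n → J₀ m ⊛ ĉF (+ 2 * n)) i) (cong₂ _+_
          (trans (𝔻-prod {ĜF} {H₀} Ĝ-loc lH i) (⊛-congˡ Ĝ₅ (≋-trans (ΣZ-⊕ (λ n → constS (+ 5) ⊛ cF (+ 10 * n)) (λ n → ⊝ cF (+ 2 * n))) (⊕-cong (≋-trans (ΣZ-const (+ 5) (sc 10 cF)) (⊙-cong (+ 5) sub10-Γ)) (≋-trans (ΣZ-⊝ (sc 2 cF)) (⊝-cong Γ₂-value)))) i))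
          (trans (𝔻-prod {J₀} {sc 2 ĉF} lJ (sc-loc 2 {ĉF} ĉ-loc) i) (⊛-cong (≋-trans (ΣZ-⊕ (λ n → constS (+ 5) ⊛ gF (+ 5 * n)) gF) (⊕-cong (≋-trans (ΣZ-const (+ 5) (sc 5 gF)) (⊙-cong (+ 5) sub5-𝒢)) 𝒢-value)) sub2-ĉ i))))
        (odd-pair {Q₁F} {R₁F} {Q₂F} {R₂F} Q₁-loc lR₁ Q₂-loc lR₂ (odF-odd kQ₁) (odF-odd kQ₂) i)) (ℤP.+-identityʳ _))

  private
    module V₂₁ = Unknowns 𝕊 A a B b C D c d c₅ E₂₁ zeroS zeroS
    module V₃₀ = Unknowns 𝕊 A a B b C D c d c₅ E₃₀ zeroS zeroS
    module V₁₂ = Unknowns 𝕊 A a B b C D c d Y₁₂ E₁₂ H₁₂ zeroS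
    module V₀₃ = Unknowns 𝕊 A a B b C D c d Γc E₀₃ zeroS zeroS

    xδ xĝ xc₂ xĉ₂ : Expr 12
    xδ  = vA :* vD :- vB :* vC
    xĝ  = vA :* vD :+ vB :* vC
    xc₂ = ((+ 2) :· (vC :* vD) :- vA :* vB) :- va :* vb
    xĉ₂ = ((+ 2) :· (vC :* vD) :+ vA :* vB) :+ va :* vb

  E₂₁-value : V₂₁.Z (nat 4 :* vx :- tE₂₁)
  E₂₁-value = V₂₁.E₂₁-value Q.zE₂₁ (via (nat 16 :* vx :- ((eU :- nat 4 :* vC :^ 2) :* eδ :+ vw :* es))
      ((+ 4) :· ((+ 4) :· vx :+ xδ :* (vC :* vC)) :- (((+ 5) :· (vB :* vB) :- vA :* vA) :* xδ :+ vw :* ((+ 5) :· (vB :* vD) :- vA :* vC))) (θ c₅ E₂₁ zeroS zeroS)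
      (x≋y⇒x-y≋0 (≋-sym (≋-trans (≋-sym (⊕-cong (⊛-cong Sc-value G₅-value) (⊛-congˡ c₅ Sg-value))) (≋-trans E₂₁-sum (⊙-cong (+ 4) (⊕-congˡ ((+ 4) ⊙ E₂₁) (⊛-cong G₅-value Γ₂-value))))))))
    c₅-u (regular₀ {⟦ nat 4 :* eu ⟧ (θ c₅ E₂₁ zeroS zeroS)} (λ ()))

  E₃₀-value : V₃₀.Z (nat 4 :* vx :- tE₃₀)
  E₃₀-value = V₃₀.E₃₀-value Q.zE₃₀ (via (nat 16 :* vx :- (hE₃₀ :- vw :* (vA :* vC :+ vB :* vD)))
      ((+ 4) :· ((+ 4) :· vx) :+ ((+ 4) :· xĝ) :* (vD :* vD) :- ((vA :* vA :- vB :* vB) :* xĝ :+ ((+ 4) :· (vA :* vB) :- vw) :* (vA :* vC :+ vB :* vD))) (θ c₅ E₃₀ zeroS zeroS)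
      (x≋y⇒x-y≋0 (≋-sym (≋-trans (≋-sym (⊕-cong (⊛-congˡ (A ⊛ A ⊕ ⊝ (B ⊛ B)) Ĝ₅-value) (⊛-congʳ (A ⊛ C ⊕ B ⊛ D) ĉ₅-value))) (≋-trans E₃₀-sum (⊕-congˡ ((+ 4) ⊙ ((+ 4) ⊙ E₃₀)) (⊛-congʳ (D ⊛ D) (⊙-cong (+ 4) Ĝ₅-value))))))))
    c₅-u (regular₀ {⟦ nat 4 :* eu ⟧ (θ c₅ E₃₀ zeroS zeroS)} (λ ()))

  E₁₂-value : V₁₂.Z (nat 2 :* vx :- tE₁₂)
  E₁₂-value = V₁₂.E₁₂-value Q.zE₁₂ (certify (θ Y₁₂ E₁₂ H₁₂ zeroS) (con (+ 5)) (nat 4 :* vx :- fE₁₂)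
      ((con (- + 1) , (+ 4) :· vw :- (xδ :* ((+ 4) :· (vC :* vC) :- ((+ 5) :· (vD :* vD) :- vC :* vC)) :+ ((+ 4) :· (vA :* vC) :- ((+ 5) :· (vB :* vD) :- vA :* vC)) :* xc₂))
        ∷ (con (+ 2) , (+ 2) :· vw :- (vy :* xδ :+ (+ 5) :· (xδ :- (+ 2) :· vx))) ∷ (con (- + 2) :* xδ , (+ 5) :· (vB :* vB) :- (vy :+ (+ 5) :· con (+ 1))) ∷ [])
      (const-regular 4) (x≋y⇒x-y≋0 (≋-trans E₁₂-product (⊕-cong (⊛-congʳ ((+ 4) ⊙ (C ⊛ C) ⊕ ⊝ ((+ 5) ⊙ (D ⊛ D) ⊕ ⊝ (C ⊛ C))) G₅-value) (⊛-congˡ ((+ 4) ⊙ (A ⊛ C) ⊕ ⊝ ((+ 5) ⊙ (B ⊛ D) ⊕ ⊝ (A ⊛ C))) c₅₂-value)))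
        All.∷ x≋y⇒x-y≋0 (≋-trans E₁₂-lines (⊕-cong (⊛-congˡ H₁₂ G₅-value) (⊙-cong (+ 5) (⊕-congʳ (⊝ ((+ 2) ⊙ E₁₂)) G₅-value)))) All.∷ x≋y⇒x-y≋0 H₁₂-value All.∷ All.[]))
    (const-regular 1)

  E₀₃-value : V₀₃.Z (nat 2 :* vx :- tE₀₃)
  E₀₃-value = V₀₃.E₀₃-value Q.zE₀₃ (certify (θ Γc E₀₃ zeroS zeroS) (con (+ 1)) (nat 4 :* vx :- fE₀₃)
      ((con (+ 1) , (xĝ :* ((+ 5) :· (vD :* vD) :- vC :* vC) :+ ((+ 5) :· (vB :* vD) :+ vA :* vC) :* xĉ₂) :- (vw :* xĝ :+ (+ 1) :· ((+ 2) :· xĝ :- (+ 2) :· ((+ 2) :· vx))))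
        ∷ (con (- + 1) :* xĝ , (+ 2) :· (vA :* vA) :- (vw :+ (+ 1) :· (con (+ 2) :* con (+ 1)))) ∷ [])
      regular₁ (x≋y⇒x-y≋0 (≋-trans (≋-sym (⊕-congʳ (((+ 5) ⊙ (B ⊛ D) ⊕ A ⊛ C) ⊛ (((+ 2) ⊙ (C ⊛ D) ⊕ A ⊛ B) ⊕ a ⊛ b)) (⊛-congʳ ((+ 5) ⊙ (D ⊛ D) ⊕ ⊝ (C ⊛ C)) Ĝ₅-value))) (≋-trans E₀₃-sum
        (⊕-cong (⊛-congˡ Γc Ĝ₅-value) (⊙-cong (+ 1) (⊕-congʳ (⊝ ((+ 2) ⊙ ((+ 2) ⊙ E₀₃))) (⊙-cong (+ 2) Ĝ₅-value)))))) All.∷ x≋y⇒x-y≋0 Γc-value All.∷ All.[]))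
    (const-regular 1)

-- Infinite products and Gauss' product for φ(- q).

module GaussProduct where

  open Polynomials
  open SeriesRing
  open Substitution
  open Families
  open RationalFamilies
  open LambertFamilies
  open Multiples
  open ArithmeticGeometricMean
  open Lattices
  open ThetaRelations

  Good : (ℕ → Series) → Set
  Good F = ∀ m n → n < m → F m n ≡ oneS n

  ⊛-one : ∀ f → f ⊛ oneS ≋ f
  ⊛-one f = ≋-trans (⊛-comm f oneS) (oneS-⊛ f)

  good-⊛ : ∀ {F G} → Good F → Good G → Good (λ m → F m ⊛ G m)
  good-⊛ {F} {G} gF gG m n n<m = trans (⊛-cong≤ {F m} {oneS} {G m} {oneS} n (λ i i≤n → gF m i (ℕP.≤-<-trans i≤n n<m)) (λ i i≤n → gG m i (ℕP.≤-<-trans i≤n n<m))) (oneS-⊛ oneS n)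

  prod-stable : ∀ {F} → Good F → ∀ N n → n ≤ N → prodTo N F n ≡ infProd F n
  prod-stable {F} g zero    zero z≤n = refl
  prod-stable {F} g (suc N) n    n≤N with ℕP.m≤n⇒m<n∨m≡n n≤N
  ... | inj₂ refl    = refl
  ... | inj₁ (s≤s n<N) = trans (⊛-cong≤ {prodTo N F} {prodTo N F} {F (suc N)} {oneS} n (λ _ _ → refl) (λ i i≤n → g (suc N) i (s≤s (ℕP.≤-trans i≤n n<N))))
          (trans (⊛-one (prodTo N F) n) (prod-stable g N n n<N))

  prodTo-⊛ : ∀ N F G → prodTo N F ⊛ prodTo N G ≋ prodTo N (λ m → F m ⊛ G m)
  prodTo-⊛ zero    F G = oneS-⊛ oneS
  prodTo-⊛ (suc N) F G = ≋-trans (poly ((# 0F :* # 1F) :* (# 2F :* # 3F)) ((# 0F :* # 2F) :* (# 1F :* # 3F)) (prodTo N F ∷ F (suc N) ∷ prodTo N G ∷ G (suc N) ∷ []))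
    (⊛-congʳ (F (suc N) ⊛ G (suc N)) (prodTo-⊛ N F G))

  prodTo-cong : ∀ N {F G} → (∀ m → F (suc m) ≋ G (suc m)) → prodTo N F ≋ prodTo N G
  prodTo-cong zero    e = ≋-refl
  prodTo-cong (suc N) e = ⊛-cong (prodTo-cong N e) (e N)

  infProd-cong : ∀ {F G} → (∀ m → F (suc m) ≋ G (suc m)) → infProd F ≋ infProd G
  infProd-cong e n = prodTo-cong n e n

  infProd-⊛ : ∀ {F G} → Good F → Good G → infProd F ⊛ infProd G ≋ infProd (λ m → F m ⊛ G m)
  infProd-⊛ {F} {G} gF gG n = trans (⊛-cong≤ {infProd F} {prodTo n F} {infProd G} {prodTo n G} n (λ i i≤n → sym (prod-stable gF n i i≤n)) (λ i i≤n → sym (prod-stable gG n i i≤n)))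
    (prodTo-⊛ n F G n)

  infProd-one : ∀ {F} → (∀ m → F (suc m) ≋ oneS) → infProd F ≋ oneS
  infProd-one {F} e n = go n n
    where
    go : ∀ N → prodTo N F ≋ oneS
    go zero    = ≋-refl
    go (suc N) = ≋-trans (⊛-cong (go N) (e N)) (oneS-⊛ oneS)

  prodTo-sub : ∀ k .{{_ : ℕ.NonZero k}} N F → sub k (prodTo N F) ≋ prodTo N (λ m → sub k (F m))
  prodTo-sub k zero    F = sub-oneS k
  prodTo-sub k (suc N) F = ≋-trans (sub-⊛ k (prodTo N F) (F (suc N))) (⊛-congʳ (sub k (F (suc N))) (prodTo-sub k N F))

  infProd-sub : ∀ k .{{_ : ℕ.NonZero k}} {F} → Good F → sub k (infProd F) ≋ infProd (λ m → sub k (F m))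
  infProd-sub k {F} g = by-multiples k (λ n → sub k (infProd F) n ≡ infProd (λ m → sub k (F m)) n)
    (λ j → trans (sub-at k (infProd F) j) (trans (sym (prod-stable g (k ℕ.* j) j (ℕP.m≤n*m j k))) (trans (sym (sub-at k (prodTo (k ℕ.* j) F) j)) (prodTo-sub k (k ℕ.* j) F (k ℕ.* j)))))
    (λ n ¬d → trans (sub-∤ k (infProd F) n ¬d) (sym (trans (sym (prodTo-sub k n F n)) (sub-∤ k (prodTo n F) n ¬d))))

  U V : ℕ → Series
  U m = constS (+ 1) ⊕ ⊝ mono m
  V m = constS (+ 1) ⊕ mono m

  oneS≋const : oneS ≋ constS (+ 1)
  oneS≋const n = sym (ℤP.*-identityˡ (oneS n))

  oneMinusQ-U : ∀ m → oneMinusQ m ≋ U m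
  oneMinusQ-U m n = cong₂ (λ x y → x + - y) (oneS≋const n) (go (n ℕ.≟ m))
    where
    go : (d : Dec (n ≡ m)) → [ ⌊ d ⌋ ]ᶻ ≡ mono m n
    go (yes refl) = sym (mono-self n)
    go (no n≢m) with mono m n ℤ.≟ + 0
    ... | yes z = sym z
    ... | no ¬z = ⊥-elim (n≢m (sym (mono-≢ m n ¬z)))

  good-U : ∀ k .{{_ : ℕ.NonZero k}} → Good (λ m → U (k ℕ.* m))
  good-U k m n n<m = trans (cong₂ (λ x y → x + - y) (sym (oneS≋const n)) (mono-ord (k ℕ.* m) n (ℕP.<-≤-trans n<m (ℕP.m≤n*m m k)))) (ℤP.+-identityʳ (oneS n))

  good-V : Good V
  good-V m n n<m = trans (cong₂ _+_ (sym (oneS≋const n)) (mono-ord m n n<m)) (ℤP.+-identityʳ (oneS n))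

  e : ℕ → Series
  e k = infProd (λ m → U (k ℕ.* m))

  sub-U : ∀ k .{{_ : ℕ.NonZero k}} m → sub k (U m) ≋ U (k ℕ.* m)
  sub-U k m = ≋-trans (sub-⊕ k (constS (+ 1)) (⊝ mono m)) (⊕-cong (sub-const k (+ 1)) (≋-trans (sub-⊝ k (mono m)) (⊝-cong (sub-mono k m))))

  sub-e : ∀ k l .{{_ : ℕ.NonZero k}} .{{_ : ℕ.NonZero l}} → sub k (e l) ≋ e (k ℕ.* l)
  sub-e k l = ≋-trans (infProd-sub k {λ m → U (l ℕ.* m)} (good-U l)) (infProd-cong (λ m → ≋-trans (sub-U k (l ℕ.* suc m)) (λ n → cong (λ j → U j n) (sym (ℕP.*-assoc k l (suc m))))))

  sumS : ℕ → (ℕ → Series) → Series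
  sumS zero    f = f 0
  sumS (suc n) f = sumS n f ⊕ f (suc n)

  H : ℕ → ℕ → Series
  H s zero    = constS (+ 1)
  H s (suc d) = H s d ⊛ U (suc (s ℕ.+ d))

  H-shift : ∀ s d → H s (suc d) ≋ U (suc s) ⊛ H (suc s) d
  H-shift s zero    = ≋-trans (⊛-comm (constS (+ 1)) (U (suc (s ℕ.+ 0)))) (⊛-congʳ (constS (+ 1)) (λ n → cong (λ j → U (suc j) n) (ℕP.+-identityʳ s)))
  H-shift s (suc d) = ≋-trans (⊛-cong (H-shift s d) (λ n → cong (λ j → U (suc j) n) (ℕP.+-suc s d))) (⊛-assoc (U (suc s)) (H (suc s) d) (U (suc (suc s ℕ.+ d))))

  P₊ : ℕ → Series
  P₊ zero    = constS (+ 1)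
  P₊ (suc n) = P₊ n ⊛ V (suc n)

  sg : ℕ → Series
  sg n = constS (sgn n)

  sg-suc : ∀ n → sg (suc n) ≋ ⊝ sg n
  sg-suc n i = sym (ℤP.neg-distribˡ-* (sgn n) (oneS i))

  -- The terms of D. Shanks' finite form of Σ (-1)ˢ q^(s²) = Π (1 - qᵐ) / (1 + qᵐ).
  t : ℕ → ℕ → Series
  t n zero    = H 0 n
  t n (suc r) = (con2 ⊛ sg (suc r)) ⊛ (mono (suc r ℕ.* suc n) ⊛ (P₊ r ⊛ H (suc r) (n ℕ.∸ suc r)))
    where con2 = constS (+ 2)

  -- The defect of the terms when n grows: `t (suc n) s` is `t n s` times 1 + q^(n+1) minus `t n s`
  -- times this bracket. The second parts have partial sums in closed form.
  br : ℕ → ℕ → Series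
  br n j = U j ⊕ mono (suc n) ⊛ V j

  telescope : ∀ n s → s ≤ n → sumS s (λ j → t n j ⊛ br n j) ≋ (constS (+ 2) ⊛ sg s) ⊛ (mono (suc s ℕ.* suc n) ⊛ (P₊ s ⊛ H s (n ℕ.∸ s)))
  telescope n zero    _   = ≋-trans (⊛-congˡ (H 0 n) (⊕-cong (⊕-congˡ (constS (+ 1)) (⊝-cong oneS≋const)) (⊛-congˡ (mono (suc n)) (⊕-congˡ (constS (+ 1)) oneS≋const))))
    (≋-trans (poly (# 0F :* ((con (+ 1) :- con (+ 1)) :+ # 1F :* (con (+ 1) :+ con (+ 1)))) ((con (+ 2) :* con (+ 1)) :* (# 1F :* (con (+ 1) :* # 0F))) (H 0 n ∷ mono (suc n) ∷ []))
      (⊛-congˡ (constS (+ 2) ⊛ sg 0) (⊛-congʳ (constS (+ 1) ⊛ H 0 n) (λ i → cong (λ j → mono j i) (sym (ℕP.*-identityˡ (suc n)))))))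
  telescope n (suc s) s<n = ≋-trans (⊕-cong (≋-trans (telescope n s (ℕP.<⇒≤ s<n)) (⊛-congˡ (constS (+ 2) ⊛ sg s) (⊛-congˡ M (⊛-congˡ (P₊ s) (≋-trans (λ i → cong (λ k → H s k i) (ℕP.+-∸-assoc 1 s<n)) (H-shift s l))))))
      (⊛-congʳ (br n (suc s)) (⊛-congʳ (M ⊛ (P₊ s ⊛ H (suc s) l)) (⊛-congˡ (constS (+ 2)) (sg-suc s)))))
    (≋-trans (x-y≈0⇒x≈y (certify (sg s ∷ M ∷ P₊ s ∷ H (suc s) l ∷ mono (suc n) ∷ mono (suc s) ∷ (⊝ sg s) ∷ []) (con (+ 1))
        ((con (+ 2) :* # 0F) :* (# 1F :* (# 2F :* ((con (+ 1) :- # 5F) :* # 3F))) :+ ((con (+ 2) :* # 6F) :* (# 1F :* (# 2F :* # 3F))) :* ((con (+ 1) :- # 5F) :+ # 4F :* (con (+ 1) :+ # 5F))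
          :- (con (+ 2) :* # 6F) :* ((# 4F :* # 1F) :* ((# 2F :* (con (+ 1) :+ # 5F)) :* # 3F)))
        ((con (+ 2) :* # 1F :* # 2F :* # 3F :* (con (+ 1) :- # 5F) , # 0F :+ # 6F) ∷ []) regular₁ ((λ i → ℤP.+-inverseʳ (sg s i)) All.∷ All.[])))
      (⊛-cong (⊛-congˡ (constS (+ 2)) (≋-sym (sg-suc s))) (⊛-congʳ (P₊ (suc s) ⊛ H (suc s) l) (≋-sym (mono-+ (suc n) (suc s ℕ.* suc n))))))
    where
    l = n ℕ.∸ suc s
    M = mono (suc s ℕ.* suc n)

  F : ℕ → Series
  F n = sumS n (t n)

  S′ : ℕ → Series
  S′ zero    = constS (+ 1)
  S′ (suc n) = S′ n ⊕ (constS (+ 2) ⊛ sg (suc n)) ⊛ mono (suc n ℕ.* suc n)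

  t-suc : ∀ n s → s ≤ n → t (suc n) s ≋ t n s ⊛ V (suc n) ⊕ ⊝ (t n s ⊛ br n s)
  t-suc n zero    _   = ≋-trans (poly (# 0F :* (con (+ 1) :- # 1F)) (# 0F :* (con (+ 1) :+ # 1F) :- # 0F :* ((con (+ 1) :- con (+ 1)) :+ # 1F :* (con (+ 1) :+ con (+ 1)))) (H 0 n ∷ mono (suc n) ∷ []))
    (⊕-congˡ (H 0 n ⊛ V (suc n)) (⊝-cong (⊛-congˡ (H 0 n) (≋-sym (⊕-cong (⊕-congˡ (constS (+ 1)) (⊝-cong oneS≋const)) (⊛-congˡ (mono (suc n)) (⊕-congˡ (constS (+ 1)) oneS≋const)))))))
  t-suc n (suc r) r<n = ≋-trans (⊛-congˡ (constS (+ 2) ⊛ sg (suc r)) (⊛-cong {mono (suc r ℕ.* suc (suc n))} {M ⊛ mono (suc r)}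
        (≋-trans (λ i → cong (λ j → mono j i) (trans (ℕP.*-suc (suc r) (suc n)) (ℕP.+-comm (suc r) (suc r ℕ.* suc n)))) (mono-+ (suc r ℕ.* suc n) (suc r)))
        (⊛-congˡ (P₊ r) {H (suc r) (suc n ℕ.∸ suc r)} {H (suc r) l ⊛ U (suc n)} (≋-trans (λ i → cong (λ k → H (suc r) k i) (ℕP.+-∸-assoc 1 r<n)) (⊛-congˡ (H (suc r) l) (λ i → cong (λ j → U (suc j) i) (ℕP.m+[n∸m]≡n r<n)))))))
    (poly (# 0F :* ((# 1F :* # 5F) :* (# 2F :* (# 3F :* (con (+ 1) :- # 4F))))) ((# 0F :* (# 1F :* (# 2F :* # 3F))) :* (con (+ 1) :+ # 4F) :- (# 0F :* (# 1F :* (# 2F :* # 3F))) :* ((con (+ 1) :- # 5F) :+ # 4F :* (con (+ 1) :+ # 5F)))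
      ((constS (+ 2) ⊛ sg (suc r)) ∷ M ∷ P₊ r ∷ H (suc r) l ∷ mono (suc n) ∷ mono (suc r) ∷ []))
    where
    l = n ℕ.∸ suc r
    M = mono (suc r ℕ.* suc n)

  sumS-split : ∀ s n {f g h : ℕ → Series} v → s ≤ n → (∀ j → j ≤ n → f j ≋ g j ⊛ v ⊕ ⊝ h j) → sumS s f ≋ sumS s g ⊛ v ⊕ ⊝ sumS s h
  sumS-split zero    n v s≤n eq′ = eq′ 0 z≤n
  sumS-split (suc s) n {f} {g} {h} v s≤n eq′ = ≋-trans (⊕-cong (sumS-split s n {f} {g} {h} v (ℕP.<⇒≤ s≤n) eq′) (eq′ (suc s) s≤n))
    (poly ((# 0F :* # 1F :- # 2F) :+ (# 3F :* # 1F :- # 4F)) ((# 0F :+ # 3F) :* # 1F :- (# 2F :+ # 4F)) (sumS s g ∷ v ∷ sumS s h ∷ g (suc s) ∷ h (suc s) ∷ []))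

  -- The telescoped defect and the new last term are ∓ 2 (-1)^(n+1) multiples of q^((n+1)²) P₊(n)
  -- with factors -1 and q^(n+1), up to sign. Together they give 2 (-1)^(n+1) q^((n+1)²) P₊(n) (1 +
  -- q^(n+1)), the contribution of the new square.
  shanks : ∀ n → F n ≋ P₊ n ⊛ S′ n
  shanks zero    = poly {0} (con (+ 1)) (con (+ 1) :* con (+ 1)) []
  shanks (suc n) = ≋-trans (⊕-cong {sumS n (t (suc n))} {F n ⊛ V (suc n) ⊕ ⊝ sumS n (λ j → t n j ⊛ br n j)} (sumS-split n n (V (suc n)) ℕP.≤-refl (t-suc n)) last)
    (≋-trans (⊕-congʳ last′ (⊕-cong (⊛-congʳ (V (suc n)) (shanks n)) (⊝-cong (≋-trans (telescope n n ℕP.≤-refl) (⊛-congˡ (constS (+ 2) ⊛ sg n) (⊛-congˡ M (⊛-congˡ (P₊ n) (λ i → cong (λ k → H n k i) (ℕP.n∸n≡0 n)))))))))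
    (x-y≈0⇒x≈y (certify (P₊ n ∷ S′ n ∷ mono (suc n) ∷ M ∷ sg n ∷ sg (suc n) ∷ []) (con (+ 1))
      (((# 0F :* # 1F) :* (con (+ 1) :+ # 2F) :- (con (+ 2) :* # 4F) :* (# 3F :* (# 0F :* con (+ 1)))) :+ (con (+ 2) :* # 5F) :* ((# 3F :* # 2F) :* (# 0F :* con (+ 1)))
        :- (# 0F :* (con (+ 1) :+ # 2F)) :* (# 1F :+ (con (+ 2) :* # 5F) :* # 3F))
      ((con (- + 2) :* # 0F :* # 3F , # 5F :+ # 4F) ∷ []) regular₁ ((λ i → trans (cong (_+ sg n i) (sg-suc n i)) (ℤP.+-inverseˡ (sg n i))) All.∷ All.[]))))
    where
    M = mono (suc n ℕ.* suc n)
    last′ = (constS (+ 2) ⊛ sg (suc n)) ⊛ ((M ⊛ mono (suc n)) ⊛ (P₊ n ⊛ constS (+ 1)))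
    last : t (suc n) (suc n) ≋ last′
    last = ⊛-congˡ (constS (+ 2) ⊛ sg (suc n)) (⊛-cong {mono (suc n ℕ.* suc (suc n))} {M ⊛ mono (suc n)} (≋-trans (λ i → cong (λ j → mono j i) (trans (ℕP.*-suc (suc n) (suc n)) (ℕP.+-comm (suc n) (suc n ℕ.* suc n)))) (mono-+ (suc n ℕ.* suc n) (suc n)))
      (⊛-congˡ (P₊ n) {H (suc n) (suc n ℕ.∸ suc n)} {constS (+ 1)} (λ i → cong (λ k → H (suc n) k i) (ℕP.n∸n≡0 (suc n)))))

  S′-win : ∀ n → S′ n ≋ win n (wt sgnᶻ (sq 1))
  S′-win zero    i = trans (sym (oneS≋const i)) (sym (ℤP.*-identityˡ (oneS i)))
  S′-win (suc n) i = cong₂ _+_ (S′-win n i) (trans (trans (⊛-congʳ (mono (suc n ℕ.* suc n)) (constS-⊛ (+ 2) (sg (suc n))) i) (trans (⊙-⊛ (+ 2) (sg (suc n)) (mono (suc n ℕ.* suc n)) i)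
    (cong (+ 2 *_) (trans (constS-⊛ (sgn (suc n)) (mono (suc n ℕ.* suc n)) i) (cong (λ j → sgn (suc n) * mono j i) (sym (ℕP.*-identityˡ (suc n ℕ.* suc n)))))))) (two (sgn (suc n) * mono (1 ℕ.* (suc n ℕ.* suc n)) i)))
    where two : ∀ x → + 2 * x ≡ x + x
          two = solve-∀

  -- Each term with s ≥ 1 contains q^(s(n+1)), so below q^(n+1) only the product of the 1 - q^m
  -- remains.
  F-low : ∀ n i → i ≤ n → F n i ≡ H 0 n i
  F-low n i i≤n = go n
    where
    go : ∀ s → sumS s (t n) i ≡ H 0 n i
    go zero    = refl
    go (suc s) = trans (cong₂ _+_ (go s) (ord-⊛ʳ (suc n) (constS (+ 2) ⊛ sg (suc s)) {mono (suc s ℕ.* suc n) ⊛ (P₊ s ⊛ H (suc s) (n ℕ.∸ suc s))}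
      (ord-⊛ˡ (suc n) {mono (suc s ℕ.* suc n)} (P₊ s ⊛ H (suc s) (n ℕ.∸ suc s)) (λ j j<n → mono-ord (suc s ℕ.* suc n) j (ℕP.<-≤-trans j<n (ℕP.m≤m+n (suc n) (s ℕ.* suc n))))) i (s≤s i≤n))) (ℤP.+-identityʳ _)

  P₊-prod : ∀ n → P₊ n ≋ prodTo n V
  P₊-prod zero    = ≋-sym oneS≋const
  P₊-prod (suc n) = ⊛-congʳ (V (suc n)) (P₊-prod n)

  H-prod : ∀ n → H 0 n ≋ prodTo n (λ m → U (1 ℕ.* m))
  H-prod zero    = ≋-sym oneS≋const
  H-prod (suc n) = ⊛-cong (H-prod n) (λ i → cong (λ j → U j i) (sym (ℕP.*-identityˡ (suc n))))

  a-product : a ⊛ infProd V ≋ e 1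
  a-product n = begin
    (a ⊛ infProd V) n   ≡⟨ ⊛-cong≤ {a} {S′ n} {infProd V} {P₊ n} n (λ i i≤n → sym (trans (S′-win n i) (win-loc (wt-loc sgnᶻ (sq-loc 1)) n i i≤n)))
                             (λ i i≤n → sym (trans (P₊-prod n i) (prod-stable good-V n i i≤n))) ⟩
    (S′ n ⊛ P₊ n) n     ≡⟨ trans (⊛-comm (S′ n) (P₊ n) n) (sym (shanks n n)) ⟩
    F n n               ≡⟨ trans (F-low n n ℕP.≤-refl) (H-prod n n) ⟩
    e 1 n               ∎
    where open ≡-Reasoning

  a-eta : a ⊛ e 2 ≋ e 1 ⊛ e 1
  a-eta = ≋-trans (⊛-congˡ a (≋-sym (≋-trans (infProd-⊛ {V} {λ m → U (1 ℕ.* m)} good-V (good-U 1)) (infProd-cong (λ m → ≋-trans (⊛-congˡ (V (suc m)) (λ i → cong (λ j → U j i) (ℕP.*-identityˡ (suc m))))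
      (≋-trans (poly ((con (+ 1) :+ # 0F) :* (con (+ 1) :- # 0F)) (con (+ 1) :- # 0F :* # 0F) (mono (suc m) ∷ [])) (⊕-congˡ (constS (+ 1)) (⊝-cong (≋-trans (≋-sym (mono-+ (suc m) (suc m))) (λ i → cong (λ j → mono (suc m ℕ.+ j) i) (sym (ℕP.+-identityʳ (suc m)))))))))))))
    (≋-trans (≋-sym (⊛-assoc a (infProd V) (e 1))) (⊛-congʳ (e 1) a-product))

-- Jacobi's product and the eta products for ρ₁, ρ₅ and N.

module EtaRelations where

  open Polynomials
  open SeriesRing
  open Substitution
  open RationalFamilies
  open LambertFamilies
  open Multiples
  open LambertPairs
  open ArithmeticGeometricMean
  open Lattices
  open ThetaNorms
  open ThetaRelations
  open TwistedTotals
  open ThetaAlgebra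
  open EtaAlgebra
  open GaussProduct

  private
    module Qt = Quotients 𝕊
    module Rt = Roots 𝕊

  e-regular : ∀ k → Regular (e k)
  e-regular k = regular₀ {e k} (λ ())

  mono-regular : ∀ k → Regular (mono k)
  mono-regular k g h n = trans (sym (mono-⊛-+ k g n)) (h (k ℕ.+ n))

  ^-regular : ∀ {f} k → Regular f → Regular (f ^ k)
  ^-regular zero    r = regular₀ {oneS} (λ ())
  ^-regular {f} (suc k) r = regular-⊛ {f} {f ^ k} r (^-regular {f} k r)

  sub-square : ∀ k .{{_ : ℕ.NonZero k}} f → sub k (f ⊛ f) ≋ sub k f ⊛ sub k f
  sub-square k f = sub-⊛ k f f

  c-eta : c ⊛ e 4 ≋ e 2 ⊛ e 2
  c-eta = ≋-trans (⊛-congˡ c (≋-sym (sub-e 2 2))) (≋-trans (≋-sym (sub-⊛ 2 a (e 2))) (≋-trans (sub-cong 2 a-eta) (≋-trans (sub-square 2 (e 1)) (⊛-cong (sub-e 2 1) (sub-e 2 1)))))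

  b-eta : b ⊛ e 10 ≋ e 5 ⊛ e 5
  b-eta = ≋-trans (⊛-congˡ b (≋-sym (sub-e 5 2))) (≋-trans (≋-sym (sub-⊛ 5 a (e 2))) (≋-trans (sub-cong 5 a-eta) (≋-trans (sub-square 5 (e 1)) (⊛-cong (sub-e 5 1) (sub-e 5 1)))))

  d-eta : d ⊛ e 20 ≋ e 10 ⊛ e 10
  d-eta = ≋-trans (⊛-congˡ d (≋-sym (sub-e 10 2))) (≋-trans (≋-sym (sub-⊛ 10 a (e 2))) (≋-trans (sub-cong 10 a-eta) (≋-trans (sub-square 10 (e 1)) (⊛-cong (sub-e 10 1) (sub-e 10 1)))))

  A-eta : A ⊛ (e 1 ^ 2 ⊛ e 4 ^ 2) ≋ e 2 ^ 5
  A-eta = Qt.A-eta A a c (e 1) (e 2) (e 4) a-eta c-eta Aa (const-regular 0)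

  private
    sub-power : ∀ k l n .{{_ : ℕ.NonZero k}} .{{_ : ℕ.NonZero l}} → sub k (e l ^ n) ≋ e (k ℕ.* l) ^ n
    sub-power k l n = ≋-trans (sub-^ k (e l) n) (^-cong n (sub-e k l))

    sub-A-eta : ∀ k .{{_ : ℕ.NonZero k}} → sub k A ⊛ (e (k ℕ.* 1) ^ 2 ⊛ e (k ℕ.* 4) ^ 2) ≋ e (k ℕ.* 2) ^ 5
    sub-A-eta k = ≋-trans (⊛-congˡ (sub k A) (≋-sym (≋-trans (sub-⊛ k (e 1 ^ 2) (e 4 ^ 2)) (⊛-cong (sub-power k 1 2) (sub-power k 4 2)))))
      (≋-trans (≋-sym (sub-⊛ k A (e 1 ^ 2 ⊛ e 4 ^ 2))) (≋-trans (sub-cong k A-eta) (sub-power k 2 5)))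

  C-eta : C ⊛ (e 2 ^ 2 ⊛ e 8 ^ 2) ≋ e 4 ^ 5
  C-eta = sub-A-eta 2

  D-eta : D ⊛ (e 10 ^ 2 ⊛ e 40 ^ 2) ≋ e 20 ^ 5
  D-eta = sub-A-eta 10

  q² : mono 2 ≋ mono 1 ⊛ mono 1
  q² = mono-+ 1 1

  J K₁₆ : Series
  J = (A ^ 4 ⊕ ⊝ (a ^ 4)) ⊛ e 2 ^ 4
  K₁₆ = constS (+ 16) ⊛ (mono 1 ⊛ e 4 ^ 8)

  sub2-J : sub 2 J ≋ (C ^ 4 ⊕ ⊝ (c ^ 4)) ⊛ e 4 ^ 4
  sub2-J = ≋-trans (sub-⊛ 2 (A ^ 4 ⊕ ⊝ (a ^ 4)) (e 2 ^ 4)) (⊛-cong (≋-trans (sub-⊕ 2 (A ^ 4) (⊝ (a ^ 4))) (⊕-cong (sub-^ 2 A 4) (≋-trans (sub-⊝ 2 (a ^ 4)) (⊝-cong (sub-^ 2 a 4))))) (sub-power 2 2 4))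

  sub-K : ∀ k .{{_ : ℕ.NonZero k}} j l n .{{_ : ℕ.NonZero l}} → sub k (constS (+ 16) ⊛ (mono j ⊛ e l ^ n)) ≋ constS (+ 16) ⊛ (mono (k ℕ.* j) ⊛ e (k ℕ.* l) ^ n)
  sub-K k j l n = ≋-trans (sub-⊛ k (constS (+ 16)) (mono j ⊛ e l ^ n)) (⊛-cong (sub-const k (+ 16)) (≋-trans (sub-⊛ k (mono j) (e l ^ n)) (⊛-cong (sub-mono k j) (sub-power k l n))))

  -- The difference E of the sides satisfies E · S = H · E(q²) with S of order 1, and its first two
  -- coefficients vanish by evaluation, so `doubling-unique` applies.
  jacobi : J ≋ K₁₆
  jacobi = x-y≈0⇒x≈y (doubling-unique (J ⊕ ⊝ K₁₆) ((J ⊕ K₁₆) ⊛ e 4 ^ 4) (constS (+ 16) ⊛ (C ^ 4 ⊛ e 2 ^ 8)) refl refl (λ { 0 _ → refl ; (suc _) (s≤s ()) }) (λ ())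
    (≋-trans (Qt.jacobi A a C c (e 2) (e 4) (e 8) (mono 1) (mono 2) A²+a² Aa C-eta q² (const-regular 0))
      (⊛-congˡ (constS (+ 16) ⊛ (C ^ 4 ⊛ e 2 ^ 8)) (≋-sym (≋-trans (sub-⊕ 2 J (⊝ K₁₆)) (⊕-cong sub2-J (≋-trans (sub-⊝ 2 K₁₆) (⊝-cong (sub-K 2 1 4 8)))))))))

  jacobi₂ : (C ^ 4 ⊕ ⊝ (c ^ 4)) ⊛ e 4 ^ 4 ≋ constS (+ 16) ⊛ (mono 2 ⊛ e 8 ^ 8)
  jacobi₂ = ≋-trans (≋-sym sub2-J) (≋-trans (sub-cong 2 jacobi) (sub-K 2 1 4 8))

  jacobi₁₀ : (D ^ 4 ⊕ ⊝ (d ^ 4)) ⊛ e 20 ^ 4 ≋ constS (+ 16) ⊛ (mono 10 ⊛ e 40 ^ 8)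
  jacobi₁₀ = ≋-trans (≋-sym (≋-trans (sub-⊛ 5 (C ^ 4 ⊕ ⊝ (c ^ 4)) (e 4 ^ 4)) (⊛-cong (≋-trans (sub-⊕ 5 (C ^ 4) (⊝ (c ^ 4))) (⊕-cong (≋-trans (sub-^ 5 C 4) (^-cong 4 sub5-C))
      (≋-trans (sub-⊝ 5 (c ^ 4)) (⊝-cong (≋-trans (sub-^ 5 c 4) (^-cong 4 (sub-sub 5 2 10 a refl))))))) (sub-power 5 4 4))))
    (≋-trans (sub-cong 5 jacobi₂) (sub-K 5 2 8 8))

  ρ₁ ρ₅ : Series
  ρ₁ = d ⊛ d ⊕ ⊝ (c ⊛ c)
  ρ₅ = constS (+ 5) ⊛ (d ⊛ d) ⊕ ⊝ (c ⊛ c)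

  N² : N ⊛ N ≋ ρ₁ ⊛ ρ₅
  N² = ≋-trans R₁ (⊛-cong (⊕-cong Bb (⊝-cong Aa)) (⊕-cong (≋-trans (⊙-cong (+ 5) Bb) (≋-sym (constS-⊛ (+ 5) (d ⊛ d)))) (⊝-cong Aa)))

  ρ-regular : Regular (ρ₁ ⊛ ρ₅)
  ρ-regular = regular-≋ {N ⊛ N} {ρ₁ ⊛ ρ₅} N² (regular-⊛ {N} {N} N-regular N-regular)

  private
    module Rs = Resultants 𝕊 (C ⊛ C) (D ⊛ D) (c ⊛ c) (d ⊛ d)

    -- Since A² + a² = 2C² and B² + b² = 2D², with A a = c², B b = d² and the mixed products given
    -- by `gR₁`, the relation `gR₂` becomes 4 times (C² - D²)(C² - 5D²) + (c² - d²)(c² - 5d²).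
    zF : ⟦ Rs.gF ⟧ Rs.ρ ≋ zeroS
    zF = certify θ₀ (con (+ 4)) ((vC :* vC :- vD :* vD) :* (vC :* vC :- nat 5 :* (vD :* vD)) :+ (vd :* vd :- vc :* vc) :* (nat 5 :* (vd :* vd) :- vc :* vc))
      ((nat 1 , gR₂) ∷ (nat 0 :- nat 6 , gR₁) ∷ (nat 2 :* vC :^ 2 :+ (vA :^ 2 :+ va :^ 2) :- nat 12 :* vD :^ 2 , gC) ∷ (nat 10 :* vD :^ 2 :+ nat 5 :* (vB :^ 2 :+ vb :^ 2) :- nat 6 :* (vA :^ 2 :+ va :^ 2) , gD)
        ∷ (nat 4 :* (vc :^ 2 :+ ep :- nat 6 :* vd :^ 2) , gc) ∷ (nat 4 :* (nat 5 :* vd :^ 2 :+ nat 5 :* er :- nat 6 :* ep) , gd) ∷ [])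
      (const-regular 3) (zR₂ All.∷ zR₁ All.∷ zC All.∷ zD All.∷ zc All.∷ zd All.∷ All.[])

    -- `gR₁′` determines 4 C D c d; squaring it leaves an equation in C², D², c², d².
    zG : ⟦ Rs.gG ⟧ Rs.ρ ≋ zeroS
    zG = certify θ₀ (con (+ 1)) ((vD :* vD :* (nat 5 :* (vd :* vd) :- vc :* vc) :- vC :* vC :* (vd :* vd :- vc :* vc)) :^ 2 :- nat 16 :* (vC :* vC) :* (vD :* vD) :* (vc :* vc) :* (vd :* vd))
      ((nat 0 :- (nat 4 :* vC :* vD :* vc :* vd :+ (vD :^ 2 :* (nat 5 :* vd :^ 2 :- vc :^ 2) :- vC :^ 2 :* (vd :^ 2 :- vc :^ 2))) , gR₁′) ∷ [])
      regular₁ (zR₁′ All.∷ All.[])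

    zP₁ : ⟦ Rs.g₁ ⟧ Rs.ρ ≋ zeroS
    zP₁ = Rs.z₁ zF zG (regular-⊛ {D ⊛ D} {ρ₁ ⊛ ρ₅} (regular₀ {D ⊛ D} (λ ())) ρ-regular)

    zP₂ : ⟦ Rs.g₂ ⟧ Rs.ρ ≋ zeroS
    zP₂ = Rs.z₂ zF zG (regular-⊛ {C ⊛ C} {ρ₁ ⊛ ρ₅} (regular₀ {C ⊛ C} (λ ())) ρ-regular)

    module E₁ = EtaProduct 𝕊 ρ₅ ρ₁ c d C (C ^ 4 ⊕ ⊝ (c ^ 4)) (e 2) (e 4) (e 8) (e 10) (e 20) (mono 2)
    module E₂ = EtaProduct 𝕊 ρ₁ ρ₅ d c D (D ^ 4 ⊕ ⊝ (d ^ 4)) (e 10) (e 20) (e 40) (e 2) (e 4) (mono 10)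

    prepare : ∀ r s c d C → ⟦ # 0F :^ 5 :* # 1F :- nat 256 :* ((# 2F :* # 2F) :* (# 3F :* # 3F)) :* (# 4F :* # 4F) :^ 2 :* ((# 4F :* # 4F) :^ 2 :- (# 2F :* # 2F) :^ 2) ⟧ (r ∷ s ∷ c ∷ d ∷ C ∷ []) ≋ zeroS →
              ⟦ # 0F :^ 5 :* # 1F :- nat 256 :* (# 2F :^ 2 :* # 3F :^ 2) :* # 4F :^ 4 :* (# 4F :^ 4 :- # 2F :^ 4) ⟧ (r ∷ s ∷ c ∷ d ∷ C ∷ []) ≋ zeroS
    prepare r s c d C = via (# 0F :^ 5 :* # 1F :- nat 256 :* (# 2F :^ 2 :* # 3F :^ 2) :* # 4F :^ 4 :* (# 4F :^ 4 :- # 2F :^ 4))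
      (# 0F :^ 5 :* # 1F :- nat 256 :* ((# 2F :* # 2F) :* (# 3F :* # 3F)) :* (# 4F :* # 4F) :^ 2 :* ((# 4F :* # 4F) :^ 2 :- (# 2F :* # 2F) :^ 2)) (r ∷ s ∷ c ∷ d ∷ C ∷ [])

    K-regular : ∀ i j k l → Regular (((e i ^ 6 ⊛ e j ^ 2) ⊛ e k ^ 8) ⊛ e l ^ 8)
    K-regular i j k l = regular-⊛ {(e i ^ 6 ⊛ e j ^ 2) ⊛ e k ^ 8} {e l ^ 8} (regular-⊛ {e i ^ 6 ⊛ e j ^ 2} {e k ^ 8} (regular-⊛ {e i ^ 6} {e j ^ 2} (^-regular {e i} 6 (e-regular i)) (^-regular {e j} 2 (e-regular j))) (^-regular {e k} 8 (e-regular k))) (^-regular {e l} 8 (e-regular l))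

  x₅ x₁ X₅ X₁ : Series
  x₅ = ρ₅ ⊛ (e 2 ⊛ e 20)
  x₁ = ρ₁ ⊛ (e 4 ⊛ e 10)
  X₅ = constS (+ 4) ⊛ (e 4 ^ 3 ⊛ e 10)
  X₁ = constS (+ 4) ⊛ (mono 2 ⊛ (e 2 ⊛ e 20 ^ 3))

  sextic₁ : x₅ ^ 5 ⊛ x₁ ≋ X₅ ^ 5 ⊛ X₁
  sextic₁ = x-y≈0⇒x≈y (E₁.sextic (prepare ρ₅ ρ₁ c d C zP₁) (x≋y⇒x-y≋0 (^-cong 2 c-eta)) (x≋y⇒x-y≋0 (^-cong 2 d-eta)) (x≋y⇒x-y≋0 (^-cong 4 C-eta)) (x≋y⇒x-y≋0 jacobi₂) (K-regular 4 20 2 8))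

  -- The second resultant is the first with the levels exchanged: c with d, C with D, e 2 with e 10,
  -- e 4 with e 20, e 8 with e 40. Now q¹⁰ = (q²)⁵ goes into the fifth power of X₁.
  sextic₂ : x₁ ^ 5 ⊛ x₅ ≋ X₁ ^ 5 ⊛ X₅
  sextic₂ = ≋-trans (⊛-cong (^-cong 5 (⊛-congˡ ρ₁ (⊛-comm (e 4) (e 10)))) (⊛-congˡ ρ₅ (⊛-comm (e 2) (e 20))))
    (≋-trans (x-y≈0⇒x≈y (E₂.sextic (prepare ρ₁ ρ₅ d c D zP₂) (x≋y⇒x-y≋0 (^-cong 2 d-eta)) (x≋y⇒x-y≋0 (^-cong 2 c-eta)) (x≋y⇒x-y≋0 (^-cong 4 D-eta)) (x≋y⇒x-y≋0 jacobi₁₀) (K-regular 20 4 10 40)))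
    (≋-trans (⊛-congˡ ((constS (+ 4) ⊛ (e 20 ^ 3 ⊛ e 2)) ^ 5) (⊛-congˡ (constS (+ 4)) (⊛-congʳ (e 10 ⊛ e 4 ^ 3) (≋-sym (mono-^ 5 2)))))
      (poly ((nat 4 :* (# 3F :^ 3 :* # 0F)) :^ 5 :* (nat 4 :* (# 4F :^ 5 :* (# 2F :* # 1F :^ 3)))) ((nat 4 :* (# 4F :* (# 0F :* # 3F :^ 3))) :^ 5 :* (nat 4 :* (# 1F :^ 3 :* # 2F)))
        (e 2 ∷ e 4 ∷ e 10 ∷ e 20 ∷ mono 2 ∷ []))))

  private
    Positive : ℤ → Set
    Positive x = ∃ λ n → x ≡ + suc n

    pos-* : ∀ {x y} → Positive x → Positive y → Positive (x * y)
    pos-* (m , refl) (n , refl) = _ , refl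

    pos-+ : ∀ {x y} → Positive x → Positive y → Positive (x + y)
    pos-+ (m , refl) (n , refl) = _ , refl

    pos-^ : ∀ {f} k → Positive (f 0) → Positive ((f ^ k) 0)
    pos-^ zero    p = 0 , refl
    pos-^ {f} (suc k) p = pos-* {f 0} {(f ^ k) 0} p (pos-^ {f} k p)

    pos-cofactor : ∀ f g k → Positive (f 0) → Positive (g 0) → Positive (Rt.cofactor f g k 0)
    pos-cofactor f g zero    p q = 0 , refl
    pos-cofactor f g (suc k) p q = pos-+ {f 0 * Rt.cofactor f g k 0} {(g ^ suc k) 0} (pos-* {f 0} {Rt.cofactor f g k 0} p (pos-cofactor f g k p q)) (pos-^ {g} (suc k) q)

    pos-regular : ∀ {f} → Positive (f 0) → Regular f
    pos-regular {f} (n , p) = regular₀ {f} (λ z → absurd (trans (sym p) z))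
      where absurd : + suc n ≢ + 0
            absurd ()

  X₁-regular : Regular X₁
  X₁-regular = regular-⊛ {constS (+ 4)} {mono 2 ⊛ (e 2 ⊛ e 20 ^ 3)} (const-regular 3) (regular-⊛ {mono 2} {e 2 ⊛ e 20 ^ 3} (mono-regular 2) (regular₀ {e 2 ⊛ e 20 ^ 3} (λ ())))

  -- From x²⁴ = X²⁴ the factor x - X is split off. Both series have constant term 4, so the
  -- complementary factor has a positive constant term and is regular.
  ρ₅-eta : x₅ ≋ X₅
  ρ₅-eta = Rt.root x₅ X₅ 23 (pos-regular {Rt.cofactor x₅ X₅ 23} (pos-cofactor x₅ X₅ 23 (3 , refl) (3 , refl)))
    (Rt.twenty-fourth x₅ x₁ X₅ X₁ sextic₁ sextic₂ (regular-⊛ {X₁ ^ 5} {X₅} (^-regular {X₁} 5 X₁-regular) (regular₀ {X₅} (λ ()))))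

  ρ₁-eta : x₁ ≋ X₁
  ρ₁-eta = x-y≈0⇒x≈y (certify (x₁ ∷ X₁ ∷ x₅ ^ 5 ∷ X₅ ^ 5 ∷ []) (# 3F) (# 0F :- # 1F)
    ((nat 1 , # 2F :* # 0F :- # 3F :* # 1F) ∷ (nat 0 :- # 0F , # 2F :- # 3F) ∷ []) (^-regular {X₅} 5 (regular₀ {X₅} (λ ())))
    (x≋y⇒x-y≋0 sextic₁ All.∷ x≋y⇒x-y≋0 (^-cong 5 ρ₅-eta) All.∷ All.[]))

  N-eta : N ≋ constS (+ 4) ⊛ (mono 1 ⊛ (e 4 ⊛ e 20))
  N-eta = Qt.N-eta N ρ₁ ρ₅ (e 2) (e 4) (e 10) (e 20) (mono 1) (mono 2) N² ρ₅-eta ρ₁-eta q²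
    (regular-⊛ {(e 2 ⊛ e 20) ⊛ (e 4 ⊛ e 10)} {G} (regular₀ {(e 2 ⊛ e 20) ⊛ (e 4 ⊛ e 10)} (λ ())) (regular-tl {G} refl (regular₀ {tl G} (λ ()))))
    where G = N ⊕ constS (+ 4) ⊛ (mono 1 ⊛ (e 4 ⊛ e 20))

-- The four eta quotients as quartic forms.

module EtaQuotients where

  open Polynomials
  open SeriesRing
  open IntegerSums
  open Substitution
  open RationalFamilies
  open Multiples
  open LambertPairs
  open ArithmeticGeometricMean
  open Lattices
  open ThetaNorms
  open ThetaRelations
  open LambertProducts
  open TwistedTotals
  open ThetaAlgebra
  open ThetaUnknowns
  open EtaAlgebra
  open GaussProduct
  open EtaRelations

  private
    module Qt = Quotients 𝕊

  ones : Series
  ones _ = + 1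

  ones-U : ones ⊛ U 1 ≋ oneS
  ones-U n = trans (poly (# 0F :* (con (+ 1) :- # 1F)) (# 0F :- # 1F :* # 0F) (ones ∷ mono 1 ∷ []) n) (value n)
    where
    value : ∀ n → + 1 + - (mono 1 ⊛ ones) n ≡ oneS n
    value zero    = refl
    value (suc n) = cong (λ z → + 1 + - z) (mono-⊛-+ 1 ones n)

  geomQ-sub : ∀ k → geomQ (suc k) ≋ sub (suc k) ones
  geomQ-sub k = by-multiples (suc k) (λ n → geomQ (suc k) n ≡ sub (suc k) ones n)
    (λ j → trans (yes′ (suc k ∣? suc k ℕ.* j) (m∣m*n j)) (sym (sub-at (suc k) ones j))) (λ n ¬d → trans (no′ (suc k ∣? n) ¬d) (sym (sub-∤ (suc k) ones n ¬d)))
    where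
    yes′ : ∀ {P : Set} (d : Dec P) → P → [ ⌊ d ⌋ ]ᶻ ≡ + 1
    yes′ (yes _) p = refl
    yes′ (no ¬p) p = ⊥-elim (¬p p)
    no′ : ∀ {P : Set} (d : Dec P) → ¬ P → [ ⌊ d ⌋ ]ᶻ ≡ + 0
    no′ (yes p) ¬p = ⊥-elim (¬p p)
    no′ (no _)  ¬p = refl

  geom-inverse : ∀ k → geomQ (suc k) ⊛ U (suc k) ≋ oneS
  geom-inverse k = ≋-trans (⊛-cong (geomQ-sub k) (≋-sym (≋-trans (sub-U (suc k) 1) (λ i → cong (λ j → U j i) (ℕP.*-identityʳ (suc k))))))
    (≋-trans (≋-sym (sub-⊛ (suc k) ones (U 1))) (≋-trans (sub-cong (suc k) ones-U) (sub-oneS (suc k))))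

  good-cong : ∀ {F G} → (∀ m → F (suc m) ≋ G (suc m)) → Good G → Good F
  good-cong h g (suc m) n n<m = trans (h m n) (g (suc m) n n<m)

  good-geom : ∀ δ → Good (λ m → geomQ (suc δ ℕ.* m))
  good-geom δ (suc m) n n<m = trans (geomQ-sub (m ℕ.+ δ ℕ.* suc m) n) (trans (sub-< (suc δ ℕ.* suc m) ones n (ℕP.<-≤-trans n<m (ℕP.m≤n*m (suc m) (suc δ)))) (sym (oneS≋const n)))

  good-oneMinus : ∀ δ → Good (λ m → oneMinusQ (suc δ ℕ.* m))
  good-oneMinus δ = good-cong (λ m → oneMinusQ-U (suc δ ℕ.* suc m)) (good-U (suc δ))

  good-one : Good (λ _ → oneS)
  good-one _ _ _ = refl

  good-pow : ∀ {F} → Good F → ∀ k → Good (λ m → powS (F m) k)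
  good-pow g zero    = good-one
  good-pow {F} g (suc k) = good-⊛ {F} {λ m → powS (F m) k} g (good-pow {F} g k)

  infProd-pow : ∀ {F} → Good F → ∀ k → infProd (λ m → powS (F m) k) ≋ infProd F ^ k
  infProd-pow g zero    = infProd-one (λ _ → ≋-refl)
  infProd-pow {F} g (suc k) = ≋-trans (≋-sym (infProd-⊛ {F} {λ m → powS (F m) k} g (good-pow {F} g k))) (⊛-congˡ (infProd F) (infProd-pow {F} g k))

  e⁻¹ : ℕ → Series
  e⁻¹ k = infProd (λ m → geomQ (k ℕ.* m))

  e⁻¹-e : ∀ δ → e⁻¹ (suc δ) ⊛ e (suc δ) ≋ constS (+ 1)
  e⁻¹-e δ = ≋-trans (infProd-⊛ {λ m → geomQ (suc δ ℕ.* m)} {λ m → U (suc δ ℕ.* m)} (good-geom δ) (good-U (suc δ))) (≋-trans (infProd-one (λ m → geom-inverse (m ℕ.+ δ ℕ.* suc m))) oneS≋const)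

  e^ : ℕ → ℤ → Series
  e^ δ (+ k)    = e δ ^ k
  e^ δ -[1+ k ] = e⁻¹ δ ^ suc k

  good-factor : ∀ δ r → Good (λ m → oneMinusQ^ (suc δ ℕ.* m) r)
  good-factor δ (+ k)    = good-pow {λ m → oneMinusQ (suc δ ℕ.* m)} (good-oneMinus δ) k
  good-factor δ -[1+ k ] = good-pow {λ m → geomQ (suc δ ℕ.* m)} (good-geom δ) (suc k)

  infProd-factor : ∀ δ r → infProd (λ m → oneMinusQ^ (suc δ ℕ.* m) r) ≋ e^ (suc δ) r
  infProd-factor δ (+ k)    = ≋-trans (infProd-pow {λ m → oneMinusQ (suc δ ℕ.* m)} (good-oneMinus δ) k) (^-cong k (infProd-cong (λ m → oneMinusQ-U (suc δ ℕ.* suc m))))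
  infProd-factor δ -[1+ k ] = infProd-pow {λ m → geomQ (suc δ ℕ.* m)} (good-geom δ) (suc k)

  -- The entries are (δ - 1 , r).
  shifted : List (ℕ × ℤ) → List (ℕ × ℤ)
  shifted []            = []
  shifted ((δ , r) ∷ l) = (suc δ , r) ∷ shifted l

  good-eta : ∀ l → Good (etaFactor (shifted l))
  good-eta []            = good-one
  good-eta ((δ , r) ∷ l) = good-⊛ {λ m → oneMinusQ^ (suc δ ℕ.* m) r} {etaFactor (shifted l)} (good-factor δ r) (good-eta l)

  eta-product : List (ℕ × ℤ) → Series
  eta-product []            = oneS
  eta-product ((δ , r) ∷ l) = e^ (suc δ) r ⊛ eta-product l

  infProd-eta : ∀ l → infProd (etaFactor (shifted l)) ≋ eta-product l
  infProd-eta []            = infProd-one (λ _ → ≋-refl)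
  infProd-eta ((δ , r) ∷ l) = ≋-trans (≋-sym (infProd-⊛ {λ m → oneMinusQ^ (suc δ ℕ.* m) r} {etaFactor (shifted l)} (good-factor δ r) (good-eta l))) (⊛-cong (infProd-factor δ r) (infProd-eta l))

  shift-mono : ∀ k f → shift k f ≋ mono k ⊛ f
  shift-mono k f n = go (k ℕ.≤? n)
    where
    go : (d : Dec (k ≤ n)) → when ⌊ d ⌋ (f (n ℕ.∸ k)) ≡ (mono k ⊛ f) n
    go (yes k≤n) = sym (trans (cong (mono k ⊛ f) (sym (ℕP.m+[n∸m]≡n k≤n))) (mono-⊛-+ k f (n ℕ.∸ k)))
    go (no k≰n)  = sym (mono-⊛-< k f n (ℕP.≰⇒> k≰n))

  D₁-quotient : D₁ ⊛ (e 2 ^ 3 ⊛ e 8 ^ 2) ≋ mono 1 ⊛ (e 1 ^ 2 ⊛ (e 4 ^ 6 ⊛ e 20))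
  D₁-quotient = ≋-trans (⊛-congʳ (e 2 ^ 3 ⊛ e 8 ^ 2) (≋-trans (shift-mono 1 (infProd (etaFactor (shifted l)))) (⊛-congˡ (mono 1) (infProd-eta l))))
    (x-y≈0⇒x≈y (certify (mono 1 ∷ e 1 ^ 2 ∷ e 4 ^ 6 ∷ e 20 ∷ e⁻¹ 2 ∷ e 2 ∷ e⁻¹ 8 ∷ e 8 ∷ []) (con (+ 1))
      ((# 0F :* (# 1F :* (# 2F :* (# 3F :^ 1 :* (# 4F :^ 3 :* (# 6F :^ 2 :* # 0F :^ 0)))))) :* (# 5F :^ 3 :* # 7F :^ 2) :- # 0F :* (# 1F :* (# 2F :* # 3F)))
      ((# 0F :* # 1F :* # 2F :* # 3F :* (u :^ 2 :+ u :+ con (+ 1)) :* v :^ 2 , u :- con (+ 1)) ∷ (# 0F :* # 1F :* # 2F :* # 3F :* (v :+ con (+ 1)) , v :- con (+ 1)) ∷ [])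
      regular₁ (x≋y⇒x-y≋0 (e⁻¹-e 1) All.∷ x≋y⇒x-y≋0 (e⁻¹-e 7) All.∷ All.[])))
    where
    l = (0 , + 2) ∷ (3 , + 6) ∷ (19 , + 1) ∷ (1 , - + 3) ∷ (7 , - + 2) ∷ []
    u v : Expr 8
    u = # 4F :* # 5F
    v = # 6F :* # 7F

  private
    cancel-last : ∀ q x y z w g e → g ⊛ e ≋ constS (+ 1) → (q ⊛ (x ⊛ (y ⊛ (z ⊛ (w ⊛ (g ^ 1 ⊛ oneS)))))) ⊛ e ≋ q ⊛ (x ⊛ (y ⊛ (z ⊛ w)))
    cancel-last q x y z w g e h = x-y≈0⇒x≈y (certify (q ∷ x ∷ y ∷ z ∷ w ∷ g ∷ e ∷ []) (con (+ 1))
      ((# 0F :* (# 1F :* (# 2F :* (# 3F :* (# 4F :* (# 5F :^ 1 :* # 0F :^ 0)))))) :* # 6F :- # 0F :* (# 1F :* (# 2F :* (# 3F :* # 4F))))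
      ((# 0F :* # 1F :* # 2F :* # 3F :* # 4F , # 5F :* # 6F :- con (+ 1)) ∷ []) regular₁ (x≋y⇒x-y≋0 h All.∷ All.[]))

    ^1 : ∀ f → f ^ 1 ≋ f
    ^1 = ⊛-one

    quotient : ∀ k l X → shift k (infProd (etaFactor (shifted l))) ⊛ X ≋ (mono k ⊛ eta-product l) ⊛ X
    quotient k l X = ⊛-congʳ X (≋-trans (shift-mono k (infProd (etaFactor (shifted l)))) (⊛-congˡ (mono k) (infProd-eta l)))

  D₂-quotient : D₂ ⊛ e 20 ≋ mono 2 ⊛ (e 5 ^ 2 ⊛ (e 8 ⊛ (e 10 ⊛ e 40)))
  D₂-quotient = ≋-trans (quotient 2 ((4 , + 2) ∷ (7 , + 1) ∷ (9 , + 1) ∷ (39 , + 1) ∷ (19 , - + 1) ∷ []) (e 20)) (≋-trans (cancel-last (mono 2) (e 5 ^ 2) (e 8 ^ 1) (e 10 ^ 1) (e 40 ^ 1) (e⁻¹ 20) (e 20) (e⁻¹-e 19))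
    (⊛-congˡ (mono 2) (⊛-congˡ (e 5 ^ 2) (⊛-cong (^1 (e 8)) (⊛-cong (^1 (e 10)) (^1 (e 40)))))))

  D₃-quotient : D₃ ⊛ e 10 ≋ mono 4 ⊛ (e 1 ⊛ (e 5 ⊛ (e 20 ⊛ e 40 ^ 2)))
  D₃-quotient = ≋-trans (quotient 4 ((0 , + 1) ∷ (4 , + 1) ∷ (19 , + 1) ∷ (39 , + 2) ∷ (9 , - + 1) ∷ []) (e 10)) (≋-trans (cancel-last (mono 4) (e 1 ^ 1) (e 5 ^ 1) (e 20 ^ 1) (e 40 ^ 2) (e⁻¹ 10) (e 10) (e⁻¹-e 9))
    (⊛-congˡ (mono 4) (⊛-cong (^1 (e 1)) (⊛-cong (^1 (e 5)) (⊛-congʳ (e 40 ^ 2) (^1 (e 20)))))))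

  D₄-quotient : D₄ ⊛ e 2 ≋ mono 1 ⊛ (e 1 ⊛ (e 4 ⊛ (e 5 ⊛ e 8 ^ 2)))
  D₄-quotient = ≋-trans (quotient 1 ((0 , + 1) ∷ (3 , + 1) ∷ (4 , + 1) ∷ (7 , + 2) ∷ (1 , - + 1) ∷ []) (e 2)) (≋-trans (cancel-last (mono 1) (e 1 ^ 1) (e 4 ^ 1) (e 5 ^ 1) (e 8 ^ 2) (e⁻¹ 2) (e 2) (e⁻¹-e 1))
    (⊛-congˡ (mono 1) (⊛-cong (^1 (e 1)) (⊛-cong (^1 (e 4)) (⊛-congʳ (e 8 ^ 2) (^1 (e 5)))))))

  -- Since b² c² - a² d² = a b N, these two split N, whose eta product is known. The square of W
  -- alone is accessible by `W²`, because c d D is free of c and d. The first enters `D₄`, the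
  -- second `D₃`.
  W W′ : Series
  W  = b ⊛ c ⊕ ⊝ (a ⊛ d)
  W′ = b ⊛ c ⊕ a ⊛ d

  W² : (W ⊛ W) ⊛ D ≋ (a ⊛ b) ⊛ (C ⊛ ρ₁)
  W² = x-y≈0⇒x≈y (certify θ₀ (con (+ 1)) (((vb :* vc :- va :* vd) :* (vb :* vc :- va :* vd)) :* vD :- (va :* vb) :* (vC :* (vd :* vd :- vc :* vc)))
    ((vb :^ 2 :* vD :+ va :* vb :* vC , gc) ∷ (va :^ 2 :* vD :- va :* vb :* vC , gd) ∷ (nat 0 :- va :* vb , nat 2 :* vc :* vd :* vD :- (eK :* vD :- vC :* eρ₁)) ∷ [])
    regular₁ (zc All.∷ zd All.∷ P.zYD All.∷ All.[]))

  WW′ : W ⊛ W′ ≋ (a ⊛ b) ⊛ N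
  WW′ = x-y≈0⇒x≈y (certify θ₀ (con (+ 1)) ((vb :* vc :- va :* vd) :* (vb :* vc :+ va :* vd) :- (va :* vb) :* (vA :* vb :- va :* vB))
    ((vb :^ 2 , gc) ∷ (nat 0 :- va :^ 2 , gd) ∷ []) regular₁ (zc All.∷ zd All.∷ All.[]))

  W-eta : W ⊛ (e 2 ⊛ (e 8 ⊛ e 20)) ≋ constS (+ 2) ⊛ (mono 1 ⊛ (e 1 ⊛ (e 5 ⊛ (e 4 ^ 2 ⊛ e 40))))
  W-eta = Qt.W-eta W a b C D ρ₁ (e 1) (e 2) (e 4) (e 5) (e 8) (e 10) (e 20) (e 40) (mono 1) (mono 2) W² a-eta b-eta C-eta D-eta ρ₁-eta q²
    (regular-⊛ {G} {D ⊛ (e 2 ⊛ (e 10 ^ 2 ⊛ e 4))} (regular-tl {G} refl (regular₀ {tl G} (λ ()))) (regular₀ {D ⊛ (e 2 ⊛ (e 10 ^ 2 ⊛ e 4))} (λ ())))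
    where G = W ⊛ (e 2 ⊛ (e 8 ⊛ e 20)) ⊕ constS (+ 2) ⊛ (mono 1 ⊛ (e 1 ⊛ (e 5 ⊛ (e 4 ^ 2 ⊛ e 40))))

  W′-eta : W′ ⊛ (e 10 ⊛ (e 4 ⊛ e 40)) ≋ constS (+ 2) ⊛ (e 1 ⊛ (e 5 ⊛ (e 8 ⊛ e 20 ^ 2)))
  W′-eta = Qt.W′-eta W W′ a b N (e 1) (e 2) (e 4) (e 5) (e 8) (e 10) (e 20) (e 40) (mono 1) WW′ a-eta b-eta N-eta W-eta
    (regular-tl {G} refl (regular₀ {tl G} (λ ())))
    where G = constS (+ 2) ⊛ (mono 1 ⊛ (e 1 ⊛ (e 5 ⊛ (e 4 ^ 2 ⊛ e 40))))

  private
    sub-const⊛ : ∀ k f → sub 2 (constS (+ k) ⊛ f) ≋ constS (+ k) ⊛ sub 2 f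
    sub-const⊛ k f = ≋-trans (sub-⊛ 2 (constS (+ k)) f) (⊛-congʳ (sub 2 f) (sub-const 2 (+ k)))

    power : ∀ l n .{{_ : ℕ.NonZero l}} → sub 2 (e l ^ n) ≋ e (2 ℕ.* l) ^ n
    power l n = ≋-trans (sub-^ 2 (e l) n) (^-cong n (sub-e 2 l))

  sub2-c : sub 2 (c ⊛ c) ≋ C ⊛ c
  sub2-c = ≋-trans (sub-cong 2 (≋-sym Aa)) (sub-⊛ 2 A a)

  sub2-d : sub 2 (d ⊛ d) ≋ D ⊛ d
  sub2-d = ≋-trans (sub-cong 2 (≋-sym Bb)) (≋-trans (sub-⊛ 2 B b) (⊛-cong sub2-B sub2-b))

  N₂-eta : C ⊛ d ⊕ ⊝ (c ⊛ D) ≋ constS (+ 4) ⊛ (mono 2 ⊛ (e 8 ⊛ e 40))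
  N₂-eta = ≋-trans (≋-sym (≋-trans (sub-⊕ 2 (A ⊛ b) (⊝ (a ⊛ B))) (⊕-cong (≋-trans (sub-⊛ 2 A b) (⊛-congˡ C sub2-b)) (≋-trans (sub-⊝ 2 (a ⊛ B)) (⊝-cong (≋-trans (sub-⊛ 2 a B) (⊛-congˡ c sub2-B)))))))
    (≋-trans (sub-cong 2 N-eta) (≋-trans (sub-const⊛ 4 (mono 1 ⊛ (e 4 ⊛ e 20))) (⊛-congˡ (constS (+ 4)) (≋-trans (sub-⊛ 2 (mono 1) (e 4 ⊛ e 20)) (⊛-cong (sub-mono 2 1) (≋-trans (sub-⊛ 2 (e 4) (e 20)) (⊛-cong (sub-e 2 4) (sub-e 2 20))))))))

  R₁-eta : (D ⊛ d ⊕ ⊝ (C ⊛ c)) ⊛ (e 8 ⊛ e 20) ≋ constS (+ 4) ⊛ (mono 4 ⊛ (e 4 ⊛ e 40 ^ 3))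
  R₁-eta = ≋-trans (≋-sym (≋-trans (sub-⊛ 2 ρ₁ (e 4 ⊛ e 10)) (⊛-cong (≋-trans (sub-⊕ 2 (d ⊛ d) (⊝ (c ⊛ c))) (⊕-cong sub2-d (≋-trans (sub-⊝ 2 (c ⊛ c)) (⊝-cong sub2-c)))) (≋-trans (sub-⊛ 2 (e 4) (e 10)) (⊛-cong (sub-e 2 4) (sub-e 2 10))))))
    (≋-trans (sub-cong 2 ρ₁-eta) (≋-trans (sub-const⊛ 4 (mono 2 ⊛ (e 2 ⊛ e 20 ^ 3))) (⊛-congˡ (constS (+ 4)) (≋-trans (sub-⊛ 2 (mono 2) (e 2 ⊛ e 20 ^ 3)) (⊛-cong (sub-mono 2 2) (≋-trans (sub-⊛ 2 (e 2) (e 20 ^ 3)) (⊛-cong (sub-e 2 2) (power 20 3))))))))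

  R₅-eta : (constS (+ 5) ⊛ (D ⊛ d) ⊕ ⊝ (C ⊛ c)) ⊛ (e 4 ⊛ e 40) ≋ constS (+ 4) ⊛ (e 8 ^ 3 ⊛ e 20)
  R₅-eta = ≋-trans (≋-sym (≋-trans (sub-⊛ 2 ρ₅ (e 2 ⊛ e 20)) (⊛-cong (≋-trans (sub-⊕ 2 (constS (+ 5) ⊛ (d ⊛ d)) (⊝ (c ⊛ c))) (⊕-cong (≋-trans (sub-const⊛ 5 (d ⊛ d)) (⊛-congˡ (constS (+ 5)) sub2-d)) (≋-trans (sub-⊝ 2 (c ⊛ c)) (⊝-cong sub2-c)))) (≋-trans (sub-⊛ 2 (e 2) (e 20)) (⊛-cong (sub-e 2 2) (sub-e 2 20))))))
    (≋-trans (sub-cong 2 ρ₅-eta) (≋-trans (sub-const⊛ 4 (e 4 ^ 3 ⊛ e 10)) (⊛-congˡ (constS (+ 4)) (≋-trans (sub-⊛ 2 (e 4 ^ 3) (e 10)) (⊛-cong (power 4 3) (sub-e 2 10))))))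

  private
    module V₁ = Unknowns 𝕊 A a B b C D c d zeroS D₁ zeroS zeroS
    module V₂ = Unknowns 𝕊 A a B b C D c d zeroS D₂ zeroS zeroS
    module V₃ = Unknowns 𝕊 A a B b C D c d zeroS D₃ zeroS zeroS
    module V₄ = Unknowns 𝕊 A a B b C D c d zeroS D₄ zeroS zeroS

  D₁-value : V₁.Z (nat 12 :* vx :- tD₁)
  D₁-value = V₁.D₁-value Q.zD₁ (x≋y⇒x-y≋0 (Qt.D₁-eta D₁ a C N (e 1) (e 2) (e 4) (e 8) (e 20) (mono 1) D₁-quotient a-eta C-eta N-eta (regular₀ {e 2 ^ 3 ⊛ e 8 ^ 2} (λ ())))) (const-regular 0)

  D₂-value : V₂.Z (nat 24 :* vx :- tD₂)
  D₂-value = V₂.D₂-value Q.zD₂ zd P.zYD (x≋y⇒x-y≋0 (Qt.D₂-eta D₂ b d (C ⊛ d ⊕ ⊝ (c ⊛ D)) (e 5) (e 8) (e 10) (e 20) (e 40) (mono 2) D₂-quotient b-eta d-eta N₂-eta (regular₀ {e 20 ⊛ e 10} (λ ())))) (const-regular 0)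

  D₃-value : V₃.Z (nat 48 :* vx :- tD₃)
  D₃-value = V₃.D₃-value Q.zD₃ zc zd P.zYD P.zYC (x≋y⇒x-y≋0 (Qt.D₃-eta D₃ (D ⊛ d ⊕ ⊝ (C ⊛ c)) W′ (e 1) (e 4) (e 5) (e 8) (e 10) (e 20) (e 40) (mono 4) D₃-quotient R₁-eta W′-eta (regular₀ {(e 10 ⊛ (e 4 ⊛ e 40)) ⊛ (e 8 ⊛ e 20)} (λ ())))) (const-regular 0)

  D₄-value : V₄.Z (nat 48 :* vx :- tD₄)
  D₄-value = V₄.D₄-value Q.zD₄ zc zd P.zYD P.zYC (via (nat 8 :* vx :- (nat 5 :* vD :* vd :- vC :* vc) :* (vb :* vc :- va :* vd)) (nat 8 :* vx :- (nat 5 :* (vD :* vd) :- vC :* vc) :* (vb :* vc :- va :* vd)) (θ zeroS D₄ zeroS zeroS)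
    (x≋y⇒x-y≋0 (Qt.D₄-eta D₄ (constS (+ 5) ⊛ (D ⊛ d) ⊕ ⊝ (C ⊛ c)) W (e 1) (e 2) (e 4) (e 5) (e 8) (e 20) (e 40) (mono 1) D₄-quotient R₅-eta W-eta (regular₀ {(e 2 ⊛ (e 8 ⊛ e 20)) ⊛ (e 4 ⊛ e 40)} (λ ()))))) (const-regular 0)

-- Inversion of the linear system between forms and series.

open Polynomials
open SeriesRing
open RationalFamilies
open Lattices
open ThetaNorms
open ThetaRelations
open ThetaAlgebra
open EisensteinValues
open EtaQuotients

private
  -- The positions of A, B, C, D are those of vA, vB, vC, vD, so that tE₀₃, …, tD₄ keep their meaning.
  ρ : Vec Series 12
  ρ = A ∷ E₀₃ ∷ B ∷ E₁₂ ∷ C ∷ D ∷ E₂₁ ∷ E₃₀ ∷ D₁ ∷ D₂ ∷ D₃ ∷ D₄ ∷ []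

  vE₀₃ vE₁₂ vE₂₁ vE₃₀ vD₁ vD₂ vD₃ vD₄ : Expr 12
  vE₀₃ = # 1F
  vE₁₂ = # 3F
  vE₂₁ = # 6F
  vE₃₀ = # 7F
  vD₁ = # 8F
  vD₂ = # 9F
  vD₃ = # Fin.suc 9F
  vD₄ = # Fin.suc (Fin.suc 9F)

  values : (k₁ k₂ k₃ k₄ k₅ k₆ k₇ k₈ : ℤ) → List (Expr 12 × Expr 12)
  values k₁ k₂ k₃ k₄ k₅ k₆ k₇ k₈ =
    (con k₁ , nat 2 :* vE₀₃ :- tE₀₃) ∷ (con k₂ , nat 2 :* vE₁₂ :- tE₁₂) ∷ (con k₃ , nat 4 :* vE₂₁ :- tE₂₁) ∷ (con k₄ , nat 4 :* vE₃₀ :- tE₃₀)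
      ∷ (con k₅ , nat 12 :* vD₁ :- tD₁) ∷ (con k₆ , nat 24 :* vD₂ :- tD₂) ∷ (con k₇ , nat 48 :* vD₃ :- tD₃) ∷ (con k₈ , nat 48 :* vD₄ :- tD₄) ∷ []

  -- 48 is the least common multiple of the denominators 2, 4, 12, 24, 48 of the eight values. Each
  -- kᵢ is minus the coefficient of its series on the right side, times 48 over its denominator.
  linear : ∀ l r k₁ k₂ k₃ k₄ k₅ k₆ k₇ k₈ → {T (null (normalise (nat 48 :* (l :- r) :- Solve.combination 𝕊 (values k₁ k₂ k₃ k₄ k₅ k₆ k₇ k₈))))} → ⟦ l ⟧ ρ ≋ ⟦ r ⟧ ρ
  linear l r k₁ k₂ k₃ k₄ k₅ k₆ k₇ k₈ {t} = x-y≈0⇒x≈y (certify ρ (nat 48) (l :- r) (values k₁ k₂ k₃ k₄ k₅ k₆ k₇ k₈) {t} (const-regular 47)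
    (E₀₃-value All.∷ E₁₂-value All.∷ E₂₁-value All.∷ E₃₀-value All.∷ D₁-value All.∷ D₂-value All.∷ D₃-value All.∷ D₄-value All.∷ All.[]))

  φ₁ : φ[q^ 1 ] ≋ A
  φ₁ = φ-A
  φ₂ : φ[q^ 2 ] ≋ C
  φ₂ = φ-sub 2
  φ₅ : φ[q^ 5 ] ≋ B
  φ₅ = φ-sub 5
  φ₁₀ : φ[q^ 10 ] ≋ D
  φ₁₀ = φ-sub 10

  quartic : ∀ {f g h k f′ g′ h′ k′ r} → f ≋ f′ → g ≋ g′ → h ≋ h′ → k ≋ k′ → (+ 7) ⊙ (f′ ⊛ g′ ⊛ h′ ⊛ k′) ≋ r → (+ 7) ⊙ (f ⊛ g ⊛ h ⊛ k) ≋ r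
  quartic p q s t i = ≋-trans (⊙-cong (+ 7) (⊛-cong (⊛-cong (⊛-cong p q) s) t)) i

theorem2p8 :
    ((+ 7) ⊙ (φ[q^ 1 ] ⊛ φ[q^ 1 ] ⊛ φ[q^ 1 ] ⊛ φ[q^ 10 ])
      ≋ (- + 1) ⊙ E₀₃ ⊕ (- + 5) ⊙ E₁₂ ⊕ (+ 4) ⊙ E₂₁ ⊕ (+ 20) ⊙ E₃₀
        ⊕ (+ 4) ⊙ ((- + 3) ⊙ D₁ ⊕ (+ 15) ⊙ D₂ ⊕ (- + 15) ⊙ D₃ ⊕ (+ 9) ⊙ D₄))
    × ((+ 7) ⊙ (φ[q^ 1 ] ⊛ φ[q^ 1 ] ⊛ φ[q^ 2 ] ⊛ φ[q^ 5 ])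
      ≋ (- + 1) ⊙ E₀₃ ⊕ (+ 5) ⊙ E₁₂ ⊕ (- + 4) ⊙ E₂₁ ⊕ (+ 20) ⊙ E₃₀
        ⊕ (+ 8) ⊙ ((- + 1) ⊙ D₁ ⊕ (+ 2) ⊙ D₄))
    × ((+ 7) ⊙ (φ[q^ 1 ] ⊛ φ[q^ 2 ] ⊛ φ[q^ 2 ] ⊛ φ[q^ 10 ])
      ≋ (- + 1) ⊙ E₀₃ ⊕ (- + 5) ⊙ E₁₂ ⊕ (+ 2) ⊙ E₂₁ ⊕ (+ 10) ⊙ E₃₀
        ⊕ (+ 4) ⊙ (D₁ ⊕ (+ 5) ⊙ D₂ ⊕ (+ 5) ⊙ D₃ ⊕ D₄))
    × ((+ 7) ⊙ (φ[q^ 1 ] ⊛ φ[q^ 5 ] ⊛ φ[q^ 5 ] ⊛ φ[q^ 10 ])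
      ≋ (- + 1) ⊙ E₀₃ ⊕ (- + 1) ⊙ E₁₂ ⊕ (+ 4) ⊙ E₂₁ ⊕ (+ 4) ⊙ E₃₀
        ⊕ (+ 8) ⊙ (D₂ ⊕ (- + 1) ⊙ D₃ ⊕ D₄))
    × ((+ 7) ⊙ (φ[q^ 1 ] ⊛ φ[q^ 10 ] ⊛ φ[q^ 10 ] ⊛ φ[q^ 10 ])
      ≋ (- + 1) ⊙ (E₀₃ ⊕ E₁₂ ⊕ (- + 2) ⊙ E₂₁ ⊕ (- + 2) ⊙ E₃₀)
        ⊕ (+ 12) ⊙ (D₂ ⊕ D₃ ⊕ D₄))
    × ((+ 7) ⊙ (φ[q^ 2 ] ⊛ φ[q^ 2 ] ⊛ φ[q^ 2 ] ⊛ φ[q^ 5 ])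
      ≋ (- + 1) ⊙ E₀₃ ⊕ (+ 5) ⊙ E₁₂ ⊕ (- + 2) ⊙ E₂₁ ⊕ (+ 10) ⊙ E₃₀
        ⊕ (- + 12) ⊙ D₁)
    × ((+ 7) ⊙ (φ[q^ 2 ] ⊛ φ[q^ 5 ] ⊛ φ[q^ 5 ] ⊛ φ[q^ 5 ])
      ≋ (- + 1) ⊙ E₀₃ ⊕ E₁₂ ⊕ (- + 4) ⊙ E₂₁ ⊕ (+ 4) ⊙ E₃₀
        ⊕ (- + 12) ⊙ (D₁ ⊕ D₂ ⊕ (+ 3) ⊙ D₃ ⊕ (- + 1) ⊙ D₄))
    × ((+ 7) ⊙ (φ[q^ 2 ] ⊛ φ[q^ 5 ] ⊛ φ[q^ 10 ] ⊛ φ[q^ 10 ])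
      ≋ (- + 1) ⊙ E₀₃ ⊕ E₁₂ ⊕ (- + 2) ⊙ E₂₁ ⊕ (+ 2) ⊙ E₃₀
        ⊕ (+ 4) ⊙ ((- + 1) ⊙ D₁ ⊕ D₂ ⊕ (- + 3) ⊙ D₃ ⊕ D₄))
theorem2p8 =
    quartic φ₁ φ₁ φ₁ φ₁₀ identity₁ , quartic φ₁ φ₁ φ₂ φ₅ identity₂ , quartic φ₁ φ₂ φ₂ φ₁₀ identity₃ , quartic φ₁ φ₅ φ₅ φ₁₀ identity₄
  , quartic φ₁ φ₁₀ φ₁₀ φ₁₀ identity₅ , quartic φ₂ φ₂ φ₂ φ₅ identity₆ , quartic φ₂ φ₅ φ₅ φ₅ identity₇ , quartic φ₂ φ₅ φ₁₀ φ₁₀ identity₈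
  where
  identity₁ = linear ((+ 7) :· (((vA :* vA) :* vA) :* vD))
    (((((- + 1) :· vE₀₃ :+ (- + 5) :· vE₁₂) :+ (+ 4) :· vE₂₁) :+ (+ 20) :· vE₃₀) :+ (+ 4) :· ((((- + 3) :· vD₁ :+ (+ 15) :· vD₂) :+ (- + 15) :· vD₃) :+ (+ 9) :· vD₄))
    (+ 24) (+ 120) (- + 48) (- + 240) (+ 48) (- + 120) (+ 60) (- + 36)
  identity₂ = linear ((+ 7) :· (((vA :* vA) :* vC) :* vB))
    (((((- + 1) :· vE₀₃ :+ (+ 5) :· vE₁₂) :+ (- + 4) :· vE₂₁) :+ (+ 20) :· vE₃₀) :+ (+ 8) :· ((- + 1) :· vD₁ :+ (+ 2) :· vD₄))
    (+ 24) (- + 120) (+ 48) (- + 240) (+ 32) (+ 0) (+ 0) (- + 16)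
  identity₃ = linear ((+ 7) :· (((vA :* vC) :* vC) :* vD))
    (((((- + 1) :· vE₀₃ :+ (- + 5) :· vE₁₂) :+ (+ 2) :· vE₂₁) :+ (+ 10) :· vE₃₀) :+ (+ 4) :· (((vD₁ :+ (+ 5) :· vD₂) :+ (+ 5) :· vD₃) :+ vD₄))
    (+ 24) (+ 120) (- + 24) (- + 120) (- + 16) (- + 40) (- + 20) (- + 4)
  identity₄ = linear ((+ 7) :· (((vA :* vB) :* vB) :* vD))
    (((((- + 1) :· vE₀₃ :+ (- + 1) :· vE₁₂) :+ (+ 4) :· vE₂₁) :+ (+ 4) :· vE₃₀) :+ (+ 8) :· ((vD₂ :+ (- + 1) :· vD₃) :+ vD₄))
    (+ 24) (+ 24) (- + 48) (- + 48) (+ 0) (- + 16) (+ 8) (- + 8)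
  identity₅ = linear ((+ 7) :· (((vA :* vD) :* vD) :* vD))
    ((- + 1) :· (((vE₀₃ :+ vE₁₂) :+ (- + 2) :· vE₂₁) :+ (- + 2) :· vE₃₀) :+ (+ 12) :· ((vD₂ :+ vD₃) :+ vD₄))
    (+ 24) (+ 24) (- + 24) (- + 24) (+ 0) (- + 24) (- + 12) (- + 12)
  identity₆ = linear ((+ 7) :· (((vC :* vC) :* vC) :* vB))
    (((((- + 1) :· vE₀₃ :+ (+ 5) :· vE₁₂) :+ (- + 2) :· vE₂₁) :+ (+ 10) :· vE₃₀) :+ (- + 12) :· vD₁)
    (+ 24) (- + 120) (+ 24) (- + 120) (+ 48) (+ 0) (+ 0) (+ 0)
  identity₇ = linear ((+ 7) :· (((vC :* vB) :* vB) :* vB))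
    (((((- + 1) :· vE₀₃ :+ vE₁₂) :+ (- + 4) :· vE₂₁) :+ (+ 4) :· vE₃₀) :+ (- + 12) :· (((vD₁ :+ vD₂) :+ (+ 3) :· vD₃) :+ (- + 1) :· vD₄))
    (+ 24) (- + 24) (+ 48) (- + 48) (+ 48) (+ 24) (+ 36) (- + 12)
  identity₈ = linear ((+ 7) :· (((vC :* vB) :* vD) :* vD))
    (((((- + 1) :· vE₀₃ :+ vE₁₂) :+ (- + 2) :· vE₂₁) :+ (+ 2) :· vE₃₀) :+ (+ 4) :· ((((- + 1) :· vD₁ :+ vD₂) :+ (- + 3) :· vD₃) :+ vD₄))
    (+ 24) (- + 24) (+ 24) (- + 24) (+ 16) (- + 8) (+ 12) (- + 4)
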